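{- Let $G=G_0,\dots,G_r$ be the reduction series for a graph $G$. Let $i\in\{0,\dots,r-1\}$ and let $H_i$ be a quotient of $G_i$. Then there is a quotient $H_{i+1}$ of $G_{i+1}$ such that $H_i$ can be constructed from $H_{i+1}$ by replacing each edge, loop and half-edge of $H_{i+1}$ that is the projection of an edge of $G_{i+1}$ replacing an atom $A$ of $G_i$ by the subgraph corresponding to the edge-quotient, the loop-quotient, or a half-quotient of the atom $A$, respectively.
   Context: GRAPHS. A graph is a tuple $(D,V,\iota,\lambda)$ with $D$ a finite set of darts, $V$ a finite set of vertices, $\iota:D\to V$ a partial function (incidence) and $\lambda:D\to D$ an involution. Edges are the orbits $\{d,\lambda d\}$ of $\lambda$ of size 2, half-edges are the orbits of size 1. An edge is standard if $\iota(d),\iota(\lambda d)$ are defined and distinct, a loop if they are defined and equal, pendant if exactly one is defined, free if none is defined. A pendant edge at $v$ is single if it is the only pendant edge attached to $v$. Edges are colored and have one of three types: halvable, undirected, directed (the latter with an orientation); pendant edges are undirected. The graph $G$ is connected, without loops and half-edges (quotients may contain loops and half-edges). When vertices are removed, their incident edges are kept as pendant or free edges; a free edge is a connected component. Automorphisms and isomorphisms are bijections on vertices and darts that commute with $\iota$ and $\lambda$ and preserve colors, types and orientations of edges. SEMIREGULARITY AND QUOTIENTS. A group $\Gamma\le\mathrm{Aut}(G)$ is semiregular if stabilizers of all vertices, darts and non-halvable edges are trivial; a halvable edge may be fixed by an involution interchanging its two darts. An automorphism $\pi$ is semiregular if $\langle\pi\rangle$ is. For semiregular $\Gamma$, the quotient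 $G/\Gamma$ has as vertices and darts the $\Gamma$-orbits of vertices and darts, with induced incidence, pairing, colors; $p:G\to G/\Gamma$ is the projection to orbits. An edge whose two darts lie in one orbit is mapped to a half-edge. A quotient of $G$ is a graph isomorphic to some $G/\Gamma$ with $\Gamma$ semiregular. BLOCK-TREE. An articulation is a vertex $u$ with $G\setminus u$ disconnected. Blocks are the maximal 2-connected subgraphs, where bridge-edges and pendant edges also count as blocks. The block-tree is the incidence graph between articulations and blocks; its center is a single vertex, called the central articulation or the central block ($K_1$, possibly with one pendant edge, is regarded as having a central articulation). The tree is rooted at its center; the rooted subtree determined by a node $x$ consists of $x$ and all nodes whose path to the center passes through $x$. ATOMS. For a subgraph $A$, $\partial A$ is the set of vertices of $A$ incident with an edge not in $A$, and $\mathring A=A\setminus\partial A$. Parts are the following subgraphs. Block part: the union $S$ of all blocks in the rooted subtree determined by a node other than the central block, where $S$ is not a single pendant edge. Proper part: given a block $B$ and a 2-cut $U=\{u,v\}$ of $B$ (i.e. $B\setminus U$ has at least two connected components containing vertices) with $u,v$ of degree at least 3 in $B$, the subgraph consisting of $u,v$ and a connected component $K$ of $G\setminus U$ that contains a component of $B\setminus U$ (with the edges joining $K$ to $U$), where $K$ is not a single free edge and $K$ does not contain all vertices of the central block or the central articulation. Dipole part (dipole): two vertices with all edges joining them, there being at least two such edges. Atoms are the inclusion-minimal parts: block atoms, proper atoms, dipoles. The boundary $\partial A$ is: the articulation at which $A$ is attached for a block atom (the center, for a star of pendant edges); $U$ for a proper atom; the two vertices for a dipole. A graph is primitive if it has no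 atoms. SYMMETRY TYPES. $\mathrm{Aut}_{\partial A}(A)$ is the set-wise stabilizer of $\partial A$ in $\mathrm{Aut}(A)$. A proper atom or dipole $A$ with $\partial A=\{u,v\}$ is halvable if some semiregular involution in $\mathrm{Aut}_{\partial A}(A)$ exchanges $u,v$; symmetric if it is not halvable but some element of $\mathrm{Aut}_{\partial A}(A)$ exchanges $u,v$; asymmetric otherwise. A $\partial$-isomorphism $A\to A'$ is an isomorphism mapping $\partial A$ onto $\partial A'$. REDUCTION. $G_{i+1}$ arises from $G_i$ by replacing simultaneously the interior of every atom $A$ of $G_i$ by an edge $e_A$, with a new color for each $\partial$-isomorphism class of atoms: a pendant edge at $u$ if $A$ is a block atom with $\partial A=\{u\}$; a halvable/undirected/directed edge $uv$ if $A$ is a halvable/symmetric/asymmetric proper atom or dipole with $\partial A=\{u,v\}$, directed edges being oriented consistently with $\partial$-isomorphisms inside each class. Atoms in all steps are taken with respect to the image of the central block/articulation of $G$. The reduction series $G=G_0,\dots,G_r$ stops when $G_r$ is primitive. QUOTIENTS OF ATOMS AND REPLACEMENT. The edge-quotient of an atom $A$ is $A$ itself. The loop-quotient of a proper atom or dipole $A$ with $\partial A=\{u,v\}$ is obtained from $A$ by identifying $u$ and $v$ (keeping $\mathring A$). A half-quotient of a halvable proper atom or dipole $A$ is $A/\langle\tau\rangle$ for a semiregular involution $\tau\in\mathrm{Aut}_{\partial A}(A)$ exchanging $u$ and $v$. Let $p_{i+1}:G_{i+1}\to H_{i+1}$ be the projection. If $p_{i+1}(e_A)$ is an edge with distinct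 ends $x=p_{i+1}(u),y=p_{i+1}(v)$ (or a pendant edge at $x=p_{i+1}(u)$, for a block atom), replacing it by the edge-quotient means deleting it and inserting a copy of $A$ with $u,v$ glued to $x,y$ (with $u$ glued to $x$, respectively). If $p_{i+1}(e_A)$ is a loop or a half-edge at $x$, replacing it means deleting it and inserting a copy of the loop-quotient, or of a half-quotient, with the common image of $u$ and $v$ glued to $x$. Edges, loops and half-edges of $H_{i+1}$ that are not projections of edges $e_A$ are kept. -}

module Defs where

open import Data.Bool using (Bool)
open import Data.Empty using (⊥)
open import Data.Fin using (Fin; zero; suc; inject₁; fromℕ)
open import Data.Fin.Properties using (any?; _≟_)
open import Data.Fin.Subset using (Subset; _∈_; _∉_; _⊆_; ⁅_⁆; _∪_; _∩_; _─_; ∣_∣; Nonempty; Empty)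
  renaming (⊤ to full)
open import Data.Fin.Subset.Properties using (_∈?_)
open import Data.List using (List; []; _∷_)
import Data.List.Membership.Propositional as List
open import Data.List.Relation.Unary.Unique.Propositional using (Unique)
open import Data.Maybe as Maybe using (Maybe; just; nothing; _>>=_)
import Data.Maybe.Properties as Maybe
open import Data.Nat using (ℕ; zero; suc; _≤_)
open import Data.Product using (Σ; ∃; _×_; _,_; proj₁; proj₂)
open import Data.Sum using (_⊎_; inj₁; inj₂)
open import Data.Unit using (⊤; tt)
open import Data.Vec using (tabulate)
open import Function.Base using (_∘_)
open import Function.Bundles using (_↔_; _⇔_; Inverse; Equivalence)
open import Function.Definitions using (Injective)
open import Function.Construct.Identity using (↔-id)
open import Function.Construct.Symmetry using (↔-sym)
open import Function.Construct.Composition using (_↔-∘_)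
open import Relation.Binary.Construct.Closure.Equivalence using (EqClosure)
open import Relation.Binary.Construct.Closure.ReflexiveTransitive using (Star; ε; _◅_)
open import Relation.Binary.PropositionalEquality using (_≡_; _≢_; refl; sym; trans; cong)
open import Relation.Nullary using (¬_; Dec; does; yes; no)
open import Relation.Nullary.Decidable using (_×-dec_; dec⇒maybe)

-- The type of an edge, recorded at each of its darts.  A directed edge has
-- one outgoing and one incoming dart, which records its orientation.

data Label : Set where
  halvable undirected outgoing incoming : Label

reverse : Label → Label
reverse halvable   = halvable
reverse undirected = undirected
reverse outgoing   = incoming
reverse incoming   = outgoing

-- mate is the involution λ on darts.  The carriers are arbitrary so that
-- subgraphs and graphs obtained by gluing need no renumbering.

record Graph (V D : Set) : Set where
  field
    ι      : D → Maybe V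
    mate   : D → D
    colour : D → ℕ
    label  : D → Label

record IsGraph {V D : Set} (G : Graph V D) : Set where
  open Graph G
  field
    mate-involutive : ∀ d → mate (mate d) ≡ d
    colour-mate     : ∀ d → colour (mate d) ≡ colour d
    label-mate      : ∀ d → label (mate d) ≡ reverse (label d)

record FinGraph : Set where
  field
    {n m}   : ℕ
    graph   : Graph (Fin n) (Fin m)
    isGraph : IsGraph graph
  open Graph graph public

open FinGraph using (graph)

record Preserves {V D V′ D′ : Set} (G : Graph V D) (H : Graph V′ D′)
                 (f : V → V′) (g : D → D′) : Set where
  private
    module G = Graph G
    module H = Graph H
  field
    ι-preserved      : ∀ d → H.ι (g d) ≡ Maybe.map f (G.ι d)
    mate-preserved   : ∀ d → H.mate (g d) ≡ g (G.mate d)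
    colour-preserved : ∀ d → H.colour (g d) ≡ G.colour d
    label-preserved  : ∀ d → H.label (g d) ≡ G.label d

infix 4 _≅_
record _≅_ {V D V′ D′ : Set} (G : Graph V D) (H : Graph V′ D′) : Set where
  field
    vertices : V ↔ V′
    darts    : D ↔ D′
  vert : V → V′
  vert = Inverse.to vertices
  dart : D → D′
  dart = Inverse.to darts
  field
    preserves : Preserves G H vert dart
  open Preserves preserves public

Aut : {V D : Set} → Graph V D → Set
Aut G = G ≅ G

module _ {V D : Set} {G : Graph V D} where

  open _≅_
  open Preserves

  infix 4 _≈_
  _≈_ : Aut G → Aut G → Set
  α ≈ β = (∀ v → vert α v ≡ vert β v) × (∀ d → dart α d ≡ dart β d)

  identity : Aut G
  vertices identity = ↔-id V
  darts    identity = ↔-id D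
  ι-preserved      (preserves identity) d = sym (Maybe.map-id (Graph.ι G d))
  mate-preserved   (preserves identity) d = refl
  colour-preserved (preserves identity) d = refl
  label-preserved  (preserves identity) d = refl

  -- α · β applies β first.
  infixl 7 _·_
  _·_ : Aut G → Aut G → Aut G
  vertices (α · β) = vertices α ↔-∘ vertices β
  darts    (α · β) = darts α ↔-∘ darts β
  ι-preserved (preserves (α · β)) d =
    trans (ι-preserved (preserves α) (dart β d))
      (trans (cong (Maybe.map (vert α)) (ι-preserved (preserves β) d))
             (sym (Maybe.map-∘ (Graph.ι G d))))
  mate-preserved (preserves (α · β)) d =
    trans (mate-preserved (preserves α) (dart β d))
          (cong (dart α) (mate-preserved (preserves β) d))
  colour-preserved (preserves (α · β)) d =
    trans (colour-preserved (preserves α) (dart β d)) (colour-preserved (preserves β) d)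
  label-preserved (preserves (α · β)) d =
    trans (label-preserved (preserves α) (dart β d)) (label-preserved (preserves β) d)

  power : Aut G → ℕ → Aut G
  power α zero    = identity
  power α (suc k) = α · power α k

  -- In a finite graph every automorphism has finite order, so the
  -- non-negative powers of α exhaust the group it generates.
  ⟨_⟩ : Aut G → Aut G → Set
  ⟨ α ⟩ γ = ∃ λ k → γ ≈ power α k

  record IsSubgroup (Γ : Aut G → Set) : Set where
    field
      respects     : ∀ {α β} → α ≈ β → Γ α → Γ β
      has-identity : Γ identity
      has-products : ∀ {α β} → Γ α → Γ β → Γ (α · β)
      has-inverses : ∀ {α} → Γ α → ∃ λ β → Γ β × β · α ≈ identity

  -- A dart sent to its mate means that its edge is stabilised, which is
  -- permitted to a non-trivial element only on halvable edges.
  IsSemiregular : (Aut G → Set) → Set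
  IsSemiregular Γ = ∀ γ → Γ γ →
      (∀ v → vert γ v ≡ v → γ ≈ identity)
    × (∀ d → dart γ d ≡ d → γ ≈ identity)
    × (∀ d → Graph.label G d ≢ halvable → dart γ d ≡ Graph.mate G d → γ ≈ identity)

  OrbitV : (Aut G → Set) → V → V → Set
  OrbitV Γ x y = ∃ λ γ → Γ γ × vert γ x ≡ y

  OrbitD : (Aut G → Set) → D → D → Set
  OrbitD Γ d e = ∃ λ γ → Γ γ × dart γ d ≡ e

-- H, together with the map π, is the quotient of G by the equivalences ~V
-- and ~D exactly when π is onto and has these equivalences as its fibres.

record Onto {V D V′ D′ : Set} (G : Graph V D) (H : Graph V′ D′) : Set where
  field
    vert      : V → V′
    dart      : D → D′
    preserves : Preserves G H vert dart
    vert-onto : ∀ y → ∃ λ x → vert x ≡ y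
    dart-onto : ∀ e → ∃ λ d → dart d ≡ e

HasFibres : {V D V′ D′ : Set} {G : Graph V D} {H : Graph V′ D′} → Onto G H →
            (V → V → Set) → (D → D → Set) → Set
HasFibres π _~V_ _~D_ =
    (∀ x y → Onto.vert π x ≡ Onto.vert π y ⇔ x ~V y)
  × (∀ d e → Onto.dart π d ≡ Onto.dart π e ⇔ d ~D e)

-- H is isomorphic to G/Γ for a semiregular Γ; the projection is composed
-- with that isomorphism.
record IsQuotient {V D V′ D′ : Set} (G : Graph V D) (H : Graph V′ D′) : Set₁ where
  field
    Γ           : Aut G → Set
    subgroup    : IsSubgroup Γ
    semiregular : IsSemiregular Γ
    projection  : Onto G H
    fibres      : HasFibres projection (OrbitV Γ) (OrbitD Γ)

select : ∀ {n} {P : Fin n → Set} → (∀ x → Dec (P x)) → Subset n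
select P? = tabulate (does ∘ P?)

-- A dart of S whose end is not a vertex of S counts as having no end in S.
-- Removing vertices therefore turns edges into pendant and free edges.

record Sub (n m : ℕ) : Set where
  constructor sub
  field
    verts : Subset n
    darts : Subset m

open Sub

Element : ℕ → ℕ → Set
Element n m = Fin n ⊎ Fin m

module _ {n m : ℕ} where

  infix 4 _⊑_ _∈ˢ_
  infixl 6 _∖_

  _⊑_ : Sub n m → Sub n m → Set
  S ⊑ T = verts S ⊆ verts T × darts S ⊆ darts T

  _∖_ : Sub n m → Subset n → Sub n m
  S ∖ U = sub (verts S ─ U) (darts S)

  whole : Sub n m
  whole = sub full full

  _∈ˢ_ : Element n m → Sub n m → Set
  inj₁ v ∈ˢ S = v ∈ verts S
  inj₂ d ∈ˢ S = d ∈ darts S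

module _ {n m : ℕ} (G : Graph (Fin n) (Fin m)) where

  open Graph G

  Closed : Subset m → Set
  Closed Q = ∀ {d} → d ∈ Q → mate d ∈ Q

  ends : Subset m → Subset n
  ends Q = select λ v → any? λ d → (d ∈? Q) ×-dec Maybe.≡-dec _≟_ (ι d) (just v)

  spanned : Subset m → Sub n m
  spanned Q = sub (ends Q) Q

  asGraph : (S : Sub n m) → Closed (darts S) →
            Graph (∃ λ v → v ∈ verts S) (∃ λ d → d ∈ darts S)
  asGraph S closed = record
    { ι      = λ (d , _) → ι d >>= λ v → Maybe.map (v ,_) (dec⇒maybe (v ∈? verts S))
    ; mate   = λ (d , d∈S) → mate d , closed d∈S
    ; colour = λ (d , _) → colour d
    ; label  = λ (d , _) → label d
    }

  data Step (S : Sub n m) : Element n m → Element n m → Set where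
    pairing   : ∀ {d} → d ∈ darts S → Step S (inj₂ d) (inj₂ (mate d))
    incidence : ∀ {d v} → d ∈ darts S → v ∈ verts S → ι d ≡ just v →
                Step S (inj₂ d) (inj₁ v)

  Linked : Sub n m → Element n m → Element n m → Set
  Linked S = EqClosure (Step S)

  Connected : Sub n m → Set
  Connected S = ∀ x y → x ∈ˢ S → y ∈ˢ S → Linked S x y

  IsComponent : Sub n m → Sub n m → Set
  IsComponent S K = ∃ λ x → x ∈ˢ S × (∀ y → y ∈ˢ K ⇔ (y ∈ˢ S × Linked S x y))

  IsArticulation : Fin n → Set
  IsArticulation u = ¬ Connected (whole ∖ ⁅ u ⁆)

  -- Connected, with at least one edge and without an articulation.  As
  -- removing an end of an edge leaves a connected pendant or free edge, a
  -- single edge satisfies this too, so that the maximal sets below include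
  -- the bridge-edges and the pendant edges.
  TwoConnected : Subset m → Set
  TwoConnected Q =
    Nonempty Q × Connected (spanned Q) × (∀ v → v ∈ ends Q → Connected (spanned Q ∖ ⁅ v ⁆))

  IsBlock : Subset m → Set
  IsBlock Q = Closed Q × TwoConnected Q
    × (∀ Q′ → Closed Q′ → TwoConnected Q′ → Q ⊆ Q′ → Q′ ⊆ Q)

  -- A block is given by its darts.
  data Node : Set where
    articulation : Fin n → Node
    block        : Subset m → Node

  IsNode : Node → Set
  IsNode (articulation u) = IsArticulation u
  IsNode (block Q)        = IsBlock Q

  data Adjacent : Node → Node → Set where
    down : ∀ {u Q} → IsArticulation u → IsBlock Q → u ∈ ends Q →
           Adjacent (articulation u) (block Q)
    up   : ∀ {u Q} → IsArticulation u → IsBlock Q → u ∈ ends Q →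
           Adjacent (block Q) (articulation u)

  Walk : Node → Node → Set
  Walk = Star Adjacent

  walkLength : ∀ {x y} → Walk x y → ℕ
  walkLength ε       = 0
  walkLength (_ ◅ w) = suc (walkLength w)

  visited : ∀ {x y} → Walk x y → List Node
  visited {x} ε       = x ∷ []
  visited {x} (_ ◅ w) = x ∷ visited w

  EccentricityAtMost : ℕ → Node → Set
  EccentricityAtMost k x = ∀ y → IsNode y → ∃ λ (w : Walk x y) → walkLength w ≤ k

  InTreeCentre : Node → Set
  InTreeCentre x = IsNode x
    × (∀ y → IsNode y → ∀ k → EccentricityAtMost k y → EccentricityAtMost k x)

  -- For a connected graph without loops and half-edges this says that the
  -- graph is K₁, possibly with one pendant edge.
  TrivialGraph : Set
  TrivialGraph = n ≡ 1 × m ≤ 2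

  IsCentre : Node → Set
  IsCentre c = (TrivialGraph × ∃ λ u → c ≡ articulation u)
             ⊎ (¬ TrivialGraph × InTreeCentre c)

  -- y belongs to the subtree of x in the block-tree rooted at c.
  InSubtree : (c x y : Node) → Set
  InSubtree c x y = ∃ λ (w : Walk y c) → Unique (visited w) × x List.∈ visited w

  degreeIn : Subset m → Fin n → ℕ
  degreeIn Q u = ∣ Q ∩ select (λ d → Maybe.≡-dec _≟_ (ι d) (just u)) ∣

  IsEdgeAt : Fin m → Subset m → Set
  IsEdgeAt d Q = ∀ e → e ∈ Q ⇔ (e ≡ d ⊎ e ≡ mate d)

  IsSinglePendantEdge : Subset m → Set
  IsSinglePendantEdge Q = ∃ λ d → ∃ λ u →
    ι d ≡ just u × ι (mate d) ≡ nothing × IsEdgeAt d Q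

  IsSingleFreeEdge : Sub n m → Set
  IsSingleFreeEdge K = Empty (verts K) × ∃ λ d → mate d ≢ d × IsEdgeAt d (darts K)

  data Boundary : Set where
    single : Fin n → Boundary
    pair   : Fin n → Fin n → Boundary

  _∈∂_ : Fin n → Boundary → Set
  x ∈∂ single u = x ≡ u
  x ∈∂ pair u v = x ≡ u ⊎ x ≡ v

  record IsDipole (S : Sub n m) (u v : Fin n) : Set where
    field
      distinct   : u ≢ v
      vertices   : verts S ≡ ⁅ u ⁆ ∪ ⁅ v ⁆
      edges      : ∀ d → d ∈ darts S ⇔
                   ((ι d ≡ just u × ι (mate d) ≡ just v) ⊎ (ι d ≡ just v × ι (mate d) ≡ just u))
      -- Each edge between u and v has exactly one dart at u.
      two-edges  : ∃ λ d → ∃ λ e → d ≢ e × d ∈ darts S × e ∈ darts S × ι d ≡ just u × ι e ≡ just u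

  IsTwoCut : Subset m → Fin n → Fin n → Set
  IsTwoCut Q u v = u ≢ v × u ∈ ends Q × v ∈ ends Q × ∃ λ x → ∃ λ y →
    x ∈ verts rest × y ∈ verts rest × ¬ Linked rest (inj₁ x) (inj₁ y)
    where
    rest : Sub n m
    rest = spanned Q ∖ (⁅ u ⁆ ∪ ⁅ v ⁆)

  module _ (c : Node) where

    -- In the last field, the first case also covers the star of pendant
    -- edges that is the whole graph, in which no vertex meets an edge
    -- outside S.
    record IsBlockPart (S : Sub n m) (u : Fin n) : Set where
      field
        node             : Node
        isNode           : IsNode node
        not-central      : ∀ Q → c ≡ block Q → node ≢ c
        vertices         : verts S ≡ ends (darts S)
        union-of-blocks  : ∀ d → d ∈ darts S ⇔
                           (∃ λ Q → IsBlock Q × InSubtree c node (block Q) × d ∈ Q)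
        not-pendant-edge : ¬ IsSinglePendantEdge (darts S)
        attached         : node ≡ articulation u
                         ⊎ ((∃ λ Q → node ≡ block Q) × u ∈ verts S
                            × ∃ λ d → d ∉ darts S × ι d ≡ just u)

    ContainsCentre : Sub n m → Set
    ContainsCentre K = (∃ λ Q → c ≡ block Q × ends Q ⊆ verts K)
                     ⊎ (∃ λ w → c ≡ articulation w × w ∈ verts K)

    record IsProperPart (S : Sub n m) (u v : Fin n) : Set where
      U : Subset n
      U = ⁅ u ⁆ ∪ ⁅ v ⁆
      field
        B             : Subset m
        isBlock       : IsBlock B
        twoCut        : IsTwoCut B u v
        degree-u      : 3 ≤ degreeIn B u
        degree-v      : 3 ≤ degreeIn B v
        K             : Sub n m
        component     : IsComponent (whole ∖ U) K
        contains      : ∃ λ L → IsComponent (spanned B ∖ U) L × L ⊑ K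
        not-free-edge : ¬ IsSingleFreeEdge K
        not-central   : ¬ ContainsCentre K
        vertices      : verts S ≡ verts K ∪ U
        edges         : darts S ≡ darts K

    -- The boundary of a part is an index because it is not determined by
    -- the subgraph alone: a dipole may coincide with a block part, and is
    -- then regarded as a dipole, with both its vertices as boundary.
    data IsPart (S : Sub n m) : Boundary → Set where
      blockPart  : ∀ {u} → IsBlockPart S u → (∀ x y → ¬ IsDipole S x y) → IsPart S (single u)
      properPart : ∀ {u v} → IsProperPart S u v → IsPart S (pair u v)
      dipolePart : ∀ {u v} → IsDipole S u v → IsPart S (pair u v)

    record Atom : Set where
      field
        S       : Sub n m
        ∂       : Boundary
        isPart  : IsPart S ∂
        minimal : ∀ T b → IsPart T b → T ⊑ S → S ⊑ T
        -- A consequence of isPart, kept so that S can be read as a graph.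
        closed  : Closed (darts S)

    IsPrimitive : Set
    IsPrimitive = ¬ Atom

-- The two darts of the edge replacing an atom.
data Side : Set where
  near far : Side

opposite : Side → Side
opposite near = far
opposite far  = near

module _ {n m : ℕ} {G : Graph (Fin n) (Fin m)} where

  -- The edge replacing a block atom is pendant: its far dart has no end.
  end : Boundary G → Side → Maybe (Fin n)
  end (single u) near = just u
  end (single u) far  = nothing
  end (pair u v) near = just u
  end (pair u v) far  = just v

  sideOf : Boundary G → Fin n → Maybe Side
  sideOf (single u) x with x ≟ u
  ... | yes _ = just near
  ... | no  _ = nothing
  sideOf (pair u v) x with x ≟ u | x ≟ v
  ... | yes _ | _     = just near
  ... | no  _ | yes _ = just far
  ... | no  _ | no  _ = nothing

module _ {n m : ℕ} {G : Graph (Fin n) (Fin m)} {c : Node G} where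

  VertexOf DartOf : Atom G c → Set
  VertexOf A = ∃ λ v → v ∈ verts (Atom.S A)
  DartOf   A = ∃ λ d → d ∈ darts (Atom.S A)

  ⟦_⟧ : (A : Atom G c) → Graph (VertexOf A) (DartOf A)
  ⟦ A ⟧ = asGraph G (Atom.S A) (Atom.closed A)

  OnBoundary Interior : Atom G c → Fin n → Set
  OnBoundary A x = _∈∂_ G x (Atom.∂ A)
  Interior   A x = x ∈ verts (Atom.S A) × ¬ OnBoundary A x

  -- On A = A′ these are the elements of Aut_∂A(A).
  record ∂-Isomorphism (A A′ : Atom G c) : Set where
    field
      iso        : ⟦ A ⟧ ≅ ⟦ A′ ⟧
      ∂-onto     : ∀ x → OnBoundary A (proj₁ x) ⇔ OnBoundary A′ (proj₁ (_≅_.vert iso x))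
    open _≅_ iso public

  Exchanges : (A : Atom G c) → Aut ⟦ A ⟧ → Set
  Exchanges A τ with Atom.∂ A
  ... | single _ = ⊥
  ... | pair u v =
      (∀ x → proj₁ x ≡ u → proj₁ (_≅_.vert τ x) ≡ v)
    × (∀ x → proj₁ x ≡ v → proj₁ (_≅_.vert τ x) ≡ u)

  record IsHalving (A : Atom G c) (τ : Aut ⟦ A ⟧) : Set where
    field
      involution  : τ · τ ≈ identity
      semiregular : IsSemiregular ⟨ τ ⟩
      exchanges   : Exchanges A τ

  Halvable Exchangeable Symmetric Asymmetric : Atom G c → Set
  Halvable     A = ∃ λ τ → IsHalving A τ
  Exchangeable A = ∃ λ τ → Exchanges A τ
  Symmetric    A = ¬ Halvable A × Exchangeable A
  Asymmetric   A = ¬ Exchangeable A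

  data IsDirected : Label → Set where
    outgoing : IsDirected outgoing
    incoming : IsDirected incoming

  HasTypeOf : Atom G c → Label → Set
  HasTypeOf A l with Atom.∂ A
  ... | single _ = l ≡ undirected
  ... | pair _ _ = (Halvable A → l ≡ halvable)
                 × (Symmetric A → l ≡ undirected)
                 × (Asymmetric A → IsDirected l)

-- H is isomorphic to the part of P formed by the live vertices and darts.
record IsLivePart {V D C E : Set} (H : Graph V D) (P : Graph C E)
                  (LiveV : C → Set) (LiveD : E → Set) : Set where
  field
    vert           : V → C
    dart           : D → E
    preserves      : Preserves H P vert dart
    vert-injective : Injective _≡_ _≡_ vert
    dart-injective : Injective _≡_ _≡_ dart
    vert-image     : ∀ x → LiveV x ⇔ ∃ λ y → vert y ≡ x
    dart-image     : ∀ d → LiveD d ⇔ ∃ λ e → dart e ≡ d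

-- The edges e_A replacing the atoms A of G, where c is the central
-- articulation or block.
record NewEdges (G : FinGraph) (c : Node (graph G)) : Set where
  private
    module G = FinGraph G

  field
    size     : ℕ
    atom     : Fin size → Atom (graph G) c
    complete : ∀ (A : Atom (graph G) c) → ∃ λ a → Atom.S (atom a) ≡ Atom.S A
    distinct : ∀ a b → Atom.S (atom a) ≡ Atom.S (atom b) → a ≡ b

    newColour : Fin size → ℕ
    fresh     : ∀ a d → newColour a ≢ G.colour d
    classes   : ∀ a b → newColour a ≡ newColour b ⇔ ∂-Isomorphism (atom a) (atom b)

    -- Only one dart is constrained by types: the other one has the reverse
    -- label because the reduced graph satisfies IsGraph.
    newLabel  : Fin size → Side → Label
    types     : ∀ a → HasTypeOf (atom a) (newLabel a near)
    oriented  : ∀ a b (f : ∂-Isomorphism (atom a) (atom b)) s t x →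
                end (Atom.∂ (atom a)) s ≡ just (proj₁ x) →
                end (Atom.∂ (atom b)) t ≡ just (proj₁ (∂-Isomorphism.vert f x)) →
                newLabel a s ≡ newLabel b t

  -- G with the edges e_A added and nothing removed.
  extended : Graph (Fin G.n) (Fin G.m ⊎ Fin size × Side)
  extended = record
    { ι      = λ { (inj₁ d) → G.ι d           ; (inj₂ (a , s)) → end (Atom.∂ (atom a)) s }
    ; mate   = λ { (inj₁ d) → inj₁ (G.mate d) ; (inj₂ (a , s)) → inj₂ (a , opposite s) }
    ; colour = λ { (inj₁ d) → G.colour d      ; (inj₂ (a , s)) → newColour a }
    ; label  = λ { (inj₁ d) → G.label d       ; (inj₂ (a , s)) → newLabel a s }
    }

  KeptV : Fin G.n → Set
  KeptV v = ∀ a → ¬ Interior (atom a) v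

  -- The darts of A are all interior to A, since removing ∂A keeps edges.
  KeptD : Fin G.m ⊎ Fin size × Side → Set
  KeptD (inj₁ d) = ∀ a → d ∉ darts (Atom.S (atom a))
  KeptD (inj₂ _) = ⊤

  -- e_A lies in the image of a block containing some edge of A.
  InImage : Subset G.m → Fin G.m ⊎ Fin size × Side → Set
  InImage Q (inj₁ d)       = d ∈ Q
  InImage Q (inj₂ (a , _)) = ∃ λ d → d ∈ Q × d ∈ darts (Atom.S (atom a))

-- G′ arises from G by one reduction step, and c′ is the image of c.
record Reduction (G : FinGraph) (c : Node (graph G))
                 (G′ : FinGraph) (c′ : Node (graph G′)) : Set where
  field
    newEdges : NewEdges G c
  open NewEdges newEdges public

  field
    live : IsLivePart (graph G′) extended KeptV KeptD
  open IsLivePart live public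

  field
    centre-articulation : ∀ w → c ≡ articulation w → ∃ λ w′ → c′ ≡ articulation w′ × vert w′ ≡ w
    centre-block        : ∀ Q → c ≡ block Q →
                          ∃ λ Q′ → c′ ≡ block Q′ × (∀ e → e ∈ Q′ ⇔ InImage Q (dart e))

  newDart : Fin size → Side → Fin (FinGraph.m G′)
  newDart a s = proj₁ (Equivalence.to (dart-image (inj₂ (a , s))) tt)

record IsAdmissible (G : FinGraph) : Set where
  open FinGraph G
  field
    connected          : Connected (graph G) whole
    no-loops           : ∀ d v → ι d ≡ just v → ι (mate d) ≢ just v
    no-half-edges      : ∀ d → mate d ≢ d
    pendant-undirected : ∀ d v → ι d ≡ just v → ι (mate d) ≡ nothing → label d ≡ undirected

record ReductionSeries (G : FinGraph) : Set where
  field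
    r             : ℕ
    member        : Fin (suc r) → FinGraph
    centre        : (i : Fin (suc r)) → Node (graph (member i))
    start         : member zero ≡ G
    start-centre  : IsCentre (graph (member zero)) (centre zero)
    step          : (i : Fin r) → Reduction (member (inject₁ i)) (centre (inject₁ i))
                                            (member (suc i)) (centre (suc i))
    not-primitive : (i : Fin r) → ¬ IsPrimitive (graph (member (inject₁ i))) (centre (inject₁ i))
    terminal      : IsPrimitive (graph (member (fromℕ r))) (centre (fromℕ r))

module _ {n m : ℕ} {G : Graph (Fin n) (Fin m)} {c : Node G}
         (A : Atom G c) {V D : Set} {Q : Graph V D} (π : Onto ⟦ A ⟧ Q) where

  IsEdgeQuotient : Set
  IsEdgeQuotient = HasFibres π _≡_ _≡_

  IsLoopQuotient : Set
  IsLoopQuotient = HasFibres π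
    (λ x y → x ≡ y ⊎ (OnBoundary A (proj₁ x) × OnBoundary A (proj₁ y))) _≡_

  IsHalfQuotient : Set
  IsHalfQuotient = ∃ λ τ → IsHalving A τ × HasFibres π (OrbitV ⟨ τ ⟩) (OrbitD ⟨ τ ⟩)

  -- The quotient of A prescribed by the edge of H containing the dart e.
  -- The first case includes the pendant edges.
  data Prescribed {V′ D′ : Set} (H : Graph V′ D′) (e : D′) : Set where
    edge      : Graph.mate H e ≢ e → Graph.ι H e ≢ Graph.ι H (Graph.mate H e) →
                IsEdgeQuotient → Prescribed H e
    loop      : Graph.mate H e ≢ e → Graph.ι H e ≡ Graph.ι H (Graph.mate H e) →
                IsLoopQuotient → Prescribed H e
    half-edge : Graph.mate H e ≡ e → IsHalfQuotient → Prescribed H e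

-- A choice of edge-, loop- and half-quotients for the edges, loops and
-- half-edges of H′ to be replaced, where p : G′ → H′ is the projection.
record AtomQuotients {G G′ : FinGraph} {c : Node (graph G)} {c′ : Node (graph G′)}
                     (R : Reduction G c G′ c′)
                     (H′ : FinGraph) (p : Onto (graph G′) (graph H′)) : Set where
  private
    module R  = Reduction R
    module H′ = FinGraph H′

  -- The two darts of p(e_A).
  image : Fin R.size → Side → Fin H′.m
  image a s = Onto.dart p (R.newDart a s)

  -- The replaced edges, loops and half-edges of H′, each given by one atom A
  -- such that it is p(e_A).
  field
    count : ℕ
    rep   : Fin count → Fin R.size
    every : ∀ a s → ∃ λ j → ∃ λ t → image (rep j) t ≡ image a s
    once  : ∀ i j s t → image (rep i) s ≡ image (rep j) t → i ≡ j

  A : (j : Fin count) → Atom (graph G) c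
  A j = R.atom (rep j)

  field
    Q          : Fin count → FinGraph
    π          : ∀ j → Onto ⟦ A j ⟧ (graph (Q j))
    prescribed : ∀ j → Prescribed (A j) (π j) (graph H′) (image (rep j) near)

  -- The boundary vertex of A at a given side of e_A goes to the end of the
  -- corresponding dart of p(e_A); interior vertices are not glued.
  attach : ∀ j → Fin (FinGraph.n G) → Maybe (Fin H′.n)
  attach j x = sideOf (Atom.∂ (A j)) x >>= λ s → H′.ι (image (rep j) s)

  field
    glue      : ∀ j → Fin (FinGraph.n (Q j)) → Maybe (Fin H′.n)
    glue-spec : ∀ j x → glue j (Onto.vert (π j) x) ≡ attach j (proj₁ x)

  GluedV GluedD : Set
  GluedV = Fin H′.n ⊎ (Σ (Fin count) λ j → Fin (FinGraph.n (Q j)))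
  GluedD = Fin H′.m ⊎ (Σ (Fin count) λ j → Fin (FinGraph.m (Q j)))

  place : ∀ j → Fin (FinGraph.n (Q j)) → GluedV
  place j x = Maybe.maybe′ inj₁ (inj₂ (j , x)) (glue j x)

  glued : Graph GluedV GluedD
  glued = record
    { ι      = λ { (inj₁ e)       → Maybe.map inj₁ (H′.ι e)
                 ; (inj₂ (j , d)) → Maybe.map (place j) (FinGraph.ι (Q j) d) }
    ; mate   = λ { (inj₁ e)       → inj₁ (H′.mate e)
                 ; (inj₂ (j , d)) → inj₂ (j , FinGraph.mate (Q j) d) }
    ; colour = λ { (inj₁ e)       → H′.colour e
                 ; (inj₂ (j , d)) → FinGraph.colour (Q j) d }
    ; label  = λ { (inj₁ e)       → H′.label e
                 ; (inj₂ (j , d)) → FinGraph.label (Q j) d }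
    }

  LiveV : GluedV → Set
  LiveV (inj₁ _)       = ⊤
  LiveV (inj₂ (j , x)) = glue j x ≡ nothing

  LiveD : GluedD → Set
  LiveD (inj₁ e) = ∀ a s → image a s ≢ e
  LiveD (inj₂ _) = ⊤

record Replacement {G G′ : FinGraph} {c : Node (graph G)} {c′ : Node (graph G′)}
                   (R : Reduction G c G′ c′)
                   (H′ : FinGraph) (p : Onto (graph G′) (graph H′)) (H : FinGraph) : Set where
  field
    quotients : AtomQuotients R H′ p
  open AtomQuotients quotients public

  field
    result : IsLivePart (graph H) glued LiveV LiveD

{-# OPTIONS --safe #-}

-- Removing a vertex keeps its incident edges, so the blocks are the classes of
-- edges that no single vertex separates.  From this description one sees that
-- two atoms sharing a dart coincide: block parts attached at different vertices
-- are nested, a proper part and a block part are nested, and two crossing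
-- proper parts always contain a smaller 2-cut part or a dipole.  The centre is
-- fixed by every automorphism: in the first graph because a block-tree has a
-- single centre, and later because the colours and types of the new edges allow
-- every automorphism of the reduced graph to be lifted.  Hence a semiregular
-- group Γ permutes the atoms and acts on the reduced graph, where its action is
-- again semiregular: a non-trivial element reversing e_A restricts to a halving
-- of A, which makes e_A halvable.  The replacement of p(e_A) is the image of A
-- under the projection to G/Γ; it is A, A with its boundary identified, or A
-- modulo a halving, according to the stabiliser of A in Γ and to whether the
-- two boundary vertices of A lie in one orbit.

module Submission where

open import Defs
open import Data.Bool using (Bool; true; false; not)
import Data.Bool.Properties as Bool
open import Data.Empty using (⊥)
open import Data.Fin using (Fin; zero; suc; inject₁; punchOut)
open import Data.Fin.Properties using (any?; all?; ¬∀⟶∃¬; _≟_; suc-injective; injective⇒≤; punchOut-injective)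
open import Data.Fin.Subset using (Subset; _∈_; _∉_; _⊆_; ⁅_⁆; _∪_; _∩_; _─_; _-_; ∣_∣; Nonempty; inside; outside)
  renaming (⊤ to full; ⊥ to none)
open import Data.Fin.Subset.Properties
  using (_∈?_; x∈⁅x⁆; x∈⁅y⁆⇒x≡y; x∈p∪q⁻; x∈p∪q⁺; x∈p∩q⁺; x∈p∩q⁻; p─q⊆p; x∈p∧x∉q⇒x∈p─q; x∈p∧x≢y⇒x∈p-y; x∈p⇒∣p-x∣<∣p∣; ∈⊤; ∉⊥; ⊆-antisym; ∣p∣≤n)
  renaming (x≢y⇒x∉⁅y⁆ to x∉⁅⁆; x∉⁅y⁆⇒x≢y to x∉⁅⁆⁻)
open import Data.List using (List; []; _∷_; allFin; concatMap; map)
import Data.List.Membership.Propositional as List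
open import Data.List.Membership.Propositional.Properties using (∈-concatMap⁺; ∈-concatMap⁻; ∈-allFin; ∈-map⁺)
open import Data.List.Relation.Unary.All as All using (All; []; _∷_)
open import Data.List.Relation.Unary.AllPairs using ([]; _∷_)
open import Data.List.Relation.Unary.Any as Any using (here; there; satisfied)
open import Data.List.Relation.Unary.Unique.Propositional using (Unique)
import Data.List.Relation.Unary.Unique.Propositional.Properties as Unique
open import Data.Maybe as Maybe using (Maybe; just; nothing; _>>=_)
import Data.Maybe.Properties as Maybe
open import Data.Nat using (ℕ; zero; suc; _≤_; _+_; _⊔_; s≤s; z≤n)
import Data.Nat.Properties as ℕ
open import Data.Product using (Σ; ∃; _×_; _,_; proj₁; proj₂)
open import Data.Sum as Sum using (_⊎_; inj₁; inj₂)
import Data.Sum.Properties as Sum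
open import Data.Unit using (⊤; tt)
open import Data.Vec using (lookup; _∷_; here; there)
open import Data.Vec.Properties as Vec using ([]=⇒lookup; lookup⇒[]=; lookup∘tabulate)
open import Data.Vec.Properties.WithK using ([]=-irrelevant)
open import Function.Base using (_∘_; id; case_of_)
open import Function.Bundles using (_↔_; _⇔_; mk⇔; mk↔ₛ′; Inverse; Equivalence)
open import Function.Construct.Composition using (_↔-∘_)
open import Function.Construct.Symmetry using (↔-sym)
open import Function.Definitions using (Injective)
open import Relation.Binary using (DecidableEquality; IsDecEquivalence)
open import Relation.Binary.Construct.Closure.Equivalence using (EqClosure; symmetric; gmap)
open import Relation.Binary.Construct.Closure.ReflexiveTransitive using (ε; _◅_; _◅◅_)
open import Relation.Binary.Construct.Closure.Symmetric using (SymClosure; fwd; bwd)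
open import Relation.Binary.PropositionalEquality using (_≡_; _≢_; refl; sym; trans; cong; cong₂; subst; subst₂)
open import Relation.Nullary using (¬_; Dec; does; yes; no; contradiction)
open import Relation.Nullary.Decidable using (_×-dec_; _⊎-dec_; ¬?; decidable-stable; map′; dec-true)
open FinGraph using (graph)

-- Three obstacles shape the proof. First, Γ is an arbitrary predicate on automorphisms, so its
-- orbits cannot be searched. Orbits on G are decided as fibres of the projection to the finite
-- graph H, and two elements of Γ that agree on one dart are equal, so that a single element settles
-- whether two new darts lie in one orbit. Second, lifting an automorphism of the reduced graph
-- would require deciding which atoms are exchangeable. The lifts are obtained under a double
-- negation only, which is enough because it is decidable whether a vertex or a set of darts is
-- fixed. Third, the centre need not stay a node of the block-tree: an atom attached at the central
-- vertex may contain every dart, and what remains is one pendant edge. That graph is primitive, so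
-- the invariant of the series promises a node only for graphs that have atoms. The degree bound 3
-- for 2-cuts is what excludes crossing parts: crossing would leave a boundary vertex with only two
-- possible neighbours in its block, and among three darts at it two are then parallel.

just-injective′ : {A : Set} {x y : A} {m : Maybe A} → m ≡ just x → m ≡ just y → x ≡ y
just-injective′ refl refl = refl

articulation-injective : ∀ {n m} {G : Graph (Fin n) (Fin m)} {u v} → articulation {G = G} u ≡ articulation v → u ≡ v
articulation-injective refl = refl

block-injective : ∀ {n m} {G : Graph (Fin n) (Fin m)} {P Q} → block {G = G} P ≡ block Q → P ≡ Q
block-injective refl = refl

-- Finite subsets and the decidability of links

module _ {n : ℕ} {P : Fin n → Set} (P? : ∀ x → Dec (P x)) where

  select⁺ : ∀ {x} → P x → x ∈ select P?
  select⁺ {x} Px = lookup⇒[]= x _ (trans (lookup∘tabulate _ x) (dec-true (P? x) Px))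

  select⁻ : ∀ {x} → x ∈ select P? → P x
  select⁻ {x} x∈ with P? x | trans (sym (lookup∘tabulate (does ∘ P?) x)) ([]=⇒lookup x∈)
  ... | yes Px | _ = Px

x∈p─q⇒x∉q : ∀ {n} (p q : Subset n) {x} → x ∈ p ─ q → x ∉ q
x∈p─q⇒x∉q (_ ∷ p) (outside ∷ q) here       ()
x∈p─q⇒x∉q (_ ∷ p) (_ ∷ q)       (there x∈) (there x∈q) = x∈p─q⇒x∉q p q x∈ x∈q

x∉pair : ∀ {n} {x u v : Fin n} → x ≢ u → x ≢ v → x ∉ ⁅ u ⁆ ∪ ⁅ v ⁆
x∉pair {u = u} {v} x≢u x≢v x∈ with x∈p∪q⁻ ⁅ u ⁆ ⁅ v ⁆ x∈
... | inj₁ x∈u = x≢u (x∈⁅y⁆⇒x≡y u x∈u)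
... | inj₂ x∈v = x≢v (x∈⁅y⁆⇒x≡y v x∈v)

x∈pair⁻ : ∀ {n} {x u v : Fin n} → x ∈ ⁅ u ⁆ ∪ ⁅ v ⁆ → x ≡ u ⊎ x ≡ v
x∈pair⁻ {u = u} {v} x∈ = Sum.map (x∈⁅y⁆⇒x≡y u) (x∈⁅y⁆⇒x≡y v) (x∈p∪q⁻ ⁅ u ⁆ ⁅ v ⁆ x∈)

x∈pair⁺ : ∀ {n} {x u v : Fin n} → x ≡ u ⊎ x ≡ v → x ∈ ⁅ u ⁆ ∪ ⁅ v ⁆
x∈pair⁺ (inj₁ refl) = x∈p∪q⁺ (inj₁ (x∈⁅x⁆ _))
x∈pair⁺ (inj₂ refl) = x∈p∪q⁺ (inj₂ (x∈⁅x⁆ _))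

module _ {X : Set} (_≟ˣ_ : DecidableEquality X) where

  Generated : List (X × X) → X → X → Set
  Generated L = EqClosure λ a b → (a , b) List.∈ L

  private
    -- A walk that may use one more pair can be shortened until it uses the new pair at most once,
    -- in one of the two directions. This turns a decision for a list into finitely many decisions
    -- for its tail.
    Through : List (X × X) → X → X → X → X → Set
    Through L a b x y = Generated L x y ⊎ (Generated L x a × Generated L b y)
                      ⊎ (Generated L x b × Generated L a y)

    weaken : ∀ {p L x y} → Generated L x y → Generated (p ∷ L) x y
    weaken = gmap id there

    through⁻ : ∀ {a b L x y} → Through L a b x y → Generated ((a , b) ∷ L) x y
    through⁻ (inj₁ p)              = weaken p
    through⁻ (inj₂ (inj₁ (p , q))) = weaken p ◅◅ fwd (here refl) ◅ weaken q
    through⁻ (inj₂ (inj₂ (p , q))) = weaken p ◅◅ bwd (here refl) ◅ weaken q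

    prepend : ∀ {a b L x y z} → SymClosure (λ a b → (a , b) List.∈ L) x y →
              Through L a b y z → Through L a b x z
    prepend s (inj₁ p)              = inj₁ (s ◅ p)
    prepend s (inj₂ (inj₁ (p , q))) = inj₂ (inj₁ (s ◅ p , q))
    prepend s (inj₂ (inj₂ (p , q))) = inj₂ (inj₂ (s ◅ p , q))

    through⁺ : ∀ {a b L x y} → Generated ((a , b) ∷ L) x y → Through L a b x y
    through⁺ ε = inj₁ ε
    through⁺ (fwd (there s) ◅ p) = prepend (fwd s) (through⁺ p)
    through⁺ (bwd (there s) ◅ p) = prepend (bwd s) (through⁺ p)
    through⁺ (fwd (here refl) ◅ p) with through⁺ p
    ... | inj₁ q              = inj₂ (inj₁ (ε , q))
    ... | inj₂ (inj₁ (_ , q)) = inj₂ (inj₁ (ε , q))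
    ... | inj₂ (inj₂ (_ , q)) = inj₁ q
    through⁺ (bwd (here refl) ◅ p) with through⁺ p
    ... | inj₁ q              = inj₂ (inj₂ (ε , q))
    ... | inj₂ (inj₁ (_ , q)) = inj₁ q
    ... | inj₂ (inj₂ (_ , q)) = inj₂ (inj₂ (ε , q))

  generated? : ∀ L x y → Dec (Generated L x y)
  generated? [] x y = map′ (λ { refl → ε }) (λ { ε → refl ; (fwd () ◅ _) ; (bwd () ◅ _) }) (x ≟ˣ y)
  generated? ((a , b) ∷ L) x y = map′ through⁻ through⁺
    (generated? L x y ⊎-dec (generated? L x a ×-dec generated? L b y)
     ⊎-dec (generated? L x b ×-dec generated? L a y))

module _ {n m : ℕ} {G : Graph (Fin n) (Fin m)} where

  open Graph G

  link-sym : ∀ {S x y} → Linked G S x y → Linked G S y x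
  link-sym {S} = symmetric (Step G S)

  step-mono : ∀ {S T x y} → S ⊑ T → Step G S x y → Step G T x y
  step-mono (_ , S⊑T)  (pairing d∈)        = pairing (S⊑T d∈)
  step-mono (V⊑ , S⊑T) (incidence d∈ v∈ e) = incidence (S⊑T d∈) (V⊑ v∈) e

  link-mono : ∀ {S T x y} → S ⊑ T → Linked G S x y → Linked G T x y
  link-mono S⊑T = gmap id (step-mono S⊑T)

  link-induct : ∀ {S} (P : Element n m → Set) →
                (∀ {x y} → Step G S x y → P x → P y) → (∀ {x y} → Step G S x y → P y → P x) →
                ∀ {x y} → Linked G S x y → P x → P y
  link-induct P f b ε           Px = Px
  link-induct P f b (fwd s ◅ l) Px = link-induct P f b l (f s Px)
  link-induct P f b (bwd s ◅ l) Px = link-induct P f b l (b s Px)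

  private
    -- Every step starts at a dart, so at most two pairs per dart exhaust the relation `Step S`.
    -- This makes `Linked` an equivalence generated by a finite list, hence decidable.
    stepsAt : Sub n m → Fin m → List (Element n m × Element n m)
    stepsAt S d with d ∈? Sub.darts S | ι d
    ... | no _  | _       = []
    ... | yes _ | nothing = (inj₂ d , inj₂ (mate d)) ∷ []
    ... | yes _ | just v with v ∈? Sub.verts S
    ...   | yes _ = (inj₂ d , inj₂ (mate d)) ∷ (inj₂ d , inj₁ v) ∷ []
    ...   | no _  = (inj₂ d , inj₂ (mate d)) ∷ []

    pairing-listed : ∀ S d → d ∈ Sub.darts S → (inj₂ d , inj₂ (mate d)) List.∈ stepsAt S d
    pairing-listed S d d∈ with d ∈? Sub.darts S | ι d
    ... | no d∉ | _       = contradiction d∈ d∉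
    ... | yes _ | nothing = here refl
    ... | yes _ | just v with v ∈? Sub.verts S
    ...   | yes _ = here refl
    ...   | no _  = here refl

    incidence-listed : ∀ S d v → d ∈ Sub.darts S → v ∈ Sub.verts S → ι d ≡ just v →
                       (inj₂ d , inj₁ v) List.∈ stepsAt S d
    incidence-listed S d v d∈ v∈ e with d ∈? Sub.darts S | ι d
    incidence-listed S d v d∈ v∈ e    | no d∉ | _ = contradiction d∈ d∉
    incidence-listed S d v d∈ v∈ refl | yes _ | just v with v ∈? Sub.verts S
    ...   | yes _ = there (here refl)
    ...   | no v∉ = contradiction v∈ v∉

    listed-step : ∀ S d {x y} → (x , y) List.∈ stepsAt S d → Step G S x y
    listed-step S d p with d ∈? Sub.darts S | ι d in eq
    listed-step S d (here refl) | yes d∈ | nothing = pairing d∈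
    listed-step S d p | yes d∈ | just v with v ∈? Sub.verts S
    listed-step S d (here refl)         | yes d∈ | just v | yes v∈ = pairing d∈
    listed-step S d (there (here refl)) | yes d∈ | just v | yes v∈ = incidence d∈ v∈ eq
    listed-step S d (here refl)         | yes d∈ | just v | no _   = pairing d∈

    steps : Sub n m → List (Element n m × Element n m)
    steps S = concatMap (stepsAt S) (allFin m)

    listed : ∀ S d {p} → p List.∈ stepsAt S d → p List.∈ steps S
    listed S d p∈ = ∈-concatMap⁺ (stepsAt S) (Any.map (λ { refl → p∈ }) (∈-allFin d))

    unlisted : ∀ S {x y} → (x , y) List.∈ steps S → Step G S x y
    unlisted S p = let d , q = satisfied (∈-concatMap⁻ (stepsAt S) {allFin m} p) in listed-step S d q

    step-listed : ∀ S {x y} → Step G S x y → (x , y) List.∈ steps S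
    step-listed S (pairing {d} d∈)            = listed S d (pairing-listed S d d∈)
    step-listed S (incidence {d} {v} d∈ v∈ e) = listed S d (incidence-listed S d v d∈ v∈ e)

  linked? : ∀ S x y → Dec (Linked G S x y)
  linked? S x y = map′ (gmap id (unlisted S)) (gmap id (step-listed S))
    (generated? (Sum.≡-dec _≟_ _≟_) (steps S) x y)

-- The conditions carried along the reduction series; `simple′` establishes them again for each
-- reduced graph.
record IsSimple {n m : ℕ} (G : Graph (Fin n) (Fin m)) : Set where
  open Graph G
  field
    isGraph       : IsGraph G
    connected     : Connected G whole
    no-loops      : ∀ d v → ι d ≡ just v → ι (mate d) ≢ just v
    no-half-edges : ∀ d → mate d ≢ d
  open IsGraph isGraph public

∈ends⁺ : ∀ {n m} (G : Graph (Fin n) (Fin m)) Q {d v} → d ∈ Q → Graph.ι G d ≡ just v → v ∈ ends G Q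
∈ends⁺ G Q d∈ e = select⁺ (λ v → any? λ d → (d ∈? Q) ×-dec Maybe.≡-dec _≟_ (Graph.ι G d) (just v)) (_ , d∈ , e)

∈ends⁻ : ∀ {n m} (G : Graph (Fin n) (Fin m)) Q {v} → v ∈ ends G Q → ∃ λ d → d ∈ Q × Graph.ι G d ≡ just v
∈ends⁻ G Q = select⁻ (λ v → any? λ d → (d ∈? Q) ×-dec Maybe.≡-dec _≟_ (Graph.ι G d) (just v))

-- Linked elements and blocks

module Links {n m : ℕ} (G : Graph (Fin n) (Fin m)) (isGraph : IsGraph G) where

  open Graph G
  open IsGraph isGraph

  infix 4 _⊢_~_
  _⊢_~_ : Subset n → Element n m → Element n m → Set
  U ⊢ x ~ y = Linked G (whole ∖ U) x y

  ⊢-dec : ∀ U x y → Dec (U ⊢ x ~ y)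
  ⊢-dec U = linked? (whole ∖ U)

  mate-link : ∀ U {d} → U ⊢ inj₂ d ~ inj₂ (mate d)
  mate-link U = fwd (pairing ∈⊤) ◅ ε

  end-link : ∀ U {d v} → v ∉ U → ι d ≡ just v → U ⊢ inj₂ d ~ inj₁ v
  end-link U v∉ e = fwd (incidence ∈⊤ (x∈p∧x∉q⇒x∈p─q ∈⊤ v∉) e) ◅ ε

  ⊢-sym : ∀ U {x y} → U ⊢ x ~ y → U ⊢ y ~ x
  ⊢-sym U = link-sym

  share-link : ∀ U {d e v} → v ∉ U → ι d ≡ just v → ι e ≡ just v → U ⊢ inj₂ d ~ inj₂ e
  share-link U v∉ p q = end-link U v∉ p ◅◅ ⊢-sym U (end-link U v∉ q)

  ⊢-anti : ∀ {U W x y} → U ⊆ W → W ⊢ x ~ y → U ⊢ x ~ y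
  ⊢-anti {U} {W} U⊆W = link-mono ((λ x∈ → x∈p∧x∉q⇒x∈p─q ∈⊤ (λ x∈U → x∈p─q⇒x∉q full W x∈ (U⊆W x∈U))) , id)

  -- The form of most reachability arguments below: an invariant is chosen that survives each step
  -- off U. Mates need one direction only because the mate is an involution.
  propagate : ∀ U (P : Element n m → Set) →
    (∀ d → P (inj₂ d) → P (inj₂ (mate d))) →
    (∀ d v → v ∉ U → ι d ≡ just v → P (inj₂ d) → P (inj₁ v)) →
    (∀ d v → v ∉ U → ι d ≡ just v → P (inj₁ v) → P (inj₂ d)) →
    ∀ {x y} → U ⊢ x ~ y → P x → P y
  propagate U P f g h = link-induct P
    (λ { (pairing _) → f _ ; (incidence _ v∈ e) → g _ _ (x∈p─q⇒x∉q full U v∈) e })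
    (λ { (pairing {d} _) Pm → subst (P ∘ inj₂) (mate-involutive d) (f _ Pm)
       ; (incidence _ v∈ e) → h _ _ (x∈p─q⇒x∉q full U v∈) e })

  isolated : ∀ U {u d} → u ∈ U → ¬ U ⊢ inj₂ d ~ inj₁ u
  isolated U {u} u∈ l = propagate U (λ { (inj₁ v) → v ≢ u ; (inj₂ _) → ⊤ })
    _ (λ { d v v∉ e _ refl → v∉ u∈ }) _ l tt refl

  -- A vertex is only ever the target of a step, so a walk that leaves it begins by reversing an
  -- incidence.
  first-dart : ∀ U {x z} → U ⊢ inj₁ x ~ z → z ≢ inj₁ x → ∃ λ d → ι d ≡ just x
  first-dart U ε                             z≢ = contradiction refl z≢
  first-dart U (bwd (incidence {d} _ _ e) ◅ _) _ = d , e

  whole-link : ∀ {x y} → Linked G whole x y → none ⊢ x ~ y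
  whole-link = link-mono ((λ _ → x∈p∧x∉q⇒x∈p─q ∈⊤ ∉⊥) , id)

  ⊢-whole : ∀ {x y} → none ⊢ x ~ y → Linked G whole x y
  ⊢-whole = link-mono ((λ _ → ∈⊤) , id)

module Blocks {n m : ℕ} (G : Graph (Fin n) (Fin m)) (simple : IsSimple G) where

  open Graph G
  open IsSimple simple
  open Links G isGraph public

  all-linked : ∀ x y → none ⊢ x ~ y
  all-linked x y = whole-link (connected x y (member x) (member y))
    where
    member : ∀ x → x ∈ˢ whole
    member (inj₁ _) = ∈⊤
    member (inj₂ _) = ∈⊤

  infix 4 _≈ᵇ_
  _≈ᵇ_ : Fin m → Fin m → Set
  d ≈ᵇ e = ∀ v → ⁅ v ⁆ ⊢ inj₂ d ~ inj₂ e

  ≈ᵇ-dec : ∀ d e → Dec (d ≈ᵇ e)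
  ≈ᵇ-dec d e = all? λ v → ⊢-dec ⁅ v ⁆ (inj₂ d) (inj₂ e)

  ≈ᵇ-refl : ∀ {d} → d ≈ᵇ d
  ≈ᵇ-refl v = ε

  ≈ᵇ-sym : ∀ {d e} → d ≈ᵇ e → e ≈ᵇ d
  ≈ᵇ-sym p v = ⊢-sym ⁅ v ⁆ (p v)

  ≈ᵇ-trans : ∀ {d e f} → d ≈ᵇ e → e ≈ᵇ f → d ≈ᵇ f
  ≈ᵇ-trans p q v = p v ◅◅ q v

  separator : ∀ {d e} → ¬ d ≈ᵇ e → ∃ λ v → ¬ ⁅ v ⁆ ⊢ inj₂ d ~ inj₂ e
  separator {d} {e} = ¬∀⟶∃¬ n _ (λ v → ⊢-dec ⁅ v ⁆ (inj₂ d) (inj₂ e))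

  -- Any vertex other than x leaves the two darts linked through x, so a separating vertex can only
  -- be x.
  separator-at : ∀ {d e x} → ι d ≡ just x → ι e ≡ just x → ¬ d ≈ᵇ e → ¬ ⁅ x ⁆ ⊢ inj₂ d ~ inj₂ e
  separator-at {d} {e} {x} dx ex d≉e with separator d≉e
  ... | v , ¬l with x ≟ v
  ...   | yes refl = ¬l
  ...   | no x≢v   = contradiction (share-link ⁅ v ⁆ (x∉⁅⁆ x≢v) dx ex) ¬l

  IsClass : Subset m → Set
  IsClass C = ∀ {d e} → d ∈ C → (e ∈ C → d ≈ᵇ e) × (d ≈ᵇ e → e ∈ C)

  module _ {C : Subset m} (class : IsClass C) where

    class-closed : Closed G C
    class-closed d∈ = proj₂ (class d∈) λ v → mate-link ⁅ v ⁆

    -- A walk that leaves the class at x is separated by x from the class, so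
    -- that it has to come back through x.
    retract : ∀ U {d e} → d ∈ C → e ∈ C → U ⊢ inj₂ d ~ inj₂ e →
              Linked G (spanned G C ∖ U) (inj₂ d) (inj₂ e)
    retract U {d} {e} d∈ e∈ l = finish (propagate U Inv at-mate at-end from-end l (inj₁ (d∈ , ε)))
      where
      T = spanned G C ∖ U
      In : Element n m → Set
      In (inj₁ v) = v ∈ ends G C
      In (inj₂ d) = d ∈ C
      Inv : Element n m → Set
      Inv z = (In z × Linked G T (inj₂ d) z)
            ⊎ ∃ λ x → x ∈ ends G C × Linked G T (inj₂ d) (inj₁ x) × z ≢ inj₁ x
                      × ¬ ⁅ x ⁆ ⊢ inj₂ d ~ z
      end-step : ∀ {f v} → v ∉ U → ι f ≡ just v → f ∈ C → Linked G T (inj₂ f) (inj₁ v)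
      end-step v∉ e f∈ = fwd (incidence f∈ (x∈p∧x∉q⇒x∈p─q (∈ends⁺ G C f∈ e) v∉) e) ◅ ε
      at-mate : ∀ f → Inv (inj₂ f) → Inv (inj₂ (mate f))
      at-mate f (inj₁ (f∈ , l)) = inj₁ (class-closed f∈ , l ◅◅ fwd (pairing f∈) ◅ ε)
      at-mate f (inj₂ (x , x∈ , l , _ , ¬l)) =
        inj₂ (x , x∈ , l , (λ ()) , λ l′ → ¬l (l′ ◅◅ ⊢-sym ⁅ x ⁆ (mate-link ⁅ x ⁆)))
      at-end : ∀ f v → v ∉ U → ι f ≡ just v → Inv (inj₂ f) → Inv (inj₁ v)
      at-end f v v∉ e (inj₁ (f∈ , l)) = inj₁ (∈ends⁺ G C f∈ e , l ◅◅ end-step v∉ e f∈)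
      at-end f v v∉ e (inj₂ (x , x∈ , l , _ , ¬l)) with v ≟ x
      ... | yes refl = inj₁ (x∈ , l)
      ... | no v≢x = inj₂ (x , x∈ , l , (λ { refl → v≢x refl }) ,
                           λ l′ → ¬l (l′ ◅◅ ⊢-sym ⁅ x ⁆ (end-link ⁅ x ⁆ (x∉⁅⁆ v≢x) e)))
      from-end : ∀ f v → v ∉ U → ι f ≡ just v → Inv (inj₁ v) → Inv (inj₂ f)
      from-end f v v∉ e (inj₂ (x , x∈ , l , z≢ , ¬l)) =
        inj₂ (x , x∈ , l , (λ ()) ,
              λ l′ → ¬l (l′ ◅◅ end-link ⁅ x ⁆ (x∉⁅⁆ λ { refl → z≢ refl }) e))
      from-end f v v∉ e (inj₁ (v∈ , l)) with f ∈? C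
      ... | yes f∈ = inj₁ (f∈ , l ◅◅ link-sym (end-step v∉ e f∈))
      ... | no f∉ = inj₂ (v , v∈ , l , (λ ()) , λ l′ →
              let g , g∈ , ge = ∈ends⁻ G C v∈
                  g≉f g≈f = f∉ (proj₂ (class g∈) g≈f)
              in separator-at ge e g≉f (proj₁ (class g∈) d∈ v ◅◅ l′))
      finish : Inv (inj₂ e) → Linked G T (inj₂ d) (inj₂ e)
      finish (inj₁ (_ , l))                 = l
      finish (inj₂ (x , _ , _ , _ , ¬l)) = contradiction (proj₁ (class d∈) e∈ x) ¬l

    connected-without : ∀ U → (∀ {d e} → d ∈ C → e ∈ C → U ⊢ inj₂ d ~ inj₂ e) → Connected G (spanned G C ∖ U)
    connected-without U links x y x∈ y∈ =
      let d , d∈ , l = dart-near x x∈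
          e , e∈ , k = dart-near y y∈
      in l ◅◅ retract U d∈ e∈ (links d∈ e∈) ◅◅ link-sym k
      where
      dart-near : ∀ z → z ∈ˢ (spanned G C ∖ U) → ∃ λ d → d ∈ C × Linked G (spanned G C ∖ U) z (inj₂ d)
      dart-near (inj₂ d) d∈ = d , d∈ , ε
      dart-near (inj₁ v) v∈ =
        let d , d∈ , e = ∈ends⁻ G C (p─q⊆p (ends G C) U v∈) in d , d∈ , bwd (incidence d∈ v∈ e) ◅ ε

    class-twoConnected : Nonempty C → TwoConnected G C
    class-twoConnected ne = ne , whole-connected ,
      λ v _ → connected-without ⁅ v ⁆ λ d∈ e∈ → proj₁ (class d∈) e∈ v
      where
      back : ∀ x → x ∈ˢ spanned G C → x ∈ˢ (spanned G C ∖ none)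
      back (inj₁ v) v∈ = x∈p∧x∉q⇒x∈p─q v∈ ∉⊥
      back (inj₂ d) d∈ = d∈
      whole-connected : Connected G (spanned G C)
      whole-connected x y x∈ y∈ = link-mono (p─q⊆p (ends G C) none , id)
        (connected-without none (λ _ _ → all-linked _ _) x y (back x x∈) (back y y∈))

  -- For a vertex of Q this is two-connectedness itself. A vertex off Q is not met by a walk inside
  -- Q, so connectedness is enough.
  twoConnected⇒≈ᵇ : ∀ {Q d e} → TwoConnected G Q → d ∈ Q → e ∈ Q → d ≈ᵇ e
  twoConnected⇒≈ᵇ {Q} {d} {e} (_ , conn , conn-v) d∈ e∈ v with v ∈? ends G Q
  ... | yes v∈ = link-mono (into , λ _ → ∈⊤) (conn-v v v∈ (inj₂ d) (inj₂ e) d∈ e∈)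
    where
    into : ends G Q ─ ⁅ v ⁆ ⊆ full ─ ⁅ v ⁆
    into x∈ = x∈p∧x∉q⇒x∈p─q ∈⊤ (x∈p─q⇒x∉q (ends G Q) ⁅ v ⁆ x∈)
  ... | no v∉ = link-mono (into , λ _ → ∈⊤) (conn (inj₂ d) (inj₂ e) d∈ e∈)
    where
    into : ends G Q ⊆ full ─ ⁅ v ⁆
    into x∈ = x∈p∧x∉q⇒x∈p─q ∈⊤ (x∉⁅⁆ λ { refl → v∉ x∈ })

  blockOf : Fin m → Subset m
  blockOf d = select (≈ᵇ-dec d)

  ∈blockOf : ∀ {d} → d ∈ blockOf d
  ∈blockOf {d} = select⁺ (≈ᵇ-dec d) ≈ᵇ-refl

  blockOf-class : ∀ d → IsClass (blockOf d)
  blockOf-class d a∈ = (λ b∈ → ≈ᵇ-trans (≈ᵇ-sym (out a∈)) (out b∈)) ,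
                       (λ a≈b → select⁺ (≈ᵇ-dec d) (≈ᵇ-trans (out a∈) a≈b))
    where
    out : ∀ {e} → e ∈ blockOf d → d ≈ᵇ e
    out = select⁻ (≈ᵇ-dec d)

  class⇒block : ∀ {C} → IsClass C → Nonempty C → IsBlock G C
  class⇒block class ne@(d , d∈) = class-closed class , class-twoConnected class ne ,
    λ Q _ twoConn C⊆Q e∈Q → proj₂ (class d∈) (twoConnected⇒≈ᵇ twoConn (C⊆Q d∈) e∈Q)

  -- Q lies in the class of any of its darts. That class is two-connected as well, and maximality of
  -- Q gives the converse inclusion.
  block⇒class : ∀ {Q} → IsBlock G Q → IsClass Q × Nonempty Q
  block⇒class {Q} (closed , twoConn@((d , d∈) , _) , maximal) = class , d , d∈
    where
    Q⊆ : Q ⊆ blockOf d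
    Q⊆ e∈ = select⁺ (≈ᵇ-dec d) (twoConnected⇒≈ᵇ twoConn d∈ e∈)
    class : IsClass Q
    class {a} {b} a∈ = twoConnected⇒≈ᵇ twoConn a∈ ,
      λ a≈b → maximal (blockOf d) (class-closed (blockOf-class d))
                (class-twoConnected (blockOf-class d) (d , ∈blockOf)) Q⊆
                (proj₂ (blockOf-class d (Q⊆ a∈)) a≈b)

  blockOf-block : ∀ d → IsBlock G (blockOf d)
  blockOf-block d = class⇒block (blockOf-class d) (d , ∈blockOf)

  module _ {Q : Subset m} (isBlock : IsBlock G Q) where

    block-≈ : ∀ {d e} → d ∈ Q → e ∈ Q → d ≈ᵇ e
    block-≈ d∈ = proj₁ (proj₁ (block⇒class isBlock) d∈)

    ≈-block : ∀ {d e} → d ∈ Q → d ≈ᵇ e → e ∈ Q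
    ≈-block d∈ = proj₂ (proj₁ (block⇒class isBlock) d∈)

    block-closed : ∀ {d} → d ∈ Q → mate d ∈ Q
    block-closed = class-closed (proj₁ (block⇒class isBlock))

    block-nonempty : Nonempty Q
    block-nonempty = proj₂ (block⇒class isBlock)

    block-end : ∀ {d x w} → d ∈ Q → x ∈ ends G Q → x ≢ w → ⁅ w ⁆ ⊢ inj₂ d ~ inj₁ x
    block-end {w = w} d∈ x∈ x≢w = let e , e∈ , ex = ∈ends⁻ G Q x∈ in
      block-≈ d∈ e∈ w ◅◅ end-link ⁅ w ⁆ (x∉⁅⁆ x≢w) ex

  block-unique : ∀ {P Q d} → IsBlock G P → IsBlock G Q → d ∈ P → d ∈ Q → P ≡ Q
  block-unique P! Q! d∈P d∈Q = ⊆-antisym (λ e∈ → ≈-block Q! d∈Q (block-≈ P! d∈P e∈))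
                                         (λ e∈ → ≈-block P! d∈P (block-≈ Q! d∈Q e∈))

  -- Darts of P and Q at u could only be separated by u itself, and the assumed link rules this out.
  blocks-at : ∀ {P Q p q u} → IsBlock G P → IsBlock G Q → u ∈ ends G P → u ∈ ends G Q →
              p ∈ P → q ∈ Q → ⁅ u ⁆ ⊢ inj₂ p ~ inj₂ q → P ≡ Q
  blocks-at {P} {Q} {p} {q} {u} P! Q! u∈P u∈Q p∈ q∈ l =
    let d , d∈ , du = ∈ends⁻ G P u∈P
        e , e∈ , eu = ∈ends⁻ G Q u∈Q
        d≈e = decidable-stable (≈ᵇ-dec d e) λ d≉e →
                separator-at du eu d≉e (block-≈ P! d∈ p∈ u ◅◅ l ◅◅ block-≈ Q! q∈ e∈ u)
    in block-unique P! Q! (≈-block P! d∈ d≈e) e∈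

  -- Consider the last visit of a walk from a to z to one of the two vertices: the rest of the walk
  -- avoids the other one. Applied to an element of the centre, this says that two vertices cannot
  -- cut each other off from the centre.
  linked-or-cut : ∀ {a b} → a ≢ b → ∀ z → ⁅ a ⁆ ⊢ z ~ inj₁ b ⊎ ⁅ b ⁆ ⊢ z ~ inj₁ a
  linked-or-cut {a} {b} a≢b z = propagate none P at-mate at-end from-end (all-linked (inj₁ a) z) (inj₂ ε)
    where
    P : Element n m → Set
    P z = ⁅ a ⁆ ⊢ z ~ inj₁ b ⊎ ⁅ b ⁆ ⊢ z ~ inj₁ a
    at-mate : ∀ d → P (inj₂ d) → P (inj₂ (mate d))
    at-mate d = Sum.map (⊢-sym ⁅ a ⁆ (mate-link ⁅ a ⁆) ◅◅_) (⊢-sym ⁅ b ⁆ (mate-link ⁅ b ⁆) ◅◅_)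
    at-end : ∀ d v → v ∉ none → ι d ≡ just v → P (inj₂ d) → P (inj₁ v)
    at-end d v _ e p with v ≟ a | v ≟ b
    ... | yes refl | _ = inj₂ ε
    ... | no _ | yes refl = inj₁ ε
    ... | no v≢a | no v≢b =
      Sum.map (⊢-sym ⁅ a ⁆ (end-link ⁅ a ⁆ (x∉⁅⁆ v≢a) e) ◅◅_) (⊢-sym ⁅ b ⁆ (end-link ⁅ b ⁆ (x∉⁅⁆ v≢b) e) ◅◅_) p
    from-end : ∀ d v → v ∉ none → ι d ≡ just v → P (inj₁ v) → P (inj₂ d)
    from-end d v _ e p with v ≟ a | v ≟ b
    ... | yes refl | _ = inj₂ (end-link ⁅ b ⁆ (x∉⁅⁆ a≢b) e)
    ... | no v≢a | yes refl = inj₁ (end-link ⁅ a ⁆ (x∉⁅⁆ v≢a) e)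
    ... | no v≢a | no v≢b = Sum.map (end-link ⁅ a ⁆ (x∉⁅⁆ v≢a) e ◅◅_) (end-link ⁅ b ⁆ (x∉⁅⁆ v≢b) e ◅◅_) p

  everything : (D : Subset m) → Nonempty D → Closed G D →
               (∀ {d e v} → d ∈ D → ι d ≡ just v → ι e ≡ just v → e ∈ D) →
               (∀ d → d ∈ D) × (∀ v → ∃ λ d → d ∈ D × ι d ≡ just v)
  everything D (d₀ , d₀∈) closed spread = (λ d → reach (inj₂ d)) , (λ v → reach (inj₁ v))
    where
    P : Element n m → Set
    P (inj₁ v) = ∃ λ d → d ∈ D × ι d ≡ just v
    P (inj₂ d) = d ∈ D
    reach : ∀ z → P z
    reach z = propagate none P (λ _ → closed) (λ d v _ e d∈ → d , d∈ , e)
      (λ { e v _ p (d , d∈ , q) → spread d∈ q p }) (all-linked (inj₂ d₀) z) d₀∈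

-- The block-tree and its subtrees

module BlockTree {n m : ℕ} (G : Graph (Fin n) (Fin m)) (simple : IsSimple G) where

  open Graph G
  open IsSimple simple
  open Blocks G simple public

  infix 4 _≟ⁿ_
  _≟ⁿ_ : DecidableEquality (Node G)
  articulation u ≟ⁿ articulation v = map′ (cong articulation) (λ { refl → refl }) (u ≟ v)
  articulation u ≟ⁿ block Q        = no λ ()
  block P        ≟ⁿ articulation v = no λ ()
  block P        ≟ⁿ block Q        = map′ (cong block) (λ { refl → refl }) (Vec.≡-dec Bool._≟_ P Q)

  visited? : ∀ (x : Node G) ys → Dec (x List.∈ ys)
  visited? x ys = Any.any? (x ≟ⁿ_) ys

  -- Elements of the graph that stand for a node, so that walks in the block-tree can be compared
  -- with links. For a block any of its darts serves, as no vertex separates two of them.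
  Rep : Node G → Element n m → Set
  Rep (articulation w) z = z ≡ inj₁ w
  Rep (block Q)        z = ∃ λ q → q ∈ Q × z ≡ inj₂ q

  rep-exists : ∀ c → IsNode G c → ∃ (Rep c)
  rep-exists (articulation w) _      = inj₁ w , refl
  rep-exists (block Q)        isNode = let q , q∈ = block-nonempty isNode in inj₂ q , q , q∈ , refl

  head-visited : ∀ {x y} (w : Walk G x y) → x List.∈ visited G w
  head-visited ε       = here refl
  head-visited (_ ◅ _) = here refl

  not-head : ∀ {x y} {z : Node G} (w : Walk G x y) → All (z ≢_) (visited G w) → z ≢ x
  not-head ε       (p ∷ _) = p
  not-head (_ ◅ _) (p ∷ _) = p

  suffix : ∀ {x y z} (w : Walk G x y) → Unique (visited G w) → z List.∈ visited G w →
           ∃ λ (w′ : Walk G z y) → Unique (visited G w′) × walkLength G w′ ≤ walkLength G w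
  suffix ε       u       (here refl) = ε , u , ℕ.≤-refl
  suffix (s ◅ w) u       (here refl) = s ◅ w , u , ℕ.≤-refl
  suffix (s ◅ w) (_ ∷ u) (there z∈)  = let w′ , u′ , ≤ = suffix w u z∈ in w′ , u′ , ℕ.m≤n⇒m≤1+n ≤

  absent : ∀ {x : Node G} {ys} → ¬ x List.∈ ys → All (x ≢_) ys
  absent {ys = []}     _  = []
  absent {ys = y ∷ ys} x∉ = (x∉ ∘ here) ∷ absent (x∉ ∘ there)

  erase-loops : ∀ {x y} (w : Walk G x y) →
                ∃ λ (w′ : Walk G x y) → Unique (visited G w′) × walkLength G w′ ≤ walkLength G w
  erase-loops ε = ε , [] ∷ [] , ℕ.≤-refl
  erase-loops {x} (s ◅ w) with erase-loops w
  ... | w′ , u , ≤ with visited? x (visited G w′)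
  ...   | yes x∈ = let w″ , u″ , ≤′ = suffix w′ u x∈ in w″ , u″ , ℕ.m≤n⇒m≤1+n (ℕ.≤-trans ≤′ ≤)
  ...   | no x∉  = s ◅ w′ , absent x∉ ∷ u , s≤s ≤

  articulation-between : ∀ {d e v} → ι d ≡ just v → ι e ≡ just v → ¬ d ≈ᵇ e → IsArticulation G v
  articulation-between dv ev d≉e conn = separator-at dv ev d≉e (conn (inj₂ _) (inj₂ _) ∈⊤ ∈⊤)

  end-of-block : ∀ {d v} → ι d ≡ just v → v ∈ ends G (blockOf d)
  end-of-block = ∈ends⁺ G _ ∈blockOf

  -- The tree walk follows a walk in the graph. Where the latter passes at v to a dart of another
  -- block, v is an articulation and the tree walk takes two steps; at a vertex, a dart with its
  -- block is remembered.
  block-walk : ∀ d c → IsNode G c → Walk G (block (blockOf d)) c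
  block-walk d c isNode = to c isNode
    where
    R : Element n m → Set
    R (inj₂ e) = Walk G (block (blockOf d)) (block (blockOf e))
    R (inj₁ v) = ∃ λ e → ι e ≡ just v × Walk G (block (blockOf d)) (block (blockOf e))
    extend : ∀ {e f} → Walk G (block (blockOf d)) (block (blockOf e)) → e ≈ᵇ f →
             Walk G (block (blockOf d)) (block (blockOf f))
    extend {e} {f} w e≈f =
      subst (λ Q → Walk G (block (blockOf d)) (block Q))
            (block-unique (blockOf-block e) (blockOf-block f)
              (≈-block (blockOf-block e) ∈blockOf e≈f) ∈blockOf) w
    reach : ∀ z → R z
    reach z = propagate none R
      (λ e w → extend w λ v → mate-link ⁅ v ⁆)
      (λ e v _ ev w → e , ev , w)
      (λ { f v _ fv (e , ev , w) → turn f v fv e ev w }) (all-linked (inj₂ d) z) ε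
      where
      turn : ∀ f v → ι f ≡ just v → ∀ e → ι e ≡ just v → R (inj₂ e) → R (inj₂ f)
      turn f v fv e ev w with ≈ᵇ-dec e f
      ... | yes e≈f = extend w e≈f
      ... | no e≉f =
        let art = articulation-between ev fv e≉f
        in w ◅◅ up art (blockOf-block e) (end-of-block ev)
             ◅ down art (blockOf-block f) (end-of-block fv) ◅ ε
    to : ∀ c → IsNode G c → Walk G (block (blockOf d)) c
    to (block P) P! =
      let p , p∈ = block-nonempty P!
      in subst (λ Q → Walk G (block (blockOf d)) (block Q))
               (block-unique (blockOf-block p) P! ∈blockOf p∈) (reach (inj₂ p))
    to (articulation w) art =
      let e , ew , walk = reach (inj₁ w)
      in walk ◅◅ up art (blockOf-block e) (end-of-block ew) ◅ ε

  -- Each block on the walk stays connected without u, and consecutive blocks share an articulation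
  -- other than u.
  avoiding-links : ∀ {u x y z z′} (w : Walk G x y) → IsNode G x → ¬ articulation u List.∈ visited G w →
                   Rep x z → Rep y z′ → ⁅ u ⁆ ⊢ z ~ z′
  avoiding-links {x = articulation _} ε _ _ refl refl = ε
  avoiding-links {u} {block Q} ε Q! _ (q , q∈ , refl) (q′ , q′∈ , refl) = block-≈ Q! q∈ q′∈ u
  avoiding-links {u} (down _ Q! v∈ ◅ w) _ u∉ refl r′ =
    let q , q∈ = block-nonempty Q!
    in ⊢-sym ⁅ u ⁆ (block-end Q! q∈ v∈ λ { refl → u∉ (here refl) })
       ◅◅ avoiding-links w Q! (u∉ ∘ there) (q , q∈ , refl) r′
  avoiding-links {u} (up art Q! v∈ ◅ w) _ u∉ (q , q∈ , refl) r′ =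
    block-end Q! q∈ v∈ (λ { refl → u∉ (there (head-visited w)) })
      ◅◅ avoiding-links w art (u∉ ∘ there) refl r′

  module _ {u : Fin n} where

    -- A link off u from q to the end would also link the blocks just before and just after u. By
    -- `blocks-at` they would be equal, but the walk has no repetitions. If the walk ends at u, no
    -- dart is linked to u once u is removed.
    crossing-separates : ∀ {Q y z q} (w : Walk G (block Q) y) → Unique (visited G w) →
      articulation u List.∈ visited G w → q ∈ Q → Rep y z → ¬ ⁅ u ⁆ ⊢ inj₂ q ~ z
    crossing-separates ε _ (here ()) _ _
    crossing-separates ε _ (there ()) _ _
    crossing-separates (up _ _ _ ◅ ε) _ (there (here refl)) q∈ refl l = isolated ⁅ u ⁆ (x∈⁅x⁆ u) l
    crossing-separates (up _ Q! a∈Q ◅ down _ Q₂! a∈Q₂ ◅ w) ((_ ∷ Q∉) ∷ u∉ ∷ _) (there (here refl)) q∈ r l =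
      let q₂ , q₂∈ = block-nonempty Q₂!
          k = avoiding-links w Q₂! (λ u∈ → All.lookup u∉ u∈ refl) (q₂ , q₂∈ , refl) r
      in not-head w Q∉ (cong block (blocks-at Q! Q₂! a∈Q a∈Q₂ q∈ q₂∈ (l ◅◅ ⊢-sym ⁅ u ⁆ k)))
    crossing-separates (up _ Q! a∈Q ◅ down _ Q₂! a∈Q₂ ◅ w) (_ ∷ a∉ ∷ uniq) (there (there u∈)) q∈ r l =
      let q₂ , q₂∈ = block-nonempty Q₂!
          a≢u = λ { refl → All.lookup a∉ u∈ refl }
      in crossing-separates w uniq u∈ q₂∈ r
           (⊢-sym ⁅ u ⁆ (block-end Q! q∈ a∈Q a≢u ◅◅ ⊢-sym ⁅ u ⁆ (block-end Q₂! q₂∈ a∈Q₂ a≢u)) ◅◅ l)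

    -- P is the node just before u on the walk; the piece of the walk up to P does not meet u and
    -- therefore yields links off u.
    block-before : ∀ {Q y} (w : Walk G (block Q) y) → Unique (visited G w) →
      articulation u List.∈ visited G w →
      ∃ λ P → IsBlock G P × block P List.∈ visited G w × u ∈ ends G P
              × (∀ {q p} → q ∈ Q → p ∈ P → ⁅ u ⁆ ⊢ inj₂ q ~ inj₂ p)
    block-before ε _ (here ())
    block-before ε _ (there ())
    block-before {Q} (up {u = a} _ Q! a∈Q ◅ w) _ (there u∈) with a ≟ u
    ... | yes refl = Q , Q! , here refl , a∈Q , λ q∈ p∈ → block-≈ Q! q∈ p∈ u
    block-before {Q} (up {u = a} _ Q! a∈Q ◅ ε) _ (there (here refl)) | no a≢u = contradiction refl a≢u
    block-before {Q} (up {u = a} _ Q! a∈Q ◅ down _ _ _ ◅ _) _ (there (here refl)) | no a≢u = contradiction refl a≢u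
    block-before {Q} (up {u = a} _ Q! a∈Q ◅ down _ Q₂! a∈Q₂ ◅ w) (_ ∷ _ ∷ uniq) (there (there u∈)) | no a≢u =
      let P , P! , P∈ , u∈P , links = block-before w uniq u∈
          q₂ , q₂∈ = block-nonempty Q₂!
      in P , P! , there (there P∈) , u∈P , λ q∈ p∈ →
           block-end Q! q∈ a∈Q a≢u ◅◅ ⊢-sym ⁅ u ⁆ (block-end Q₂! q₂∈ a∈Q₂ a≢u) ◅◅ links q₂∈ p∈

  -- The witness a is the node after P on the walk, that is, the parent of P when the tree is rooted
  -- at y. It cuts P off from the root, while the starting block stays linked to P without it.
  parent : ∀ {Q P y z} (w : Walk G (block Q) y) → Unique (visited G w) →
    block P List.∈ visited G w → y ≢ block P → Rep y z →
    ∃ λ a → articulation a List.∈ visited G w × IsBlock G P × a ∈ ends G P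
            × (∀ {p} → p ∈ P → ¬ ⁅ a ⁆ ⊢ inj₂ p ~ z)
            × (∀ {q p} → q ∈ Q → p ∈ P → ⁅ a ⁆ ⊢ inj₂ q ~ inj₂ p)
  parent ε _ (here refl) y≢ _ = contradiction refl y≢
  parent (up {a} art Q! a∈Q ◅ w) uniq (here refl) _ r =
    a , a∈ , Q! , a∈Q , (λ p∈ → crossing-separates (up art Q! a∈Q ◅ w) uniq a∈ p∈ r) ,
    (λ q∈ p∈ → block-≈ Q! q∈ p∈ a)
    where
    a∈ : articulation a List.∈ visited G (up art Q! a∈Q ◅ w)
    a∈ = there (head-visited w)
  parent (up _ _ _ ◅ ε) _ (there (here ())) _ _
  parent (up _ _ _ ◅ ε) _ (there (there ())) _ _
  parent (up _ Q! b∈Q ◅ down _ Q₂! b∈Q₂ ◅ w) (_ ∷ b∉ ∷ uniq) (there (there P∈)) y≢ r =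
    let a , a∈ , P! , a∈P , sep , links = parent w uniq P∈ y≢ r
        q₂ , q₂∈ = block-nonempty Q₂!
        b≢a = λ { refl → All.lookup b∉ a∈ refl }
    in a , there (there a∈) , P! , a∈P , sep , λ q∈ p∈ →
         block-end Q! q∈ b∈Q b≢a ◅◅ ⊢-sym ⁅ a ⁆ (block-end Q₂! q₂∈ b∈Q₂ b≢a) ◅◅ links q₂∈ p∈

-- Block parts in terms of links

module Parts {n m : ℕ} (G : Graph (Fin n) (Fin m)) (simple : IsSimple G)
             (c : Node G) (centre : IsNode G c) where

  open Graph G
  open IsSimple simple
  open BlockTree G simple public

  zᶜ : Element n m
  zᶜ = proj₁ (rep-exists c centre)

  rep-zᶜ : Rep c zᶜ
  rep-zᶜ = proj₂ (rep-exists c centre)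

  -- A block part without reference to the tree: a union of components of the graph without u that
  -- do not meet the centre. `shape` tells the two kinds of node apart: an articulation takes all
  -- these components, a block a single one. If u is the centre, no dart is linked to it after its
  -- removal, so `apart` holds for every dart.
  record BlockPartFacts (S : Sub n m) (u : Fin n) : Set where
    field
      vertices : Sub.verts S ≡ ends G (Sub.darts S)
      spread   : ∀ {d e} → d ∈ Sub.darts S → ⁅ u ⁆ ⊢ inj₂ d ~ inj₂ e → e ∈ Sub.darts S
      apart    : ∀ {d} → d ∈ Sub.darts S → ¬ ⁅ u ⁆ ⊢ inj₂ d ~ zᶜ
      shape    : (∀ {d} → ¬ ⁅ u ⁆ ⊢ inj₂ d ~ zᶜ → d ∈ Sub.darts S)
               ⊎ (∀ {d e} → d ∈ Sub.darts S → e ∈ Sub.darts S → ⁅ u ⁆ ⊢ inj₂ d ~ inj₂ e)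
      nonempty : Nonempty (Sub.darts S)

  tree-walk : ∀ {Q} → IsBlock G Q → ∃ λ (w : Walk G (block Q) c) → Unique (visited G w)
  tree-walk Q! =
    let q , q∈ = block-nonempty Q!
    in subst (λ Q → ∃ λ (w : Walk G (block Q) c) → Unique (visited G w))
             (block-unique (blockOf-block q) Q! ∈blockOf q∈)
             (let w , uniq , _ = erase-loops (block-walk q c centre) in w , uniq)

  -- A vertex other than u is `zᶜ` or has a dart, because the graph is connected.
  no-articulation : ∀ {u} → (∀ d → ⁅ u ⁆ ⊢ inj₂ d ~ zᶜ) → ¬ IsArticulation G u
  no-articulation {u} links art = art λ x y x∈ y∈ → to x x∈ ◅◅ ⊢-sym ⁅ u ⁆ (to y y∈)
    where
    to : ∀ x → x ∈ˢ (whole ∖ ⁅ u ⁆) → ⁅ u ⁆ ⊢ x ~ zᶜ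
    to (inj₂ d) _ = links d
    to (inj₁ v) v∈ with Sum.≡-dec _≟_ _≟_ zᶜ (inj₁ v)
    ... | yes p = subst (⁅ u ⁆ ⊢ inj₁ v ~_) (sym p) ε
    ... | no p  = let d , dv = first-dart none (all-linked (inj₁ v) zᶜ) p
                  in ⊢-sym ⁅ u ⁆ (end-link ⁅ u ⁆ (x∈p─q⇒x∉q full ⁅ u ⁆ v∈) dv) ◅◅ links d

  -- For an articulation, a dart belongs to S when its tree walk to the centre visits u; by
  -- `crossing-separates` and `avoiding-links` this means that u separates it from the centre. For a
  -- block P with parent a, the darts of S are those linked to P off a, and the dart at u outside S
  -- then forces u to be a.
  blockPart-facts : ∀ {S u} → IsBlockPart G c S u → BlockPartFacts S u
  blockPart-facts {S} {u} part = facts node isNode not-central union-of-blocks attached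
    where
    open IsBlockPart part using (node; isNode; not-central; union-of-blocks; attached)
    D : Subset m
    D = Sub.darts S
    facts : ∀ node → IsNode G node → (∀ Q → c ≡ block Q → node ≢ c) →
      (∀ d → d ∈ D ⇔ (∃ λ Q → IsBlock G Q × InSubtree G c node (block Q) × d ∈ Q)) →
      node ≡ articulation u ⊎ ((∃ λ Q → node ≡ block Q) × u ∈ Sub.verts S
                               × ∃ λ d → d ∉ D × ι d ≡ just u) →
      BlockPartFacts S u
    facts (block P) _ _ _ (inj₁ ())
    facts (articulation a) art _ union attached = go a art union (is-u attached)
      where
      is-u : articulation a ≡ articulation u ⊎ ((∃ λ Q → articulation a ≡ block Q) × _) → a ≡ u
      is-u (inj₁ refl) = refl
      is-u (inj₂ ((_ , ()) , _))
      go : ∀ a → IsNode G (articulation a) →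
        (∀ d → d ∈ D ⇔ (∃ λ Q → IsBlock G Q × InSubtree G c (articulation a) (block Q) × d ∈ Q)) →
        a ≡ u → BlockPartFacts S u
      go a art union refl = record
        { vertices = IsBlockPart.vertices part
        ; spread   = λ d∈ d~e → in-D λ e~z → out-D d∈ (d~e ◅◅ e~z)
        ; apart    = out-D
        ; shape    = inj₁ in-D
        ; nonempty = let d , ¬l = ¬∀⟶∃¬ m _ (λ d → ⊢-dec ⁅ u ⁆ (inj₂ d) zᶜ) λ links → no-articulation links art
                     in d , in-D ¬l
        }
        where
        out-D : ∀ {d} → d ∈ D → ¬ ⁅ u ⁆ ⊢ inj₂ d ~ zᶜ
        out-D d∈ = let Q , _ , (w , uniq , u∈) , d∈Q = Equivalence.to (union _) d∈
                   in crossing-separates w uniq u∈ d∈Q rep-zᶜ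
        in-D : ∀ {d} → ¬ ⁅ u ⁆ ⊢ inj₂ d ~ zᶜ → d ∈ D
        in-D {d} ¬l =
          let w , uniq = tree-walk (blockOf-block d)
          in case visited? (articulation u) (visited G w) of λ
             { (yes u∈) → Equivalence.from (union d) (blockOf d , blockOf-block d , (w , uniq , u∈) , ∈blockOf)
             ; (no u∉) → contradiction (avoiding-links w (blockOf-block d) u∉ (d , ∈blockOf , refl) rep-zᶜ) ¬l }
    facts (block P) P! nc union (inj₂ (_ , u∈ , d₀ , d₀∉ , d₀u)) =
      let w , uniq = tree-walk P!
          a , _ , _ , a∈P , sep , _ = parent w uniq (head-visited w) c≢P rep-zᶜ
      in go a a∈P sep
      where
      c≢P : c ≢ block P
      c≢P eq = nc P eq (sym eq)
      p = proj₁ (block-nonempty P!)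
      p∈ = proj₂ (block-nonempty P!)
      go : ∀ a → a ∈ ends G P → (∀ {p} → p ∈ P → ¬ ⁅ a ⁆ ⊢ inj₂ p ~ zᶜ) → BlockPartFacts S u
      go a a∈P sep = conclude (decidable-stable (u ≟ a) u≡a)
        where
        out-D : ∀ {d} → d ∈ D → ⁅ a ⁆ ⊢ inj₂ d ~ inj₂ p
        out-D d∈ =
          let Q , _ , (w , uniq , P∈) , d∈Q = Equivalence.to (union _) d∈
              b , _ , _ , b∈P , sep′ , links = parent w uniq P∈ c≢P rep-zᶜ
          in case a ≟ b of λ
             { (yes refl) → links d∈Q p∈
             -- If P had two different parents a and b, each of them would be cut off from the
             -- centre by the other.
             ; (no a≢b) → contradiction (linked-or-cut a≢b zᶜ) Sum.[
                 (λ l → sep p∈ (block-end P! p∈ b∈P (a≢b ∘ sym) ◅◅ ⊢-sym ⁅ a ⁆ l)) ,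
                 (λ l → sep′ p∈ (block-end P! p∈ a∈P a≢b ◅◅ ⊢-sym ⁅ b ⁆ l)) ] }
        in-D : ∀ {d} → ⁅ a ⁆ ⊢ inj₂ d ~ inj₂ p → d ∈ D
        in-D {d} l =
          let w , uniq = tree-walk (blockOf-block d)
          in case visited? (articulation a) (visited G w) of λ
             { (yes a∈) →
                 let Q , Q! , Q∈ , a∈Q , links = block-before w uniq a∈
                     q , q∈ = block-nonempty Q!
                     Q≡P = blocks-at Q! P! a∈Q a∈P q∈ p∈ (⊢-sym ⁅ a ⁆ (links ∈blockOf q∈) ◅◅ l)
                 in Equivalence.from (union d) (blockOf d , blockOf-block d ,
                      (w , uniq , subst (λ Q → block Q List.∈ visited G w) Q≡P Q∈) , ∈blockOf)
             ; (no a∉) → contradiction (⊢-sym ⁅ a ⁆ l ◅◅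
                 avoiding-links w (blockOf-block d) a∉ (d , ∈blockOf , refl) rep-zᶜ) (sep p∈) }
        u≡a : ¬ u ≢ a
        u≡a u≢a = let d , d∈ , du = ∈ends⁻ G D (subst (u ∈_) (IsBlockPart.vertices part) u∈)
                  in d₀∉ (in-D (share-link ⁅ a ⁆ (x∉⁅⁆ u≢a) d₀u du ◅◅ out-D d∈))
        conclude : u ≡ a → BlockPartFacts S u
        conclude refl = record
          { vertices = IsBlockPart.vertices part
          ; spread   = λ d∈ d~e → in-D (⊢-sym ⁅ u ⁆ d~e ◅◅ out-D d∈)
          ; apart    = λ d∈ d~z → sep p∈ (⊢-sym ⁅ u ⁆ (out-D d∈) ◅◅ d~z)
          ; shape    = inj₂ λ d∈ e∈ → out-D d∈ ◅◅ ⊢-sym ⁅ u ⁆ (out-D e∈)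
          ; nonempty = p , in-D ε
          }

pair-comm : ∀ {n} {u v : Fin n} → ⁅ v ⁆ ∪ ⁅ u ⁆ ⊆ ⁅ u ⁆ ∪ ⁅ v ⁆
pair-comm x∈ = x∈pair⁺ (Sum.swap (x∈pair⁻ x∈))

-- Parts

module PartFacts {n m : ℕ} (G : Graph (Fin n) (Fin m)) (simple : IsSimple G)
                 (c : Node G) (centre : IsNode G c) where

  open Graph G
  open IsSimple simple
  open Parts G simple c centre public

  module BlockPart {S : Sub n m} {u : Fin n} (facts : BlockPartFacts S u) where

    open BlockPartFacts facts public

    private
      D : Subset m
      D = Sub.darts S

    ∈verts⁺ : ∀ {d x} → d ∈ D → ι d ≡ just x → x ∈ Sub.verts S
    ∈verts⁺ d∈ dx = subst (_ ∈_) (sym vertices) (∈ends⁺ G D d∈ dx)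

    ∈verts⁻ : ∀ {x} → x ∈ Sub.verts S → ∃ λ d → d ∈ D × ι d ≡ just x
    ∈verts⁻ x∈ = ∈ends⁻ G D (subst (_ ∈_) vertices x∈)

    around : ∀ {d x} → x ∈ Sub.verts S → x ≢ u → ι d ≡ just x → d ∈ D
    around x∈ x≢u dx = let e , e∈ , ex = ∈verts⁻ x∈ in spread e∈ (share-link ⁅ u ⁆ (x∉⁅⁆ x≢u) ex dx)

    closed : Closed G D
    closed d∈ = spread d∈ (mate-link ⁅ u ⁆)

    -- Every element other than u is a dart of S or linked to one off u, so only u is left for the
    -- centre.
    not-everything : (∀ d → d ∈ D) → (∀ v → ∃ λ d → d ∈ D × ι d ≡ just v) → zᶜ ≡ inj₁ u
    not-everything all all-v = go zᶜ refl
      where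
      go : ∀ z → zᶜ ≡ z → zᶜ ≡ inj₁ u
      go (inj₂ p) eq = contradiction (subst (⁅ u ⁆ ⊢ inj₂ p ~_) (sym eq) ε) (apart (all p))
      go (inj₁ w) eq with w ≟ u
      ... | yes refl = eq
      ... | no w≢u   = let d , d∈ , dw = all-v w
                       in contradiction (subst (⁅ u ⁆ ⊢ inj₂ d ~_) (sym eq) (end-link ⁅ u ⁆ (x∉⁅⁆ w≢u) dw)) (apart d∈)

    -- If S missed u, `around` would apply at each of its vertices, and S would swallow the whole
    -- connected graph, including a dart at u.
    u∈verts : u ∈ Sub.verts S
    u∈verts = decidable-stable (u ∈? Sub.verts S) λ u∉ →
      let all , all-v = everything D nonempty closed
                          λ d∈ dv ev → around (∈verts⁺ d∈ dv) (λ { refl → u∉ (∈verts⁺ d∈ dv) }) ev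
          d , d∈ , du = all-v u
      in u∉ (∈verts⁺ d∈ du)

    -- A walk from u may enter S, but it returns to the outside only through u, where it can be
    -- restarted. After its last passage of u on the way to a dart outside S it does not meet w.
    outside-link : ∀ {w d e} → w ∈ Sub.verts S → w ≢ u → d ∉ D → e ∉ D → ⁅ w ⁆ ⊢ inj₂ d ~ inj₂ e
    outside-link {w} w∈ w≢u d∉ e∉ = ⊢-sym ⁅ w ⁆ (to-u d∉) ◅◅ to-u e∉
      where
      P : Element n m → Set
      P (inj₂ e) = e ∈ D ⊎ ⁅ w ⁆ ⊢ inj₁ u ~ inj₂ e
      P (inj₁ x) = (x ∈ Sub.verts S × x ≢ u) ⊎ ⁅ w ⁆ ⊢ inj₁ u ~ inj₁ x
      at-end : ∀ d x → x ∉ none → ι d ≡ just x → P (inj₂ d) → P (inj₁ x)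
      at-end d x _ dx p with x ≟ u | x ≟ w
      ... | yes refl | _ = inj₂ ε
      ... | no x≢u | yes refl = inj₁ (w∈ , x≢u)
      ... | no x≢u | no x≢w = Sum.map (λ d∈ → ∈verts⁺ d∈ dx , x≢u) (_◅◅ end-link ⁅ w ⁆ (x∉⁅⁆ x≢w) dx) p
      from-end : ∀ d x → x ∉ none → ι d ≡ just x → P (inj₁ x) → P (inj₂ d)
      from-end d x _ dx (inj₁ (x∈ , x≢u)) = inj₁ (around x∈ x≢u dx)
      from-end d x _ dx (inj₂ l) with x ≟ w
      ... | yes refl = inj₁ (around w∈ w≢u dx)
      ... | no x≢w = inj₂ (l ◅◅ ⊢-sym ⁅ w ⁆ (end-link ⁅ w ⁆ (x∉⁅⁆ x≢w) dx))
      to-u : ∀ {d} → d ∉ D → ⁅ w ⁆ ⊢ inj₁ u ~ inj₂ d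
      to-u {d} d∉ with propagate none P (λ _ → Sum.map closed (_◅◅ mate-link ⁅ w ⁆)) at-end from-end
                         (all-linked (inj₁ u) (inj₂ d)) (inj₂ ε)
      ... | inj₁ d∈ = contradiction d∈ d∉
      ... | inj₂ l  = l

    -- A walk from d to u stays in S until it first reaches u, and W does not meet S.
    boundary-link : ∀ {W d} → (∀ {x} → x ∈ W → x ∉ Sub.verts S) → d ∈ D → W ⊢ inj₂ d ~ inj₁ u
    boundary-link {W} {d} W∉ d∈ = finish (propagate none P at-mate at-end from-end
                                    (all-linked (inj₂ d) (inj₁ u)) (inj₁ (d∈ , ε)))
      where
      avoids : ∀ {x} → x ∈ Sub.verts S → x ∉ W
      avoids x∈ x∈W = W∉ x∈W x∈
      P : Element n m → Set
      P (inj₂ e) = (e ∈ D × W ⊢ inj₂ d ~ inj₂ e) ⊎ W ⊢ inj₂ d ~ inj₁ u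
      P (inj₁ x) = ((x ∈ Sub.verts S × x ≢ u) × W ⊢ inj₂ d ~ inj₁ x) ⊎ W ⊢ inj₂ d ~ inj₁ u
      at-mate : ∀ e → P (inj₂ e) → P (inj₂ (mate e))
      at-mate e = Sum.map₁ λ (e∈ , l) → closed e∈ , l ◅◅ mate-link W
      at-end : ∀ e x → x ∉ none → ι e ≡ just x → P (inj₂ e) → P (inj₁ x)
      at-end e x _ ex (inj₂ l) = inj₂ l
      at-end e x _ ex (inj₁ (e∈ , l)) with x ≟ u
      ... | yes refl = inj₂ (l ◅◅ end-link W (avoids u∈verts) ex)
      ... | no x≢u = inj₁ ((∈verts⁺ e∈ ex , x≢u) , l ◅◅ end-link W (avoids (∈verts⁺ e∈ ex)) ex)
      from-end : ∀ e x → x ∉ none → ι e ≡ just x → P (inj₁ x) → P (inj₂ e)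
      from-end e x _ ex (inj₂ l) = inj₂ l
      from-end e x _ ex (inj₁ ((x∈ , x≢u) , l)) =
        inj₁ (around x∈ x≢u ex , l ◅◅ ⊢-sym W (end-link W (avoids x∈) ex))
      finish : P (inj₁ u) → W ⊢ inj₂ d ~ inj₁ u
      finish (inj₁ ((_ , u≢u) , _)) = contradiction refl u≢u
      finish (inj₂ l) = l

  -- If the two vertices differed, S could be left at neither of them, since only u′ is an exit for
  -- one description and only u for the other. S would be the whole graph, and `not-everything`
  -- would put the centre at both.
  blockPart-boundary : ∀ {S u u′} → BlockPartFacts S u → BlockPartFacts S u′ → u ≡ u′
  blockPart-boundary {S} {u} {u′} F F′ = decidable-stable (u ≟ u′) λ u≢u′ →
    let all , all-v = everything (Sub.darts S) F.nonempty F.closed (spread u≢u′)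
    in case trans (sym (F.not-everything all all-v)) (F′.not-everything all all-v) of λ { refl → u≢u′ refl }
    where
    module F  = BlockPart F
    module F′ = BlockPart F′
    spread : u ≢ u′ → ∀ {d e v} → d ∈ Sub.darts S → ι d ≡ just v → ι e ≡ just v → e ∈ Sub.darts S
    spread u≢u′ {v = v} d∈ dv ev with v ≟ u
    ... | no v≢u   = F.around (F.∈verts⁺ d∈ dv) v≢u ev
    ... | yes refl = F′.around (F.∈verts⁺ d∈ dv) u≢u′ ev

  -- The component K of IsProperPart consists of the inner vertices and of all
  -- darts of S.
  record ProperPartFacts (S : Sub n m) (u v : Fin n) : Set where
    D : Subset m
    D = Sub.darts S
    field
      {B}      : Subset m
      isBlock  : IsBlock G B
      u≢v      : u ≢ v
      u∈B      : u ∈ ends G B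
      v∈B      : v ∈ ends G B
      degree-u : 3 ≤ degreeIn G B u
      degree-v : 3 ≤ degreeIn G B v
      inner    : Subset n
    In : Element n m → Set
    In z = z ∈ˢ sub inner D
    field
      verts⁻   : ∀ {x} → x ∈ Sub.verts S → x ∈ inner ⊎ x ≡ u ⊎ x ≡ v
      verts⁺   : ∀ {x} → x ∈ inner ⊎ x ≡ u ⊎ x ≡ v → x ∈ Sub.verts S
      inner≢u  : ∀ {x} → x ∈ inner → x ≢ u
      inner≢v  : ∀ {x} → x ∈ inner → x ≢ v
      linked   : ∀ {z z′} → In z → In z′ → ⁅ u ⁆ ∪ ⁅ v ⁆ ⊢ z ~ z′
      spread   : ∀ {z z′} → In z → ⁅ u ⁆ ∪ ⁅ v ⁆ ⊢ z ~ z′ → z′ ∈ˢ (whole ∖ (⁅ u ⁆ ∪ ⁅ v ⁆)) → In z′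
      {y₀}     : Fin n
      y₀∈inner : y₀ ∈ inner
      y₀∈B     : y₀ ∈ ends G B
      {r}      : Fin n
      r∈B      : r ∈ ends G B
      r∉inner  : r ∉ inner
      r≢u      : r ≢ u
      r≢v      : r ≢ v
      cut      : ∃ λ x → x ∈ ends G B × x ≢ u × x ≢ v × ¬ ⁅ u ⁆ ∪ ⁅ v ⁆ ⊢ inj₁ r ~ inj₁ x

  swap : ∀ {S u v} → ProperPartFacts S u v → ProperPartFacts S v u
  swap F = record
    { isBlock = isBlock ; u≢v = u≢v ∘ sym ; u∈B = v∈B ; v∈B = u∈B ; degree-u = degree-v ; degree-v = degree-u
    ; inner = inner
    ; verts⁻ = λ x∈ → Sum.map₂ Sum.swap (verts⁻ x∈) ; verts⁺ = λ p → verts⁺ (Sum.map₂ Sum.swap p)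
    ; inner≢u = inner≢v ; inner≢v = inner≢u
    ; linked = λ {z} {z′} z∈ z′∈ → ⊢-anti pair-comm (linked {z} {z′} z∈ z′∈)
    ; spread = λ {z} {z′} z∈ l z′∈ → spread {z} {z′} z∈ (⊢-anti pair-comm l) (flip z′ z′∈)
    ; y₀∈inner = y₀∈inner ; y₀∈B = y₀∈B ; r∈B = r∈B ; r∉inner = r∉inner ; r≢u = r≢v ; r≢v = r≢u
    ; cut = let x , x∈ , x≢u , x≢v , ¬l = cut in x , x∈ , x≢v , x≢u , λ l → ¬l (⊢-anti pair-comm l)
    }
    where
    open ProperPartFacts F
    flip : ∀ {u v} z → z ∈ˢ (whole ∖ (⁅ u ⁆ ∪ ⁅ v ⁆)) → z ∈ˢ (whole ∖ (⁅ v ⁆ ∪ ⁅ u ⁆))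
    flip {u} {v} (inj₁ x) x∈ = x∈p∧x∉q⇒x∈p─q ∈⊤ λ x∈U → x∈p─q⇒x∉q full (⁅ u ⁆ ∪ ⁅ v ⁆) x∈ (pair-comm x∈U)
    flip (inj₂ _) _ = ∈⊤

  module ProperPart {S : Sub n m} {u v : Fin n} (facts : ProperPartFacts S u v) where

    open ProperPartFacts facts public

    U : Subset n
    U = ⁅ u ⁆ ∪ ⁅ v ⁆

    not-in-U : ∀ {x} → x ≢ u → x ≢ v → x ∈ full ─ U
    not-in-U x≢u x≢v = x∈p∧x∉q⇒x∈p─q ∈⊤ (x∉pair x≢u x≢v)

    inner∉U : ∀ {x} → x ∈ inner → x ∉ U
    inner∉U x∈ = x∉pair (inner≢u x∈) (inner≢v x∈)

    around : ∀ {d x} → x ∈ inner → ι d ≡ just x → d ∈ D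
    around x∈ dx = spread {inj₁ _} {inj₂ _} x∈ (⊢-sym U (end-link U (inner∉U x∈) dx)) ∈⊤

    inside-or-boundary : ∀ {d x} → d ∈ D → ι d ≡ just x → x ∈ inner ⊎ x ≡ u ⊎ x ≡ v
    inside-or-boundary {d} {x} d∈ dx with x ≟ u | x ≟ v
    ... | yes p | _ = inj₂ (inj₁ p)
    ... | no _ | yes p = inj₂ (inj₂ p)
    ... | no x≢u | no x≢v =
      inj₁ (spread {inj₂ d} {inj₁ x} d∈ (end-link U (x∉pair x≢u x≢v) dx) (not-in-U x≢u x≢v))

    closed : Closed G D
    closed {d} d∈ = spread {inj₂ d} {inj₂ (mate d)} d∈ (mate-link U) ∈⊤

    module _ (W : Subset n) where

      Reaches : Element n m → Fin n → Set
      Reaches z x = x ∉ W × ∃ λ e → e ∈ D × ι e ≡ just x × W ⊢ z ~ inj₂ e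

      -- The walk can leave S only at u or v. The dart before the first exit is recorded with the
      -- link leading to it, so that the walk can be continued differently from there.
      exit : ∀ {z z′} → In z → ¬ In z′ → W ⊢ z ~ z′ → Reaches z u ⊎ Reaches z v
      exit {z} {z′} z∈ z′∉ l = finish (propagate W P at-mate at-end from-end l (inj₁ (z∈ , ε)))
        where
        P : Element n m → Set
        P z′ = (In z′ × W ⊢ z ~ z′) ⊎ Reaches z u ⊎ Reaches z v
        at-mate : ∀ d → P (inj₂ d) → P (inj₂ (mate d))
        at-mate d = Sum.map₁ λ (d∈ , l) → closed d∈ , l ◅◅ mate-link W
        at-end : ∀ d x → x ∉ W → ι d ≡ just x → P (inj₂ d) → P (inj₁ x)
        at-end d x x∉ dx (inj₂ q) = inj₂ q
        at-end d x x∉ dx (inj₁ (d∈ , l)) with inside-or-boundary d∈ dx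
        ... | inj₁ x∈ = inj₁ (x∈ , l ◅◅ end-link W x∉ dx)
        ... | inj₂ (inj₁ refl) = inj₂ (inj₁ (x∉ , d , d∈ , dx , l))
        ... | inj₂ (inj₂ refl) = inj₂ (inj₂ (x∉ , d , d∈ , dx , l))
        from-end : ∀ d x → x ∉ W → ι d ≡ just x → P (inj₁ x) → P (inj₂ d)
        from-end d x x∉ dx = Sum.map₁ λ (x∈ , l) → around x∈ dx , l ◅◅ ⊢-sym W (end-link W x∉ dx)
        finish : P z′ → _
        finish (inj₁ (z′∈ , _)) = contradiction z′∈ z′∉
        finish (inj₂ q) = q

    Outside : Sub n m
    Outside = sub (full ─ inner) (full ─ D)

    outside-⊢ : ∀ {W z z′} → W ⊆ inner → Linked G Outside z z′ → W ⊢ z ~ z′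
    outside-⊢ {W} W⊆ = link-mono
      ((λ x∈ → x∈p∧x∉q⇒x∈p─q ∈⊤ λ x∈W → x∈p─q⇒x∉q full inner x∈ (W⊆ x∈W)) , λ _ → ∈⊤)

    -- The first meeting with the boundary is recorded. The link up to it lies in `Outside`, so it
    -- survives the removal of any inner vertices.
    enter : ∀ W {z z′} → ¬ In z → In z′ → W ⊢ z ~ z′ →
            (u ∉ W × Linked G Outside z (inj₁ u)) ⊎ (v ∉ W × Linked G Outside z (inj₁ v))
    enter W {z} {z′} z∉ z′∈ l = finish (propagate W P at-mate at-end from-end l (inj₁ (z∉ , ε)))
      where
      Goal : Set
      Goal = (u ∉ W × Linked G Outside z (inj₁ u)) ⊎ (v ∉ W × Linked G Outside z (inj₁ v))
      P : Element n m → Set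
      P z′ = (¬ In z′ × Linked G Outside z z′) ⊎ Goal
      out-end : ∀ {d x} → d ∉ D → x ∉ inner → ι d ≡ just x → Linked G Outside (inj₂ d) (inj₁ x)
      out-end d∉ x∉ dx = fwd (incidence (x∈p∧x∉q⇒x∈p─q ∈⊤ d∉) (x∈p∧x∉q⇒x∈p─q ∈⊤ x∉) dx) ◅ ε
      at-mate : ∀ d → P (inj₂ d) → P (inj₂ (mate d))
      at-mate d = Sum.map₁ λ (d∉ , l) →
        (λ md∈ → d∉ (subst (_∈ D) (mate-involutive d) (closed md∈))) ,
        l ◅◅ fwd (pairing (x∈p∧x∉q⇒x∈p─q ∈⊤ d∉)) ◅ ε
      at-end : ∀ d x → x ∉ W → ι d ≡ just x → P (inj₂ d) → P (inj₁ x)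
      at-end d x x∉ dx = Sum.map₁ λ (d∉ , l) → (λ x∈ → d∉ (around x∈ dx)) ,
                                                l ◅◅ out-end d∉ (λ x∈ → d∉ (around x∈ dx)) dx
      from-end : ∀ d x → x ∉ W → ι d ≡ just x → P (inj₁ x) → P (inj₂ d)
      from-end d x x∉ dx (inj₂ g) = inj₂ g
      from-end d x x∉ dx (inj₁ (x∉K , l)) with d ∈? D
      ... | no d∉ = inj₁ (d∉ , l ◅◅ link-sym (out-end d∉ x∉K dx))
      ... | yes d∈ with inside-or-boundary d∈ dx
      ...   | inj₁ x∈ = contradiction x∈ x∉K
      ...   | inj₂ (inj₁ refl) = inj₂ (inj₁ (x∉ , l))
      ...   | inj₂ (inj₂ refl) = inj₂ (inj₂ (x∉ , l))
      finish : P z′ → Goal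
      finish (inj₁ (z′∉ , _)) = contradiction z′∈ z′∉
      finish (inj₂ g) = g

    block-vertices : ∀ {x y w} → x ∈ ends G B → y ∈ ends G B → x ≢ w → y ≢ w → ⁅ w ⁆ ⊢ inj₁ x ~ inj₁ y
    block-vertices {w = w} x∈ y∈ x≢w y≢w =
      let b , b∈ = block-nonempty isBlock
      in ⊢-sym ⁅ w ⁆ (block-end isBlock b∈ x∈ x≢w) ◅◅ block-end isBlock b∈ y∈ y≢w

    -- Without v the block still links r to the inner vertex `y₀`, and such a walk can only enter at
    -- u.
    r-out-u : Linked G Outside (inj₁ r) (inj₁ u)
    r-out-u with enter ⁅ v ⁆ {inj₁ r} {inj₁ y₀} r∉inner y₀∈inner
                   (block-vertices r∈B y₀∈B r≢v (inner≢v y₀∈inner))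
    ... | inj₁ (_ , l) = l
    ... | inj₂ (v∉ , _) = contradiction (x∈⁅x⁆ v) v∉

    u-in : ∃ λ e → e ∈ D × ι e ≡ just u
    u-in with exit ⁅ v ⁆ {inj₁ y₀} {inj₁ r} y₀∈inner r∉inner
                (block-vertices y₀∈B r∈B (inner≢v y₀∈inner) r≢v)
    ... | inj₁ (_ , e , e∈ , eu , _) = e , e∈ , eu
    ... | inj₂ (v∉ , _) = contradiction (x∈⁅x⁆ v) v∉

    u-out : ∃ λ e → e ∉ D × ι e ≡ just u
    u-out = go (link-sym r-out-u) λ { refl → r≢u refl }
      where
      go : ∀ {z} → Linked G Outside (inj₁ u) z → z ≢ inj₁ u → ∃ λ e → e ∉ D × ι e ≡ just u
      go ε z≢ = contradiction refl z≢
      go (bwd (incidence d∈ _ du) ◅ _) _ = _ , x∈p─q⇒x∉q full D d∈ , du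

  module ProperPart₂ {S : Sub n m} {u v : Fin n} (facts : ProperPartFacts S u v) where

    open ProperPart facts public
    private module Swapped = ProperPart (swap facts)

    v-in : ∃ λ e → e ∈ D × ι e ≡ just v
    v-in = Swapped.u-in

    v-out : ∃ λ e → e ∉ D × ι e ≡ just v
    v-out = Swapped.u-out

    r-out-v : Linked G Outside (inj₁ r) (inj₁ v)
    r-out-v = Swapped.r-out-u

    -- A walk that meets the boundary at v goes on through r, which reaches both u and v outside S.
    outside-u : ∀ {z} → ¬ In z → Linked G Outside z (inj₁ u)
    outside-u {z} z∉ with enter none {z} {inj₁ y₀} z∉ y₀∈inner (all-linked z (inj₁ y₀))
    ... | inj₁ (_ , l) = l
    ... | inj₂ (_ , l) = l ◅◅ link-sym r-out-v ◅◅ r-out-u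

    outside-link : ∀ {W z z′} → W ⊆ inner → ¬ In z → ¬ In z′ → W ⊢ z ~ z′
    outside-link W⊆ z∉ z′∉ = outside-⊢ W⊆ (outside-u z∉ ◅◅ link-sym (outside-u z′∉))

    -- The links given by `linked` avoid the boundary, so they never leave the inside of S, and W
    -- contains none of the vertices they visit.
    linked-off : ∀ {W z z′} → (∀ {x} → x ∈ W → x ∉ inner) → In z → In z′ → W ⊢ z ~ z′
    linked-off {W} {z} {z′} W∉ z∈ z′∈ = proj₂ (propagate U P at-mate at-end from-end (linked {z} {z′} z∈ z′∈) (z∈ , ε))
      where
      P : Element n m → Set
      P z′ = In z′ × W ⊢ z ~ z′
      at-mate : ∀ d → P (inj₂ d) → P (inj₂ (mate d))
      at-mate d (d∈ , l) = closed d∈ , l ◅◅ mate-link W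
      at-end : ∀ d x → x ∉ U → ι d ≡ just x → P (inj₂ d) → P (inj₁ x)
      at-end d x x∉ dx (d∈ , l) with inside-or-boundary d∈ dx
      ... | inj₁ x∈ = x∈ , l ◅◅ end-link W (λ x∈W → W∉ x∈W x∈) dx
      ... | inj₂ p  = contradiction (x∈pair⁺ p) x∉
      from-end : ∀ d x → x ∉ U → ι d ≡ just x → P (inj₁ x) → P (inj₂ d)
      from-end d x x∉ dx (x∈ , l) = around x∈ dx , l ◅◅ ⊢-sym W (end-link W (λ x∈W → W∉ x∈W x∈) dx)

    B-dart-in : ∃ λ d → d ∈ B × d ∈ D
    B-dart-in = let d , d∈ , dy = ∈ends⁻ G B y₀∈B in d , d∈ , around y₀∈inner dy

    B-dart-out : ∃ λ d → d ∈ B × d ∉ D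
    B-dart-out = let d , d∈ , dr = ∈ends⁻ G B r∈B in d , d∈ , λ d∈D → case inside-or-boundary d∈D dr of λ
      { (inj₁ r∈) → r∉inner r∈ ; (inj₂ (inj₁ p)) → r≢u p ; (inj₂ (inj₂ p)) → r≢v p }

-- Components and the parts cut off by a 2-cut

compOf : ∀ {n m} (G : Graph (Fin n) (Fin m)) → Sub n m → Element n m → Sub n m
compOf G T z = sub (select λ v → (v ∈? Sub.verts T) ×-dec linked? {G = G} T z (inj₁ v))
                   (select λ d → (d ∈? Sub.darts T) ×-dec linked? {G = G} T z (inj₂ d))

∈compOf⁺ : ∀ {n m} (G : Graph (Fin n) (Fin m)) T z y → y ∈ˢ T → Linked G T z y → y ∈ˢ compOf G T z
∈compOf⁺ G T z (inj₁ v) y∈ l = select⁺ (λ v → (v ∈? Sub.verts T) ×-dec linked? {G = G} T z (inj₁ v)) (y∈ , l)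
∈compOf⁺ G T z (inj₂ d) y∈ l = select⁺ (λ d → (d ∈? Sub.darts T) ×-dec linked? {G = G} T z (inj₂ d)) (y∈ , l)

∈compOf⁻ : ∀ {n m} (G : Graph (Fin n) (Fin m)) T z y → y ∈ˢ compOf G T z → y ∈ˢ T × Linked G T z y
∈compOf⁻ G T z (inj₁ v) = select⁻ (λ v → (v ∈? Sub.verts T) ×-dec linked? {G = G} T z (inj₁ v))
∈compOf⁻ G T z (inj₂ d) = select⁻ (λ d → (d ∈? Sub.darts T) ×-dec linked? {G = G} T z (inj₂ d))

compOf-component : ∀ {n m} (G : Graph (Fin n) (Fin m)) T z → z ∈ˢ T → IsComponent G T (compOf G T z)
compOf-component G T z z∈ = z , z∈ , λ y → mk⇔ (∈compOf⁻ G T z y) λ (y∈ , l) → ∈compOf⁺ G T z y y∈ l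

module CutParts {n m : ℕ} (G : Graph (Fin n) (Fin m)) (simple : IsSimple G)
                (c : Node G) (centre : IsNode G c) where

  open Graph G
  open IsSimple simple
  open PartFacts G simple c centre public

  ContainsCentre-mono : ∀ {K L} → Sub.verts K ⊆ Sub.verts L → ContainsCentre G c K → ContainsCentre G c L
  ContainsCentre-mono K⊆L (inj₁ (Q , eq , ⊆K)) = inj₁ (Q , eq , λ x∈ → K⊆L (⊆K x∈))
  ContainsCentre-mono K⊆L (inj₂ (w , eq , w∈)) = inj₂ (w , eq , K⊆L w∈)

  -- A 2-cut together with a vertex x on the side that is to be cut off and a vertex y on another
  -- side. Separation is stated in the whole graph, where the part is formed; `retract` obtains it
  -- from separation inside the block.
  record Cut (B : Subset m) (a b x y : Fin n) : Set where
    field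
      isBlock  : IsBlock G B
      a≢b      : a ≢ b
      a∈B      : a ∈ ends G B
      b∈B      : b ∈ ends G B
      degree-a : 3 ≤ degreeIn G B a
      degree-b : 3 ≤ degreeIn G B b
      x∈B      : x ∈ ends G B
      y∈B      : y ∈ ends G B
      x≢a      : x ≢ a
      x≢b      : x ≢ b
      y≢a      : y ≢ a
      y≢b      : y ≢ b
      apart    : ¬ ⁅ a ⁆ ∪ ⁅ b ⁆ ⊢ inj₁ x ~ inj₁ y

  module CutPart {B a b x y} (cut : Cut B a b x y) where

    open Cut cut

    private
      U : Subset n
      U = ⁅ a ⁆ ∪ ⁅ b ⁆

    off : ∀ {v} → v ≢ a → v ≢ b → v ∈ full ─ U
    off v≢a v≢b = x∈p∧x∉q⇒x∈p─q ∈⊤ (x∉pair v≢a v≢b)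

    K : Sub n m
    K = compOf G (whole ∖ U) (inj₁ x)

    part : Sub n m
    part = sub (Sub.verts K ∪ U) (Sub.darts K)

    K⁻ : ∀ z → z ∈ˢ K → z ∈ˢ (whole ∖ U) × U ⊢ inj₁ x ~ z
    K⁻ = ∈compOf⁻ G (whole ∖ U) (inj₁ x)

    K⁺ : ∀ z → z ∈ˢ (whole ∖ U) → U ⊢ inj₁ x ~ z → z ∈ˢ K
    K⁺ = ∈compOf⁺ G (whole ∖ U) (inj₁ x)

    x∈K : x ∈ Sub.verts K
    x∈K = K⁺ (inj₁ x) (off x≢a x≢b) ε

    y∉K : y ∉ Sub.verts K
    y∉K y∈ = apart (proj₂ (K⁻ (inj₁ y) y∈))

    facts : ProperPartFacts part a b
    facts = record
      { isBlock = isBlock ; u≢v = a≢b ; u∈B = a∈B ; v∈B = b∈B ; degree-u = degree-a ; degree-v = degree-b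
      ; inner = Sub.verts K
      ; verts⁻ = λ v∈ → Sum.map₂ x∈pair⁻ (x∈p∪q⁻ (Sub.verts K) U v∈)
      ; verts⁺ = λ p → x∈p∪q⁺ (Sum.map₂ x∈pair⁺ p)
      ; inner≢u = λ v∈ v≡a → x∈p─q⇒x∉q full U (proj₁ (K⁻ (inj₁ _) v∈)) (x∈pair⁺ (inj₁ v≡a))
      ; inner≢v = λ v∈ v≡b → x∈p─q⇒x∉q full U (proj₁ (K⁻ (inj₁ _) v∈)) (x∈pair⁺ (inj₂ v≡b))
      ; linked = λ {z} {z′} z∈ z′∈ → ⊢-sym U (proj₂ (K⁻ z (to z z∈))) ◅◅ proj₂ (K⁻ z′ (to z′ z′∈))
      ; spread = λ {z} {z′} z∈ l z′∈ → from z′ (K⁺ z′ z′∈ (proj₂ (K⁻ z (to z z∈)) ◅◅ l))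
      ; y₀∈inner = x∈K ; y₀∈B = x∈B ; r∈B = y∈B ; r∉inner = y∉K ; r≢u = y≢a ; r≢v = y≢b
      ; cut = x , x∈B , x≢a , x≢b , λ l → apart (⊢-sym U l)
      }
      where
      to : ∀ z → z ∈ˢ sub (Sub.verts K) (Sub.darts part) → z ∈ˢ K
      to (inj₁ _) p = p
      to (inj₂ _) p = p
      from : ∀ z → z ∈ˢ K → z ∈ˢ sub (Sub.verts K) (Sub.darts part)
      from (inj₁ _) p = p
      from (inj₂ _) p = p

    isProperPart : ¬ ContainsCentre G c K → IsProperPart G c part a b
    isProperPart ¬centre = record
      { B = B ; isBlock = isBlock
      ; twoCut = a≢b , a∈B , b∈B , x , y , x∈p∧x∉q⇒x∈p─q x∈B (x∉pair x≢a x≢b) ,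
                 x∈p∧x∉q⇒x∈p─q y∈B (x∉pair y≢a y≢b) , λ l → apart (link-mono rest⊑ l)
      ; degree-u = degree-a ; degree-v = degree-b
      ; K = K ; component = compOf-component G (whole ∖ U) (inj₁ x) (off x≢a x≢b)
      ; contains = L , compOf-component G rest (inj₁ x) (x∈p∧x∉q⇒x∈p─q x∈B (x∉pair x≢a x≢b)) ,
          (λ {v} v∈ → let v∈′ , l = ∈compOf⁻ G rest (inj₁ x) (inj₁ v) v∈
                      in K⁺ (inj₁ v) (proj₁ rest⊑ v∈′) (link-mono rest⊑ l)) ,
          (λ {d} d∈ → let d∈′ , l = ∈compOf⁻ G rest (inj₁ x) (inj₂ d) d∈
                      in K⁺ (inj₂ d) ∈⊤ (link-mono rest⊑ l))
      ; not-free-edge = λ (empty , _) → empty (x , x∈K)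
      ; not-central = ¬centre ; vertices = refl ; edges = refl
      }
      where
      rest : Sub n m
      rest = spanned G B ∖ U
      rest⊑ : rest ⊑ whole ∖ U
      rest⊑ = (λ v∈ → x∈p∧x∉q⇒x∈p─q ∈⊤ (x∈p─q⇒x∉q (ends G B) U v∈)) , λ _ → ∈⊤
      L : Sub n m
      L = compOf G rest (inj₁ x)

  module FromProperPart {S : Sub n m} {u v : Fin n} (part : IsProperPart G c S u v) where

    open IsProperPart part

    private
      k₀ = proj₁ component
      in-K : ∀ z → z ∈ˢ K → z ∈ˢ (whole ∖ U) × U ⊢ k₀ ~ z
      in-K z = Equivalence.to (proj₂ (proj₂ component) z)
      K-in : ∀ z → z ∈ˢ (whole ∖ U) → U ⊢ k₀ ~ z → z ∈ˢ K
      K-in z z∈ l = Equivalence.from (proj₂ (proj₂ component) z) (z∈ , l)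
      off : ∀ {x} → x ≢ u → x ≢ v → x ∈ full ─ U
      off x≢u x≢v = x∈p∧x∉q⇒x∈p─q ∈⊤ (x∉pair x≢u x≢v)

      Free : Fin m → Set
      Free d = ∃ λ x → ι d ≡ just x × x ∉ U

      free? : ∀ d → Free d ⊎ (∀ {x} → ι d ≡ just x → x ∈ U)
      free? d with ι d
      ... | nothing = inj₂ λ ()
      ... | just x with x ∈? U
      ...   | yes x∈ = inj₂ λ { refl → x∈ }
      ...   | no x∉  = inj₁ (x , refl , x∉)

      inner-end : ∀ {d} → d ∈ B → d ∈ Sub.darts K → Free d → ∃ λ y → y ∈ Sub.verts K × y ∈ ends G B
      inner-end {d} d∈B d∈K (x , dx , x∉) =
        x , K-in (inj₁ x) (x∈p∧x∉q⇒x∈p─q ∈⊤ x∉) (proj₂ (in-K (inj₂ d) d∈K) ◅◅ end-link U x∉ dx) , ∈ends⁺ G B d∈B dx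

      -- A component of B without U might be a single edge with no end outside U. Then K would be
      -- that edge alone, which `not-free-edge` excludes.
      inner-vertex : ∃ λ y → y ∈ Sub.verts K × y ∈ ends G B
      inner-vertex = go (proj₁ contains) (proj₁ (proj₂ contains)) (proj₂ (proj₂ contains))
        where
        go : ∀ L → IsComponent G (spanned G B ∖ U) L → L ⊑ K → ∃ λ y → y ∈ Sub.verts K × y ∈ ends G B
        go L (inj₁ y , y∈ , spec) L⊑K =
          y , proj₁ L⊑K (Equivalence.from (spec (inj₁ y)) (y∈ , ε)) , p─q⊆p (ends G B) U y∈
        go L (inj₂ d , d∈ , spec) L⊑K = pick (free? d) (free? (mate d))
          where
          d∈K : d ∈ Sub.darts K
          d∈K = proj₂ L⊑K (Equivalence.from (spec (inj₂ d)) (d∈ , ε))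
          mate∈K : mate d ∈ Sub.darts K
          mate∈K = K-in (inj₂ (mate d)) ∈⊤ (proj₂ (in-K (inj₂ d) d∈K) ◅◅ mate-link U)
          pick : _ → _ → _
          pick (inj₁ f) _ = inner-end d∈ d∈K f
          pick (inj₂ _) (inj₁ f) = inner-end (block-closed isBlock d∈) mate∈K f
          pick (inj₂ d-not) (inj₂ m-not) = contradiction
            ((λ (x , x∈) → only (inj₁ x) x∈) , d , no-half-edges d , λ e → mk⇔ (only (inj₂ e))
              λ { (inj₁ refl) → d∈K ; (inj₂ refl) → mate∈K }) not-free-edge
            where
            P : Element n m → Set
            P (inj₁ _) = ⊥
            P (inj₂ e) = e ≡ d ⊎ e ≡ mate d
            only : ∀ z → z ∈ˢ K → P z
            only z z∈ = propagate U P
              (λ { e (inj₁ refl) → inj₂ refl ; e (inj₂ refl) → inj₁ (mate-involutive d) })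
              (λ { e x x∉ ex (inj₁ refl) → x∉ (d-not ex) ; e x x∉ ex (inj₂ refl) → x∉ (m-not ex) })
              (λ _ _ _ _ ())
              (⊢-sym U (proj₂ (in-K (inj₂ d) d∈K)) ◅◅ proj₂ (in-K z z∈)) (inj₁ refl)

      two-sides : ∃ λ x → ∃ λ y → x ∈ ends G B × y ∈ ends G B × x ∉ U × y ∉ U × ¬ U ⊢ inj₁ x ~ inj₁ y
      two-sides =
        let _ , _ , _ , x , y , x∈ , y∈ , ¬l = twoCut
            x∈B = p─q⊆p (ends G B) U x∈
            y∈B = p─q⊆p (ends G B) U y∈
            x∉ = x∈p─q⇒x∉q (ends G B) U x∈
            y∉ = x∈p─q⇒x∉q (ends G B) U y∈
            d , d∈ , dx = ∈ends⁻ G B x∈B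
            e , e∈ , ey = ∈ends⁻ G B y∈B
        in x , y , x∈B , y∈B , x∉ , y∉ , λ l → ¬l
             (bwd (incidence d∈ x∈ dx) ◅
              retract (proj₁ (block⇒class isBlock)) U d∈ e∈ (end-link U x∉ dx ◅◅ l ◅◅ ⊢-sym U (end-link U y∉ ey))
              ◅◅ fwd (incidence e∈ y∈ ey) ◅ ε)

      ∉U⇒≢u : ∀ {x} → x ∉ U → x ≢ u
      ∉U⇒≢u x∉ eq = x∉ (x∈pair⁺ (inj₁ eq))
      ∉U⇒≢v : ∀ {x} → x ∉ U → x ≢ v
      ∉U⇒≢v x∉ eq = x∉ (x∈pair⁺ (inj₂ eq))

      OtherSide : Set
      OtherSide = ∃ λ r → r ∈ ends G B × r ∉ Sub.verts K × r ∉ U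
                  × ∃ λ x → x ∈ ends G B × x ≢ u × x ≢ v × ¬ U ⊢ inj₁ r ~ inj₁ x

      -- The separated vertices x and y are not both in K. One outside K serves as r, and the other
      -- shows that the boundary separates r from something in B.
      choose : ∀ x y → x ∈ ends G B → y ∈ ends G B → x ∉ U → y ∉ U → ¬ U ⊢ inj₁ x ~ inj₁ y →
               Dec (x ∈ Sub.verts K) → OtherSide
      choose x y x∈B y∈B x∉ y∉ ¬l (no x∉K)  = x , x∈B , x∉K , x∉ , y , y∈B , ∉U⇒≢u y∉ , ∉U⇒≢v y∉ , ¬l
      choose x y x∈B y∈B x∉ y∉ ¬l (yes x∈K) = y , y∈B ,
        (λ y∈K → ¬l (⊢-sym U (proj₂ (in-K (inj₁ x) x∈K)) ◅◅ proj₂ (in-K (inj₁ y) y∈K))) , y∉ ,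
        x , x∈B , ∉U⇒≢u x∉ , ∉U⇒≢v x∉ , λ l → ¬l (⊢-sym U l)

      other-side : OtherSide
      other-side = let x , y , x∈B , y∈B , x∉ , y∉ , ¬l = two-sides
                   in choose x y x∈B y∈B x∉ y∉ ¬l (x ∈? Sub.verts K)

      to : ∀ z → z ∈ˢ sub (Sub.verts K) (Sub.darts S) → z ∈ˢ K
      to (inj₁ _) p = p
      to (inj₂ d) p = subst (d ∈_) edges p
      from : ∀ z → z ∈ˢ K → z ∈ˢ sub (Sub.verts K) (Sub.darts S)
      from (inj₁ _) p = p
      from (inj₂ d) p = subst (d ∈_) (sym edges) p

    abstract
      facts : Σ (ProperPartFacts S u v) λ F → ∀ T → Sub.verts T ⊆ ProperPartFacts.inner F → ¬ ContainsCentre G c T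
      facts = build twoCut inner-vertex other-side , λ T T⊆K → not-central ∘ ContainsCentre-mono {T} {K} T⊆K
        where
        build : IsTwoCut G B u v → (∃ λ y → y ∈ Sub.verts K × y ∈ ends G B) → OtherSide → ProperPartFacts S u v
        build (u≢v , u∈B , v∈B , _) (y₀ , y₀∈K , y₀∈B) (r , r∈B , r∉K , r∉U , cut) = record
          { isBlock = isBlock ; u≢v = u≢v ; u∈B = u∈B
          ; v∈B = v∈B ; degree-u = degree-u ; degree-v = degree-v
          ; inner = Sub.verts K
          ; verts⁻ = λ x∈ → Sum.map₂ x∈pair⁻ (x∈p∪q⁻ (Sub.verts K) U (subst (_ ∈_) vertices x∈))
          ; verts⁺ = λ p → subst (_ ∈_) (sym vertices) (x∈p∪q⁺ (Sum.map₂ x∈pair⁺ p))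
          ; inner≢u = λ x∈ → ∉U⇒≢u (x∈p─q⇒x∉q full U (proj₁ (in-K (inj₁ _) x∈)))
          ; inner≢v = λ x∈ → ∉U⇒≢v (x∈p─q⇒x∉q full U (proj₁ (in-K (inj₁ _) x∈)))
          ; linked = λ {z} {z′} z∈ z′∈ → ⊢-sym U (proj₂ (in-K z (to z z∈))) ◅◅ proj₂ (in-K z′ (to z′ z′∈))
          ; spread = λ {z} {z′} z∈ l z′∈ → from z′ (K-in z′ z′∈ (proj₂ (in-K z (to z z∈)) ◅◅ l))
          ; y₀∈inner = y₀∈K ; y₀∈B = y₀∈B
          ; r∈B = r∈B ; r∉inner = r∉K
          ; r≢u = ∉U⇒≢u r∉U
          ; r≢v = ∉U⇒≢v r∉U
          ; cut = cut
          }

-- Atoms are disjoint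

one-element : ∀ {n} (p : Subset n) → 1 ≤ ∣ p ∣ → Nonempty p
one-element (inside ∷ p)  _  = zero , here
one-element (outside ∷ p) 1≤ = let x , x∈ = one-element p 1≤ in suc x , there x∈

two-elements : ∀ {n} (p : Subset n) → 2 ≤ ∣ p ∣ → ∃ λ x → ∃ λ y → x ∈ p × y ∈ p × x ≢ y
two-elements (inside ∷ p) (s≤s 1≤) = let y , y∈ = one-element p 1≤ in zero , suc y , here , there y∈ , λ ()
two-elements (outside ∷ p) 2≤ =
  let x , y , x∈ , y∈ , x≢y = two-elements p 2≤
  in suc x , suc y , there x∈ , there y∈ , x≢y ∘ suc-injective

three-elements : ∀ {n} (p : Subset n) → 3 ≤ ∣ p ∣ →
  ∃ λ x → ∃ λ y → ∃ λ z → x ∈ p × y ∈ p × z ∈ p × x ≢ y × x ≢ z × y ≢ z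
three-elements (inside ∷ p) (s≤s 2≤) =
  let y , z , y∈ , z∈ , y≢z = two-elements p 2≤
  in zero , suc y , suc z , here , there y∈ , there z∈ , (λ ()) , (λ ()) , y≢z ∘ suc-injective
three-elements (outside ∷ p) 3≤ =
  let x , y , z , x∈ , y∈ , z∈ , x≢y , x≢z , y≢z = three-elements p 3≤
  in suc x , suc y , suc z , there x∈ , there y∈ , there z∈ ,
     x≢y ∘ suc-injective , x≢z ∘ suc-injective , y≢z ∘ suc-injective

module Disjoint {n m : ℕ} (G : Graph (Fin n) (Fin m)) (simple : IsSimple G)
                (c : Node G) (centre : IsNode G c) where

  open Graph G
  open IsSimple simple
  open CutParts G simple c centre public

  Minimal : Sub n m → Set
  Minimal S = ∀ T b → IsPart G c T b → T ⊑ S → S ⊑ T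

  -- Holds for all three kinds of parts, so that comparing parts reduces to comparing their darts.
  IsSpanned : Sub n m → Set
  IsSpanned S = (∀ {x} → x ∈ Sub.verts S → ∃ λ d → d ∈ Sub.darts S × ι d ≡ just x)
              × (∀ {d x} → d ∈ Sub.darts S → ι d ≡ just x → x ∈ Sub.verts S)

  darts-⊑ : ∀ {S T} → IsSpanned S → IsSpanned T → Sub.darts S ⊆ Sub.darts T → S ⊑ T
  darts-⊑ (out , _) (_ , into) S⊆T = (λ x∈ → let d , d∈ , dx = out x∈ in into (S⊆T d∈) dx) , S⊆T

  ⊑-antisym : ∀ {S T : Sub n m} → S ⊑ T → T ⊑ S → S ≡ T
  ⊑-antisym {sub _ _} {sub _ _} (p , q) (p′ , q′) = cong₂ sub (⊆-antisym p p′) (⊆-antisym q q′)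

  blockPart-spanned : ∀ {S u} → BlockPartFacts S u → IsSpanned S
  blockPart-spanned F = BlockPart.∈verts⁻ F , BlockPart.∈verts⁺ F

  properPart-spanned : ∀ {S u v} → ProperPartFacts S u v → IsSpanned S
  properPart-spanned {S} {u} {v} F = out , λ d∈ dx → verts⁺ (inside-or-boundary d∈ dx)
    where
    open ProperPart₂ F
    out : ∀ {x} → x ∈ Sub.verts S → ∃ λ d → d ∈ Sub.darts S × ι d ≡ just x
    out {x} x∈ with verts⁻ x∈
    ... | inj₂ (inj₁ refl) = u-in
    ... | inj₂ (inj₂ refl) = v-in
    ... | inj₁ x∈K = let e , e∈ , _ = u-in
                         d , dx = first-dart U (linked {inj₁ x} {inj₂ e} x∈K e∈) λ ()
                     in d , around x∈K dx , dx

  dipole-spanned : ∀ {S u v} → IsDipole G S u v → IsSpanned S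
  dipole-spanned {S} {u} {v} dip = out , into
    where
    open IsDipole dip
    out : ∀ {x} → x ∈ Sub.verts S → ∃ λ d → d ∈ Sub.darts S × ι d ≡ just x
    out x∈ with x∈pair⁻ (subst (_ ∈_) vertices x∈) | two-edges
    ... | inj₁ refl | d , _ , _ , d∈ , _ , du , _ = d , d∈ , du
    ... | inj₂ refl | d , _ , _ , d∈ , _ , du , _ with Equivalence.to (edges d) d∈
    ...   | inj₁ (_ , mv) = mate d , Equivalence.from (edges (mate d)) (inj₂ (mv , trans (cong ι (mate-involutive d)) du)) , mv
    ...   | inj₂ (dv , _) = contradiction (just-injective′ du dv) distinct
    into : ∀ {d x} → d ∈ Sub.darts S → ι d ≡ just x → x ∈ Sub.verts S
    into {d} d∈ dx with Equivalence.to (edges d) d∈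
    ... | inj₁ (du , _) = subst (_ ∈_) (sym vertices) (x∈pair⁺ (inj₁ (just-injective′ dx du)))
    ... | inj₂ (dv , _) = subst (_ ∈_) (sym vertices) (x∈pair⁺ (inj₂ (just-injective′ dx dv)))

  module _ {S S′ u u′} (F : BlockPartFacts S u) (F′ : BlockPartFacts S′ u′)
           {d} (d∈ : d ∈ Sub.darts S) (d∈′ : d ∈ Sub.darts S′) where

    private
      module F  = BlockPart F
      module F′ = BlockPart F′

    -- S hangs together at u without meeting u′, so all of it is linked off u′ to the common dart d.
    blockParts-nested-if : u′ ∉ Sub.verts S → S ⊑ S′
    blockParts-nested-if u′∉ = darts-⊑ (blockPart-spanned F) (blockPart-spanned F′) λ e∈ →
      F′.spread d∈′ (F.boundary-link off d∈ ◅◅ ⊢-sym ⁅ u′ ⁆ (F.boundary-link off e∈))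
      where
      off : ∀ {x} → x ∈ ⁅ u′ ⁆ → x ∉ Sub.verts S
      off x∈ = subst (_∉ Sub.verts S) (sym (x∈⁅y⁆⇒x≡y u′ x∈)) u′∉

  -- With a common vertex of attachment the shapes decide. With different ones, if each part
  -- contained the vertex of the other, the two vertices would cut each other off from the centre,
  -- which `linked-or-cut` forbids.
  blockParts-nested : ∀ {S S′ u u′ d} → BlockPartFacts S u → BlockPartFacts S′ u′ →
                      d ∈ Sub.darts S → d ∈ Sub.darts S′ → S ⊑ S′ ⊎ S′ ⊑ S
  blockParts-nested {S} {S′} {u} {u′} {d} F F′ d∈ d∈′ = split (u ≟ u′)
    where
    module F  = BlockPart F
    module F′ = BlockPart F′
    split : Dec (u ≡ u′) → S ⊑ S′ ⊎ S′ ⊑ S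
    split (yes refl) = shapes F.shape F′.shape
      where
      into : Sub.darts S ⊆ Sub.darts S′ → S ⊑ S′ ⊎ S′ ⊑ S
      into ⊆ = inj₁ (darts-⊑ (blockPart-spanned F) (blockPart-spanned F′) ⊆)
      shapes : _ → _ → S ⊑ S′ ⊎ S′ ⊑ S
      shapes (inj₂ conn) _ = into λ e∈ → F′.spread d∈′ (conn d∈ e∈)
      shapes (inj₁ _) (inj₁ all) = into λ e∈ → all (F.apart e∈)
      shapes (inj₁ _) (inj₂ conn) =
        inj₂ (darts-⊑ (blockPart-spanned F′) (blockPart-spanned F) λ e∈ → F.spread d∈ (conn d∈′ e∈))
    split (no u≢u′) with u′ ∈? Sub.verts S | u ∈? Sub.verts S′
    ... | no u′∉ | _ = inj₁ (blockParts-nested-if F F′ d∈ d∈′ u′∉)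
    ... | yes _ | no u∉ = inj₂ (blockParts-nested-if F′ F d∈′ d∈ u∉)
    ... | yes u′∈ | yes u∈ =
      let e , e∈ , eu′ = F.∈verts⁻ u′∈
          e′ , e′∈ , e′u = F′.∈verts⁻ u∈
      in contradiction (linked-or-cut u≢u′ zᶜ) Sum.[
           (λ l → F.apart e∈ (end-link ⁅ u ⁆ (x∉⁅⁆ (u≢u′ ∘ sym)) eu′ ◅◅ ⊢-sym ⁅ u ⁆ l)) ,
           (λ l → F′.apart e′∈ (end-link ⁅ u′ ⁆ (x∉⁅⁆ u≢u′) e′u ◅◅ ⊢-sym ⁅ u′ ⁆ l)) ]

  NoCentre : ∀ {S u v} → ProperPartFacts S u v → Set
  NoCentre F = ∀ T → Sub.verts T ⊆ ProperPartFacts.inner F → ¬ ContainsCentre G c T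

  -- Replaces a condition on all subgraphs by one vertex that no other vertex cuts off from the
  -- centre: the central articulation itself, or a vertex of the central block that is not inner.
  centre-outside : ∀ {S u v} (F : ProperPartFacts S u v) → NoCentre F →
                   ∃ λ x → x ∉ ProperPartFacts.inner F × (∀ {w} → w ≢ x → ⁅ w ⁆ ⊢ zᶜ ~ inj₁ x)
  centre-outside F none = go c refl centre zᶜ rep-zᶜ
    where
    open ProperPartFacts F
    go : ∀ c′ → c ≡ c′ → IsNode G c′ → ∀ z → Rep c′ z →
         ∃ λ x → x ∉ inner × (∀ {w} → w ≢ x → ⁅ w ⁆ ⊢ z ~ inj₁ x)
    go (articulation w) eq _ _ refl = w , (λ w∈ → none (sub inner D) id (inj₂ (w , eq , w∈))) , λ _ → ε
    go (block P) eq P! _ (p , p∈ , refl) with any? (λ x → (x ∈? ends G P) ×-dec ¬? (x ∈? inner))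
    ... | yes (x , x∈ , x∉) = x , x∉ , λ w≢x → block-end P! p∈ x∈ (w≢x ∘ sym)
    ... | no ¬ex = contradiction (inj₁ (P , eq , λ {x} x∈ → decidable-stable (x ∈? inner) λ x∉ → ¬ex (x , x∈ , x∉)))
                                 (none (sub inner D) id)

  -- If u is not inner to S′, the inside of S′ hangs together off u and falls into S. If it is,
  -- everything outside S′ is linked to the centre off u, so that S, which u cuts off from the
  -- centre, lies in S′.
  block-proper-nested : ∀ {S S′ u u′ v′ d} → BlockPartFacts S u → (F′ : ProperPartFacts S′ u′ v′) →
    NoCentre F′ → d ∈ Sub.darts S → d ∈ Sub.darts S′ → S ⊑ S′ ⊎ S′ ⊑ S
  block-proper-nested {S} {S′} {u} {d = d} F F′ none d∈ d∈′ with u ∈? ProperPartFacts.inner F′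
  ... | no u∉ = inj₂ (darts-⊑ (properPart-spanned F′) (blockPart-spanned F) λ {e} e∈ →
          F.spread d∈ (F′.linked-off {⁅ u ⁆} {inj₂ d} {inj₂ e}
            (λ x∈ → subst (_∉ F′.inner) (sym (x∈⁅y⁆⇒x≡y u x∈)) u∉) d∈′ e∈))
    where
    module F  = BlockPart F
    module F′ = ProperPart₂ F′
  ... | yes u∈ = inj₁ (darts-⊑ (blockPart-spanned F) (properPart-spanned F′) λ {e} e∈ →
          decidable-stable (e ∈? Sub.darts S′) λ e∉ →
            let x , x∉ , to-x = centre-outside F′ none
            in F.apart e∈ (F′.outside-link {⁅ u ⁆} {inj₂ e} {inj₁ x}
                 (λ y∈ → subst (_∈ F′.inner) (sym (x∈⁅y⁆⇒x≡y u y∈)) u∈) e∉ x∉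
                 ◅◅ ⊢-sym ⁅ u ⁆ (to-x λ u≡x → x∉ (subst (_∈ F′.inner) u≡x u∈))))
    where
    module F  = BlockPart F
    module F′ = ProperPart₂ F′

  -- The boundary of S′ does not cut the inside of S, which therefore lies in the component of d.
  properParts-nested-if : ∀ {S S′ u v u′ v′ d} (F : ProperPartFacts S u v) → ProperPartFacts S′ u′ v′ →
    d ∈ Sub.darts S → d ∈ Sub.darts S′ →
    u′ ∉ ProperPartFacts.inner F → v′ ∉ ProperPartFacts.inner F → S ⊑ S′
  properParts-nested-if {u′ = u′} {v′} {d} F F′ d∈ d∈′ u′∉ v′∉ =
    darts-⊑ (properPart-spanned F) (properPart-spanned F′) λ {e} e∈ →
      F′.spread {inj₂ d} {inj₂ e} d∈′ (F.linked-off {⁅ u′ ⁆ ∪ ⁅ v′ ⁆} {inj₂ d} {inj₂ e} off d∈ e∈) ∈⊤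
    where
    module F  = ProperPart₂ F
    module F′ = ProperPart₂ F′
    off : ∀ {x} → x ∈ ⁅ u′ ⁆ ∪ ⁅ v′ ⁆ → x ∉ F.inner
    off x∈ x∈K with x∈pair⁻ x∈
    ... | inj₁ refl = u′∉ x∈K
    ... | inj₂ refl = v′∉ x∈K

  -- The part cut off lies in S but misses w, against minimality. It does not contain the centre
  -- because its inner vertices are inner to S.
  no-smaller-cut : ∀ {S u v B a b x y w} (F : ProperPartFacts S u v) → NoCentre F → Minimal S →
    (cut : Cut B a b x y) → a ∈ Sub.verts S → b ∈ Sub.verts S →
    (∀ {z} → z ∈ˢ CutPart.K cut → ProperPartFacts.In F z) →
    w ∈ Sub.verts S → w ∉ Sub.verts (CutPart.K cut) → w ≢ a → w ≢ b → ⊥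
  no-smaller-cut {S} {a = a} {b} {w = w} F none minimal cut a∈ b∈ K⊆ w∈ w∉K w≢a w≢b =
    case F″.verts⁻ (proj₁ (minimal C.part (pair a b) (properPart (C.isProperPart (none C.K (λ {v} → K⊆ {inj₁ v})))) ⊑S) w∈) of λ
      { (inj₁ p) → w∉K p ; (inj₂ (inj₁ p)) → w≢a p ; (inj₂ (inj₂ p)) → w≢b p }
    where
    module C  = CutPart cut
    module F″ = ProperPartFacts C.facts
    ⊑S : C.part ⊑ S
    ⊑S = (λ {x} x∈ → case F″.verts⁻ x∈ of λ
           { (inj₁ x∈K) → ProperPartFacts.verts⁺ F (inj₁ (K⊆ {inj₁ x} x∈K))
           ; (inj₂ (inj₁ refl)) → a∈ ; (inj₂ (inj₂ refl)) → b∈ }) ,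
         λ {d} → K⊆ {inj₂ d}

  module Crossing {S S′ u v u′ v′} (F : ProperPartFacts S u v) (F′ : ProperPartFacts S′ u′ v′)
                  (u′∈ : u′ ∈ ProperPartFacts.inner F) (u∈ : u ∈ ProperPartFacts.inner F′) where

    private
      module F  = ProperPart₂ F
      module F′ = ProperPart₂ F′

    -- A component of G ∖ {u′, v′} other than that of S′ lies inside S.
    one-sided : NoCentre F → Minimal S → v′ ∈ F.inner ⊎ v′ ≡ v → ⊥
    one-sided none minimal v′∈ =
      let x , x∈B , x≢u′ , x≢v′ , ¬l = F′.cut in go x x∈B x≢u′ x≢v′ ¬l
      where
      go : ∀ x → x ∈ ends G F′.B → x ≢ u′ → x ≢ v′ → ¬ F′.U ⊢ inj₁ F′.r ~ inj₁ x → ⊥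
      go x x∈B x≢u′ x≢v′ ¬l = no-smaller-cut F none minimal cut (F.verts⁺ (inj₁ u′∈))
          (F.verts⁺ (Sum.map₂ inj₂ v′∈)) (λ {z} → K⊆ z) (F.verts⁺ (inj₂ (inj₁ refl))) u∉K
          (F.inner≢u u′∈ ∘ sym) (F′.inner≢v u∈)
        where
        cut : Cut F′.B u′ v′ F′.r x
        cut = record { isBlock = F′.isBlock ; a≢b = F′.u≢v ; a∈B = F′.u∈B ; b∈B = F′.v∈B
                     ; degree-a = F′.degree-u ; degree-b = F′.degree-v ; x∈B = F′.r∈B ; y∈B = x∈B
                     ; x≢a = F′.r≢u ; x≢b = F′.r≢v ; y≢a = x≢u′ ; y≢b = x≢v′ ; apart = ¬l }
        module C = CutPart cut
        module T = ProperPart₂ C.facts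
        u∉K : u ∉ Sub.verts C.K
        u∉K u∈K = F′.r∉inner (F′.spread {inj₁ u} {inj₁ F′.r} u∈ (⊢-sym F′.U (proj₂ (C.K⁻ (inj₁ u) u∈K)))
                               (F′.not-in-U F′.r≢u F′.r≢v))
        v∉K : v ∉ Sub.verts C.K
        v∉K v∈K = by v′∈
         where
         by : v′ ∈ F.inner ⊎ v′ ≡ v → ⊥
         by (inj₂ refl) = T.inner≢v v∈K refl
         by (inj₁ v′∈K) = u∉K (T.spread {inj₁ v} {inj₁ u} v∈K
                  (F.outside-link {F′.U} {inj₁ v} {inj₁ u} U′⊆ (λ v∈ → F.inner≢v v∈ refl) (λ u∈ → F.inner≢u u∈ refl))
                  (F′.not-in-U (F′.inner≢u u∈) (F′.inner≢v u∈)))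
          where
          U′⊆ : F′.U ⊆ F.inner
          U′⊆ y∈ with x∈pair⁻ y∈
          ... | inj₁ refl = u′∈
          ... | inj₂ refl = v′∈K
        off : ∀ {y} → y ∈ F.U → y ∉ Sub.verts C.K
        off y∈ y∈K with x∈pair⁻ y∈
        ... | inj₁ refl = u∉K y∈K
        ... | inj₂ refl = v∉K y∈K
        reach : ∀ z → T.In z → z ∈ˢ (whole ∖ F.U) → F.In z
        reach z z∈ z∉U = let e , e∈ , eu′ = T.u-in in
          F.spread {inj₂ e} {z} (F.around u′∈ eu′) (T.linked-off {F.U} {inj₂ e} {z} off e∈ z∈) z∉U
        K⊆ : ∀ z → z ∈ˢ C.K → F.In z
        K⊆ (inj₁ y) y∈ = reach (inj₁ y) y∈ (F.not-in-U (λ { refl → u∉K y∈ }) (λ { refl → v∉K y∈ }))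
        K⊆ (inj₂ d) d∈ = reach (inj₂ d) d∈ ∈⊤

    -- The second block has a dart at u′, inside S, and one at v′, outside S. Off w it links the
    -- two, so a walk leaves S through u or v, and both are vertices of the first block.
    linked-across : ∀ {w b b′} → v′ ∉ Sub.verts S → w ≢ u → w ≢ v → b ∈ F.B → b′ ∈ F′.B →
                    ⁅ w ⁆ ⊢ inj₂ b′ ~ inj₂ b
    linked-across {w} {b} {b′} v′∉ w≢u w≢v b∈ b′∈ =
      let e , e∈ , eu′ = ∈ends⁻ G F′.B F′.u∈B
          f , f∈ , fv′ = ∈ends⁻ G F′.B F′.v∈B
          to-e = block-≈ F′.isBlock b′∈ e∈ w
          f∉ : f ∉ F.D
          f∉ f∈D = v′∉ (F.verts⁺ (F.inside-or-boundary f∈D fv′))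
      in case F.exit ⁅ w ⁆ {inj₂ e} {inj₂ f} (F.around u′∈ eu′) f∉ (block-≈ F′.isBlock e∈ f∈ w) of λ
         { (inj₁ (u∉ , g , _ , gu , l)) → to-e ◅◅ l ◅◅ end-link ⁅ w ⁆ u∉ gu
             ◅◅ ⊢-sym ⁅ w ⁆ (block-end F.isBlock b∈ F.u∈B (w≢u ∘ sym))
         ; (inj₂ (v∉ , g , _ , gv , l)) → to-e ◅◅ l ◅◅ end-link ⁅ w ⁆ v∉ gv
             ◅◅ ⊢-sym ⁅ w ⁆ (block-end F.isBlock b∈ F.v∈B (w≢v ∘ sym)) }

  dipoleSub : Fin n → Fin n → Sub n m
  dipoleSub a b = sub (⁅ a ⁆ ∪ ⁅ b ⁆) (select λ d →
    (Maybe.≡-dec _≟_ (ι d) (just a) ×-dec Maybe.≡-dec _≟_ (ι (mate d)) (just b))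
    ⊎-dec (Maybe.≡-dec _≟_ (ι d) (just b) ×-dec Maybe.≡-dec _≟_ (ι (mate d)) (just a)))

  dipoleSub-dipole : ∀ {a b d e} → a ≢ b → d ≢ e → ι d ≡ just a → ι (mate d) ≡ just b →
                     ι e ≡ just a → ι (mate e) ≡ just b → IsDipole G (dipoleSub a b) a b
  dipoleSub-dipole {a} {b} {d} {e} a≢b d≢e da mb ea nb = record
    { distinct = a≢b ; vertices = refl ; edges = λ d → mk⇔ (select⁻ dec) (select⁺ dec)
    ; two-edges = d , e , d≢e , select⁺ dec (inj₁ (da , mb)) , select⁺ dec (inj₁ (ea , nb)) , da , ea }
    where
    dec : ∀ d → Dec ((ι d ≡ just a × ι (mate d) ≡ just b) ⊎ (ι d ≡ just b × ι (mate d) ≡ just a))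
    dec d = (Maybe.≡-dec _≟_ (ι d) (just a) ×-dec Maybe.≡-dec _≟_ (ι (mate d)) (just b))
            ⊎-dec (Maybe.≡-dec _≟_ (ι d) (just b) ×-dec Maybe.≡-dec _≟_ (ι (mate d)) (just a))

  -- When v′ or v lies in the other part, `one-sided` gives a smaller proper part. Otherwise the
  -- boundaries alternate. Both parts then belong to one block, in which u′ has no neighbours
  -- besides u and v, since `cut-vertex` would give a smaller proper part. Two of three darts at u′
  -- are parallel, and their dipole is smaller than S.
  no-crossing : ∀ {S S′ u v u′ v′} (F : ProperPartFacts S u v) (F′ : ProperPartFacts S′ u′ v′) →
    NoCentre F → NoCentre F′ → Minimal S → Minimal S′ →
    u′ ∈ ProperPartFacts.inner F → u ∈ ProperPartFacts.inner F′ → ⊥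
  no-crossing {S} {S′} {u} {v} {u′} {v′} F F′ none none′ minimal minimal′ u′∈ u∈ =
    dispatch (v′ ∈? Sub.verts S) (v ∈? Sub.verts S′)
    where
    module F  = ProperPart₂ F
    module F′ = ProperPart₂ F′
    module X  = Crossing F F′ u′∈ u∈
    module X′ = Crossing F′ F u∈ u′∈

    crossing : v′ ∉ Sub.verts S → v ∉ Sub.verts S′ → ⊥
    crossing v′∉ v∉ = neighbours (three-elements _ F′.degree-u)
      where
      same-≈ : ∀ {b b′} → b ∈ F.B → b′ ∈ F′.B → b ≈ᵇ b′
      same-≈ {b} {b′} b∈ b′∈ w with w ≟ u | w ≟ v
      ... | no w≢u | no w≢v = ⊢-sym ⁅ w ⁆ (X.linked-across v′∉ w≢u w≢v b∈ b′∈)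
      -- The vertices u and v are neither u′ nor v′, so for them the roles of the two parts are
      -- exchanged.
      ... | yes refl | _ = X′.linked-across v∉ (F′.inner≢u u∈) (F′.inner≢v u∈) b′∈ b∈
      ... | no _ | yes refl = X′.linked-across v∉ (λ { refl → v∉ (F′.verts⁺ (inj₂ (inj₁ refl))) })
                                                  (λ { refl → v∉ (F′.verts⁺ (inj₂ (inj₂ refl))) }) b′∈ b∈
      B≡ : F.B ≡ F′.B
      B≡ = ⊆-antisym
        (λ b∈ → let b′ , b′∈ = block-nonempty F′.isBlock in ≈-block F′.isBlock b′∈ (≈ᵇ-sym (same-≈ b∈ b′∈)))
        (λ b′∈ → let b , b∈ = block-nonempty F.isBlock in ≈-block F.isBlock b∈ (same-≈ b∈ b′∈))

      u∈B′ : u ∈ ends G F′.B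
      u∈B′ = subst (λ B → u ∈ ends G B) B≡ F.u∈B
      v∈B′ : v ∈ ends G F′.B
      v∈B′ = subst (λ B → v ∈ ends G B) B≡ F.v∈B
      v∉inner : v ∉ F.inner
      v∉inner v∈ = F.inner≢v v∈ refl

      -- The inside of S splits into a quadrant inside S′, bounded by u and u′, and a quadrant
      -- outside S′, bounded by u′ and v. Whichever contains x gives a proper part smaller than S:
      -- the first misses v, the second misses u.
      cut-vertex : ∀ x → x ∈ F.inner → x ∈ ends G F′.B → x ≢ u′ → ⊥
      cut-vertex x x∈ x∈B x≢u′ with x ∈? F′.inner
      ... | yes x∈′ = no-smaller-cut F none minimal cut (F.verts⁺ (inj₂ (inj₁ refl))) (F.verts⁺ (inj₁ u′∈))
              (λ {z} z∈ → proj₁ (reach z (proj₂ (CutPart.K⁻ cut z z∈))))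
              (F.verts⁺ (inj₂ (inj₂ refl)))
              (λ v∈K → v∉inner (proj₁ (reach (inj₁ v) (proj₂ (CutPart.K⁻ cut (inj₁ v) v∈K)))))
              (F.u≢v ∘ sym) v≢u′
        where
        W : Subset n
        W = ⁅ u ⁆ ∪ ⁅ u′ ⁆
        P : Element n m → Set
        P z = F.In z × F′.In z
        v≢u′ : v ≢ u′
        v≢u′ refl = v∉ (F′.verts⁺ (inj₂ (inj₁ refl)))
        at-end : ∀ d y → y ∉ W → ι d ≡ just y → P (inj₂ d) → P (inj₁ y)
        at-end d y y∉ dy (d∈ , d∈′) with F.inside-or-boundary d∈ dy | F′.inside-or-boundary d∈′ dy
        ... | inj₁ y∈ | inj₁ y∈′ = y∈ , y∈′
        ... | inj₂ (inj₁ p) | _ = contradiction (x∈pair⁺ (inj₁ p)) y∉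
        ... | _ | inj₂ (inj₁ p) = contradiction (x∈pair⁺ (inj₂ p)) y∉
        ... | inj₂ (inj₂ refl) | p = contradiction (F′.verts⁺ p) v∉
        ... | p | inj₂ (inj₂ refl) = contradiction (F.verts⁺ p) v′∉
        reach : ∀ z → W ⊢ inj₁ x ~ z → P z
        reach z l = propagate W P (λ _ (d∈ , d∈′) → F.closed d∈ , F′.closed d∈′) at-end
          (λ d y _ dy (y∈ , y∈′) → F.around y∈ dy , F′.around y∈′ dy) l (x∈ , x∈′)
        cut : Cut F′.B u u′ x v
        cut = record { isBlock = F′.isBlock ; a≢b = F.inner≢u u′∈ ∘ sym ; a∈B = u∈B′ ; b∈B = F′.u∈B
                     ; degree-a = subst (λ B → 3 ≤ degreeIn G B u) B≡ F.degree-u ; degree-b = F′.degree-u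
                     ; x∈B = x∈B ; y∈B = v∈B′ ; x≢a = F.inner≢u x∈ ; x≢b = x≢u′ ; y≢a = F.u≢v ∘ sym ; y≢b = v≢u′
                     ; apart = λ l → v∉inner (proj₁ (reach (inj₁ v) l)) }
      ... | no x∉′ = no-smaller-cut F none minimal cut (F.verts⁺ (inj₁ u′∈)) (F.verts⁺ (inj₂ (inj₂ refl)))
              (λ {z} z∈ → proj₁ (reach z (proj₂ (CutPart.K⁻ cut z z∈))))
              (F.verts⁺ (inj₂ (inj₁ refl)))
              (λ u∈K → proj₂ (reach (inj₁ u) (proj₂ (CutPart.K⁻ cut (inj₁ u) u∈K))) u∈)
              (F.inner≢u u′∈ ∘ sym) F.u≢v
        where
        W : Subset n
        W = ⁅ u′ ⁆ ∪ ⁅ v ⁆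
        P : Element n m → Set
        P z = F.In z × ¬ F′.In z
        u′≢v : u′ ≢ v
        u′≢v = F.inner≢v u′∈
        at-mate : ∀ d → P (inj₂ d) → P (inj₂ (mate d))
        at-mate d (d∈ , d∉) = F.closed d∈ , λ md∈ → d∉ (subst (_∈ F′.D) (mate-involutive d) (F′.closed md∈))
        at-end : ∀ d y → y ∉ W → ι d ≡ just y → P (inj₂ d) → P (inj₁ y)
        at-end d y y∉ dy (d∈ , d∉) with F.inside-or-boundary d∈ dy
        ... | inj₁ y∈ = y∈ , λ y∈′ → d∉ (F′.around y∈′ dy)
        ... | inj₂ (inj₁ refl) = contradiction (F′.around u∈ dy) d∉
        ... | inj₂ (inj₂ p) = contradiction (x∈pair⁺ (inj₂ p)) y∉
        from-end : ∀ d y → y ∉ W → ι d ≡ just y → P (inj₁ y) → P (inj₂ d)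
        from-end d y y∉ dy (y∈ , y∉′) = F.around y∈ dy , λ d∈ → case F′.inside-or-boundary d∈ dy of λ
          { (inj₁ y∈′) → y∉′ y∈′ ; (inj₂ (inj₁ p)) → y∉ (x∈pair⁺ (inj₁ p))
          ; (inj₂ (inj₂ refl)) → v′∉ (F.verts⁺ (inj₁ y∈)) }
        reach : ∀ z → W ⊢ inj₁ x ~ z → P z
        reach z l = propagate W P at-mate at-end from-end l (x∈ , x∉′)
        cut : Cut F′.B u′ v x u
        cut = record { isBlock = F′.isBlock ; a≢b = u′≢v ; a∈B = F′.u∈B ; b∈B = v∈B′
                     ; degree-a = F′.degree-u ; degree-b = subst (λ B → 3 ≤ degreeIn G B v) B≡ F.degree-v
                     ; x∈B = x∈B ; y∈B = u∈B′ ; x≢a = x≢u′ ; x≢b = F.inner≢v x∈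
                     ; y≢a = F.inner≢u u′∈ ∘ sym ; y≢b = F.u≢v
                     ; apart = λ l → proj₂ (reach (inj₁ u) l) u∈ }

      at-u′? : ∀ d → Dec (ι d ≡ just u′)
      at-u′? d = Maybe.≡-dec _≟_ (ι d) (just u′)

      -- An end of B other than u′ exists, so no edge of B at u′ is pendant.
      neighbour : ∀ {d} → d ∈ F′.B → ι d ≡ just u′ → ∃ λ y → ι (mate d) ≡ just y
      neighbour {d} d∈ du′ = find (ι (mate d)) refl
        where
        find : ∀ my → ι (mate d) ≡ my → ∃ λ y → ι (mate d) ≡ just y
        find (just y) eq = y , eq
        find nothing eq = contradiction
          (propagate ⁅ u′ ⁆ P
            (λ { e (inj₁ refl) → inj₂ refl ; e (inj₂ refl) → inj₁ (mate-involutive d) })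
            (λ { e y y∉ ey (inj₁ refl) → x∉⁅⁆⁻ y∉ (just-injective′ ey du′)
               ; e y y∉ ey (inj₂ refl) → case trans (sym ey) eq of λ () })
            (λ _ _ _ _ ())
            (block-end F′.isBlock d∈ F′.v∈B (F′.u≢v ∘ sym)) (inj₁ refl)) id
          where
          P : Element n m → Set
          P (inj₁ _) = ⊥
          P (inj₂ e) = e ≡ d ⊎ e ≡ mate d

      Neighbour : Fin m → Set
      Neighbour d = ι d ≡ just u′ × (ι (mate d) ≡ just u ⊎ ι (mate d) ≡ just v)

      neighbour-in-U : ∀ {d} → d ∈ F′.B ∩ select at-u′? → Neighbour d
      neighbour-in-U {d} d∈ =
        let d∈B , d∈u′ = x∈p∩q⁻ F′.B (select at-u′?) d∈
        in locate d∈B (select⁻ at-u′? d∈u′) (neighbour d∈B (select⁻ at-u′? d∈u′))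
        where
        locate : d ∈ F′.B → ι d ≡ just u′ → (∃ λ y → ι (mate d) ≡ just y) → Neighbour d
        locate d∈B du′ (y , my) with F.inside-or-boundary (F.closed (F.around u′∈ du′)) my
        ... | inj₁ y∈ = contradiction (cut-vertex y y∈ (∈ends⁺ G F′.B (block-closed F′.isBlock d∈B) my)
                                         (λ { refl → no-loops d u′ du′ my })) id
        ... | inj₂ (inj₁ refl) = du′ , inj₁ my
        ... | inj₂ (inj₂ refl) = du′ , inj₂ my

      no-dipole : ∀ {d e y z} → d ≢ e → ι d ≡ just u′ → ι e ≡ just u′ → ι (mate d) ≡ just y → ι (mate e) ≡ just y →
                  u′ ≢ y → y ∈ Sub.verts S → z ∈ Sub.verts S → z ≢ u′ → z ≢ y → ⊥
      no-dipole {d} {e} {y} {z} d≢e du′ eu′ my ny u′≢y y∈ z∈ z≢u′ z≢y =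
        case x∈pair⁻ (proj₁ (minimal (dipoleSub u′ y) (pair u′ y) (dipolePart dip) ⊑S) z∈) of λ
          { (inj₁ p) → z≢u′ p ; (inj₂ p) → z≢y p }
        where
        dip : IsDipole G (dipoleSub u′ y) u′ y
        dip = dipoleSub-dipole u′≢y d≢e du′ my eu′ ny
        darts⊆ : ∀ {f} → f ∈ Sub.darts (dipoleSub u′ y) → f ∈ F.D
        darts⊆ {f} f∈ with Equivalence.to (IsDipole.edges dip f) f∈
        ... | inj₁ (fu′ , _) = F.around u′∈ fu′
        ... | inj₂ (_ , mu′) = subst (_∈ F.D) (mate-involutive f) (F.closed (F.around u′∈ mu′))
        ⊑S : dipoleSub u′ y ⊑ S
        ⊑S = (λ x∈ → case x∈pair⁻ x∈ of λ { (inj₁ refl) → F.verts⁺ (inj₁ u′∈) ; (inj₂ refl) → y∈ }) , λ {f} → darts⊆ {f}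

      both-u : ∀ {d e} → d ≢ e → ι d ≡ just u′ → ι e ≡ just u′ → ι (mate d) ≡ just u → ι (mate e) ≡ just u → ⊥
      both-u d≢e du′ eu′ mu nu = no-dipole d≢e du′ eu′ mu nu (F.inner≢u u′∈)
        (F.verts⁺ (inj₂ (inj₁ refl))) (F.verts⁺ (inj₂ (inj₂ refl))) (F.inner≢v u′∈ ∘ sym) (F.u≢v ∘ sym)

      both-v : ∀ {d e} → d ≢ e → ι d ≡ just u′ → ι e ≡ just u′ → ι (mate d) ≡ just v → ι (mate e) ≡ just v → ⊥
      both-v d≢e du′ eu′ mv nv = no-dipole d≢e du′ eu′ mv nv (F.inner≢v u′∈)
        (F.verts⁺ (inj₂ (inj₂ refl))) (F.verts⁺ (inj₂ (inj₁ refl))) (F.inner≢u u′∈ ∘ sym) F.u≢v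

      -- The three darts come from the degree condition on u′; with two possible neighbours, two of
      -- the darts are parallel.
      pigeon : ∀ {d e f} → d ≢ e → d ≢ f → e ≢ f → Neighbour d → Neighbour e → Neighbour f → ⊥
      pigeon de df ef (a , inj₁ x) (b , inj₁ y) _ = both-u de a b x y
      pigeon de df ef (a , inj₁ x) _ (b , inj₁ y) = both-u df a b x y
      pigeon de df ef _ (a , inj₁ x) (b , inj₁ y) = both-u ef a b x y
      pigeon de df ef (a , inj₂ x) (b , inj₂ y) _ = both-v de a b x y
      pigeon de df ef (a , inj₂ x) _ (b , inj₂ y) = both-v df a b x y
      pigeon de df ef _ (a , inj₂ x) (b , inj₂ y) = both-v ef a b x y

      neighbours : (∃ λ d → ∃ λ e → ∃ λ f → d ∈ F′.B ∩ select at-u′? × e ∈ F′.B ∩ select at-u′?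
                    × f ∈ F′.B ∩ select at-u′? × d ≢ e × d ≢ f × e ≢ f) → ⊥
      neighbours (d , e , f , d∈ , e∈ , f∈ , d≢e , d≢f , e≢f) =
        pigeon d≢e d≢f e≢f (neighbour-in-U d∈) (neighbour-in-U e∈) (neighbour-in-U f∈)

    off-u : v′ ≢ u
    off-u = λ { refl → F′.inner≢v u∈ refl }
    off-u′ : v ≢ u′
    off-u′ = λ { refl → F.inner≢v u′∈ refl }

    dispatch : Dec (v′ ∈ Sub.verts S) → Dec (v ∈ Sub.verts S′) → ⊥
    dispatch (yes v′∈) _ with F.verts⁻ v′∈
    ... | inj₁ p = X.one-sided none minimal (inj₁ p)
    ... | inj₂ (inj₁ p) = off-u p
    ... | inj₂ (inj₂ p) = X.one-sided none minimal (inj₂ p)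
    dispatch (no _) (yes v∈) with F′.verts⁻ v∈
    ... | inj₁ p = X′.one-sided none′ minimal′ (inj₁ p)
    ... | inj₂ (inj₁ p) = off-u′ p
    ... | inj₂ (inj₂ p) = X′.one-sided none′ minimal′ (inj₂ p)
    dispatch (no v′∉) (no v∉) = crossing v′∉ v∉

  -- Unless an inclusion is immediate, each part has a boundary vertex of the other among its inner
  -- vertices; `swap` brings these into the positions that `no-crossing` expects.
  proper-nested : ∀ {S S′ u v u′ v′ d} (F : ProperPartFacts S u v) (F′ : ProperPartFacts S′ u′ v′) →
    NoCentre F → NoCentre F′ → Minimal S → Minimal S′ →
    d ∈ Sub.darts S → d ∈ Sub.darts S′ → S ⊑ S′ ⊎ S′ ⊑ S
  proper-nested {S} {S′} {u} {v} {u′} {v′} F F′ none none′ minimal minimal′ d∈ d∈′ =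
    decide (u′ ∈? K) (v′ ∈? K) (u ∈? K′) (v ∈? K′)
    where
    K  = ProperPartFacts.inner F
    K′ = ProperPartFacts.inner F′
    decide : Dec (u′ ∈ K) → Dec (v′ ∈ K) → Dec (u ∈ K′) → Dec (v ∈ K′) → S ⊑ S′ ⊎ S′ ⊑ S
    decide (no u′∉) (no v′∉) _ _ = inj₁ (properParts-nested-if F F′ d∈ d∈′ u′∉ v′∉)
    decide _ _ (no u∉) (no v∉) = inj₂ (properParts-nested-if F′ F d∈′ d∈ u∉ v∉)
    decide (yes u′∈) _ (yes u∈) _ = contradiction (no-crossing F F′ none none′ minimal minimal′ u′∈ u∈) id
    decide (yes u′∈) _ _ (yes v∈) = contradiction (no-crossing (swap F) F′ none none′ minimal minimal′ u′∈ v∈) id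
    decide _ (yes v′∈) (yes u∈) _ = contradiction (no-crossing F (swap F′) none none′ minimal minimal′ v′∈ u∈) id
    decide _ (yes v′∈) _ (yes v∈) = contradiction (no-crossing (swap F) (swap F′) none none′ minimal minimal′ v′∈ v∈) id

  dipole-link : ∀ {S u v d e} → IsDipole G S u v → d ∈ Sub.darts S → e ∈ Sub.darts S →
                ∀ W → u ∉ W ⊎ v ∉ W → W ⊢ inj₂ d ~ inj₂ e
  dipole-link {S} {u} {v} dip d∈ e∈ W = Sum.[ (λ u∉ → to-u u∉ d∈ ◅◅ ⊢-sym W (to-u u∉ e∈))
                                            , (λ v∉ → to-v v∉ d∈ ◅◅ ⊢-sym W (to-v v∉ e∈)) ]
    where
    open IsDipole dip
    to-u : u ∉ W → ∀ {d} → d ∈ Sub.darts S → W ⊢ inj₂ d ~ inj₁ u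
    to-u u∉ {d} d∈ with Equivalence.to (edges d) d∈
    ... | inj₁ (du , _) = end-link W u∉ du
    ... | inj₂ (_ , mu) = mate-link W ◅◅ end-link W u∉ mu
    to-v : v ∉ W → ∀ {d} → d ∈ Sub.darts S → W ⊢ inj₂ d ~ inj₁ v
    to-v v∉ {d} d∈ with Equivalence.to (edges d) d∈
    ... | inj₁ (_ , mv) = mate-link W ◅◅ end-link W v∉ mv
    ... | inj₂ (dv , _) = end-link W v∉ dv

  dipole-ends : ∀ {S u v d} → IsDipole G S u v → d ∈ Sub.darts S →
                (ι d ≡ just u ⊎ ι (mate d) ≡ just u) × (ι d ≡ just v ⊎ ι (mate d) ≡ just v)
  dipole-ends {d = d} dip d∈ with Equivalence.to (IsDipole.edges dip d) d∈
  ... | inj₁ (du , mv) = inj₁ du , inj₂ mv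
  ... | inj₂ (dv , mu) = inj₂ mu , inj₁ dv

  dipole-closed : ∀ {S u v d} → IsDipole G S u v → d ∈ Sub.darts S → mate d ∈ Sub.darts S
  dipole-closed {d = d} dip d∈ with Equivalence.to (IsDipole.edges dip d) d∈
  ... | inj₁ (du , mv) = Equivalence.from (IsDipole.edges dip (mate d)) (inj₂ (mv , trans (cong ι (mate-involutive d)) du))
  ... | inj₂ (dv , mu) = Equivalence.from (IsDipole.edges dip (mate d)) (inj₁ (mu , trans (cong ι (mate-involutive d)) dv))

  dipole-in-block : ∀ {S S′ u v u′ d} → IsDipole G S u v → BlockPartFacts S′ u′ →
                    d ∈ Sub.darts S → d ∈ Sub.darts S′ → S ⊑ S′
  dipole-in-block {u = u} {v} {u′} dip F d∈ d∈′ =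
    darts-⊑ (dipole-spanned dip) (blockPart-spanned F) λ e∈ → F.spread d∈′ (dipole-link dip d∈ e∈ ⁅ u′ ⁆ off)
    where
    module F = BlockPart F
    off : u ∉ ⁅ u′ ⁆ ⊎ v ∉ ⁅ u′ ⁆
    off with u ≟ u′
    ... | no u≢ = inj₁ (x∉⁅⁆ u≢)
    ... | yes refl = inj₂ (x∉⁅⁆ (IsDipole.distinct dip ∘ sym))

  -- If u or v is inner to S′, all edges of the dipole lie in S′. Otherwise both ends of the common
  -- edge are on the boundary of S′; off the boundary that edge is linked to nothing else, yet it
  -- should be linked to `y₀`.
  dipole-in-proper : ∀ {S S′ u v u′ v′ d} → IsDipole G S u v → ProperPartFacts S′ u′ v′ →
                     d ∈ Sub.darts S → d ∈ Sub.darts S′ → S ⊑ S′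
  dipole-in-proper {S} {S′} {u} {v} {u′} {v′} {d} dip F d∈ d∈′ =
    darts-⊑ (dipole-spanned dip) (properPart-spanned F) (λ {e} e∈ → into e∈ (u ∈? F.inner) (v ∈? F.inner))
    where
    module F = ProperPart₂ F
    all-at : ∀ {x e} → x ∈ F.inner → ι e ≡ just x ⊎ ι (mate e) ≡ just x → e ∈ F.D
    all-at x∈ (inj₁ ex) = F.around x∈ ex
    all-at {e = e} x∈ (inj₂ mx) = subst (_∈ F.D) (mate-involutive e) (F.closed (F.around x∈ mx))
    into : ∀ {e} → e ∈ Sub.darts S → Dec (u ∈ F.inner) → Dec (v ∈ F.inner) → e ∈ F.D
    into e∈ (yes u∈) _ = all-at u∈ (proj₁ (dipole-ends dip e∈))
    into e∈ _ (yes v∈) = all-at v∈ (proj₂ (dipole-ends dip e∈))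
    into e∈ (no u∉) (no v∉) = contradiction
      (propagate F.U P (λ { e (inj₁ refl) → inj₂ refl ; e (inj₂ refl) → inj₁ (mate-involutive d) })
        (λ { e y y∉ ey (inj₁ refl) → y∉ (on-boundary d∈ d∈′ ey)
           ; e y y∉ ey (inj₂ refl) → y∉ (on-boundary (dipole-closed dip d∈) (F.closed d∈′) ey) })
        (λ _ _ _ _ ()) (F.linked {inj₂ d} {inj₁ F.y₀} d∈′ F.y₀∈inner) (inj₁ refl)) id
      where
      P : Element n m → Set
      P (inj₁ _) = ⊥
      P (inj₂ e) = e ≡ d ⊎ e ≡ mate d
      on-boundary : ∀ {e y} → e ∈ Sub.darts S → e ∈ F.D → ι e ≡ just y → y ∈ F.U
      on-boundary {e} {y} e∈S e∈ ey with F.inside-or-boundary e∈ ey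
      ... | inj₂ p = x∈pair⁺ p
      ... | inj₁ y∈ with x∈pair⁻ (subst (y ∈_) (IsDipole.vertices dip) (proj₂ (dipole-spanned dip) e∈S ey))
      ...   | inj₁ refl = contradiction y∈ u∉
      ...   | inj₂ refl = contradiction y∈ v∉

  dipoles-equal : ∀ {S S′ u v u′ v′ d} → IsDipole G S u v → IsDipole G S′ u′ v′ →
                  d ∈ Sub.darts S → d ∈ Sub.darts S′ → S ⊑ S′
  dipoles-equal {d = d} dip dip′ d∈ d∈′ = darts-⊑ (dipole-spanned dip) (dipole-spanned dip′) λ {e} e∈ →
      Equivalence.from (IsDipole.edges dip′ e)
        (combine (Equivalence.to (IsDipole.edges dip d) d∈) (Equivalence.to (IsDipole.edges dip′ d) d∈′)
                 (Equivalence.to (IsDipole.edges dip e) e∈))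
    where
    combine : ∀ {u v u′ v′} {d m e k : Maybe (Fin n)} →
      (d ≡ just u × m ≡ just v) ⊎ (d ≡ just v × m ≡ just u) →
      (d ≡ just u′ × m ≡ just v′) ⊎ (d ≡ just v′ × m ≡ just u′) →
      (e ≡ just u × k ≡ just v) ⊎ (e ≡ just v × k ≡ just u) →
      (e ≡ just u′ × k ≡ just v′) ⊎ (e ≡ just v′ × k ≡ just u′)
    combine (inj₁ (refl , refl)) (inj₁ (refl , refl)) p = p
    combine (inj₁ (refl , refl)) (inj₂ (refl , refl)) p = Sum.swap p
    combine (inj₂ (refl , refl)) (inj₁ (refl , refl)) p = Sum.swap p
    combine (inj₂ (refl , refl)) (inj₂ (refl , refl)) p = p

  data PartView (S : Sub n m) : Boundary G → Set where
    blockPart  : ∀ {u} → BlockPartFacts S u → (∀ x y → ¬ IsDipole G S x y) → PartView S (single u)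
    properPart : ∀ {u v} (F : ProperPartFacts S u v) → NoCentre F → PartView S (pair u v)
    dipolePart : ∀ {u v} → IsDipole G S u v → PartView S (pair u v)

  part-facts : ∀ {S b} → IsPart G c S b → PartView S b
  part-facts (blockPart p ¬dip) = blockPart (blockPart-facts p) ¬dip
  part-facts (properPart p) = let F , none = FromProperPart.facts p in properPart F none
  part-facts (dipolePart p) = dipolePart p

  parts-nested : ∀ {S S′ b b′ d} → PartView S b → PartView S′ b′ → Minimal S → Minimal S′ →
                 d ∈ Sub.darts S → d ∈ Sub.darts S′ → S ⊑ S′ ⊎ S′ ⊑ S
  parts-nested (blockPart F _) (blockPart F′ _) _ _ d∈ d∈′ = blockParts-nested F F′ d∈ d∈′
  parts-nested (blockPart F _) (properPart F′ none) _ _ d∈ d∈′ = block-proper-nested F F′ none d∈ d∈′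
  parts-nested (blockPart F _) (dipolePart dip) _ _ d∈ d∈′ = inj₂ (dipole-in-block dip F d∈′ d∈)
  parts-nested (properPart F none) (blockPart F′ _) _ _ d∈ d∈′ = Sum.swap (block-proper-nested F′ F none d∈′ d∈)
  parts-nested (properPart F none) (properPart F′ none′) min min′ d∈ d∈′ = proper-nested F F′ none none′ min min′ d∈ d∈′
  parts-nested (properPart F _) (dipolePart dip) _ _ d∈ d∈′ = inj₂ (dipole-in-proper dip F d∈′ d∈)
  parts-nested (dipolePart dip) (blockPart F _) _ _ d∈ d∈′ = inj₁ (dipole-in-block dip F d∈ d∈′)
  parts-nested (dipolePart dip) (properPart F _) _ _ d∈ d∈′ = inj₁ (dipole-in-proper dip F d∈ d∈′)
  parts-nested (dipolePart dip) (dipolePart dip′) _ _ d∈ d∈′ = inj₁ (dipoles-equal dip dip′ d∈ d∈′)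

  atoms-disjoint : ∀ (A A′ : Atom G c) {d} → d ∈ Sub.darts (Atom.S A) → d ∈ Sub.darts (Atom.S A′) →
                   Atom.S A ≡ Atom.S A′
  atoms-disjoint A A′ d∈ d∈′
    with parts-nested (part-facts (Atom.isPart A)) (part-facts (Atom.isPart A′)) (Atom.minimal A) (Atom.minimal A′) d∈ d∈′
  ... | inj₁ S⊑S′ = ⊑-antisym S⊑S′ (Atom.minimal A′ (Atom.S A) (Atom.∂ A) (Atom.isPart A) S⊑S′)
  ... | inj₂ S′⊑S = ⊑-antisym (Atom.minimal A (Atom.S A′) (Atom.∂ A′) (Atom.isPart A′) S′⊑S) S′⊑S

  -- Together with `proper-boundary⁻` this describes the boundary by S alone: its vertices are those
  -- that meet a dart outside S.
  proper-boundary : ∀ {S u v} (F : ProperPartFacts S u v) {x} → (x ≡ u ⊎ x ≡ v) →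
    x ∈ Sub.verts S × ∃ λ d → d ∉ Sub.darts S × ι d ≡ just x
  proper-boundary F (inj₁ refl) = ProperPartFacts.verts⁺ F (inj₂ (inj₁ refl)) , ProperPart₂.u-out F
  proper-boundary F (inj₂ refl) = ProperPartFacts.verts⁺ F (inj₂ (inj₂ refl)) , ProperPart₂.v-out F

  proper-boundary⁻ : ∀ {S u v} (F : ProperPartFacts S u v) {x d} → x ∈ Sub.verts S →
                     d ∉ Sub.darts S → ι d ≡ just x → x ≡ u ⊎ x ≡ v
  proper-boundary⁻ F x∈ d∉ dx with ProperPartFacts.verts⁻ F x∈
  ... | inj₁ x∈K = contradiction (ProperPart₂.around F x∈K dx) d∉
  ... | inj₂ p = p

  -- At most one vertex of a block part meets darts outside it, whereas a proper part has two.
  block≢proper : ∀ {S u u′ v′} → BlockPartFacts S u → ProperPartFacts S u′ v′ → ⊥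
  block≢proper {u = u} F F′ = ProperPartFacts.u≢v F′ (trans (is-u (inj₁ refl)) (sym (is-u (inj₂ refl))))
    where
    is-u : ∀ {x} → x ≡ _ ⊎ x ≡ _ → x ≡ u
    is-u {x} p = let x∈ , d , d∉ , dx = proper-boundary F′ p
                 in decidable-stable (x ≟ u) λ x≢u → d∉ (BlockPart.around F x∈ x≢u dx)

  dipole≢proper : ∀ {S u v u′ v′} → IsDipole G S u v → ProperPartFacts S u′ v′ → ⊥
  dipole≢proper {S} {u} {v} dip F = three F.u≢v (F.inner≢u F.y₀∈inner) (F.inner≢v F.y₀∈inner)
      (on (inj₂ (inj₁ refl))) (on (inj₂ (inj₂ refl))) (on (inj₁ F.y₀∈inner))
    where
    module F = ProperPart₂ F
    on : ∀ {x} → x ∈ F.inner ⊎ x ≡ _ ⊎ x ≡ _ → x ≡ u ⊎ x ≡ v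
    on p = x∈pair⁻ (subst (_ ∈_) (IsDipole.vertices dip) (F.verts⁺ p))
    three : ∀ {x y z : Fin n} → x ≢ y → z ≢ x → z ≢ y → x ≡ u ⊎ x ≡ v → y ≡ u ⊎ y ≡ v → z ≡ u ⊎ z ≡ v → ⊥
    three x≢y _ _ (inj₁ refl) (inj₁ refl) _ = x≢y refl
    three x≢y _ _ (inj₂ refl) (inj₂ refl) _ = x≢y refl
    three _ z≢x _ (inj₁ refl) (inj₂ refl) (inj₁ refl) = z≢x refl
    three _ _ z≢y (inj₁ refl) (inj₂ refl) (inj₂ refl) = z≢y refl
    three _ _ z≢y (inj₂ refl) (inj₁ refl) (inj₁ refl) = z≢y refl
    three _ z≢x _ (inj₂ refl) (inj₁ refl) (inj₂ refl) = z≢x refl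

  -- Atoms are listed by their subgraphs, so the boundary has to be recovered from S. Different
  -- kinds of parts never share a subgraph, and each kind determines its boundary vertices; their
  -- order in a `pair` stays open and is handled by `matching-side`.
  boundary-unique : ∀ {S b b′} → PartView S b → PartView S b′ → ∀ {x} → _∈∂_ G x b → _∈∂_ G x b′
  boundary-unique (blockPart F _) (blockPart F′ _) p = trans p (blockPart-boundary F F′)
  boundary-unique (blockPart F _) (properPart F′ _) p = contradiction (block≢proper F F′) id
  boundary-unique (blockPart F ¬dip) (dipolePart dip) p = contradiction dip (¬dip _ _)
  boundary-unique (properPart F _) (blockPart F′ _) p = contradiction (block≢proper F′ F) id
  boundary-unique (properPart F _) (properPart F′ _) p =
    let x∈ , d , d∉ , dx = proper-boundary F p in proper-boundary⁻ F′ x∈ d∉ dx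
  boundary-unique (properPart F _) (dipolePart dip) p = contradiction (dipole≢proper dip F) id
  boundary-unique (dipolePart dip) (blockPart F ¬dip) p = contradiction dip (¬dip _ _)
  boundary-unique (dipolePart dip) (properPart F _) p = contradiction (dipole≢proper dip F) id
  boundary-unique (dipolePart dip) (dipolePart dip′) p =
    x∈pair⁻ (subst (_ ∈_) (trans (sym (IsDipole.vertices dip)) (IsDipole.vertices dip′)) (x∈pair⁺ p))

-- Automorphisms permute the atoms

module _ {V D V′ D′ : Set} {G : Graph V D} {H : Graph V′ D′} where

  private
    module G = Graph G
    module H = Graph H

  module Iso (f : G ≅ H) where

    open _≅_ f public

    vert⁻ : V′ → V
    vert⁻ = Inverse.from vertices

    dart⁻ : D′ → D
    dart⁻ = Inverse.from darts

    vert-vert⁻ : ∀ y → vert (vert⁻ y) ≡ y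
    vert-vert⁻ = Inverse.strictlyInverseˡ vertices

    vert⁻-vert : ∀ x → vert⁻ (vert x) ≡ x
    vert⁻-vert = Inverse.strictlyInverseʳ vertices

    dart-dart⁻ : ∀ e → dart (dart⁻ e) ≡ e
    dart-dart⁻ = Inverse.strictlyInverseˡ darts

    dart⁻-dart : ∀ d → dart⁻ (dart d) ≡ d
    dart⁻-dart = Inverse.strictlyInverseʳ darts

    vert-injective : ∀ {x y} → vert x ≡ vert y → x ≡ y
    vert-injective {x} {y} p = trans (sym (vert⁻-vert x)) (trans (cong vert⁻ p) (vert⁻-vert y))

    dart-injective : ∀ {x y} → dart x ≡ dart y → x ≡ y
    dart-injective {x} {y} p = trans (sym (dart⁻-dart x)) (trans (cong dart⁻ p) (dart⁻-dart y))

    end-preserved : ∀ {d x} → G.ι d ≡ just x → H.ι (dart d) ≡ just (vert x)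
    end-preserved {d} p = trans (ι-preserved d) (cong (Maybe.map vert) p)

  inverse : G ≅ H → H ≅ G
  inverse f = record
    { vertices  = ↔-sym vertices
    ; darts     = ↔-sym darts
    ; preserves = record
      { ι-preserved = λ e → sym (trans (cong (Maybe.map vert⁻ ∘ H.ι) (sym (dart-dart⁻ e)))
          (trans (cong (Maybe.map vert⁻) (ι-preserved (dart⁻ e)))
            (trans (sym (Maybe.map-∘ (G.ι (dart⁻ e))))
              (trans (Maybe.map-cong vert⁻-vert (G.ι (dart⁻ e))) (Maybe.map-id (G.ι (dart⁻ e)))))))
      ; mate-preserved = λ e → dart-injective (trans (sym (mate-preserved (dart⁻ e)))
          (trans (cong H.mate (dart-dart⁻ e)) (sym (dart-dart⁻ (H.mate e)))))
      ; colour-preserved = λ e → trans (sym (colour-preserved (dart⁻ e))) (cong H.colour (dart-dart⁻ e))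
      ; label-preserved = λ e → trans (sym (label-preserved (dart⁻ e))) (cong H.label (dart-dart⁻ e))
      }
    }
    where open Iso f

module _ {k : ℕ} (f : Fin k ↔ Fin k) where

  open Inverse f

  image : Subset k → Subset k
  image p = select λ y → from y ∈? p

  ∈image⁺ : ∀ {p x} → x ∈ p → to x ∈ image p
  ∈image⁺ {p} {x} x∈ = select⁺ (λ y → from y ∈? p) (subst (_∈ p) (sym (strictlyInverseʳ x)) x∈)

  ∈image⁻ : ∀ {p y} → y ∈ image p → from y ∈ p
  ∈image⁻ {p} = select⁻ (λ y → from y ∈? p)

  from∈⇒∈image : ∀ {p y} → from y ∈ p → y ∈ image p
  from∈⇒∈image {p} = select⁺ (λ y → from y ∈? p)

  ∈image⇒∈ : ∀ {p x} → to x ∈ image p → x ∈ p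
  ∈image⇒∈ {p} {x} tx∈ = subst (_∈ p) (strictlyInverseʳ x) (∈image⁻ tx∈)

  image-injective : ∀ {p q} → image p ≡ image q → p ≡ q
  image-injective eq = ⊆-antisym (λ x∈ → ∈image⇒∈ (subst (_ ∈_) eq (∈image⁺ x∈)))
                                 (λ x∈ → ∈image⇒∈ (subst (_ ∈_) (sym eq) (∈image⁺ x∈)))

image-inverse : ∀ {k} (f : Fin k ↔ Fin k) p → image f (image (↔-sym f) p) ≡ p
image-inverse f p = ⊆-antisym
  (λ {y} y∈ → ∈image⇒∈ (↔-sym f) (∈image⁻ f y∈))
  (λ {y} y∈ → from∈⇒∈image f (∈image⁺ (↔-sym f) y∈))

elements-three : ∀ {n} {p : Subset n} {x y z} → x ∈ p → y ∈ p → z ∈ p → x ≢ y → x ≢ z → y ≢ z → 3 ≤ ∣ p ∣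
elements-three {p = p} {x} {y} {z} x∈ y∈ z∈ x≢y x≢z y≢z =
  ℕ.≤-<-trans (ℕ.≤-<-trans (ℕ.≤-<-trans z≤n (x∈p⇒∣p-x∣<∣p∣ x∈′)) (x∈p⇒∣p-x∣<∣p∣ y∈′)) (x∈p⇒∣p-x∣<∣p∣ z∈)
  where
  y∈′ : y ∈ p - z
  y∈′ = x∈p∧x≢y⇒x∈p-y y∈ y≢z
  x∈′ : x ∈ p - z - y
  x∈′ = x∈p∧x≢y⇒x∈p-y (x∈p∧x≢y⇒x∈p-y x∈ x≢z) x≢y

module Transport {n m : ℕ} (G : Graph (Fin n) (Fin m)) (simple : IsSimple G) (α : Aut G) where

  open Graph G
  open IsSimple simple
  open Blocks G simple
  open Iso α

  imageV : Subset n → Subset n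
  imageV = image vertices

  imageD : Subset m → Subset m
  imageD = image darts

  imageSub : Sub n m → Sub n m
  imageSub S = sub (imageV (Sub.verts S)) (imageD (Sub.darts S))

  mapElement : Element n m → Element n m
  mapElement = Sum.map vert dart

  mapNode : Node G → Node G
  mapNode (articulation u) = articulation (vert u)
  mapNode (block Q)        = block (imageD Q)

  mapBoundary : Boundary G → Boundary G
  mapBoundary (single u) = single (vert u)
  mapBoundary (pair u v) = pair (vert u) (vert v)

  mapNode-injective : ∀ x y → mapNode x ≡ mapNode y → x ≡ y
  mapNode-injective (articulation u) (articulation v) p = cong articulation (vert-injective (articulation-injective p))
  mapNode-injective (block P) (block Q) p = cong block (image-injective darts (block-injective p))

  end-reflected : ∀ {d x} → ι (dart d) ≡ just (vert x) → ι d ≡ just x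
  end-reflected {d} p with ι d | ι-preserved d
  ... | nothing | q = case trans (sym p) q of λ ()
  ... | just y  | q = cong just (vert-injective (Maybe.just-injective (trans (sym q) p)))

  map-link : ∀ {U W x y} → (∀ {v} → v ∉ U → vert v ∉ W) → U ⊢ x ~ y → W ⊢ mapElement x ~ mapElement y
  map-link {U} {W} off = gmap mapElement λ
    { (pairing {d} _) → subst (λ e → Step G (whole ∖ W) (inj₂ (dart d)) (inj₂ e)) (mate-preserved d) (pairing ∈⊤)
    ; (incidence _ v∈ e) → incidence ∈⊤ (x∈p∧x∉q⇒x∈p─q ∈⊤ (off (x∈p─q⇒x∉q full U v∈))) (end-preserved e) }

  map-link₁ : ∀ {u x y} → ⁅ u ⁆ ⊢ x ~ y → ⁅ vert u ⁆ ⊢ mapElement x ~ mapElement y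
  map-link₁ {u} = map-link λ v∉ → x∉⁅⁆ λ p → x∉⁅⁆⁻ v∉ (vert-injective p)

  ends-image : ∀ {Q x} → x ∈ ends G Q → vert x ∈ ends G (imageD Q)
  ends-image {Q} x∈ = let d , d∈ , dx = ∈ends⁻ G Q x∈ in ∈ends⁺ G (imageD Q) (∈image⁺ darts d∈) (end-preserved dx)

  ends-image⁻ : ∀ {Q x} → vert x ∈ ends G (imageD Q) → x ∈ ends G Q
  ends-image⁻ {Q} x∈ =
    let e , e∈ , ex = ∈ends⁻ G (imageD Q) x∈
    in ∈ends⁺ G Q (∈image⁻ darts e∈) (end-reflected (trans (cong ι (dart-dart⁻ e)) ex))

module TransportBack {n m : ℕ} (G : Graph (Fin n) (Fin m)) (simple : IsSimple G) (α : Aut G) where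

  open Graph G
  open IsSimple simple
  open Blocks G simple
  open Iso α
  open Transport G simple α public
  private module Back = Transport G simple (inverse α)

  map-link⁻ : ∀ {U W x y} → (∀ {v} → vert v ∉ U → v ∉ W) → U ⊢ mapElement x ~ mapElement y → W ⊢ x ~ y
  map-link⁻ {U} {W} {x} {y} off l = subst₂ (W ⊢_~_) (cancel x) (cancel y)
      (Back.map-link (λ {v} v∉ → off (subst (_∉ U) (sym (vert-vert⁻ v)) v∉)) l)
    where
    cancel : ∀ z → Back.mapElement (mapElement z) ≡ z
    cancel (inj₁ v) = cong inj₁ (vert⁻-vert v)
    cancel (inj₂ d) = cong inj₂ (dart⁻-dart d)

  map-link₁⁻ : ∀ {u x y} → ⁅ vert u ⁆ ⊢ mapElement x ~ mapElement y → ⁅ u ⁆ ⊢ x ~ y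
  map-link₁⁻ = map-link⁻ λ v∉ → x∉⁅⁆ λ { refl → v∉ (x∈⁅x⁆ _) }

  mapNode-inverse : ∀ y → mapNode (Back.mapNode y) ≡ y
  mapNode-inverse (articulation u) = cong articulation (vert-vert⁻ u)
  mapNode-inverse (block Q)        = cong block (image-inverse darts Q)

  inverse-mapNode : ∀ y → Back.mapNode (mapNode y) ≡ y
  inverse-mapNode (articulation u) = cong articulation (vert⁻-vert u)
  inverse-mapNode (block Q)        = cong block (image-inverse (↔-sym darts) Q)

  ≈ᵇ-map : ∀ {d e} → d ≈ᵇ e → dart d ≈ᵇ dart e
  ≈ᵇ-map d≈e v = subst (λ v → ⁅ v ⁆ ⊢ _ ~ _) (vert-vert⁻ v) (map-link₁ (d≈e (vert⁻ v)))

  ≈ᵇ-map⁻ : ∀ {d e} → dart d ≈ᵇ dart e → d ≈ᵇ e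
  ≈ᵇ-map⁻ d≈e v = map-link₁⁻ (d≈e (vert v))

  image-block : ∀ {Q} → IsBlock G Q → IsBlock G (imageD Q)
  image-block {Q} Q! = class⇒block class (let d , d∈ = block-nonempty Q! in dart d , ∈image⁺ darts d∈)
    where
    class : IsClass (imageD Q)
    class {d} {e} d∈ =
      (λ e∈ → subst₂ _≈ᵇ_ (dart-dart⁻ d) (dart-dart⁻ e) (≈ᵇ-map (block-≈ Q! (∈image⁻ darts d∈) (∈image⁻ darts e∈)))) ,
      (λ d≈e → from∈⇒∈image darts (≈-block Q! (∈image⁻ darts d∈)
        (≈ᵇ-map⁻ (subst₂ _≈ᵇ_ (sym (dart-dart⁻ d)) (sym (dart-dart⁻ e)) d≈e))))

  image-articulation : ∀ {u} → IsArticulation G u → IsArticulation G (vert u)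
  image-articulation {u} art conn = art λ x y x∈ y∈ → map-link₁⁻ (conn (mapElement x) (mapElement y) (into x x∈) (into y y∈))
    where
    into : ∀ x → x ∈ˢ (whole ∖ ⁅ u ⁆) → mapElement x ∈ˢ (whole ∖ ⁅ vert u ⁆)
    into (inj₂ _) _ = ∈⊤
    into (inj₁ v) v∈ = x∈p∧x∉q⇒x∈p─q ∈⊤ (x∉⁅⁆ λ p → x∉⁅⁆⁻ (x∈p─q⇒x∉q full ⁅ u ⁆ v∈) (vert-injective p))

  image-node : ∀ x → IsNode G x → IsNode G (mapNode x)
  image-node (articulation u) = image-articulation
  image-node (block Q)        = image-block

  map-adjacent : ∀ {x y} → Adjacent G x y → Adjacent G (mapNode x) (mapNode y)
  map-adjacent (down a Q! u∈) = down (image-articulation a) (image-block Q!) (ends-image u∈)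
  map-adjacent (up a Q! u∈)   = up (image-articulation a) (image-block Q!) (ends-image u∈)

  map-walk : ∀ {x y} → Walk G x y → Walk G (mapNode x) (mapNode y)
  map-walk ε       = ε
  map-walk (s ◅ w) = map-adjacent s ◅ map-walk w

  visited-map : ∀ {x y} (w : Walk G x y) → visited G (map-walk w) ≡ map mapNode (visited G w)
  visited-map ε           = refl
  visited-map {x} (s ◅ w) = cong (mapNode x ∷_) (visited-map w)

  length-map : ∀ {x y} (w : Walk G x y) → walkLength G (map-walk w) ≡ walkLength G w
  length-map ε       = refl
  length-map (s ◅ w) = cong suc (length-map w)

  map-subtree : ∀ {c x y} → InSubtree G c x y → InSubtree G (mapNode c) (mapNode x) (mapNode y)
  map-subtree {x = x} (w , uniq , x∈) = map-walk w ,
    subst Unique (sym (visited-map w)) (Unique.map⁺ (mapNode-injective _ _) uniq) ,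
    subst (mapNode x List.∈_) (sym (visited-map w)) (∈-map⁺ mapNode x∈)

  image-dipole : ∀ {S u v} → IsDipole G S u v → IsDipole G (imageSub S) (vert u) (vert v)
  image-dipole {S} {u} {v} dip = record
    { distinct = λ p → distinct (vert-injective p)
    ; vertices = ⊆-antisym
        (λ {y} y∈ → x∈pair⁺ (Sum.map (λ p → trans (sym (vert-vert⁻ y)) (cong vert p))
                                      (λ p → trans (sym (vert-vert⁻ y)) (cong vert p))
                                      (x∈pair⁻ (subst (_ ∈_) verts≡ (∈image⁻ vertices y∈)))))
        (λ y∈ → Sum.[ (λ { refl → ∈image⁺ vertices (subst (_ ∈_) (sym verts≡) (x∈pair⁺ (inj₁ refl))) })
                    , (λ { refl → ∈image⁺ vertices (subst (_ ∈_) (sym verts≡) (x∈pair⁺ (inj₂ refl))) }) ] (x∈pair⁻ y∈))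
    ; edges = λ e → mk⇔
        (λ e∈ → subst (λ e → (ι e ≡ just (vert u) × ι (mate e) ≡ just (vert v))
                            ⊎ (ι e ≡ just (vert v) × ι (mate e) ≡ just (vert u))) (dart-dart⁻ e)
                  (Sum.map (λ (p , q) → end-preserved p , mate-end q) (λ (p , q) → end-preserved p , mate-end q)
                    (Equivalence.to (edges (dart⁻ e)) (∈image⁻ darts e∈))))
        (λ p → from∈⇒∈image darts (Equivalence.from (edges (dart⁻ e))
                  (Sum.map (λ (p , q) → back p , mate-back q) (λ (p , q) → back p , mate-back q) p)))
    ; two-edges = let d , e , d≢e , d∈ , e∈ , du , eu = two-edges
                  in dart d , dart e , (λ p → d≢e (dart-injective p)) , ∈image⁺ darts d∈ , ∈image⁺ darts e∈ ,
                     end-preserved du , end-preserved eu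
    }
    where
    open IsDipole dip renaming (vertices to verts≡)
    mate-end : ∀ {d x} → ι (mate d) ≡ just x → ι (mate (dart d)) ≡ just (vert x)
    mate-end {d} p = trans (cong ι (mate-preserved d)) (end-preserved p)
    back : ∀ {e x} → ι e ≡ just (vert x) → ι (dart⁻ e) ≡ just x
    back {e} p = end-reflected (trans (cong ι (dart-dart⁻ e)) p)
    mate-back : ∀ {e x} → ι (mate e) ≡ just (vert x) → ι (mate (dart⁻ e)) ≡ just x
    mate-back {e} p = end-reflected (trans (cong ι (trans (sym (mate-preserved (dart⁻ e)))
                                                          (cong mate (dart-dart⁻ e)))) p)

module MoveParts {n m : ℕ} (G : Graph (Fin n) (Fin m)) (simple : IsSimple G)
                 (c : Node G) (centre : IsNode G c) (α : Aut G)
                 (fixed : TransportBack.mapNode G simple α c ≡ c) where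

  open Graph G
  open IsSimple simple
  open Disjoint G simple c centre
  open Iso α
  open TransportBack G simple α public
  private module Back = TransportBack G simple (inverse α)

  image-subtree : ∀ {x y} → InSubtree G c x y → InSubtree G c (mapNode x) (mapNode y)
  image-subtree {x} {y} s = subst (λ c → InSubtree G c (mapNode x) (mapNode y)) fixed (map-subtree s)

  private
    fixed⁻ : Back.mapNode c ≡ c
    fixed⁻ = trans (cong Back.mapNode (sym fixed)) (inverse-mapNode c)

    back-subtree : ∀ {x Q} → InSubtree G c (mapNode x) (block Q) → InSubtree G c x (block (Back.imageD Q))
    back-subtree {x} {Q} s = subst₂ (λ c x → InSubtree G c x (block (Back.imageD Q))) fixed⁻ (inverse-mapNode x)
                               (Back.map-subtree s)

    back-sub : ∀ {S} → Back.imageSub (imageSub S) ≡ S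
    back-sub = cong₂ sub (image-inverse (↔-sym vertices) _) (image-inverse (↔-sym darts) _)

    back-end : ∀ {e y} → ι e ≡ just y → ι (dart⁻ e) ≡ just (vert⁻ y)
    back-end = Iso.end-preserved (inverse α)

  image-blockPart : ∀ {S u} → IsBlockPart G c S u → IsBlockPart G c (imageSub S) (vert u)
  image-blockPart {S} {u} part = record
    { node = mapNode node
    ; isNode = image-node node isNode
    ; not-central = λ Q eq eq′ → not-central Q eq (mapNode-injective _ _ (trans eq′ (sym fixed)))
    ; vertices = ⊆-antisym
        (λ {y} y∈ → subst (_∈ ends G (imageD D)) (vert-vert⁻ y)
                      (ends-image (subst (_ ∈_) verts≡ (∈image⁻ vertices y∈))))
        (λ {y} y∈ → from∈⇒∈image vertices (subst (_ ∈_) (sym verts≡)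
                      (ends-image⁻ (subst (_∈ ends G (imageD D)) (sym (vert-vert⁻ y)) y∈))))
    ; union-of-blocks = λ e → mk⇔
        (λ e∈ → let Q , Q! , s , d∈ = Equivalence.to (union-of-blocks (dart⁻ e)) (∈image⁻ darts e∈)
                in imageD Q , image-block Q! , image-subtree s , from∈⇒∈image darts d∈)
        (λ (Q , Q! , s , e∈) → from∈⇒∈image darts (Equivalence.from (union-of-blocks (dart⁻ e))
                (Back.imageD Q , Back.image-block Q! , back-subtree s , ∈image⁺ (↔-sym darts) e∈)))
    ; not-pendant-edge = λ (d , x , dx , mx , isEdge) → not-pendant-edge
        (dart⁻ d , vert⁻ x , back-end dx ,
         trans (cong ι (Iso.mate-preserved (inverse α) d)) (trans (Iso.ι-preserved (inverse α) (mate d)) (cong (Maybe.map vert⁻) mx)) ,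
         λ e → mk⇔
           (λ e∈ → Sum.map (λ p → trans (sym (dart⁻-dart e)) (cong dart⁻ p))
                           (λ p → trans (sym (dart⁻-dart e)) (trans (cong dart⁻ p) (sym (Iso.mate-preserved (inverse α) d))))
                     (Equivalence.to (isEdge (dart e)) (∈image⁺ darts e∈)))
           (λ p → ∈image⇒∈ darts (Equivalence.from (isEdge (dart e))
                    (Sum.map (λ { refl → dart-dart⁻ d })
                             (λ { refl → trans (cong dart (Iso.mate-preserved (inverse α) d)) (dart-dart⁻ (mate d)) }) p))))
    ; attached = Sum.map (cong mapNode)
        (λ ((Q , eq) , u∈ , d , d∉ , du) → (imageD Q , cong mapNode eq) , ∈image⁺ vertices u∈ ,
           dart d , (λ d∈ → d∉ (∈image⇒∈ darts d∈)) , end-preserved du) attached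
    }
    where
    open IsBlockPart part renaming (vertices to verts≡)
    D = Sub.darts S

  image-cut : ∀ {B a b x y} → Cut B a b x y → Cut (imageD B) (vert a) (vert b) (vert x) (vert y)
  image-cut {B} {a} {b} cut = record
    { isBlock = image-block isBlock ; a≢b = a≢b ∘ vert-injective
    ; a∈B = ends-image a∈B ; b∈B = ends-image b∈B
    ; degree-a = image-degree degree-a ; degree-b = image-degree degree-b
    ; x∈B = ends-image x∈B ; y∈B = ends-image y∈B
    ; x≢a = x≢a ∘ vert-injective ; x≢b = x≢b ∘ vert-injective
    ; y≢a = y≢a ∘ vert-injective ; y≢b = y≢b ∘ vert-injective
    ; apart = λ l → apart (map-link⁻ (λ {v} v∉ v∈ → v∉ (x∈pair⁺ (Sum.map (cong vert) (cong vert) (x∈pair⁻ v∈)))) l)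
    }
    where
    open Cut cut
    at : ∀ u d → Dec (ι d ≡ just u)
    at u d = Maybe.≡-dec _≟_ (ι d) (just u)
    image-degree : ∀ {u} → 3 ≤ degreeIn G B u → 3 ≤ degreeIn G (imageD B) (vert u)
    image-degree {u} deg =
      let d , e , f , d∈ , e∈ , f∈ , d≢e , d≢f , e≢f = three-elements _ deg
      in elements-three (into d∈) (into e∈) (into f∈)
           (d≢e ∘ dart-injective) (d≢f ∘ dart-injective) (e≢f ∘ dart-injective)
      where
      into : ∀ {d} → d ∈ B ∩ select (at u) → dart d ∈ imageD B ∩ select (at (vert u))
      into d∈ = let d∈B , du = x∈p∩q⁻ B (select (at u)) d∈
                in x∈p∩q⁺ (∈image⁺ darts d∈B , select⁺ (at (vert u)) (end-preserved (select⁻ (at u) du)))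

  -- The image is built as the part cut off by the image of the 2-cut, with the image of `y₀`
  -- marking the side; afterwards it is identified with the image of S. The centre is not inside
  -- because the automorphism fixes it.
  image-properPart : ∀ {S u v} (F : ProperPartFacts S u v) → NoCentre F → IsProperPart G c (imageSub S) (vert u) (vert v)
  image-properPart {S} {u} {v} F none = subst (λ T → IsProperPart G c T (vert u) (vert v)) same (C.isProperPart ¬centre)
    where
    module F = ProperPart₂ F
    cut : Cut F.B u v F.y₀ F.r
    cut = record { isBlock = F.isBlock ; a≢b = F.u≢v ; a∈B = F.u∈B ; b∈B = F.v∈B
                 ; degree-a = F.degree-u ; degree-b = F.degree-v ; x∈B = F.y₀∈B ; y∈B = F.r∈B
                 ; x≢a = F.inner≢u F.y₀∈inner ; x≢b = F.inner≢v F.y₀∈inner ; y≢a = F.r≢u ; y≢b = F.r≢v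
                 ; apart = λ l → F.r∉inner (F.spread {inj₁ F.y₀} {inj₁ F.r} F.y₀∈inner l (F.not-in-U F.r≢u F.r≢v)) }
    module C = CutPart (image-cut cut)
    W = ⁅ vert u ⁆ ∪ ⁅ vert v ⁆
    in-W : ∀ {x} → x ∈ F.U → vert x ∈ W
    in-W x∈ = x∈pair⁺ (Sum.map (cong vert) (cong vert) (x∈pair⁻ x∈))
    out-W : ∀ {x} → x ∉ F.U → vert x ∉ W
    out-W x∉ p = x∉ (x∈pair⁺ (Sum.map vert-injective vert-injective (x∈pair⁻ p)))
    K⁻ : ∀ z → mapElement z ∈ˢ C.K → F.In z
    K⁻ z z∈ = let z∈′ , l = C.K⁻ (mapElement z) z∈
              in F.spread {inj₁ F.y₀} {z} F.y₀∈inner (map-link⁻ (λ v∉ v∈ → v∉ (in-W v∈)) l) (into z z∈′)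
      where
      into : ∀ z → mapElement z ∈ˢ (whole ∖ W) → z ∈ˢ (whole ∖ F.U)
      into (inj₁ x) x∈ = x∈p∧x∉q⇒x∈p─q ∈⊤ λ x∈U → x∈p─q⇒x∉q full W x∈ (in-W x∈U)
      into (inj₂ _) _ = ∈⊤
    K⁺ : ∀ z → F.In z → mapElement z ∈ˢ C.K
    K⁺ z z∈ = C.K⁺ (mapElement z) (into z z∈) (map-link out-W (F.linked {inj₁ F.y₀} {z} F.y₀∈inner z∈))
      where
      into : ∀ z → F.In z → mapElement z ∈ˢ (whole ∖ W)
      into (inj₁ x) x∈ = x∈p∧x∉q⇒x∈p─q ∈⊤ (out-W (F.inner∉U x∈))
      into (inj₂ _) _ = ∈⊤
    ¬centre : ¬ ContainsCentre G c C.K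
    ¬centre (inj₁ (Q , eq , ends⊆)) = none (sub F.inner F.D) id (inj₁ (Q , eq , λ {x} x∈ →
      K⁻ (inj₁ x) (ends⊆ (subst (λ Q → vert x ∈ ends G Q) (Q-fixed eq) (ends-image x∈)))))
      where
      Q-fixed : c ≡ block Q → imageD Q ≡ Q
      Q-fixed refl = block-injective fixed
    ¬centre (inj₂ (w , eq , w∈)) = none (sub F.inner F.D) id (inj₂ (w , eq ,
      K⁻ (inj₁ w) (subst (_∈ Sub.verts C.K) (sym (w-fixed eq)) w∈)))
      where
      w-fixed : c ≡ articulation w → vert w ≡ w
      w-fixed refl = articulation-injective fixed
    same : C.part ≡ imageSub S
    same = cong₂ sub
      (⊆-antisym
        (λ {y} y∈ → from∈⇒∈image vertices (F.verts⁺ (case ProperPartFacts.verts⁻ C.facts y∈ of λ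
          { (inj₁ y∈K) → inj₁ (K⁻ (inj₁ (vert⁻ y)) (subst (_∈ Sub.verts C.K) (sym (vert-vert⁻ y)) y∈K))
          ; (inj₂ (inj₁ refl)) → inj₂ (inj₁ (vert⁻-vert u))
          ; (inj₂ (inj₂ refl)) → inj₂ (inj₂ (vert⁻-vert v)) })))
        (λ {y} y∈ → subst (_∈ Sub.verts C.part) (vert-vert⁻ y) (ProperPartFacts.verts⁺ C.facts
          (Sum.map (K⁺ (inj₁ (vert⁻ y))) (Sum.map (cong vert) (cong vert)) (F.verts⁻ (∈image⁻ vertices y∈))))))
      (⊆-antisym
        (λ {e} e∈ → from∈⇒∈image darts (K⁻ (inj₂ (dart⁻ e)) (subst (_∈ Sub.darts C.K) (sym (dart-dart⁻ e)) e∈)))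
        (λ {e} e∈ → subst (_∈ Sub.darts C.K) (dart-dart⁻ e) (K⁺ (inj₂ (dart⁻ e)) (∈image⁻ darts e∈))))

  image-part : ∀ {S b} → IsPart G c S b → IsPart G c (imageSub S) (mapBoundary b)
  image-part (blockPart p ¬dip) = blockPart (image-blockPart p) λ x y dip →
    ¬dip _ _ (subst (λ S → IsDipole G S _ _) back-sub (Back.image-dipole dip))
  image-part (properPart p) = let F , none = FromProperPart.facts p in properPart (image-properPart F none)
  image-part (dipolePart p) = dipolePart (image-dipole p)

module AtomFacts {n m : ℕ} (G : Graph (Fin n) (Fin m)) (simple : IsSimple G)
                 (c : Node G) (centre : IsNode G c) where

  open Graph G
  open IsSimple simple
  open Disjoint G simple c centre public

  module MoveAtom (α : Aut G) (fixed : ∀ α → TransportBack.mapNode G simple α c ≡ c) where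

    open MoveParts G simple c centre α (fixed α) public
    open Iso α
    private module Back = MoveParts G simple c centre (inverse α) (fixed (inverse α))

    move : Atom G c → Atom G c
    move A = record
      { S = imageSub S ; ∂ = mapBoundary ∂ ; isPart = image-part isPart
      ; minimal = λ T b part T⊑ →
          let S⊑ = minimal (Back.imageSub T) (Back.mapBoundary b) (Back.image-part part)
                     ((λ x∈ → ∈image⇒∈ vertices (proj₁ T⊑ (∈image⁻ (↔-sym vertices) x∈))) ,
                      (λ x∈ → ∈image⇒∈ darts (proj₂ T⊑ (∈image⁻ (↔-sym darts) x∈))))
          in (λ {y} y∈ → subst (_∈ Sub.verts T) (vert-vert⁻ y) (∈image⁻ (↔-sym vertices) (proj₁ S⊑ (∈image⁻ vertices y∈)))) ,
             (λ {y} y∈ → subst (_∈ Sub.darts T) (dart-dart⁻ y) (∈image⁻ (↔-sym darts) (proj₂ S⊑ (∈image⁻ darts y∈))))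
      ; closed = λ {e} e∈ → from∈⇒∈image darts (subst (_∈ Sub.darts S)
          (Iso.mate-preserved (inverse α) e) (closed (∈image⁻ darts e∈)))
      }
      where open Atom A

  module _ (A : Atom G c) where

    open Atom A

    private
      D : Subset m
      D = Sub.darts S

    atom-facts : PartView S ∂
    atom-facts = part-facts isPart

    private
      spanned′ : ∀ {b} → PartView S b → IsSpanned S
      spanned′ (blockPart F _)  = blockPart-spanned F
      spanned′ (properPart F _) = properPart-spanned F
      spanned′ (dipolePart dip) = dipole-spanned dip

    atom-end : ∀ {d x} → d ∈ D → ι d ≡ just x → x ∈ Sub.verts S
    atom-end = proj₂ (spanned′ atom-facts)

    vertex-dart : ∀ {x} → x ∈ Sub.verts S → ∃ λ d → d ∈ D × ι d ≡ just x
    vertex-dart = proj₁ (spanned′ atom-facts)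

    atom-nonempty : Nonempty D
    atom-nonempty = go atom-facts
      where
      go : ∀ {b} → PartView S b → Nonempty D
      go (blockPart F _)  = BlockPartFacts.nonempty F
      go (properPart F _) = let d , d∈ , _ = ProperPart₂.u-in F in d , d∈
      go (dipolePart dip) = let d , _ , _ , d∈ , _ = IsDipole.two-edges dip in d , d∈

    interior-dart : ∀ {d x} → Interior A x → ι d ≡ just x → d ∈ D
    interior-dart (x∈ , x∉) dx = go atom-facts x∈ x∉ dx
      where
      go : ∀ {b x d} → PartView S b → x ∈ Sub.verts S → ¬ _∈∂_ G x b → ι d ≡ just x → d ∈ D
      go (blockPart F _) x∈ x∉ dx = BlockPart.around F x∈ x∉ dx
      go (properPart F _) x∈ x∉ dx with ProperPartFacts.verts⁻ F x∈
      ... | inj₁ x∈K = ProperPart₂.around F x∈K dx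
      ... | inj₂ p   = contradiction p x∉
      go (dipolePart dip) x∈ x∉ _ = contradiction (x∈pair⁻ (subst (_ ∈_) (IsDipole.vertices dip) x∈)) x∉

    boundary∈ : ∀ {x} → OnBoundary A x → x ∈ Sub.verts S
    boundary∈ p = go atom-facts p
      where
      go : ∀ {b x} → PartView S b → _∈∂_ G x b → x ∈ Sub.verts S
      go (blockPart F _) refl = BlockPart.u∈verts F
      go (properPart F _) p = ProperPartFacts.verts⁺ F (inj₂ p)
      go (dipolePart dip) p = subst (_ ∈_) (sym (IsDipole.vertices dip)) (x∈pair⁺ p)

    boundary-distinct : ∀ {u v} → ∂ ≡ pair u v → u ≢ v
    boundary-distinct eq = go atom-facts eq
      where
      go : ∀ {b u v} → PartView S b → b ≡ pair u v → u ≢ v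
      go (properPart F _) refl = ProperPartFacts.u≢v F
      go (dipolePart dip) refl = IsDipole.distinct dip

    -- This is what allows a dart of A to stand for `e_A`: after the removal of a vertex that is not
    -- interior, it is still linked to every remaining end of `e_A`.
    boundary-linked : ∀ {w x d} → ¬ Interior A w → OnBoundary A x → x ≢ w → d ∈ D → ⁅ w ⁆ ⊢ inj₂ d ~ inj₁ x
    boundary-linked {w} w∉ x∈ x≢w d∈ = go atom-facts w∉ x∈ x≢w d∈
      where
      go : ∀ {b x d} → PartView S b → ¬ (w ∈ Sub.verts S × ¬ _∈∂_ G w b) → _∈∂_ G x b → x ≢ w → d ∈ D →
           ⁅ w ⁆ ⊢ inj₂ d ~ inj₁ x
      go (blockPart F _) w∉ refl x≢w d∈ = BlockPart.boundary-link F
        (λ {y} y∈ y∈S → w∉ (subst (_∈ Sub.verts S) (x∈⁅y⁆⇒x≡y w y∈) y∈S , λ w≡u → x≢w (sym w≡u))) d∈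
      go {d = d} (properPart F _) w∉ x∈ x≢w d∈ = by x∈ x≢w
        where
        module F = ProperPart₂ F
        off : ∀ {y} → y ∈ ⁅ w ⁆ → y ∉ F.inner
        off y∈ y∈K with x∈⁅y⁆⇒x≡y w y∈
        ... | refl = w∉ (F.verts⁺ (inj₁ y∈K) , Sum.[ F.inner≢u y∈K , F.inner≢v y∈K ])
        by : ∀ {x} → x ≡ _ ⊎ x ≡ _ → x ≢ w → ⁅ w ⁆ ⊢ inj₂ d ~ inj₁ x
        by (inj₁ refl) x≢w = let e , e∈ , eu = F.u-in in
          F.linked-off {⁅ w ⁆} {inj₂ d} {inj₂ e} off d∈ e∈ ◅◅ end-link ⁅ w ⁆ (x∉⁅⁆ x≢w) eu
        by (inj₂ refl) x≢w = let e , e∈ , ev = F.v-in in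
          F.linked-off {⁅ w ⁆} {inj₂ d} {inj₂ e} off d∈ e∈ ◅◅ end-link ⁅ w ⁆ (x∉⁅⁆ x≢w) ev
      go (dipolePart dip) _ (inj₁ refl) x≢w d∈ = let e , _ , _ , e∈ , _ , eu , _ = IsDipole.two-edges dip in
        dipole-link dip d∈ e∈ ⁅ w ⁆ (inj₁ (x∉⁅⁆ x≢w)) ◅◅ end-link ⁅ w ⁆ (x∉⁅⁆ x≢w) eu
      go (dipolePart dip) _ (inj₂ refl) x≢w d∈ with dipole-ends dip d∈
      ... | _ , inj₁ dv = end-link ⁅ w ⁆ (x∉⁅⁆ x≢w) dv
      ... | _ , inj₂ mv = mate-link ⁅ w ⁆ ◅◅ end-link ⁅ w ⁆ (x∉⁅⁆ x≢w) mv

    -- Only block atoms and proper atoms have interior vertices, and what lies outside such an atom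
    -- hangs together without its interior.
    outside-linked : ∀ {w d e} → Interior A w → d ∉ D → e ∉ D → ⁅ w ⁆ ⊢ inj₂ d ~ inj₂ e
    outside-linked {w} (w∈ , w∉) d∉ e∉ = go atom-facts w∈ w∉ d∉ e∉
      where
      go : ∀ {b d e} → PartView S b → w ∈ Sub.verts S → ¬ _∈∂_ G w b → d ∉ D → e ∉ D → ⁅ w ⁆ ⊢ inj₂ d ~ inj₂ e
      go (blockPart F _) w∈ w∉ d∉ e∉ = BlockPart.outside-link F w∈ w∉ d∉ e∉
      go {d = d} {e} (properPart F _) w∈ w∉ d∉ e∉ with ProperPartFacts.verts⁻ F w∈
      ... | inj₁ w∈K = ProperPart₂.outside-link F {⁅ w ⁆} {inj₂ d} {inj₂ e}
                         (λ y∈ → subst (_∈ ProperPartFacts.inner F) (sym (x∈⁅y⁆⇒x≡y w y∈)) w∈K) d∉ e∉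
      ... | inj₂ p = contradiction p w∉
      go (dipolePart dip) w∈ w∉ _ _ = contradiction (x∈pair⁻ (subst (_ ∈_) (IsDipole.vertices dip) w∈)) w∉

  same-boundary : ∀ (A A′ : Atom G c) → Atom.S A ≡ Atom.S A′ → ∀ {x} → OnBoundary A x → OnBoundary A′ x
  same-boundary A A′ eq = boundary-unique (subst (λ S → PartView S (Atom.∂ A)) eq (atom-facts A)) (atom-facts A′)

-- The centre

module TreeCentre {n m : ℕ} (G : Graph (Fin n) (Fin m)) (simple : IsSimple G) where

  open Graph G
  open IsSimple simple
  open BlockTree G simple

  articulation-dart : ∀ {u} → IsArticulation G u → ∃ λ d → ι d ≡ just u
  articulation-dart {u} art = decidable-stable (any? λ d → Maybe.≡-dec _≟_ (ι d) (just u)) λ none-at →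
    art λ x y _ _ → propagate none (λ z → ⁅ u ⁆ ⊢ x ~ z)
      (λ d l → l ◅◅ mate-link ⁅ u ⁆)
      (λ d v _ dv l → l ◅◅ end-link ⁅ u ⁆ (x∉⁅⁆ λ { refl → none-at (d , dv) }) dv)
      (λ d v _ dv l → l ◅◅ ⊢-sym ⁅ u ⁆ (end-link ⁅ u ⁆ (x∉⁅⁆ λ { refl → none-at (d , dv) }) dv))
      (all-linked x y) ε

  walk-between : ∀ x y → IsNode G x → IsNode G y → Walk G x y
  walk-between (articulation u) y art y! =
    let d , du = articulation-dart art
    in down art (blockOf-block d) (end-of-block du) ◅ block-walk d y y!
  walk-between (block Q) y Q! y! =
    let q , q∈ = block-nonempty Q!
    in subst (λ Q → Walk G (block Q) y) (block-unique (blockOf-block q) Q! ∈blockOf q∈) (block-walk q y y!)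

  bounded : ∀ {k} (f : Fin k → ℕ) → ∃ λ b → ∀ i → f i ≤ b
  bounded {zero}  f = 0 , λ ()
  bounded {suc k} f = let b , f≤b = bounded (f ∘ suc)
                      in f zero ⊔ b , λ { zero → ℕ.m≤m⊔n (f zero) b ; (suc i) → ℕ.≤-trans (f≤b i) (ℕ.m≤n⊔m (f zero) b) }

  length-◅◅ : ∀ {x y z} (w : Walk G x y) (w′ : Walk G y z) →
              walkLength G (w ◅◅ w′) ≡ walkLength G w + walkLength G w′
  length-◅◅ ε       w′ = refl
  length-◅◅ (s ◅ w) w′ = cong suc (length-◅◅ w w′)

  some-eccentricity : ∀ x → IsNode G x → ∃ λ k → EccentricityAtMost G k x
  some-eccentricity x x! = suc b , reach
    where
    to : ∀ d → Walk G x (block (blockOf d))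
    to d = walk-between x (block (blockOf d)) x! (blockOf-block d)
    b = proj₁ (bounded (walkLength G ∘ to))
    ≤b = proj₂ (bounded (walkLength G ∘ to))
    -- The bound b covers the blocks, one walk for each dart; an articulation lies one step beyond a
    -- block.
    reach : EccentricityAtMost G (suc b) x
    reach (block Q) Q! = let q , q∈ = block-nonempty Q!
                         in subst (λ Q → ∃ λ (w : Walk G x (block Q)) → walkLength G w ≤ suc b)
                              (block-unique (blockOf-block q) Q! ∈blockOf q∈) (to q , ℕ.m≤n⇒m≤1+n (≤b q))
    reach (articulation u) art =
      let d , du = articulation-dart art
          w = to d ◅◅ up art (blockOf-block d) (end-of-block du) ◅ ε
      in w , ℕ.≤-trans (ℕ.≤-reflexive (trans (length-◅◅ (to d) _) (ℕ.+-comm (walkLength G (to d)) 1))) (s≤s (≤b d))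

  split-walk : ∀ {x y s} (w : Walk G x y) → s List.∈ visited G w →
               ∃ λ (w₁ : Walk G x s) → ∃ λ (w₂ : Walk G s y) →
                 walkLength G w₁ + walkLength G w₂ ≡ walkLength G w
  split-walk ε       (here refl) = ε , ε , refl
  split-walk (s ◅ w) (here refl) = ε , s ◅ w , refl
  split-walk (s ◅ w) (there s∈)  = let w₁ , w₂ , eq = split-walk w s∈ in s ◅ w₁ , w₂ , cong suc eq

  Within : ℕ → Node G → Node G → Set
  Within k x y = ∃ λ (w : Walk G x y) → walkLength G w ≤ k

  from-later : ∀ {x y s k} (w : Walk G x y) → walkLength G w ≤ suc k → s List.∈ visited G w → s ≢ x → Within k s y
  from-later w ≤k s∈ s≢x with split-walk w s∈
  ... | ε , _ , _ = contradiction refl s≢x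
  ... | _ ◅ w₁ , w₂ , eq = w₂ , ℕ.≤-trans (ℕ.m≤n+m (walkLength G w₂) (walkLength G w₁))
        (ℕ.≤-pred (ℕ.≤-trans (ℕ.≤-reflexive eq) ≤k))

  to-earlier : ∀ {x y s k} (w : Walk G x y) → walkLength G w ≤ suc k → s List.∈ visited G w → s ≢ y → Within k x s
  to-earlier w ≤k s∈ s≢y with split-walk w s∈
  ... | _ , ε , _ = contradiction refl s≢y
  ... | w₁ , _ ◅ w₂ , eq = w₁ , ℕ.≤-trans (ℕ.m≤m+n (walkLength G w₁) (walkLength G w₂))
        (ℕ.≤-pred (ℕ.≤-trans (ℕ.≤-reflexive (trans (sym (ℕ.+-suc (walkLength G w₁) (walkLength G w₂))) eq)) ≤k))

  unique-within : ∀ {k x y} → EccentricityAtMost G k x → IsNode G y →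
                  ∃ λ (w : Walk G x y) → Unique (visited G w) × walkLength G w ≤ k
  unique-within ecc y! = let w , ≤k = ecc _ y!
                             w′ , uniq , ≤ = erase-loops w
                         in w′ , uniq , ℕ.≤-trans ≤ ≤k

  last-visited : ∀ {x y} (w : Walk G x y) → y List.∈ visited G w
  last-visited ε       = here refl
  last-visited (_ ◅ w) = there (last-visited w)

  passes-cut : ∀ {u x y z z′} (w : Walk G x y) → IsNode G x → Rep x z → Rep y z′ → ¬ ⁅ u ⁆ ⊢ z ~ z′ →
               articulation u List.∈ visited G w
  passes-cut {u} w x! r r′ ¬l with visited? (articulation u) (visited G w)
  ... | yes u∈ = u∈
  ... | no u∉  = contradiction (avoiding-links w x! u∉ r r′) ¬l

  first-block : ∀ {u P p t z} (w : Walk G (articulation u) t) → Unique (visited G w) → t ≢ articulation u →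
                IsBlock G P → u ∈ ends G P → p ∈ P → Rep t z → ⁅ u ⁆ ⊢ inj₂ p ~ z → block P List.∈ visited G w
  first-block ε _ t≢ _ _ _ _ _ = contradiction refl t≢
  first-block {u} (down art P₁! u∈P₁ ◅ w) (u∉ ∷ _) _ P! u∈P p∈ r l =
    let p₁ , p₁∈ = block-nonempty P₁!
        k = avoiding-links w P₁! (λ u∈ → All.lookup u∉ u∈ refl) (p₁ , p₁∈ , refl) r
    in subst (λ Q → block Q List.∈ visited G (down art P₁! u∈P₁ ◅ w))
             (blocks-at P₁! P! u∈P₁ u∈P p₁∈ p∈ (k ◅◅ ⊢-sym ⁅ u ⁆ l)) (there (head-visited w))

  -- Beyond an articulation there is always a further block.
  articulation-closer : ∀ {k x b} → IsNode G x → EccentricityAtMost G (suc k) x → IsArticulation G b →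
                        x ≢ articulation b → Within k x (articulation b)
  articulation-closer {k} {x} {b} x! ecc art x≢b =
    let d , ¬l = ¬∀⟶∃¬ m _ (λ d → ⊢-dec ⁅ b ⁆ (inj₂ d) (Parts.zᶜ G simple x x!))
                   λ links → Parts.no-articulation G simple x x! links art
        w , ≤k = ecc (block (blockOf d)) (blockOf-block d)
    in to-earlier w ≤k
         (passes-cut w x! (Parts.rep-zᶜ G simple x x!) (d , ∈blockOf , refl) λ l → ¬l (⊢-sym ⁅ b ⁆ l)) λ ()

  kind : Node G → Bool
  kind (articulation _) = false
  kind (block _)        = true

  flips : ℕ → Bool → Bool
  flips zero    b = b
  flips (suc k) b = flips k (not b)

  flips-not : ∀ k b → flips k (not b) ≡ not (flips k b)
  flips-not zero    b = refl
  flips-not (suc k) b = flips-not k (not b)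

  -- The block-tree is bipartite between articulations and blocks.
  walk-parity : ∀ {x y} (w : Walk G x y) → kind y ≡ flips (walkLength G w) (kind x)
  walk-parity ε                = refl
  walk-parity (down _ _ _ ◅ w) = walk-parity w
  walk-parity (up _ _ _ ◅ w)   = walk-parity w

  -- A node at distance exactly k + 1 would be an articulation by parity. By `articulation-closer`
  -- no articulation is that far, because a block lies beyond it.
  wrong-parity : ∀ {k x} → IsNode G x → EccentricityAtMost G (suc k) x → flips (suc k) (kind x) ≡ false →
                 EccentricityAtMost G k x
  wrong-parity {k} {x} x! ecc odd (articulation b) art with x ≟ⁿ articulation b
  ... | yes refl = ε , z≤n
  ... | no x≢b = articulation-closer x! ecc art x≢b
  wrong-parity {k} {x} x! ecc odd (block Q) Q! with ecc (block Q) Q!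
  ... | w , ≤k with ℕ.m≤n⇒m<n∨m≡n ≤k
  ...   | inj₁ (s≤s ≤k′) = w , ≤k′
  ...   | inj₂ eq = case trans (walk-parity w) (trans (cong (λ l → flips l (kind x)) eq) odd) of λ ()

  -- Farthest nodes are blocks, so parity allows the bound k + 1 to be attained from only one of two
  -- neighbours; the other one satisfies the smaller bound.
  adjacent-centres : ∀ {k u P} → IsArticulation G u → IsBlock G P →
    EccentricityAtMost G (suc k) (articulation u) → EccentricityAtMost G (suc k) (block P) →
    ∃ λ z → IsNode G z × EccentricityAtMost G k z
  adjacent-centres {k} {u} {P} art P! eccᵤ eccₚ = go (flips (suc k) false) refl
    where
    go : ∀ b → flips (suc k) false ≡ b → ∃ λ z → IsNode G z × EccentricityAtMost G k z
    go false eq = articulation u , art , wrong-parity art eccᵤ eq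
    go true  eq = block P , P! , wrong-parity P! eccₚ (trans (flips-not (suc k) false) (cong not eq))

  block-before-on : ∀ {u P p y t z} (w : Walk G y t) → IsNode G y → Unique (visited G w) →
    articulation u List.∈ visited G w → y ≢ articulation u →
    IsBlock G P → u ∈ ends G P → p ∈ P → Rep y z → ⁅ u ⁆ ⊢ inj₂ p ~ z → block P List.∈ visited G w
  block-before-on {u} {p = p} {y = block Q} w Q! uniq u∈ _ P! u∈P p∈ (q , q∈ , refl) l =
    let P′ , P′! , P′∈ , u∈P′ , links = block-before w uniq u∈
        p′ , p′∈ = block-nonempty P′!
    in subst (λ Q → block Q List.∈ visited G w)
             (blocks-at P′! P! u∈P′ u∈P p′∈ p∈ (⊢-sym ⁅ u ⁆ (l ◅◅ links q∈ p′∈))) P′∈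
  block-before-on {y = articulation b} ε _ _ (here refl) y≢ _ _ _ _ _ = contradiction refl y≢
  block-before-on {y = articulation b} (s ◅ w) _ _ (here refl) y≢ _ _ _ _ _ = contradiction refl y≢
  block-before-on {u} {y = articulation b} (down _ Q! b∈Q ◅ w) _ (_ ∷ uniq) (there u∈) y≢ P! u∈P p∈ refl l =
    let q , q∈ = block-nonempty Q!
    in there (block-before-on w Q! uniq u∈ (λ ()) P! u∈P p∈ (q , q∈ , refl)
         (l ◅◅ ⊢-sym ⁅ u ⁆ (block-end Q! q∈ b∈Q λ { refl → y≢ refl })))

  -- Let P be the node after u on the way to y. A node on the side of P is reached from u through P;
  -- any other node, and u itself, is reached from y through P. Either way at least one step of a
  -- walk of length at most k + 1 precedes P. If P is y, the two nodes are adjacent and parity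
  -- decides.
  articulation-other : ∀ {k u y} → IsArticulation G u → IsNode G y → y ≢ articulation u →
    EccentricityAtMost G (suc k) (articulation u) → EccentricityAtMost G (suc k) y →
    ∃ λ z → IsNode G z × EccentricityAtMost G k z
  articulation-other {k} {u} {y} art y! y≢u eccᵤ ecc_y = go (unique-within eccᵤ y!)
    where
    go : (∃ λ (w : Walk G (articulation u) y) → Unique (visited G w) × walkLength G w ≤ suc k) →
         ∃ λ z → IsNode G z × EccentricityAtMost G k z
    go (ε , _) = contradiction refl y≢u
    go (down {Q = P} _ P! u∈P ◅ w , u∉ ∷ _ , _) with y ≟ⁿ block P
    ... | yes refl = adjacent-centres art P! eccᵤ ecc_y
    ... | no y≢P = block P , P! , ecc
      where
      p  = proj₁ (block-nonempty P!)
      p∈ = proj₂ (block-nonempty P!)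
      z  = proj₁ (rep-exists y y!)
      r  = proj₂ (rep-exists y y!)
      p~y : ⁅ u ⁆ ⊢ inj₂ p ~ z
      p~y = avoiding-links w P! (λ u∈ → All.lookup u∉ u∈ refl) (p , p∈ , refl) r
      via-y : ∀ {t} → IsNode G t → (∀ (v : Walk G y t) → articulation u List.∈ visited G v) → Within k (block P) t
      via-y t! visits =
        let v , uniq , ≤k = unique-within ecc_y t!
        in from-later v ≤k (block-before-on v y! uniq (visits v) y≢u P! u∈P p∈ r p~y) (y≢P ∘ sym)
      ecc : EccentricityAtMost G k (block P)
      ecc t t! with t ≟ⁿ articulation u
      ... | yes refl = via-y t! last-visited
      ... | no t≢u with ⊢-dec ⁅ u ⁆ (inj₂ p) (proj₁ (rep-exists t t!))
      ...   | yes l = let v , uniq , ≤k = unique-within eccᵤ t!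
                      in from-later v ≤k (first-block v uniq t≢u P! u∈P p∈ (proj₂ (rep-exists t t!)) l) λ ()
      ...   | no ¬l = via-y t! λ v → passes-cut v y! r (proj₂ (rep-exists t t!)) λ l → ¬l (p~y ◅◅ l)

  -- The articulation a after P on the way to Q separates the two blocks. Each node is thus
  -- separated by a from at least one of them, and the short walk from that block passes a.
  two-blocks : ∀ {k P Q} → IsBlock G P → IsBlock G Q → block {G = G} P ≢ block Q →
    EccentricityAtMost G (suc k) (block P) → EccentricityAtMost G (suc k) (block Q) →
    ∃ λ z → IsNode G z × EccentricityAtMost G k z
  two-blocks {k} {P} {Q} P! Q! P≢Q eccₚ ecc_q = go (unique-within eccₚ Q!)
    where
    go : (∃ λ (w : Walk G (block P) (block Q)) → Unique (visited G w) × walkLength G w ≤ suc k) →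
         ∃ λ z → IsNode G z × EccentricityAtMost G k z
    go (ε , _) = contradiction refl P≢Q
    go (up {u = a} art P!′ a∈P ◅ w , uniq , _) = articulation a , art , ecc
      where
      p  = proj₁ (block-nonempty P!)
      p∈ = proj₂ (block-nonempty P!)
      q  = proj₁ (block-nonempty Q!)
      q∈ = proj₂ (block-nonempty Q!)
      sep : ¬ ⁅ a ⁆ ⊢ inj₂ p ~ inj₂ q
      sep = crossing-separates (up art P!′ a∈P ◅ w) uniq (there (head-visited w)) p∈ (q , q∈ , refl)
      ecc : EccentricityAtMost G k (articulation a)
      ecc t t! with ⊢-dec ⁅ a ⁆ (inj₂ p) (proj₁ (rep-exists t t!))
      ... | no ¬l = let v , ≤k = eccₚ t t!
                    in from-later v ≤k (passes-cut v P! (p , p∈ , refl) (proj₂ (rep-exists t t!)) ¬l) λ ()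
      ... | yes l = let v , ≤k = ecc_q t t!
                    in from-later v ≤k (passes-cut v Q! (q , q∈ , refl) (proj₂ (rep-exists t t!))
                                          λ l′ → sep (l ◅◅ ⊢-sym ⁅ a ⁆ l′)) λ ()

  smaller-eccentricity : ∀ {k x y} → IsNode G x → IsNode G y → x ≢ y →
    EccentricityAtMost G (suc k) x → EccentricityAtMost G (suc k) y →
    ∃ λ z → IsNode G z × EccentricityAtMost G k z
  smaller-eccentricity {x = articulation u} {y} x! y! x≢y eccₓ ecc_y =
    articulation-other x! y! (x≢y ∘ sym) eccₓ ecc_y
  smaller-eccentricity {x = block P} {articulation v} x! y! x≢y eccₓ ecc_y =
    articulation-other y! x! x≢y ecc_y eccₓ
  smaller-eccentricity {x = block P} {block Q} = two-blocks

  -- Descent on a common bound of the eccentricities: two different nodes with bound k + 1 give some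
  -- node with bound k, which minimality transfers to x; bound 0 leaves room for one node only.
  treeCentre-unique : ∀ {x y} → InTreeCentre G x → InTreeCentre G y → x ≡ y
  treeCentre-unique {x} {y} (x! , x-min) (y! , y-min) = decidable-stable (x ≟ⁿ y) λ x≢y →
    let k , ecc = some-eccentricity x x! in descend k x≢y ecc
    where
    descend : ∀ k → x ≢ y → EccentricityAtMost G k x → ⊥
    descend zero x≢y ecc with ecc y y!
    ... | ε , _ = x≢y refl
    descend (suc k) x≢y ecc =
      let z , z! , ecc_z = smaller-eccentricity x! y! x≢y ecc (y-min x x! (suc k) ecc)
      in descend k x≢y (x-min z z! k ecc_z)

  module _ (α : Aut G) where

    open TransportBack G simple α
    private module Back = TransportBack G simple (inverse α)

    eccentricity-image : ∀ {k x} → EccentricityAtMost G k x → EccentricityAtMost G k (mapNode x)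
    eccentricity-image {k} {x} ecc y y! =
      let w , ≤k = ecc (Back.mapNode y) (Back.image-node y y!)
      in subst (λ y → Within k (mapNode x) y) (mapNode-inverse y)
               (map-walk w , ℕ.≤-trans (ℕ.≤-reflexive (length-map w)) ≤k)

    treeCentre-fixed : ∀ {c} → InTreeCentre G c → mapNode c ≡ c
    treeCentre-fixed {c} centre@(c! , c-min) = treeCentre-unique
      (image-node c c! , λ y y! k ecc → eccentricity-image (c-min y y! k ecc)) centre

-- Graphs without articulations and the invariant of the series

module _ {n m : ℕ} (G : Graph (Fin n) (Fin m)) where

  -- Serves the case of a central vertex that is not an articulation. Without articulations the
  -- block-tree has no edges, so no block has a walk to the centre.
  no-blockPart : (∀ u → ¬ IsArticulation G u) → ∀ {w S u} → ¬ IsBlockPart G (articulation w) S u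
  no-blockPart no-art {w} {S} {u} part = go node isNode union-of-blocks attached
    where
    open IsBlockPart part
    go : ∀ node → IsNode G node →
      (∀ d → d ∈ Sub.darts S ⇔ (∃ λ Q → IsBlock G Q × InSubtree G (articulation w) node (block Q) × d ∈ Q)) →
      node ≡ articulation u ⊎ ((∃ λ Q → node ≡ block Q) × u ∈ Sub.verts S × ∃ λ d → d ∉ Sub.darts S × Graph.ι G d ≡ just u) → ⊥
    go (articulation a) art _ _ = no-art a art
    go (block Q) _ union (inj₂ (_ , u∈ , _)) =
      let d , d∈ , _ = ∈ends⁻ G (Sub.darts S) (subst (u ∈_) vertices u∈)
          _ , _ , (walk , _) , _ = Equivalence.to (union d) d∈
      in no-walk walk
      where
      no-walk : ∀ {P} → ¬ Walk G (block P) (articulation w)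
      no-walk (up art _ _ ◅ _) = no-art _ art

-- The invariant of the series. The condition in `isNode` is needed because a central vertex is no
-- articulation in K₁, or when a single pendant edge is left at it; such graphs have no atoms. Its
-- double negation is the form in which the series asserts that a member is not primitive.
record IsGood {n m : ℕ} (G : Graph (Fin n) (Fin m)) (c : Node G) : Set where
  field
    simple    : IsSimple G
    fixed     : ∀ α → TransportBack.mapNode G simple α c ≡ c
    isNode    : ¬ ¬ Atom G c → IsNode G c

module _ (G : FinGraph) (admissible : IsAdmissible G) where

  open FinGraph G using (n; m; ι; mate)
  open IsAdmissible admissible

  admissible-simple : IsSimple (graph G)
  admissible-simple = record { isGraph = FinGraph.isGraph G ; connected = connected ; no-loops = no-loops ; no-half-edges = no-half-edges }

  open Blocks (graph G) admissible-simple using (_⊢_~_; mate-link; ⊢-sym)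

  module _ (trivial : TrivialGraph (graph G)) where

    private
      one-vertex : ∀ {k} → k ≡ 1 → (x y : Fin k) → x ≡ y
      one-vertex refl zero zero = refl

    trivial-no-articulation : ∀ u → ¬ IsArticulation (graph G) u
    trivial-no-articulation u art = art linked
      where
      linked : Connected (graph G) (whole ∖ ⁅ u ⁆)
      linked (inj₁ x) _ x∈ _ = contradiction (one-vertex (proj₁ trivial) x u) (x∉⁅⁆⁻ (x∈p─q⇒x∉q full ⁅ u ⁆ x∈))
      linked (inj₂ _) (inj₁ y) _ y∈ = contradiction (one-vertex (proj₁ trivial) y u) (x∉⁅⁆⁻ (x∈p─q⇒x∉q full ⁅ u ⁆ y∈))
      linked (inj₂ d) (inj₂ e) _ _ with d ≟ e | mate d ≟ e
      ... | yes refl | _ = ε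
      ... | no _ | yes refl = mate-link ⁅ u ⁆
      -- Then d, its mate and e are three darts, whereas a trivial graph has at most two.
      ... | no d≢e | no m≢e = contradiction
        (ℕ.≤-trans (elements-three (∈⊤ {x = d}) (∈⊤ {x = mate d}) (∈⊤ {x = e}) (no-half-edges d ∘ sym) d≢e m≢e)
                   (ℕ.≤-trans (∣p∣≤n full) (proj₂ trivial))) λ { (s≤s (s≤s ())) }

    trivial-no-atom : ∀ {u} → ¬ Atom (graph G) (articulation u)
    trivial-no-atom A = go (Atom.isPart A)
      where
      go : ∀ {S b} → ¬ IsPart (graph G) (articulation _) S b
      go (blockPart part _) = no-blockPart (graph G) trivial-no-articulation part
      go (properPart part)  = proj₁ (IsProperPart.twoCut part) (one-vertex (proj₁ trivial) _ _)
      go (dipolePart dip)   = IsDipole.distinct dip (one-vertex (proj₁ trivial) _ _)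

    trivial-fixed : ∀ {u} α → TransportBack.mapNode (graph G) admissible-simple α (articulation u) ≡ articulation u
    trivial-fixed {u} α = cong articulation (one-vertex (proj₁ trivial) _ u)

  centre-good : ∀ {c} → IsCentre (graph G) c → IsGood (graph G) c
  centre-good (inj₁ (trivial , u , refl)) = record
    { simple = admissible-simple ; fixed = trivial-fixed trivial
    ; isNode = λ ¬¬atom → contradiction (trivial-no-atom trivial) ¬¬atom }
  centre-good (inj₂ (_ , centre)) = record
    { simple = admissible-simple ; fixed = λ α → TreeCentre.treeCentre-fixed (graph G) admissible-simple α centre
    ; isNode = λ _ → proj₁ centre }

-- The reduced graph

element-≡ : ∀ {k} {p : Subset k} {x y : ∃ λ v → v ∈ p} → proj₁ x ≡ proj₁ y → x ≡ y
element-≡ {x = v , p} {.v , q} refl = cong (v ,_) ([]=-irrelevant p q)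

opposite-involutive : ∀ s → opposite (opposite s) ≡ s
opposite-involutive near = refl
opposite-involutive far  = refl

opposite-≢ : ∀ s → opposite s ≢ s
opposite-≢ near ()
opposite-≢ far ()

same-or-opposite : ∀ s t → s ≡ t ⊎ opposite s ≡ t
same-or-opposite near near = inj₁ refl
same-or-opposite near far  = inj₂ refl
same-or-opposite far near  = inj₂ refl
same-or-opposite far far   = inj₁ refl

module _ {n m : ℕ} {G : Graph (Fin n) (Fin m)} where

  end⇒∈∂ : ∀ (b : Boundary G) s {x} → end b s ≡ just x → _∈∂_ G x b
  end⇒∈∂ (single u) near refl = refl
  end⇒∈∂ (pair u v) near refl = inj₁ refl
  end⇒∈∂ (pair u v) far  refl = inj₂ refl

  ∈∂⇒end : ∀ (b : Boundary G) {x} → _∈∂_ G x b → ∃ λ s → end b s ≡ just x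
  ∈∂⇒end (single u) refl = near , refl
  ∈∂⇒end (pair u v) (inj₁ refl) = near , refl
  ∈∂⇒end (pair u v) (inj₂ refl) = far , refl

  ∈∂? : ∀ x (b : Boundary G) → Dec (_∈∂_ G x b)
  ∈∂? x (single u) = x ≟ u
  ∈∂? x (pair u v) = (x ≟ u) ⊎-dec (x ≟ v)

module Reduced {G G′ : FinGraph} {c : Node (graph G)} {c′ : Node (graph G′)} (R : Reduction G c G′ c′)
               (simple : IsSimple (graph G)) (centre : IsNode (graph G) c) where

  module G  = FinGraph G
  module G′ = FinGraph G′

  open Reduction R public
  open AtomFacts (graph G) simple c centre public
  open IsSimple simple using (mate-involutive)

  Dᴬ : Fin size → Subset G.m
  Dᴬ a = Sub.darts (Atom.S (atom a))

  Vᴬ : Fin size → Subset G.n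
  Vᴬ a = Sub.verts (Atom.S (atom a))

  index-unique : ∀ {a b d} → d ∈ Dᴬ a → d ∈ Dᴬ b → a ≡ b
  index-unique {a} {b} d∈a d∈b = distinct a b (atoms-disjoint (atom a) (atom b) d∈a d∈b)

  end-injective : ∀ a s t {x} → end (Atom.∂ (atom a)) s ≡ just x → end (Atom.∂ (atom a)) t ≡ just x → s ≡ t
  end-injective a s t p q = go (Atom.∂ (atom a)) refl s t p q
    where
    go : ∀ b → Atom.∂ (atom a) ≡ b → ∀ s t {x} → end b s ≡ just x → end b t ≡ just x → s ≡ t
    go _ _ near near _ _ = refl
    go _ _ far far _ _ = refl
    go (pair u v) eq near far refl refl = contradiction refl (boundary-distinct (atom a) eq)
    go (pair u v) eq far near refl refl = contradiction refl (boundary-distinct (atom a) eq)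

  interior? : ∀ a x → Dec (Interior (atom a) x)
  interior? a x = (x ∈? Vᴬ a) ×-dec ¬? (∈∂? x (Atom.∂ (atom a)))

  vert-kept : ∀ y → KeptV (vert y)
  vert-kept y = Equivalence.from (vert-image (vert y)) (y , refl)

  kept-or-interior : ∀ x → (∃ λ y → vert y ≡ x) ⊎ (∃ λ a → Interior (atom a) x)
  kept-or-interior x with any? (λ a → interior? a x)
  ... | yes (a , i) = inj₂ (a , i)
  ... | no ¬i = inj₁ (Equivalence.to (vert-image x) λ a i → ¬i (a , i))

  old-or-in-atom : ∀ d → (∃ λ e → dart e ≡ inj₁ d) ⊎ (∃ λ a → d ∈ Dᴬ a)
  old-or-in-atom d with any? (λ a → d ∈? Dᴬ a)
  ... | yes p = inj₂ p
  ... | no ¬p = inj₁ (Equivalence.to (dart-image (inj₁ d)) λ a d∈ → ¬p (a , d∈))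

  dart-kept : ∀ {e d} a → dart e ≡ inj₁ d → d ∉ Dᴬ a
  dart-kept {e} {d} a eq = Equivalence.from (dart-image (inj₁ d)) (e , eq) a

  dart-newDart : ∀ a s → dart (newDart a s) ≡ inj₂ (a , s)
  dart-newDart a s = proj₂ (Equivalence.to (dart-image (inj₂ (a , s))) tt)

  new-unique : ∀ {e a s} → dart e ≡ inj₂ (a , s) → e ≡ newDart a s
  new-unique {e} {a} {s} eq = dart-injective (trans eq (sym (dart-newDart a s)))

  open Preserves preserves public

  dart-end : ∀ {e y} → G′.ι e ≡ just y → Graph.ι extended (dart e) ≡ just (vert y)
  dart-end {e} p = trans (ι-preserved e) (cong (Maybe.map vert) p)

  end-kept : ∀ {e x} → Graph.ι extended (dart e) ≡ just x → ∃ λ y → vert y ≡ x × G′.ι e ≡ just y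
  end-kept {e} {x} p with G′.ι e | ι-preserved e
  ... | just y  | q = y , Maybe.just-injective (trans (sym q) p) , refl
  ... | nothing | q = case trans (sym p) q of λ ()

  boundary-kept : ∀ {a x} → OnBoundary (atom a) x → ∃ λ y → vert y ≡ x
  boundary-kept {a} {x} x∈ =
    let s , p = ∈∂⇒end (Atom.∂ (atom a)) x∈
        y , eq , _ = end-kept {newDart a s} (trans (cong (Graph.ι extended) (dart-newDart a s)) p)
    in y , eq

  interior-or-kept : ∀ {a x} → x ∈ Vᴬ a → Interior (atom a) x ⊎ OnBoundary (atom a) x
  interior-or-kept {a} {x} x∈ with ∈∂? x (Atom.∂ (atom a))
  ... | yes p = inj₂ p
  ... | no ¬p = inj₁ (x∈ , ¬p)

  interior-index : ∀ {a b x} → Interior (atom a) x → x ∈ Vᴬ b → a ≡ b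
  interior-index {a} {b} i x∈b with vertex-dart (atom b) x∈b
  ... | d , d∈ , dx = index-unique (interior-dart (atom a) i dx) d∈

  dart-mate : ∀ {e z} → dart e ≡ z → dart (G′.mate e) ≡ Graph.mate extended z
  dart-mate {e} eq = trans (sym (mate-preserved e)) (cong (Graph.mate extended) eq)

  no-loops′ : ∀ d v → G′.ι d ≡ just v → G′.ι (G′.mate d) ≢ just v
  no-loops′ e v p q = go (dart e) refl (dart-end p) (dart-end q)
    where
    go : ∀ z → dart e ≡ z → Graph.ι extended (dart e) ≡ just (vert v) →
         Graph.ι extended (dart (G′.mate e)) ≡ just (vert v) → ⊥
    go (inj₁ d) eq p q = IsSimple.no-loops simple d (vert v) (trans (cong (Graph.ι extended) (sym eq)) p)
                           (trans (cong (Graph.ι extended) (sym (dart-mate eq))) q)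
    go (inj₂ (a , s)) eq p q = opposite-≢ s (sym (end-injective a s (opposite s)
      (trans (cong (Graph.ι extended) (sym eq)) p) (trans (cong (Graph.ι extended) (sym (dart-mate eq))) q)))

  no-half-edges′ : ∀ e → G′.mate e ≢ e
  no-half-edges′ e p = go (dart e) refl
    where
    go : ∀ z → dart e ≡ z → ⊥
    go (inj₁ d) eq = IsSimple.no-half-edges simple d
      (Sum.inj₁-injective (trans (sym (dart-mate eq)) (trans (cong dart p) eq)))
    go (inj₂ (a , s)) eq = opposite-≢ s
      (cong proj₂ (Sum.inj₂-injective (trans (sym (dart-mate eq)) (trans (cong dart p) eq))))

  open Links (graph G′) G′.isGraph public renaming
    ( _⊢_~_ to _⊢′_~_ ; propagate to propagate′ ; mate-link to mate-link′ ; end-link to end-link′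
    ; ⊢-sym to ⊢-sym′ ; ⊢-dec to ⊢-dec′ ; ⊢-whole to ⊢-whole′ )
    using ()

  -- Ψ z z′ says that z′ is what z becomes in G′, where everything inside an
  -- atom becomes either dart of the edge replacing the atom.
  data Ψ : Element G.n G.m → Element G′.n G′.m → Set where
    kept-vertex  : ∀ {x y} → vert y ≡ x → Ψ (inj₁ x) (inj₁ y)
    kept-dart    : ∀ {d e} → dart e ≡ inj₁ d → Ψ (inj₂ d) (inj₂ e)
    inner-vertex : ∀ {x a s e} → Interior (atom a) x → dart e ≡ inj₂ (a , s) → Ψ (inj₁ x) (inj₂ e)
    inner-dart   : ∀ {d a s e} → d ∈ Dᴬ a → dart e ≡ inj₂ (a , s) → Ψ (inj₂ d) (inj₂ e)

  same-new-edge : ∀ W {a s t e f} → dart e ≡ inj₂ (a , s) → dart f ≡ inj₂ (a , t) → W ⊢′ inj₂ e ~ inj₂ f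
  same-new-edge W {a} {s} {t} {e} {f} p q with same-or-opposite s t
  ... | inj₁ refl = subst (λ f → W ⊢′ inj₂ e ~ inj₂ f) (dart-injective (trans p (sym q))) ε
  ... | inj₂ refl = subst (λ f → W ⊢′ inj₂ e ~ inj₂ f) (dart-injective (trans (dart-mate p) (sym q))) (mate-link′ W)

  Ψ-functional : ∀ W {z y y′} → Ψ z y → Ψ z y′ → W ⊢′ y ~ y′
  Ψ-functional W (kept-vertex p) (kept-vertex q) =
    subst (λ y → W ⊢′ inj₁ _ ~ inj₁ y) (vert-injective (trans p (sym q))) ε
  Ψ-functional W (kept-vertex refl) (inner-vertex i _) = contradiction i (vert-kept _ _)
  Ψ-functional W (inner-vertex i _) (kept-vertex refl) = contradiction i (vert-kept _ _)
  Ψ-functional W (inner-vertex i p) (inner-vertex i′ q) with interior-index i (proj₁ i′)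
  ... | refl = same-new-edge W p q
  Ψ-functional W (kept-dart p) (kept-dart q) =
    subst (λ e → W ⊢′ inj₂ _ ~ inj₂ e) (dart-injective (trans p (sym q))) ε
  Ψ-functional W (kept-dart p) (inner-dart d∈ _) = contradiction d∈ (dart-kept _ p)
  Ψ-functional W (inner-dart d∈ _) (kept-dart p) = contradiction d∈ (dart-kept _ p)
  Ψ-functional W (inner-dart d∈ p) (inner-dart d∈′ q) with index-unique d∈ d∈′
  ... | refl = same-new-edge W p q

  -- The invariant speaks of all images of an element at once, because the inside of an atom has
  -- two, the darts of `e_A`, which are linked as mates. Which of them is taken matters only at a
  -- boundary vertex, and boundary vertices are kept.
  Ψ-links : ∀ U W → (∀ y → vert y ∉ U → y ∉ W) → ∀ {z z′ y y′} → (propagate-from : U ⊢ z ~ z′) →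
            Ψ z y → Ψ z′ y′ → W ⊢′ y ~ y′
  Ψ-links U W off {z} {z′} {y} l ψ ψ′ = propagate U P at-mate at-end from-end l (λ y′ ψ″ → Ψ-functional W ψ ψ″) _ ψ′
    where
    P : Element G.n G.m → Set
    P z = ∀ y′ → Ψ z y′ → W ⊢′ y ~ y′
    at-mate : ∀ d → P (inj₂ d) → P (inj₂ (G.mate d))
    at-mate d Pd _ (kept-dart {e = e} p) =
      Pd (inj₂ (G′.mate e)) (kept-dart (trans (dart-mate p) (cong inj₁ (mate-involutive d)))) ◅◅ ⊢-sym′ W (mate-link′ W)
    at-mate d Pd _ (inner-dart {a = a} d∈ p) =
      Pd _ (inner-dart (subst (_∈ Dᴬ a) (mate-involutive d) (Atom.closed (atom a) d∈)) p)
    boundary-dart : ∀ {a x y} → OnBoundary (atom a) x → vert y ≡ x → x ∉ U →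
                    ∃ λ e → ∃ λ s → dart e ≡ inj₂ (a , s) × W ⊢′ inj₂ e ~ inj₁ y
    boundary-dart {a} {x} {y} x∈ eq x∉ =
      let s , p = ∈∂⇒end (Atom.∂ (atom a)) x∈
          y′ , eq′ , q = end-kept {newDart a s} (trans (cong (Graph.ι extended) (dart-newDart a s)) p)
      in newDart a s , s , dart-newDart a s ,
         subst (λ y → W ⊢′ inj₂ (newDart a s) ~ inj₁ y) (vert-injective (trans eq′ (sym eq)))
               (end-link′ W (off y′ (subst (_∉ U) (sym eq′) x∉)) q)
    at-end : ∀ d x → x ∉ U → G.ι d ≡ just x → P (inj₂ d) → P (inj₁ x)
    at-end d x x∉ dx Pd _ (inner-vertex i p) = Pd _ (inner-dart (interior-dart (atom _) i dx) p)
    at-end d x x∉ dx Pd _ (kept-vertex {y = y′} eq) with old-or-in-atom d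
    ... | inj₁ (e , p) =
      let y″ , eq′ , q = end-kept {e} (trans (cong (Graph.ι extended) p) dx)
      in Pd (inj₂ e) (kept-dart p) ◅◅ subst (λ y → W ⊢′ inj₂ e ~ inj₁ y) (vert-injective (trans eq′ (sym eq)))
           (end-link′ W (off y″ (subst (_∉ U) (sym eq′) x∉)) q)
    ... | inj₂ (a , d∈) with interior-or-kept {a} (atom-end (atom a) d∈ dx)
    ...   | inj₁ i = contradiction (subst (Interior (atom a)) (sym eq) i) (vert-kept y′ a)
    ...   | inj₂ b = let e , s , p , l = boundary-dart {a} b eq x∉ in Pd (inj₂ e) (inner-dart d∈ p) ◅◅ l
    from-end : ∀ d x → x ∉ U → G.ι d ≡ just x → P (inj₁ x) → P (inj₂ d)
    from-end d x x∉ dx Px _ (kept-dart {e = e} p) =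
      let y′ , eq , q = end-kept {e} (trans (cong (Graph.ι extended) p) dx)
      in Px (inj₁ y′) (kept-vertex eq) ◅◅ ⊢-sym′ W (end-link′ W (off y′ (subst (_∉ U) (sym eq) x∉)) q)
    from-end d x x∉ dx Px _ (inner-dart {a = a} d∈ p) with interior-or-kept {a} (atom-end (atom a) d∈ dx)
    ... | inj₁ i = Px _ (inner-vertex i p)
    ... | inj₂ b = let y′ , eq = boundary-kept {a} b
                       e , s , q , l = boundary-dart {a} b eq x∉
                   in Px (inj₁ y′) (kept-vertex eq) ◅◅ ⊢-sym′ W l ◅◅ same-new-edge W q p

  Ψ-onto : ∀ y → ∃ λ z → Ψ z y
  Ψ-onto (inj₁ y) = inj₁ (vert y) , kept-vertex refl
  Ψ-onto (inj₂ e) = go (dart e) refl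
    where
    go : ∀ z → dart e ≡ z → ∃ λ z → Ψ z (inj₂ e)
    go (inj₁ d)       eq = inj₂ d , kept-dart eq
    go (inj₂ (a , s)) eq = let d , d∈ = atom-nonempty (atom a) in inj₂ d , inner-dart d∈ eq

  simple′ : IsSimple (graph G′)
  simple′ = record
    { isGraph = G′.isGraph
    ; connected = λ y y′ _ _ → let z , ψ = Ψ-onto y ; z′ , ψ′ = Ψ-onto y′
                                in ⊢-whole′ (Ψ-links none none (λ _ _ → ∉⊥) (all-linked z z′) ψ ψ′)
    ; no-loops = no-loops′
    ; no-half-edges = no-half-edges′
    }

  link-down : ∀ w {z z′ y y′} → ⁅ vert w ⁆ ⊢ z ~ z′ → Ψ z y → Ψ z′ y′ → ⁅ w ⁆ ⊢′ y ~ y′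
  link-down w = Ψ-links ⁅ vert w ⁆ ⁅ w ⁆ λ y y∉ → x∉⁅⁆ λ { refl → y∉ (x∈⁅x⁆ _) }

  module _ (rep : Fin size → Fin G.m) (rep∈ : ∀ a → rep a ∈ Dᴬ a) where

    dartUp : Fin G.m ⊎ Fin size × Side → Fin G.m
    dartUp (inj₁ d)       = d
    dartUp (inj₂ (a , _)) = rep a

    raise : Element G′.n G′.m → Element G.n G.m
    raise (inj₁ y) = inj₁ (vert y)
    raise (inj₂ e) = inj₂ (dartUp (dart e))

    -- A chosen dart of A stands for `e_A`. A kept vertex is not interior to A, so by
    -- `boundary-linked` that dart stays linked to the other ends of `e_A`.
    link-up : ∀ w {y y′} → ⁅ w ⁆ ⊢′ y ~ y′ → ⁅ vert w ⁆ ⊢ raise y ~ raise y′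
    link-up w {y} l = propagate′ ⁅ w ⁆ (λ y′ → W ⊢ raise y ~ raise y′)
        (λ e p → p ◅◅ subst (λ z → W ⊢ inj₂ (dartUp (dart e)) ~ inj₂ (dartUp z)) (mate-preserved e) (at-mate (dart e)))
        (λ e v v∉ ev p → p ◅◅ at-end (dart e) (vert v) (λ q → x∉⁅⁆⁻ v∉ (vert-injective q)) (dart-end ev))
        (λ e v v∉ ev p → p ◅◅ ⊢-sym W (at-end (dart e) (vert v) (λ q → x∉⁅⁆⁻ v∉ (vert-injective q)) (dart-end ev)))
        l ε
      where
      W : Subset G.n
      W = ⁅ vert w ⁆
      at-mate : ∀ z → W ⊢ inj₂ (dartUp z) ~ inj₂ (dartUp (Graph.mate extended z))
      at-mate (inj₁ d)       = mate-link W
      at-mate (inj₂ (a , _)) = ε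
      at-end : ∀ z x → x ≢ vert w → Graph.ι extended z ≡ just x → W ⊢ inj₂ (dartUp z) ~ inj₁ x
      at-end (inj₁ d) x x≢ p = end-link W (x∉⁅⁆ x≢) p
      at-end (inj₂ (a , s)) x x≢ p =
        boundary-linked (atom a) (vert-kept w a) (end⇒∈∂ (Atom.∂ (atom a)) s p) x≢ (rep∈ a)

  -- With this choice an edge `e_A` lies in the image of Q exactly when its representative lies in
  -- Q.
  rep-preferring : ∀ (Q : Subset G.m) → ∃ λ (rep : Fin size → Fin G.m) → (∀ a → rep a ∈ Dᴬ a)
                   × (∀ a {d} → d ∈ Q → d ∈ Dᴬ a → rep a ∈ Q)
  rep-preferring Q = (λ a → proj₁ (pick a)) , (λ a → proj₁ (proj₂ (pick a))) , λ a → proj₂ (proj₂ (pick a))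
    where
    pick : ∀ a → ∃ λ d → d ∈ Dᴬ a × (∀ {e} → e ∈ Q → e ∈ Dᴬ a → d ∈ Q)
    pick a with any? (λ d → (d ∈? Q) ×-dec (d ∈? Dᴬ a))
    ... | yes (d , d∈Q , d∈A) = d , d∈A , λ _ _ → d∈Q
    ... | no ¬meets = let d , d∈ = atom-nonempty (atom a)
                      in d , d∈ , λ e∈Q e∈A → contradiction (_ , e∈Q , e∈A) ¬meets

  -- The image of the central block

  module CentralBlock (Q : Subset G.m) (c≡ : c ≡ block Q) where

    Q! : IsBlock (graph G) Q
    Q! = subst (IsNode (graph G)) c≡ centre

    zᶜ∈Q : ∃ λ q → q ∈ Q × zᶜ ≡ inj₂ q
    zᶜ∈Q = subst (λ c → Rep c zᶜ) c≡ rep-zᶜ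

    apart-from-Q : ∀ {S u d q} → BlockPartFacts S u → d ∈ Sub.darts S → q ∈ Q → ¬ ⁅ u ⁆ ⊢ inj₂ d ~ inj₂ q
    apart-from-Q {u = u} F d∈ q∈ l =
      let p , p∈ , eq = zᶜ∈Q
      in BlockPartFacts.apart F d∈ (subst (λ z → ⁅ u ⁆ ⊢ inj₂ _ ~ z) (sym eq) (l ◅◅ block-≈ Q! q∈ p∈ u))

    -- A block atom contains no dart of the centre at all. For a proper atom, Q has a vertex x that
    -- is not inner. If a dart of Q at x lies in the atom, x is on the boundary; as the inside of
    -- the atom hangs together off x, Q is then the block of the 2-cut, which has darts outside.
    Q-dart-outside : ∀ {a w} → Interior (atom a) w → ∃ λ q → q ∈ Q × q ∉ Dᴬ a
    Q-dart-outside {a} {w} (w∈ , w∉) = go (atom-facts (atom a)) w∈ w∉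
      where
      S = Atom.S (atom a)
      go : ∀ {b} → PartView S b → w ∈ Sub.verts S → ¬ _∈∂_ (graph G) w b → ∃ λ q → q ∈ Q × q ∉ Dᴬ a
      go (blockPart F _) _ _ = let q , q∈ = block-nonempty Q! in q , q∈ , λ q∈D → apart-from-Q F q∈D q∈ ε
      go (dipolePart dip) w∈ w∉ = contradiction (x∈pair⁻ (subst (w ∈_) (IsDipole.vertices dip) w∈)) w∉
      go (properPart {u} {v} F no-centre) _ _ with any? (λ x → (x ∈? ends (graph G) Q) ×-dec ¬? (x ∈? ProperPartFacts.inner F))
      ... | no ¬ex = contradiction (inj₁ (Q , c≡ , λ {x} x∈ → decidable-stable (x ∈? _) λ x∉ → ¬ex (x , x∈ , x∉)))
                       (no-centre (sub (ProperPartFacts.inner F) (Dᴬ a)) id)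
      ... | yes (x , x∈ , x∉) = let q , q∈ , qx = ∈ends⁻ (graph G) Q x∈ in by q q∈ qx (q ∈? Dᴬ a)
        where
        module F = ProperPart₂ F
        β   = proj₁ F.B-dart-in
        β∈B = proj₁ (proj₂ F.B-dart-in)
        β∈D = proj₂ (proj₂ F.B-dart-in)
        same : ∀ {q x} → q ∈ Q → q ∈ Dᴬ a → x ∈ ends (graph G) Q → x ∈ ends (graph G) F.B → x ∉ F.inner → Q ≡ F.B
        same {q} {x} q∈ q∈D x∈Q x∈B x∉ = blocks-at Q! F.isBlock x∈Q x∈B q∈ β∈B
          (F.linked-off {⁅ x ⁆} {inj₂ q} {inj₂ β} (λ y∈ → subst (_∉ F.inner) (sym (x∈⁅y⁆⇒x≡y x y∈)) x∉) q∈D β∈D)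
        out : Q ≡ F.B → ∃ λ q → q ∈ Q × q ∉ Dᴬ a
        out refl = F.B-dart-out
        by : ∀ q → q ∈ Q → G.ι q ≡ just x → Dec (q ∈ Dᴬ a) → ∃ λ q → q ∈ Q × q ∉ Dᴬ a
        by q q∈ qx (no q∉) = q , q∈ , q∉
        by q q∈ qx (yes q∈D) with F.inside-or-boundary q∈D qx
        ... | inj₁ x∈K = contradiction x∈K x∉
        ... | inj₂ (inj₁ refl) = out (same q∈ q∈D x∈ F.u∈B x∉)
        ... | inj₂ (inj₂ refl) = out (same q∈ q∈D x∈ F.v∈B x∉)

    MeetsQ : Fin size → Set
    MeetsQ a = ∃ λ e → e ∈ Q × e ∈ Dᴬ a

    meetsQ? : ∀ a → Dec (MeetsQ a)
    meetsQ? a = any? (λ e → (e ∈? Q) ×-dec (e ∈? Dᴬ a))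

    kept-not-inner : ∀ {a u v} (F : ProperPartFacts (Atom.S (atom a)) u v) y → vert y ∉ ProperPartFacts.inner F
    kept-not-inner {a} F y y∈ = vert-kept y a
      (ProperPartFacts.verts⁺ F (inj₁ y∈) , avoid (atom-facts (atom a)))
      where
      avoid : ∀ {b} → PartView (Atom.S (atom a)) b → ¬ _∈∂_ (graph G) (vert y) b
      avoid (blockPart F′ _) _ = block≢proper F′ F
      avoid (properPart F′ none′) y∈∂ =
        let _ , e , e∉ , ey = proper-boundary F′ y∈∂ in e∉ (ProperPart₂.around F y∈ ey)
      avoid (dipolePart dip) _ = dipole≢proper dip F

    module _ {d q} (q∈ : q ∈ Q) (links : ∀ w → ⁅ vert w ⁆ ⊢ inj₂ d ~ inj₂ q) where

      private
        module _ {a} (d∈ : d ∈ Dᴬ a) (¬meets : ¬ MeetsQ a)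
                 {u v} (F : ProperPartFacts (Atom.S (atom a)) u v) where

          module F = ProperPart₂ F

          -- A kept vertex is not inner to the atom, so β reaches d inside it and then q. For a
          -- vertex interior to an atom b, everything outside b is linked to Q; if β itself is
          -- inside b, then b is a, and the block of the 2-cut leads from β to ρ outside.
          not-separated : ∀ {β ρ v} → β ∈ F.B → β ∈ Dᴬ a → ρ ∈ F.B → ρ ∉ Dᴬ a →
            (∃ λ y → vert y ≡ v) ⊎ (∃ λ b → Interior (atom b) v) → ⁅ v ⁆ ⊢ inj₂ β ~ inj₂ q
          not-separated {β} β∈B β∈D _ _ (inj₁ (y , refl)) = F.linked-off {⁅ vert y ⁆} {inj₂ β} {inj₂ d}
            (λ x∈ x∈K → kept-not-inner F y (subst (_∈ F.inner) (x∈⁅y⁆⇒x≡y (vert y) x∈) x∈K)) β∈D d∈ ◅◅ links y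
          not-separated {β} {ρ} {v} β∈B β∈D ρ∈B ρ∉D (inj₂ (b , j)) = go (Q-dart-outside j) (β ∈? Dᴬ b)
            where
            via : ∀ {q₁} → β ∈ Dᴬ b → a ≡ b → q₁ ∈ Q → q₁ ∉ Dᴬ b → ⁅ v ⁆ ⊢ inj₂ β ~ inj₂ q
            via β∈b refl q₁∈ q₁∉ = block-≈ F.isBlock β∈B ρ∈B v ◅◅ outside-linked (atom a) j ρ∉D q₁∉ ◅◅ block-≈ Q! q₁∈ q∈ v
            go : (∃ λ q → q ∈ Q × q ∉ Dᴬ b) → Dec (β ∈ Dᴬ b) → ⁅ v ⁆ ⊢ inj₂ β ~ inj₂ q
            go (q₁ , q₁∈ , q₁∉) (no β∉) = outside-linked (atom b) j β∉ q₁∉ ◅◅ block-≈ Q! q₁∈ q∈ v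
            go (q₁ , q₁∈ , q₁∉) (yes β∈b) = via β∈b (index-unique β∈D β∈b) q₁∈ q₁∉

          proper-meets : ⊥
          proper-meets = go F.B-dart-in F.B-dart-out
            where
            go : (∃ λ d → d ∈ F.B × d ∈ Dᴬ a) → (∃ λ d → d ∈ F.B × d ∉ Dᴬ a) → ⊥
            go (β , β∈B , β∈D) (ρ , ρ∈B , ρ∉D) = ¬meets (β , ≈-block Q! q∈ (≈ᵇ-sym λ v →
              not-separated β∈B β∈D ρ∈B ρ∉D (kept-or-interior v)) , β∈D)

        -- The boundary vertex of a block atom is kept and cuts the atom off from Q, against
        -- `links`. A dipole has no interior vertex, and for a proper atom the block of its 2-cut
        -- turns out to be Q.
        inside-atom : ∀ {a w} → Interior (atom a) w → d ∈ Dᴬ a → ¬ MeetsQ a → ⊥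
        inside-atom {a} {w} i d∈ ¬meets = go (atom-facts (atom a)) (λ {x} → boundary-kept {a} {x}) (proj₂ i)
          where
          go : ∀ {b} → PartView (Atom.S (atom a)) b → (∀ {x} → _∈∂_ (graph G) x b → ∃ λ y → vert y ≡ x) →
               ¬ _∈∂_ (graph G) w b → ⊥
          go (blockPart {u} F _) kept _ = by (kept {u} refl)
            where
            by : (∃ λ y → vert y ≡ u) → ⊥
            by (y , refl) = apart-from-Q F d∈ q∈ (links y)
          go (dipolePart dip) _ w∉ = w∉ (x∈pair⁻ (subst (w ∈_) (IsDipole.vertices dip) (proj₁ i)))
          go (properPart F _) _ _ = proper-meets d∈ ¬meets F

        not-through : ∀ {w} → (∃ λ a → d ∈ Dᴬ a × MeetsQ a) ⊎ ⁅ w ⁆ ⊢ inj₂ d ~ inj₂ q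
        not-through {w} = start (kept-or-interior w)
          where
          in-atom : ∀ {a} → Interior (atom a) w → Dec (d ∈ Dᴬ a) → Dec (MeetsQ a) → (∃ λ q → q ∈ Q × q ∉ Dᴬ a) →
                    (∃ λ a → d ∈ Dᴬ a × MeetsQ a) ⊎ ⁅ w ⁆ ⊢ inj₂ d ~ inj₂ q
          in-atom {a} i (no d∉) _ (q₀ , q₀∈ , q₀∉) = inj₂ (outside-linked (atom a) i d∉ q₀∉ ◅◅ block-≈ Q! q₀∈ q∈ w)
          in-atom {a} i (yes d∈) (yes meets) _ = inj₁ (a , d∈ , meets)
          in-atom {a} i (yes d∈) (no ¬meets) _ = contradiction (inside-atom i d∈ ¬meets) id
          start : (∃ λ y → vert y ≡ w) ⊎ (∃ λ b → Interior (atom b) w) → _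
          start (inj₁ (y , refl)) = inj₂ (links y)
          start (inj₂ (a , i)) = in-atom i (d ∈? Dᴬ a) (meetsQ? a) (Q-dart-outside i)

      -- Some vertex separates d from Q. It is not a kept one, so it is interior to an atom, and off
      -- it everything outside that atom is linked to Q. Thus d lies in the atom, which meets Q by
      -- `inside-atom`.
      kept-separator : d ∉ Q → ∃ λ a → d ∈ Dᴬ a × MeetsQ a
      kept-separator d∉ = go (separator (λ d≈q → d∉ (≈-block Q! q∈ (≈ᵇ-sym d≈q))))
        where
        go : (∃ λ w → ¬ ⁅ w ⁆ ⊢ inj₂ d ~ inj₂ q) → ∃ λ a → d ∈ Dᴬ a × MeetsQ a
        go (w , ¬l) = Sum.[ id , (λ l → contradiction l ¬l) ] (not-through {w})

    module _ {Q′ : Subset G′.m} (Q′-spec : ∀ e → e ∈ Q′ ⇔ InImage Q (dart e)) where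

      private
        module B′ = Blocks (graph G′) simple′
        rep  = proj₁ (rep-preferring Q)
        rep∈ = proj₁ (proj₂ (rep-preferring Q))
        rep-Q : ∀ a {d} → d ∈ Q → d ∈ Dᴬ a → rep a ∈ Q
        rep-Q = proj₂ (proj₂ (rep-preferring Q))

        up-Q : ∀ z → InImage Q z → dartUp rep rep∈ z ∈ Q
        up-Q (inj₁ d) d∈ = d∈
        up-Q (inj₂ (a , _)) (d , d∈Q , d∈A) = rep-Q a d∈Q d∈A

        Q-up : ∀ z → dartUp rep rep∈ z ∈ Q → InImage Q z
        Q-up (inj₁ d) d∈ = d∈
        Q-up (inj₂ (a , _)) d∈ = rep a , d∈ , rep∈ a

        up-Ψ : ∀ {e} z → dart e ≡ z → Ψ (inj₂ (dartUp rep rep∈ z)) (inj₂ e)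
        up-Ψ (inj₁ d) eq = kept-dart eq
        up-Ψ (inj₂ (a , s)) eq = inner-dart (rep∈ a) eq

        in-Q : ∀ {e} → e ∈ Q′ → dartUp rep rep∈ (dart e) ∈ Q
        in-Q {e} e∈ = up-Q (dart e) (Equivalence.to (Q′-spec e) e∈)

      -- The danger is that blocks merge when interior vertices disappear. By `kept-separator` a
      -- dart outside Q can join it only from inside an atom that meets Q, and then `e_A` belongs to
      -- the image of Q by definition.
      image-block′ : IsBlock (graph G′) Q′
      image-block′ = B′.class⇒block class nonempty
        where
        class : B′.IsClass Q′
        class {e} {f} e∈ = (λ f∈ w → link-down w (block-≈ Q! (in-Q e∈) (in-Q f∈) (vert w)) (up-Ψ (dart e) refl) (up-Ψ (dart f) refl)) ,
          λ e≈f → decidable-stable (f ∈? Q′) λ f∉ → absurd f f∉ (dart f) refl λ w → link-up rep rep∈ w (B′.⊢-sym ⁅ w ⁆ (e≈f w))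
          where
          absurd : ∀ f → f ∉ Q′ → ∀ z → dart f ≡ z →
            (∀ w → ⁅ vert w ⁆ ⊢ inj₂ (dartUp rep rep∈ (dart f)) ~ inj₂ (dartUp rep rep∈ (dart e))) → ⊥
          absurd f f∉ z eq links = by z eq (kept-separator (in-Q e∈) links
              (λ q∈ → f∉ (Equivalence.from (Q′-spec f) (Q-up (dart f) q∈))))
            where
            by : ∀ z → dart f ≡ z → (∃ λ a → dartUp rep rep∈ (dart f) ∈ Dᴬ a × MeetsQ a) → ⊥
            by (inj₁ d) eq (a , d∈ , _) = dart-kept a eq (subst (λ z → dartUp rep rep∈ z ∈ Dᴬ a) eq d∈)
            by (inj₂ (b , s)) eq (a , d∈ , q , q∈ , q∈A) = f∉ (Equivalence.from (Q′-spec f) (subst (InImage Q) (sym eq)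
              (q , q∈ , subst (λ a → q ∈ Dᴬ a) (index-unique (subst (λ z → dartUp rep rep∈ z ∈ Dᴬ a) eq d∈) (rep∈ b)) q∈A)))
        nonempty : Nonempty Q′
        nonempty = go (block-nonempty Q!)
          where
          from : ∀ {q} → q ∈ Q → (∃ λ e → dart e ≡ inj₁ q) ⊎ (∃ λ a → q ∈ Dᴬ a) → Nonempty Q′
          from q∈ (inj₁ (e , eq)) = e , Equivalence.from (Q′-spec e) (subst (InImage Q) (sym eq) q∈)
          from {q} q∈ (inj₂ (a , q∈A)) = newDart a near ,
            Equivalence.from (Q′-spec _) (subst (InImage Q) (sym (dart-newDart a near)) (q , q∈ , q∈A))
          go : Nonempty Q → Nonempty Q′
          go (q , q∈) = from q∈ (old-or-in-atom q)

-- Lifting automorphisms of the reduced graph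

injective⇒bijective : ∀ {k} (f : Fin k → Fin k) → Injective _≡_ _≡_ f → Fin k ↔ Fin k
injective⇒bijective {k} f inj = mk↔ₛ′ f (proj₁ ∘ preimage) (proj₂ ∘ preimage) λ x → inj (proj₂ (preimage (f x)))
  where
  onto : ∀ {k} (f : Fin k → Fin k) → Injective _≡_ _≡_ f → ∀ y → ∃ λ x → f x ≡ y
  onto {suc k} f inj y = decidable-stable (any? λ x → f x ≟ y) λ ¬hit →
    let miss = λ x (p : y ≡ f x) → ¬hit (x , sym p)
    in ℕ.1+n≰n (injective⇒≤ {f = λ x → punchOut (miss x)}
         λ {x} {x′} p → inj (punchOut-injective (miss x) (miss x′) p))
  preimage : ∀ y → ∃ λ x → f x ≡ y
  preimage = onto f inj

injection⇒automorphism : ∀ {n m} {G : Graph (Fin n) (Fin m)} (f : Fin n → Fin n) (g : Fin m → Fin m) →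
  Injective _≡_ _≡_ f → Injective _≡_ _≡_ g → Preserves G G f g → Aut G
injection⇒automorphism f g f-inj g-inj preserves = record
  { vertices = injective⇒bijective f f-inj ; darts = injective⇒bijective g g-inj ; preserves = preserves }

compose : ∀ {V D V′ D′ V″ D″ : Set} {G : Graph V D} {H : Graph V′ D′} {K : Graph V″ D″} → G ≅ H → H ≅ K → G ≅ K
compose {G = G} f g = record
  { vertices = g.vertices ↔-∘ f.vertices ; darts = g.darts ↔-∘ f.darts
  ; preserves = record
    { ι-preserved = λ d → trans (g.ι-preserved (f.dart d)) (trans (cong (Maybe.map g.vert) (f.ι-preserved d))
                            (sym (Maybe.map-∘ (Graph.ι G d))))
    ; mate-preserved = λ d → trans (g.mate-preserved (f.dart d)) (cong g.dart (f.mate-preserved d))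
    ; colour-preserved = λ d → trans (g.colour-preserved (f.dart d)) (f.colour-preserved d)
    ; label-preserved = λ d → trans (g.label-preserved (f.dart d)) (f.label-preserved d)
    } }
  where
  module f = _≅_ f
  module g = _≅_ g

-- Double negation commutes with finite products. This makes it possible to assume lifts for all
-- atoms at once when the goal is a contradiction.
¬¬-finite-choice : ∀ {k} {P : Fin k → Set} → (∀ i → ¬ ¬ P i) → ¬ ¬ (∀ i → P i)
¬¬-finite-choice {zero}  ps ¬all = ¬all λ ()
¬¬-finite-choice {suc k} ps ¬all = ps zero λ p₀ → ¬¬-finite-choice (ps ∘ suc) λ p →
  ¬all λ { zero → p₀ ; (suc i) → p i }

module _ {n m : ℕ} {G : Graph (Fin n) (Fin m)} {c : Node G} where

  atom-ι : ∀ (A : Atom G c) → (∀ {d x} → d ∈ Sub.darts (Atom.S A) → Graph.ι G d ≡ just x → x ∈ Sub.verts (Atom.S A)) →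
           ∀ δ → Maybe.map proj₁ (Graph.ι ⟦ A ⟧ δ) ≡ Graph.ι G (proj₁ δ)
  atom-ι A into (d , d∈) with Graph.ι G d in eq
  ... | nothing = refl
  ... | just x with x ∈? Sub.verts (Atom.S A)
  ...   | yes _ = refl
  ...   | no x∉ = contradiction (into d∈ eq) x∉

  map-proj₁-injective : ∀ {p : Subset n} {x y : Maybe (∃ λ v → v ∈ p)} → Maybe.map proj₁ x ≡ Maybe.map proj₁ y → x ≡ y
  map-proj₁-injective {x = nothing} {nothing} _ = refl
  map-proj₁-injective {x = just x} {just y} eq = cong just (element-≡ (Maybe.just-injective eq))

  exchanges-pair : ∀ (A : Atom G c) {u v} τ → Atom.∂ A ≡ pair u v → Exchanges A τ →
      (∀ x → proj₁ x ≡ u → proj₁ (_≅_.vert τ x) ≡ v) × (∀ x → proj₁ x ≡ v → proj₁ (_≅_.vert τ x) ≡ u)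
  exchanges-pair record { ∂ = pair u v } τ refl ex = ex

  pair-exchanges : ∀ (A : Atom G c) {u v} τ → Atom.∂ A ≡ pair u v →
      (∀ x → proj₁ x ≡ u → proj₁ (_≅_.vert τ x) ≡ v) → (∀ x → proj₁ x ≡ v → proj₁ (_≅_.vert τ x) ≡ u) → Exchanges A τ
  pair-exchanges record { ∂ = pair u v } τ refl p q = p , q

  type-pair : ∀ (A : Atom G c) {u v} l → Atom.∂ A ≡ pair u v → HasTypeOf A l →
      (Halvable A → l ≡ halvable) × (Symmetric A → l ≡ undirected) × (Asymmetric A → IsDirected {c = c} l)
  type-pair record { ∂ = pair u v } l refl t = t

module Lifting {G G′ : FinGraph} {c : Node (graph G)} {c′ : Node (graph G′)} (R : Reduction G c G′ c′)
               (simple : IsSimple (graph G)) (centre : IsNode (graph G) c) where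

  open Reduced R simple centre public

  ι-inside : ∀ a δ → Maybe.map proj₁ (Graph.ι ⟦ atom a ⟧ δ) ≡ G.ι (proj₁ δ)
  ι-inside a = atom-ι (atom a) (atom-end (atom a))

  newLabel-opposite : ∀ a s → newLabel a (opposite s) ≡ reverse (newLabel a s)
  newLabel-opposite a s =
    trans (cong (Graph.label extended) (sym (dart-mate (dart-newDart a s))))
      (trans (label-preserved (G′.mate (newDart a s)))
        (trans (IsGraph.label-mate G′.isGraph (newDart a s))
          (cong reverse (trans (sym (label-preserved (newDart a s))) (cong (Graph.label extended) (dart-newDart a s))))))

  not-directed : ∀ {l} → l ≡ reverse l → ¬ IsDirected {c = c} l
  not-directed () outgoing
  not-directed () incoming

  infixl 6 _⊙_
  -- Composition in the group of order two: the bijection of sides that sends `near` to s sends t to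
  -- `s ⊙ t`.
  _⊙_ : Side → Side → Side
  s ⊙ near = s
  s ⊙ far  = opposite s

  module _ (α′ : Aut (graph G′)) where

    private module α′ = Iso α′

    Compatible : ∀ {a b} → ⟦ atom a ⟧ ≅ ⟦ atom b ⟧ → Side → Set
    Compatible {a} {b} f s = ∀ t x → end (Atom.∂ (atom a)) t ≡ just (proj₁ x) →
      end (Atom.∂ (atom b)) (s ⊙ t) ≡ just (proj₁ (_≅_.vert f x))

    -- A ∂-isomorphism alone is not enough: it has to move the boundary vertices as α′ moves the
    -- ends of `e_A`, or the pieces would not fit together at the boundary.
    record LiftAt (a : Fin size) : Set where
      field
        target     : Fin size
        side       : Side
        image-dart : dart (α′.dart (newDart a near)) ≡ inj₂ (target , side)
        iso        : ∂-Isomorphism (atom a) (atom target)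
        compatible : Compatible (∂-Isomorphism.iso iso) side

    module _ {a b : Fin size} (s : Side) (eq : dart (α′.dart (newDart a near)) ≡ inj₂ (b , s))
             (f : ∂-Isomorphism (atom a) (atom b)) where

      private
        module f = ∂-Isomorphism f
        module I = Iso f.iso
        A = atom a
        B = atom b

      image-boundary : ∀ {x} → OnBoundary A (proj₁ x) → OnBoundary B (proj₁ (f.vert x))
      image-boundary {x} = Equivalence.to (f.∂-onto x)

      near-image : end (Atom.∂ B) s ≡ nothing → end (Atom.∂ A) near ≡ nothing
      near-image none-at with G′.ι (newDart a near) | dart-ι | α′-ι
        where
        dart-ι : end (Atom.∂ A) near ≡ Maybe.map vert (G′.ι (newDart a near))
        dart-ι = trans (cong (Graph.ι extended) (sym (dart-newDart a near))) (ι-preserved (newDart a near))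
        α′-ι : end (Atom.∂ B) s ≡ Maybe.map vert (Maybe.map α′.vert (G′.ι (newDart a near)))
        α′-ι = trans (cong (Graph.ι extended) (sym eq)) (trans (ι-preserved _) (cong (Maybe.map vert) (α′.ι-preserved _)))
      ... | nothing | p | q = p
      ... | just y  | p | q = case trans (sym none-at) q of λ ()

      labels-agree : newLabel b s ≡ newLabel a near
      labels-agree = trans (cong (Graph.label extended) (sym eq)) (trans (label-preserved _)
        (trans (α′.label-preserved (newDart a near)) (trans (sym (label-preserved (newDart a near)))
          (cong (Graph.label extended) (dart-newDart a near)))))

      lift-with : Compatible f.iso s → LiftAt a
      lift-with compat = record { target = b ; side = s ; image-dart = eq ; iso = f ; compatible = compat }

      module _ {u v u′ v′} (A-pair : Atom.∂ A ≡ pair u v) (B-pair : Atom.∂ B ≡ pair u′ v′) where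

        private
          ends-A : ∀ t → end (Atom.∂ A) t ≡ end (pair u v) t
          ends-A t = cong (λ b → end b t) A-pair
          ends-B : ∀ t → end (Atom.∂ B) t ≡ end (pair u′ v′) t
          ends-B t = cong (λ b → end b t) B-pair
          u∈ : OnBoundary A u
          u∈ = subst (_∈∂_ (graph G) u) (sym A-pair) (inj₁ refl)
          v∈ : OnBoundary A v
          v∈ = subst (_∈∂_ (graph G) v) (sym A-pair) (inj₂ refl)
          û : VertexOf A
          û = u , boundary∈ A u∈
          v̂ : VertexOf A
          v̂ = v , boundary∈ A v∈
          fu∈ : proj₁ (f.vert û) ≡ u′ ⊎ proj₁ (f.vert û) ≡ v′
          fu∈ = subst (_∈∂_ (graph G) _) B-pair (image-boundary u∈)
          fv∈ : proj₁ (f.vert v̂) ≡ u′ ⊎ proj₁ (f.vert v̂) ≡ v′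
          fv∈ = subst (_∈∂_ (graph G) _) B-pair (image-boundary v∈)
          fu≢fv : proj₁ (f.vert û) ≢ proj₁ (f.vert v̂)
          fu≢fv p = boundary-distinct A A-pair (cong proj₁ (I.vert-injective {û} {v̂} (element-≡ p)))

        pair-side : ∃ λ t → Compatible f.iso t
        pair-side = go fu∈ fv∈
          where
          at : ∀ t → end (Atom.∂ B) t ≡ just (proj₁ (f.vert û)) → end (Atom.∂ B) (opposite t) ≡ just (proj₁ (f.vert v̂)) →
               Compatible f.iso t
          at t p q near x e = trans p (cong (just ∘ proj₁ ∘ f.vert)
            (element-≡ {x = û} {x} (Maybe.just-injective (trans (sym (ends-A near)) e))))
          at t p q far x e = trans q (cong (just ∘ proj₁ ∘ f.vert)
            (element-≡ {x = v̂} {x} (Maybe.just-injective (trans (sym (ends-A far)) e))))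
          go : proj₁ (f.vert û) ≡ u′ ⊎ proj₁ (f.vert û) ≡ v′ → proj₁ (f.vert v̂) ≡ u′ ⊎ proj₁ (f.vert v̂) ≡ v′ →
               ∃ λ t → Compatible f.iso t
          go (inj₁ p) (inj₁ q) = contradiction (trans p (sym q)) fu≢fv
          go (inj₂ p) (inj₂ q) = contradiction (trans p (sym q)) fu≢fv
          go (inj₁ p) (inj₂ q) = near , at near (trans (ends-B near) (cong just (sym p))) (trans (ends-B far) (cong just (sym q)))
          go (inj₂ p) (inj₁ q) = far , at far (trans (ends-B far) (cong just (sym p))) (trans (ends-B near) (cong just (sym q)))

        module _ {τ : Aut ⟦ B ⟧} (exchanges : Exchanges B τ) where

          private
            module τ = Iso τ
            u→v = proj₁ (exchanges-pair B τ B-pair exchanges)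
            v→u = proj₂ (exchanges-pair B τ B-pair exchanges)
            û′ : VertexOf B
            û′ = u′ , boundary∈ B (subst (_∈∂_ (graph G) u′) (sym B-pair) (inj₁ refl))
            v̂′ : VertexOf B
            v̂′ = v′ , boundary∈ B (subst (_∈∂_ (graph G) v′) (sym B-pair) (inj₂ refl))
            τ-∂ : ∀ y → OnBoundary B (proj₁ y) ⇔ OnBoundary B (proj₁ (τ.vert y))
            τ-∂ y = mk⇔
              (λ p → to-B (Sum.swap (Sum.map (u→v y) (v→u y) (from-B p))))
              (λ p → to-B (Sum.map
                 (λ q → cong proj₁ (τ.vert-injective {y} {û′} (element-≡ (trans q (sym (u→v û′ refl))))))
                 (λ q → cong proj₁ (τ.vert-injective {y} {v̂′} (element-≡ (trans q (sym (v→u v̂′ refl))))))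
                 (Sum.swap (from-B p))))
              where
              from-B : ∀ {x} → OnBoundary B x → x ≡ u′ ⊎ x ≡ v′
              from-B = subst (_∈∂_ (graph G) _) B-pair
              to-B : ∀ {x} → x ≡ u′ ⊎ x ≡ v′ → OnBoundary B x
              to-B = subst (_∈∂_ (graph G) _) (sym B-pair)

          exchanged : ∂-Isomorphism A B
          exchanged = record
            { iso = compose f.iso τ
            ; ∂-onto = λ x → mk⇔ (λ p → Equivalence.to (τ-∂ (f.vert x)) (Equivalence.to (f.∂-onto x) p))
                                  (λ p → Equivalence.from (f.∂-onto x) (Equivalence.from (τ-∂ (f.vert x)) p)) }

          exchanged-compatible : ∀ {t} → Compatible f.iso t → Compatible (compose f.iso τ) (opposite t)
          exchanged-compatible {t} compat r x e = swapped (t ⊙ r) (opposite t ⊙ r) (opp t r) (compat r x e)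
            where
            opp : ∀ t r → opposite t ⊙ r ≡ opposite (t ⊙ r)
            opp t near = refl
            opp t far  = refl
            swapped : ∀ s s′ → s′ ≡ opposite s → end (Atom.∂ B) s ≡ just (proj₁ (f.vert x)) →
                      end (Atom.∂ B) s′ ≡ just (proj₁ (τ.vert (f.vert x)))
            swapped near _ refl p = trans (ends-B far) (cong just (sym (u→v (f.vert x)
              (sym (Maybe.just-injective (trans (sym (ends-B near)) p))))))
            swapped far _ refl p = trans (ends-B near) (cong just (sym (v→u (f.vert x)
              (sym (Maybe.just-injective (trans (sym (ends-B far)) p))))))

        -- The isomorphism f may match the ends in the wrong order. If the target is exchangeable,
        -- an exchange corrects this. If not, the new edge is directed; but `oriented` and the
        -- labels preserved by α′ give both its darts the same label, which no directed edge has.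
        -- The double negation replaces the decision between the two cases.
        lift-pair : ¬ ¬ LiftAt a
        lift-pair ¬lift = go pair-side
          where
          go : (∃ λ t → Compatible f.iso t) → ⊥
          go (t , compat) = by (same-or-opposite s t)
            where
            by : s ≡ t ⊎ opposite s ≡ t → ⊥
            by (inj₁ refl) = ¬lift (lift-with compat)
            by (inj₂ refl) = not-directed self-reverse (proj₂ (proj₂ (type-pair B _ B-pair (types b))) asymmetric)
              where
              other : newLabel b (opposite s) ≡ newLabel b s
              other = trans (sym (oriented a b f near (opposite s) û (ends-A near) (compat near û (ends-A near))))
                            (sym labels-agree)
              self-reverse : newLabel b near ≡ reverse (newLabel b near)
              self-reverse = trans (all-same s other) (newLabel-opposite b near)
                where
                all-same : ∀ s → newLabel b (opposite s) ≡ newLabel b s → newLabel b near ≡ newLabel b (opposite near)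
                all-same near p = sym p
                all-same far  p = p
              asymmetric : Asymmetric B
              asymmetric (τ , ex) = ¬lift (record
                { target = b ; side = s ; image-dart = eq ; iso = exchanged ex
                ; compatible = subst (Compatible (compose f.iso τ)) (opposite-involutive s) (exchanged-compatible ex compat) })

      -- A ∂-isomorphism matches the boundaries bijectively, which excludes a single vertex against
      -- a pair. For two block atoms the missing end of the far dart determines the side.
      lift-any : ¬ ¬ LiftAt a
      lift-any = go (Atom.∂ A) (Atom.∂ B) refl refl
        where
        go : ∀ ∂A ∂B → Atom.∂ A ≡ ∂A → Atom.∂ B ≡ ∂B → ¬ ¬ LiftAt a
        go (pair u v) (pair u′ v′) p q = lift-pair p q
        go (single u) (single u′) p q ¬lift = ¬lift (lift-with (compat s side-near))
          where
          side-near : s ≡ near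
          side-near = at s refl
            where
            at : ∀ t → s ≡ t → s ≡ near
            at near e = e
            at far e = case trans (sym (near-image (trans (cong₂ end q e) refl))) (cong (λ b → end b near) p) of λ ()
          compat : ∀ s → s ≡ near → Compatible f.iso s
          compat _ refl near x e = trans (cong (λ b → end b near) q) (cong just (sym
            (subst (_∈∂_ (graph G) _) q (image-boundary {x} (end⇒∈∂ (Atom.∂ A) near e)))))
          compat _ refl far x e = case trans (sym e) (cong (λ b → end b far) p) of λ ()
        go (single u) (pair u′ v′) p q _ = boundary-distinct B q
            (trans (sym (vertex≡ (inj₁ refl))) (trans (cong (proj₁ ∘ f.vert) same) (vertex≡ (inj₂ refl))))
          where
          pre : ∀ {y} → y ≡ u′ ⊎ y ≡ v′ → VertexOf A
          pre {y} y∈ = I.vert⁻ (y , boundary∈ B (subst (_∈∂_ (graph G) y) (sym q) y∈))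
          vertex≡ : ∀ {y} (y∈ : y ≡ u′ ⊎ y ≡ v′) → proj₁ (f.vert (pre y∈)) ≡ y
          vertex≡ y∈ = cong proj₁ (I.vert-vert⁻ _)
          is-u : ∀ {y} (y∈ : y ≡ u′ ⊎ y ≡ v′) → proj₁ (pre y∈) ≡ u
          is-u {y} y∈ = subst (_∈∂_ (graph G) _) p (Equivalence.from (f.∂-onto (pre y∈))
            (subst (OnBoundary B) (sym (vertex≡ y∈)) (subst (_∈∂_ (graph G) y) (sym q) y∈)))
          same : pre (inj₁ refl) ≡ pre (inj₂ refl)
          same = element-≡ (trans (is-u (inj₁ refl)) (sym (is-u (inj₂ refl))))
        go (pair u v) (single u′) p q _ = boundary-distinct A p (cong proj₁ (I.vert-injective {û} {v̂}
            (element-≡ (trans (is-u′ û u∈) (sym (is-u′ v̂ v∈))))))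
          where
          u∈ : OnBoundary A u
          u∈ = subst (_∈∂_ (graph G) u) (sym p) (inj₁ refl)
          v∈ : OnBoundary A v
          v∈ = subst (_∈∂_ (graph G) v) (sym p) (inj₂ refl)
          û v̂ : VertexOf A
          û = u , boundary∈ A u∈
          v̂ = v , boundary∈ A v∈
          is-u′ : ∀ x → OnBoundary A (proj₁ x) → proj₁ (f.vert x) ≡ u′
          is-u′ x x∈ = subst (_∈∂_ (graph G) _) q (image-boundary {x} x∈)

    -- New colours are fresh, so the image of `e_A` is again a new edge, and equal colours mean
    -- ∂-isomorphic atoms.
    lift-at : ∀ a → ¬ ¬ LiftAt a
    lift-at a = go (dart (α′.dart (newDart a near))) refl
      where
      colour≡ : Graph.colour extended (dart (α′.dart (newDart a near))) ≡ newColour a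
      colour≡ = trans (colour-preserved _) (trans (α′.colour-preserved (newDart a near))
        (trans (sym (colour-preserved (newDart a near))) (cong (Graph.colour extended) (dart-newDart a near))))
      go : ∀ z → dart (α′.dart (newDart a near)) ≡ z → ¬ ¬ LiftAt a
      go (inj₁ d) eq _ = fresh a d (trans (sym colour≡) (cong (Graph.colour extended) eq))
      go (inj₂ (b , s)) eq = lift-any s eq (Equivalence.to (classes a b)
        (trans (sym colour≡) (cong (Graph.colour extended) eq)))

module LiftedAutomorphism {G G′ : FinGraph} {c : Node (graph G)} {c′ : Node (graph G′)} (R : Reduction G c G′ c′)
  (simple : IsSimple (graph G)) (centre : IsNode (graph G) c)
  (α′ : Aut (graph G′)) (lift : ∀ a → Lifting.LiftAt R simple centre α′ a) where

  open Lifting R simple centre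

  private
    module α′ = Iso α′
    module L a = LiftAt (lift a)
    module f a = ∂-Isomorphism (L.iso a)
    module I a = Iso (f.iso a)

  lift-dart : ∀ a t → dart (α′.dart (newDart a t)) ≡ inj₂ (L.target a , L.side a ⊙ t)
  lift-dart a near = L.image-dart a
  lift-dart a far = trans (cong (dart ∘ α′.dart) (dart-injective (trans (dart-newDart a far) (sym (dart-mate (dart-newDart a near))))))
    (trans (cong dart (sym (α′.mate-preserved (newDart a near)))) (dart-mate (L.image-dart a)))

  target-injective : ∀ {a b} → L.target a ≡ L.target b → a ≡ b
  target-injective {a} {b} eq = by (same-or-opposite (L.side a) (L.side b))
    where
    conclude : ∀ {s t} → dart (α′.dart (newDart a s)) ≡ dart (α′.dart (newDart b t)) → a ≡ b
    conclude {s} {t} p = cong proj₁ (Sum.inj₂-injective (trans (sym (dart-newDart a s))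
      (trans (cong dart (α′.dart-injective (dart-injective p))) (dart-newDart b t))))
    by : L.side a ≡ L.side b ⊎ opposite (L.side a) ≡ L.side b → a ≡ b
    by (inj₁ p) = conclude {near} {near} (trans (lift-dart a near) (trans (cong₂ (λ x y → inj₂ (x , y)) eq p) (sym (lift-dart b near))))
    by (inj₂ p) = conclude {far} {near} (trans (lift-dart a far) (trans (cong₂ (λ x y → inj₂ (x , y)) eq p) (sym (lift-dart b near))))

  -- Stated as a relation so that uniqueness and injectivity can be shown case by case,
  -- independently of the choice made by `kept-or-interior`.
  VertexImage : Fin G.n → Fin G.n → Set
  VertexImage x x′ = (∃ λ y → vert y ≡ x × x′ ≡ vert (α′.vert y))
                   ⊎ (∃ λ a → Interior (atom a) x × ∃ λ (p : x ∈ Vᴬ a) → x′ ≡ proj₁ (f.vert a (x , p)))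

  vertexImage : ∀ x → ∃ (VertexImage x)
  vertexImage x = go (kept-or-interior x)
    where
    go : (∃ λ y → vert y ≡ x) ⊎ (∃ λ a → Interior (atom a) x) → ∃ (VertexImage x)
    go (inj₁ (y , eq)) = _ , inj₁ (y , eq , refl)
    go (inj₂ (a , i))  = _ , inj₂ (a , i , proj₁ i , refl)

  image-interior : ∀ a {x} (p : x ∈ Vᴬ a) → Interior (atom a) x →
                   Interior (atom (L.target a)) (proj₁ (f.vert a (x , p)))
  image-interior a p (_ , x∉) = proj₂ (f.vert a (_ , p)) , λ fx∈ → x∉ (Equivalence.from (f.∂-onto a (_ , p)) fx∈)

  vertexImage-functional : ∀ {x x₁ x₂} → VertexImage x x₁ → VertexImage x x₂ → x₁ ≡ x₂
  vertexImage-functional (inj₁ (y , p , q)) (inj₁ (y′ , p′ , q′)) =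
    trans q (trans (cong (vert ∘ α′.vert) (vert-injective (trans p (sym p′)))) (sym q′))
  vertexImage-functional (inj₁ (y , refl , _)) (inj₂ (a , i , _)) = contradiction i (vert-kept y a)
  vertexImage-functional (inj₂ (a , i , _)) (inj₁ (y , refl , _)) = contradiction i (vert-kept y a)
  vertexImage-functional {x} (inj₂ (a , i , p , q)) (inj₂ (b , i′ , p′ , q′)) = go (interior-index i (proj₁ i′)) p′ q′
    where
    go : ∀ {b x₂} → a ≡ b → ∀ p′ → x₂ ≡ proj₁ (f.vert b (x , p′)) → _ ≡ x₂
    go refl p′ q′ = trans q (trans (cong (proj₁ ∘ f.vert a) (element-≡ refl)) (sym q′))

  vertexImage-injective : ∀ {x₁ x₂ x} → VertexImage x₁ x → VertexImage x₂ x → x₁ ≡ x₂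
  vertexImage-injective (inj₁ (y , p , q)) (inj₁ (y′ , p′ , q′)) =
    trans (sym p) (trans (cong vert (α′.vert-injective (vert-injective (trans (sym q) q′)))) p′)
  vertexImage-injective (inj₁ (y , _ , q)) (inj₂ (a , i , p , q′)) =
    contradiction (subst (Interior (atom (L.target a))) (trans (sym q′) q) (image-interior a p i)) (vert-kept _ _)
  vertexImage-injective (inj₂ (a , i , p , q)) (inj₁ (y , _ , q′)) =
    contradiction (subst (Interior (atom (L.target a))) (trans (sym q) q′) (image-interior a p i)) (vert-kept _ _)
  vertexImage-injective {x₁} {x₂} (inj₂ (a , i , p , q)) (inj₂ (b , i′ , p′ , q′)) =
    go (target-injective (interior-index (image-interior a p i)
          (subst (_∈ Vᴬ (L.target b)) (trans (sym q′) q) (proj₁ (image-interior b p′ i′))))) p′ q′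
    where
    go : ∀ {b} → a ≡ b → ∀ p′ → _ ≡ proj₁ (f.vert b (x₂ , p′)) → x₁ ≡ x₂
    go refl p′ q′ = cong proj₁ (I.vert-injective a {x₁ , p} {x₂ , p′} (element-≡ (trans (sym q) q′)))

  vertexMap : Fin G.n → Fin G.n
  vertexMap = proj₁ ∘ vertexImage

  vertexMap-spec : ∀ {x x′} → VertexImage x x′ → vertexMap x ≡ x′
  vertexMap-spec = vertexImage-functional (proj₂ (vertexImage _))

  vertexMap-kept : ∀ y → vertexMap (vert y) ≡ vert (α′.vert y)
  vertexMap-kept y = vertexMap-spec (inj₁ (y , refl , refl))

  -- A boundary vertex is kept, so its image is prescribed by α′; that the ∂-isomorphism agrees with
  -- it is the content of `compatible`.
  vertexMap-inside : ∀ a (x : VertexOf (atom a)) → vertexMap (proj₁ x) ≡ proj₁ (f.vert a x)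
  vertexMap-inside a x = go (interior-or-kept {a} (proj₂ x))
    where
    go : Interior (atom a) (proj₁ x) ⊎ OnBoundary (atom a) (proj₁ x) → vertexMap (proj₁ x) ≡ proj₁ (f.vert a x)
    go (inj₁ i) = vertexMap-spec (inj₂ (a , i , proj₂ x , refl))
    go (inj₂ b) =
      let s , p = ∈∂⇒end (Atom.∂ (atom a)) b
          y , vy , ιy = end-kept {newDart a s} (trans (cong (Graph.ι extended) (dart-newDart a s)) p)
          image-end : end (Atom.∂ (atom (L.target a))) (L.side a ⊙ s) ≡ just (vert (α′.vert y))
          image-end = trans (cong (Graph.ι extended) (sym (lift-dart a s))) (dart-end (α′.end-preserved ιy))
      in trans (trans (cong vertexMap (sym vy)) (vertexMap-kept y))
           (Maybe.just-injective (trans (sym image-end) (L.compatible a s x p)))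

  DartImage : Fin G.m → Fin G.m → Set
  DartImage d d′ = (∃ λ e → dart e ≡ inj₁ d × dart (α′.dart e) ≡ inj₁ d′)
                 ⊎ (∃ λ a → ∃ λ (p : d ∈ Dᴬ a) → d′ ≡ proj₁ (f.dart a (d , p)))

  dartImage : ∀ d → ∃ (DartImage d)
  dartImage d = go (old-or-in-atom d)
    where
    old : ∀ e → dart e ≡ inj₁ d → ∀ z → dart (α′.dart e) ≡ z → ∃ (DartImage d)
    old e eq (inj₁ d′) eq′ = d′ , inj₁ (e , eq , eq′)
    old e eq (inj₂ (b , s)) eq′ = contradiction
      (trans (cong (Graph.colour extended) (sym eq′)) (trans (colour-preserved _) (trans (α′.colour-preserved e)
        (trans (sym (colour-preserved e)) (cong (Graph.colour extended) eq))))) (fresh b d)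
    go : (∃ λ e → dart e ≡ inj₁ d) ⊎ (∃ λ a → d ∈ Dᴬ a) → ∃ (DartImage d)
    go (inj₁ (e , eq)) = old e eq (dart (α′.dart e)) refl
    go (inj₂ (a , p)) = _ , inj₂ (a , p , refl)

  dartImage-functional : ∀ {d d₁ d₂} → DartImage d d₁ → DartImage d d₂ → d₁ ≡ d₂
  dartImage-functional (inj₁ (e , p , q)) (inj₁ (e′ , p′ , q′)) =
    Sum.inj₁-injective (trans (sym q) (trans (cong (dart ∘ α′.dart) (dart-injective (trans p (sym p′)))) q′))
  dartImage-functional (inj₁ (e , eq , _)) (inj₂ (a , p , _)) = contradiction p (dart-kept a eq)
  dartImage-functional (inj₂ (a , p , _)) (inj₁ (e , eq , _)) = contradiction p (dart-kept a eq)
  dartImage-functional {d} (inj₂ (a , p , q)) (inj₂ (b , p′ , q′)) = go (index-unique p p′) p′ q′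
    where
    go : ∀ {b d₂} → a ≡ b → ∀ p′ → d₂ ≡ proj₁ (f.dart b (d , p′)) → _ ≡ d₂
    go refl p′ q′ = trans q (trans (cong (proj₁ ∘ f.dart a) (element-≡ refl)) (sym q′))

  dartImage-injective : ∀ {d₁ d₂ d} → DartImage d₁ d → DartImage d₂ d → d₁ ≡ d₂
  dartImage-injective (inj₁ (e , p , q)) (inj₁ (e′ , p′ , q′)) =
    Sum.inj₁-injective (trans (sym p) (trans (cong dart (α′.dart-injective (dart-injective (trans q (sym q′))))) p′))
  dartImage-injective (inj₁ (e , _ , q)) (inj₂ (a , p , q′)) =
    contradiction (subst (_∈ Dᴬ (L.target a)) (sym q′) (proj₂ (f.dart a (_ , p)))) (dart-kept _ q)
  dartImage-injective (inj₂ (a , p , q)) (inj₁ (e , _ , q′)) =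
    contradiction (subst (_∈ Dᴬ (L.target a)) (sym q) (proj₂ (f.dart a (_ , p)))) (dart-kept _ q′)
  dartImage-injective {d₁} {d₂} (inj₂ (a , p , q)) (inj₂ (b , p′ , q′)) =
    go (target-injective (index-unique (proj₂ (f.dart a (_ , p)))
          (subst (_∈ Dᴬ (L.target b)) (trans (sym q′) q) (proj₂ (f.dart b (_ , p′)))))) p′ q′
    where
    go : ∀ {b} → a ≡ b → ∀ p′ → _ ≡ proj₁ (f.dart b (d₂ , p′)) → d₁ ≡ d₂
    go refl p′ q′ = cong proj₁ (I.dart-injective a {d₁ , p} {d₂ , p′} (element-≡ (trans (sym q) q′)))

  dartMap : Fin G.m → Fin G.m
  dartMap = proj₁ ∘ dartImage

  dartMap-spec : ∀ {d d′} → DartImage d d′ → dartMap d ≡ d′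
  dartMap-spec = dartImage-functional (proj₂ (dartImage _))

  dartMap-preserves : Preserves (graph G) (graph G) vertexMap dartMap
  dartMap-preserves = record
    { ι-preserved = λ d → ι-at (proj₂ (dartImage d))
    ; mate-preserved = λ d → sym (dartMap-spec (mate-at (proj₂ (dartImage d))))
    ; colour-preserved = λ d → colour-at (proj₂ (dartImage d))
    ; label-preserved = λ d → label-at (proj₂ (dartImage d)) }
    where
    ι-at : ∀ {d d′} → DartImage d d′ → G.ι d′ ≡ Maybe.map vertexMap (G.ι d)
    ι-at {d} {d′} (inj₁ (e , p , q)) = trans (cong (Graph.ι extended) (sym q)) (trans (ι-preserved (α′.dart e))
      (trans (cong (Maybe.map vert) (α′.ι-preserved e)) (trans (sym (Maybe.map-∘ (G′.ι e)))
        (trans (Maybe.map-cong (λ y → sym (vertexMap-kept y)) (G′.ι e)) (trans (Maybe.map-∘ (G′.ι e))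
          (cong (Maybe.map vertexMap) (trans (sym (ι-preserved e)) (cong (Graph.ι extended) p))))))))
    ι-at {d} {d′} (inj₂ (a , p , refl)) = trans (sym (ι-inside (L.target a) (f.dart a (d , p))))
      (trans (cong (Maybe.map proj₁) (f.ι-preserved a (d , p)))
        (trans (sym (Maybe.map-∘ (Graph.ι ⟦ atom a ⟧ (d , p))))
          (trans (Maybe.map-cong (λ x → sym (vertexMap-inside a x)) (Graph.ι ⟦ atom a ⟧ (d , p)))
            (trans (Maybe.map-∘ (Graph.ι ⟦ atom a ⟧ (d , p))) (cong (Maybe.map vertexMap) (ι-inside a (d , p)))))))
    mate-at : ∀ {d d′} → DartImage d d′ → DartImage (G.mate d) (G.mate d′)
    mate-at (inj₁ (e , p , q)) = inj₁ (G′.mate e , dart-mate p ,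
      trans (cong dart (sym (α′.mate-preserved e))) (dart-mate q))
    mate-at {d} (inj₂ (a , p , refl)) = inj₂ (a , Atom.closed (atom a) p , cong proj₁ (f.mate-preserved a (d , p)))
    colour-at : ∀ {d d′} → DartImage d d′ → G.colour d′ ≡ G.colour d
    colour-at (inj₁ (e , p , q)) = trans (cong (Graph.colour extended) (sym q)) (trans (colour-preserved (α′.dart e))
      (trans (α′.colour-preserved e) (trans (sym (colour-preserved e)) (cong (Graph.colour extended) p))))
    colour-at {d} (inj₂ (a , p , refl)) = f.colour-preserved a (d , p)
    label-at : ∀ {d d′} → DartImage d d′ → G.label d′ ≡ G.label d
    label-at (inj₁ (e , p , q)) = trans (cong (Graph.label extended) (sym q)) (trans (label-preserved (α′.dart e))
      (trans (α′.label-preserved e) (trans (sym (label-preserved e)) (cong (Graph.label extended) p))))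
    label-at {d} (inj₂ (a , p , refl)) = f.label-preserved a (d , p)

  lifted : Aut (graph G)
  lifted = injection⇒automorphism vertexMap dartMap
    (λ {x} {x′} p → vertexImage-injective (proj₂ (vertexImage x)) (subst (VertexImage x′) (sym p) (proj₂ (vertexImage x′))))
    (λ {d} {d′} p → dartImage-injective (proj₂ (dartImage d)) (subst (DartImage d′) (sym p) (proj₂ (dartImage d′))))
    dartMap-preserves

  open TransportBack (graph G) simple lifted using (mapNode; imageD)

  lifted-centre-vertex : ∀ {w w′} → mapNode (articulation w) ≡ articulation w → vert w′ ≡ w → α′.vert w′ ≡ w′
  lifted-centre-vertex {w} {w′} fixed refl = vert-injective (trans (sym (vertexMap-kept w′)) (articulation-injective fixed))

  lifted-image : ∀ {Q} → imageD Q ≡ Q → ∀ e → InImage Q (dart e) → InImage Q (dart (α′.dart e))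
  lifted-image {Q} fixed e = go (dart e) refl
    where
    moved : ∀ {d} → d ∈ Q → dartMap d ∈ Q
    moved d∈ = subst (_ ∈_) fixed (∈image⁺ (_≅_.darts lifted) d∈)
    go : ∀ z → dart e ≡ z → InImage Q z → InImage Q (dart (α′.dart e))
    go (inj₁ d) eq d∈ = by (proj₂ (dartImage d)) (moved d∈)
      where
      by : ∀ {d′} → DartImage d d′ → d′ ∈ Q → InImage Q (dart (α′.dart e))
      by (inj₁ (e′ , p , q)) d′∈ = subst (InImage Q)
        (trans (sym q) (cong (dart ∘ α′.dart) (dart-injective (trans p (sym eq))))) d′∈
      by (inj₂ (a , p , _)) _ = contradiction p (dart-kept a eq)
    go (inj₂ (a , s)) eq (d , d∈Q , d∈A) = subst (InImage Q)
      (trans (sym (lift-dart a s)) (cong (dart ∘ α′.dart) (sym (new-unique eq))))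
      (dartMap d , moved d∈Q , subst (_∈ Dᴬ (L.target a)) (sym (dartMap-spec (inj₂ (a , d∈A , refl)))) (proj₂ (f.dart a (d , d∈A))))

-- The centre of the reduced graph

module GoodReduction {G G′ : FinGraph} {c : Node (graph G)} {c′ : Node (graph G′)} (R : Reduction G c G′ c′)
  (simple : IsSimple (graph G)) (centre : IsNode (graph G) c)
  (fixed : ∀ α → TransportBack.mapNode (graph G) simple α c ≡ c) where

  open Lifting R simple centre public

  module _ (α′ : Aut (graph G′)) where

    open TransportBack (graph G′) simple′ α′ using () renaming (mapNode to mapNode′; imageD to imageD′)

    -- The lift exists only under a double negation, which decidable equality of vertices removes.
    vertex-fixed : ∀ {w w′} → c ≡ articulation w → vert w′ ≡ w → Iso.vert α′ w′ ≡ w′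
    vertex-fixed {w} {w′} refl eq = decidable-stable (Iso.vert α′ w′ ≟ w′) λ ¬fixed →
      ¬¬-finite-choice (lift-at α′) λ lift →
        let open LiftedAutomorphism R simple centre α′ lift in ¬fixed (lifted-centre-vertex (fixed lifted) eq)

    block-preserved : ∀ {Q Q′} → c ≡ block Q → (∀ e → e ∈ Q′ ⇔ InImage Q (dart e)) → ∀ e → e ∈ Q′ → Iso.dart α′ e ∈ Q′
    block-preserved {Q} {Q′} refl spec e e∈ = decidable-stable (Iso.dart α′ e ∈? Q′) λ e∉ →
      ¬¬-finite-choice (lift-at α′) λ lift →
        let open LiftedAutomorphism R simple centre α′ lift
        in e∉ (Equivalence.from (spec _) (lifted-image (block-injective (fixed lifted)) e (Equivalence.to (spec e) e∈)))

  fixed′ : ∀ α′ → TransportBack.mapNode (graph G′) simple′ α′ c′ ≡ c′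
  fixed′ α′ = go c refl
    where
    go : ∀ c₀ → c ≡ c₀ → TransportBack.mapNode (graph G′) simple′ α′ c′ ≡ c′
    go (articulation w) eq with centre-articulation w eq
    ... | w′ , refl , vw = cong articulation (vertex-fixed α′ eq vw)
    go (block Q) eq with centre-block Q eq
    ... | Q′ , refl , spec = cong block (⊆-antisym
            (λ {e} e∈ → subst (_∈ Q′) (Iso.dart-dart⁻ α′ e) (block-preserved α′ eq spec _ (∈image⁻ (_≅_.darts α′) e∈)))
            (λ {e} e∈ → from∈⇒∈image (_≅_.darts α′) (block-preserved (inverse α′) eq spec e e∈)))

  module CentralArticulation {w : Fin G.n} {w′ : Fin G′.n} (c≡ : c ≡ articulation w) (vw : vert w′ ≡ w) where

    zᶜ≡ : zᶜ ≡ inj₁ w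
    zᶜ≡ = subst (λ c → Rep c zᶜ) c≡ rep-zᶜ

    -- The obstacle to w′ being an articulation is an atom whose darts w separates from each other
    -- but which becomes a single edge. Such an atom is a block atom at w that takes all darts cut
    -- off from the centre, and these are all darts, since w is the centre.
    Together Swallowing : Fin size → Set
    Together a = ∀ {d e} → d ∈ Dᴬ a → e ∈ Dᴬ a → ⁅ w ⁆ ⊢ inj₂ d ~ inj₂ e
    Swallowing a = Atom.∂ (atom a) ≡ single w × (∀ d → d ∈ Dᴬ a)

    together-or-swallowing : ∀ a → Together a ⊎ Swallowing a
    together-or-swallowing a = go (Atom.∂ (atom a)) refl
      where
      via : ∀ {x} → OnBoundary (atom a) x → x ≢ w → Together a ⊎ Swallowing a
      via x∈ x≢w = inj₁ λ d∈ e∈ → to d∈ ◅◅ ⊢-sym ⁅ w ⁆ (to e∈)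
        where
        to : ∀ {d} → d ∈ Dᴬ a → ⁅ w ⁆ ⊢ inj₂ d ~ inj₁ _
        to = boundary-linked (atom a) (subst (λ w → ¬ Interior (atom a) w) vw (vert-kept w′ a)) x∈ x≢w
      at-w : Atom.∂ (atom a) ≡ single w → PartView (Atom.S (atom a)) (single w) → Together a ⊎ Swallowing a
      at-w eq (blockPart F _) with BlockPartFacts.shape F
      ... | inj₂ conn = inj₁ conn
      ... | inj₁ all = inj₂ (eq , λ d → all λ l → isolated ⁅ w ⁆ (x∈⁅x⁆ w) (subst (λ z → ⁅ w ⁆ ⊢ inj₂ d ~ z) zᶜ≡ l))
      go : ∀ b → Atom.∂ (atom a) ≡ b → Together a ⊎ Swallowing a
      go (single u) eq with u ≟ w
      ... | yes refl = at-w eq (subst (PartView _) eq (atom-facts (atom a)))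
      ... | no u≢w   = via (subst (_∈∂_ (graph G) u) (sym eq) refl) u≢w
      go (pair u v) eq with u ≟ w
      ... | no u≢w   = via (subst (_∈∂_ (graph G) u) (sym eq) (inj₁ refl)) u≢w
      ... | yes refl = via (subst (_∈∂_ (graph G) v) (sym eq) (inj₂ refl)) (boundary-distinct (atom a) eq ∘ sym)

    -- If the reduced graph were connected without w′, its links could be lifted, `Together`
    -- allowing each dart of an atom to be replaced by the representative.
    articulation-kept : (∀ a → Together a) → IsArticulation (graph G′) w′
    articulation-kept together conn = subst (IsNode (graph G)) c≡ centre λ z z′ z∈ z′∈ →
        let y , y∈ , l = down-up z z∈
            y′ , y′∈ , l′ = down-up z′ z′∈
        in ⊢-sym ⁅ w ⁆ l ◅◅ subst (λ w → ⁅ w ⁆ ⊢ raise rep rep∈ y ~ raise rep rep∈ y′) vw (link-up rep rep∈ w′ (conn y y′ y∈ y′∈)) ◅◅ l′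
      where
      rep : Fin size → Fin G.m
      rep a = proj₁ (atom-nonempty (atom a))
      rep∈ : ∀ a → rep a ∈ Dᴬ a
      rep∈ a = proj₂ (atom-nonempty (atom a))
      Lowered : Element G.n G.m → Set
      Lowered z = ∃ λ y → y ∈ˢ (whole ∖ ⁅ w′ ⁆) × ⁅ w ⁆ ⊢ raise rep rep∈ y ~ z
      new : ∀ a {d} → d ∈ Dᴬ a → Lowered (inj₂ d)
      new a {d} d∈ = inj₂ (newDart a near) , ∈⊤ , subst (λ z → ⁅ w ⁆ ⊢ inj₂ (dartUp rep rep∈ z) ~ inj₂ d) (sym (dart-newDart a near))
                       (together a (rep∈ a) d∈)
      down-up : ∀ z → z ∈ˢ (whole ∖ ⁅ w ⁆) → Lowered z
      down-up (inj₂ d) _ with old-or-in-atom d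
      ... | inj₁ (e , eq) = inj₂ e , ∈⊤ , subst (λ z → ⁅ w ⁆ ⊢ inj₂ (dartUp rep rep∈ z) ~ inj₂ d) (sym eq) ε
      ... | inj₂ (a , d∈) = new a d∈
      down-up (inj₁ x) x∈ with kept-or-interior x
      ... | inj₁ (y , refl) = inj₁ y , x∈p∧x∉q⇒x∈p─q ∈⊤ (x∉⁅⁆ λ { refl → x∉⁅⁆⁻ (x∈p─q⇒x∉q full ⁅ w ⁆ x∈) vw }) , ε
      ... | inj₂ (a , i) = let d , d∈ , dx = vertex-dart (atom a) (proj₁ i)
                               y , y∈ , l = new a d∈
                           in y , y∈ , l ◅◅ end-link ⁅ w ⁆ (x∈p─q⇒x∉q full ⁅ w ⁆ x∈) dx

    module _ {a : Fin size} (swallowing : Swallowing a) where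

      -- What is left of the graph is a single pendant edge at w′, which has neither articulations
      -- nor atoms.
      only-new : ∀ e → ∃ λ s → dart e ≡ inj₂ (a , s)
      only-new e = go (dart e) refl
        where
        go : ∀ z → dart e ≡ z → ∃ λ s → dart e ≡ inj₂ (a , s)
        go (inj₁ d) eq = contradiction (proj₂ swallowing d) (dart-kept a eq)
        go (inj₂ (b , s)) eq = s , trans eq (cong (λ b → inj₂ (b , s))
          (let d , d∈ = atom-nonempty (atom b) in index-unique d∈ (proj₂ swallowing d)))

      only-end : ∀ {e y} → G′.ι e ≡ just y → y ≡ w′ × dart e ≡ inj₂ (a , near)
      only-end {e} {y} ey = go (only-new e)
        where
        at : ∀ s → dart e ≡ inj₂ (a , s) → end (Atom.∂ (atom a)) s ≡ just (vert y) → y ≡ w′ × dart e ≡ inj₂ (a , near)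
        at near eq p = vert-injective (trans (sym (Maybe.just-injective
          (trans (sym (cong (λ b → end b near) (proj₁ swallowing))) p))) (sym vw)) , eq
        at far eq p = case trans (sym p) (cong (λ b → end b far) (proj₁ swallowing)) of λ ()
        go : (∃ λ s → dart e ≡ inj₂ (a , s)) → y ≡ w′ × dart e ≡ inj₂ (a , near)
        go (s , eq) = at s eq (trans (cong (Graph.ι extended) (sym eq)) (dart-end ey))

      no-articulation′ : ∀ u → ¬ IsArticulation (graph G′) u
      no-articulation′ u art = art λ z z′ z∈ z′∈ → to z z∈ ◅◅ ⊢-sym′ ⁅ u ⁆ (to z′ z′∈)
        where
        module B′ = Blocks (graph G′) simple′
        to : ∀ z → z ∈ˢ (whole ∖ ⁅ u ⁆) → ⁅ u ⁆ ⊢′ z ~ inj₂ (newDart a near)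
        to (inj₂ e) _ = let s , eq = only-new e in same-new-edge ⁅ u ⁆ eq (dart-newDart a near)
        to (inj₁ y) y∈ =
          let e , ey = B′.first-dart none (B′.all-linked (inj₁ y) (inj₂ (newDart a near))) λ ()
          in ⊢-sym′ ⁅ u ⁆ (end-link′ ⁅ u ⁆ (x∈p─q⇒x∉q full ⁅ u ⁆ y∈) ey) ◅◅ to (inj₂ e) ∈⊤

      no-atom′ : ¬ Atom (graph G′) (articulation w′)
      no-atom′ A = go (Atom.isPart A)
        where
        go : ∀ {S b} → ¬ IsPart (graph G′) (articulation w′) S b
        go (blockPart part _) = no-blockPart (graph G′) no-articulation′ part
        go (properPart part) =
          let u≢v , u∈ , v∈ , _ = IsProperPart.twoCut part
              _ , _ , du = ∈ends⁻ (graph G′) (IsProperPart.B part) u∈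
              _ , _ , dv = ∈ends⁻ (graph G′) (IsProperPart.B part) v∈
          in u≢v (trans (proj₁ (only-end du)) (sym (proj₁ (only-end dv))))
        go (dipolePart dip) =
          let _ , _ , d≢e , _ , _ , du , eu = IsDipole.two-edges dip
          in d≢e (dart-injective (trans (proj₂ (only-end du)) (sym (proj₂ (only-end eu)))))

    -- A swallowing atom would leave a graph without atoms, against the assumption. So all atoms
    -- satisfy `Together` up to a double negation, which is harmless because being an articulation
    -- is itself a negation.
    articulation′ : ¬ ¬ Atom (graph G′) (articulation w′) → IsArticulation (graph G′) w′
    articulation′ ¬¬atom conn = ¬¬-finite-choice
      (λ a ¬together → Sum.[ (λ t → ¬together (λ {d} {e} → t {d} {e})) , (λ s → ¬¬atom (no-atom′ s)) ] (together-or-swallowing a))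
      λ together → articulation-kept (λ a {d} {e} → together a {d} {e}) conn

  isNode′ : ¬ ¬ Atom (graph G′) c′ → IsNode (graph G′) c′
  isNode′ = go c refl
    where
    go : ∀ c₀ → c ≡ c₀ → ¬ ¬ Atom (graph G′) c′ → IsNode (graph G′) c′
    go (articulation w) eq with centre-articulation w eq
    ... | w′ , refl , vw = CentralArticulation.articulation′ eq vw
    go (block Q) eq with centre-block Q eq
    ... | Q′ , refl , spec = λ _ → CentralBlock.image-block′ Q eq spec

  good′ : IsGood (graph G′) c′
  good′ = record { simple = simple′ ; fixed = fixed′ ; isNode = isNode′ }

module _ {G : FinGraph} (admissible : IsAdmissible G) (series : ReductionSeries G) where

  open ReductionSeries series

  good-start : IsGood (graph (member zero)) (centre zero)
  good-start = go (member zero) (centre zero) start start-centre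
    where
    go : ∀ H c → H ≡ G → IsCentre (graph H) c → IsGood (graph H) c
    go _ c refl = centre-good G admissible

  member-good : ∀ i → IsGood (graph (member i)) (centre i)
  member-good = all-good r member centre good-start step not-primitive
    where
    all-good : ∀ r (member : Fin (suc r) → FinGraph) (centre : ∀ i → Node (graph (member i))) →
      IsGood (graph (member zero)) (centre zero) →
      (∀ (i : Fin r) → Reduction (member (inject₁ i)) (centre (inject₁ i)) (member (suc i)) (centre (suc i))) →
      (∀ (i : Fin r) → ¬ IsPrimitive (graph (member (inject₁ i))) (centre (inject₁ i))) →
      ∀ i → IsGood (graph (member i)) (centre i)
    all-good r member centre good step np zero = good
    all-good (suc r) member centre good step np (suc i) =
      all-good r (member ∘ suc) (centre ∘ suc)
        (GoodReduction.good′ (step zero) (IsGood.simple good) (IsGood.isNode good (np zero)) (IsGood.fixed good))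
        (step ∘ suc) (np ∘ suc) i

-- Quotient graphs

-- A `FinGraph` lives on `Fin`, so a quotient set is realised by representatives, one for each
-- class.
record Transversal {X : Set} (_~_ : X → X → Set) : Set where
  field
    size       : ℕ
    rep        : Fin size → X
    class      : X → Fin size
    class-spec : ∀ x → x ~ rep (class x)
    separate   : ∀ i j → rep i ~ rep j → i ≡ j

module _ {X : Set} {_~_ : X → X → Set} (equivalence : IsDecEquivalence _~_) where

  open IsDecEquivalence equivalence using () renaming (refl to ~-refl; sym to ~-sym; trans to ~-trans; _≟_ to ~-dec)

  private
    record Partial {N : ℕ} (enumerate : Fin N → Maybe X) : Set where
      field
        size     : ℕ
        rep      : Fin size → X
        cover    : ∀ i x → enumerate i ≡ just x → ∃ λ j → x ~ rep j
        separate : ∀ i j → rep i ~ rep j → i ≡ j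

    partial : ∀ {N} (enumerate : Fin N → Maybe X) → Partial enumerate
    partial {zero} enumerate = record { size = 0 ; rep = λ () ; cover = λ () ; separate = λ () }
    partial {suc N} enumerate = extend (enumerate zero) refl
      where
      rest = partial (enumerate ∘ suc)
      open Partial rest
      skip : (∀ x → enumerate zero ≡ just x → ∃ λ j → x ~ rep j) → Partial enumerate
      skip zero-covered = record
        { size = size ; rep = rep ; cover = λ { zero → zero-covered ; (suc i) → cover i } ; separate = separate }
      extend : ∀ z → enumerate zero ≡ z → Partial enumerate
      extend nothing eq = skip λ x p → case trans (sym eq) p of λ ()
      extend (just x) eq with any? (λ j → ~-dec x (rep j))
      ... | yes (j , x~j) = skip λ y p → j , subst (_~ rep j) (Maybe.just-injective (trans (sym eq) p)) x~j
      ... | no new = record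
        { size = suc size ; rep = λ { zero → x ; (suc j) → rep j }
        ; cover = λ { zero y p → zero , subst (y ~_) (sym (Maybe.just-injective (trans (sym eq) p))) ~-refl
                    ; (suc i) y p → let j , y~j = cover i y p in suc j , y~j }
        ; separate = λ { zero zero _ → refl ; zero (suc j) p → contradiction (j , p) new
                       ; (suc i) zero p → contradiction (i , ~-sym p) new
                       ; (suc i) (suc j) p → cong suc (separate i j p) } }

  -- The enumeration may skip indices, so that the members of a subset can be enumerated along the
  -- ambient set.
  transversal : ∀ {N} (enumerate : Fin N → Maybe X) → (∀ x → ∃ λ i → enumerate i ≡ just x) → Transversal _~_
  transversal enumerate complete = record
    { size = size ; rep = rep
    ; class = λ x → proj₁ (covered x) ; class-spec = λ x → proj₂ (covered x)
    ; separate = separate }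
    where
    open Partial (partial enumerate)
    covered : ∀ x → ∃ λ j → x ~ rep j
    covered x = let i , eq = complete x in cover i x eq

  class-≡ : (t : Transversal _~_) → ∀ {x y} → Transversal.class t x ≡ Transversal.class t y ⇔ x ~ y
  class-≡ t {x} {y} = mk⇔
    (λ eq → ~-trans (class-spec x) (subst (λ i → rep i ~ y) (sym eq) (~-sym (class-spec y))))
    (λ x~y → separate _ _ (~-trans (~-sym (class-spec x)) (~-trans x~y (class-spec y))))
    where open Transversal t

  class-rep : (t : Transversal _~_) → ∀ i → Transversal.class t (Transversal.rep t i) ≡ i
  class-rep t i = separate _ _ (~-sym (class-spec (rep i)))
    where open Transversal t

kernel : ∀ {X : Set} {k} (f : X → Fin k) → IsDecEquivalence (λ x y → f x ≡ f y)
kernel f = record { isEquivalence = record { refl = refl ; sym = sym ; trans = trans } ; _≟_ = λ x y → f x ≟ f y }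

finTransversal : ∀ {k} {_~_ : Fin k → Fin k → Set} → IsDecEquivalence _~_ → Transversal _~_
finTransversal eq = transversal eq just λ x → x , refl

subsetTransversal : ∀ {k} {p : Subset k} {_~_ : (∃ λ x → x ∈ p) → (∃ λ x → x ∈ p) → Set} →
                    IsDecEquivalence _~_ → Transversal _~_
subsetTransversal {p = p} eq = transversal eq enumerate λ (x , x∈) → x , listed x x∈
  where
  enumerate : Fin _ → Maybe (∃ λ x → x ∈ p)
  enumerate x with x ∈? p
  ... | yes x∈ = just (x , x∈)
  ... | no _   = nothing
  listed : ∀ x x∈ → enumerate x ≡ just (x , x∈)
  listed x x∈ with x ∈? p
  ... | yes _ = cong just (element-≡ refl)
  ... | no x∉ = contradiction x∈ x∉

module QuotientGraph {V D : Set} (G : Graph V D) (isGraph : IsGraph G)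
  {_~V_ : V → V → Set} {_~D_ : D → D → Set}
  (equivV : IsDecEquivalence _~V_) (equivD : IsDecEquivalence _~D_)
  (transV : Transversal _~V_) (transD : Transversal _~D_)
  (ι-resp : ∀ {d e} → d ~D e → Maybe.map (Transversal.class transV) (Graph.ι G d) ≡ Maybe.map (Transversal.class transV) (Graph.ι G e))
  (mate-resp : ∀ {d e} → d ~D e → Graph.mate G d ~D Graph.mate G e)
  (colour-resp : ∀ {d e} → d ~D e → Graph.colour G d ≡ Graph.colour G e)
  (label-resp : ∀ {d e} → d ~D e → Graph.label G d ≡ Graph.label G e) where

  open Graph G
  open IsGraph isGraph
  open IsDecEquivalence equivD using () renaming (sym to ~-sym)

  private
    module tV = Transversal transV
    module tD = Transversal transD

    class-mate : ∀ d → tD.class (mate (tD.rep (tD.class d))) ≡ tD.class (mate d)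
    class-mate d = Equivalence.from (class-≡ equivD transD) (mate-resp (~-sym (tD.class-spec d)))

  quotient : FinGraph
  quotient = record
    { graph = record
      { ι = λ i → Maybe.map tV.class (ι (tD.rep i)) ; mate = λ i → tD.class (mate (tD.rep i))
      ; colour = colour ∘ tD.rep ; label = label ∘ tD.rep }
    ; isGraph = record
      { mate-involutive = λ i → trans (class-mate (mate (tD.rep i)))
          (trans (cong tD.class (mate-involutive (tD.rep i))) (class-rep equivD transD i))
      ; colour-mate = λ i → trans (colour-resp (~-sym (tD.class-spec _))) (colour-mate (tD.rep i))
      ; label-mate = λ i → trans (label-resp (~-sym (tD.class-spec _))) (label-mate (tD.rep i)) } }

  onto : Onto G (graph quotient)
  onto = record
    { vert = tV.class ; dart = tD.class
    ; preserves = record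
      { ι-preserved = λ d → ι-resp (~-sym (tD.class-spec d)) ; mate-preserved = class-mate
      ; colour-preserved = λ d → colour-resp (~-sym (tD.class-spec d))
      ; label-preserved = λ d → label-resp (~-sym (tD.class-spec d)) }
    ; vert-onto = λ i → tV.rep i , class-rep equivV transV i
    ; dart-onto = λ i → tD.rep i , class-rep equivD transD i }

module _ {n m : ℕ} {G : Graph (Fin n) (Fin m)} where

  end-side : ∀ (b : Boundary G) → (∀ {u v} → b ≡ pair u v → u ≢ v) → ∀ s t → end b s ≡ end b t → s ≡ t
  end-side b _ near near _ = refl
  end-side b _ far far _ = refl
  end-side (pair u v) d near far refl = contradiction refl (d refl)
  end-side (pair u v) d far near refl = contradiction refl (d refl)

  -- Boundaries with the same vertices may list them in different orders. For single vertices the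
  -- far sides match because neither has an end.
  matching-side : ∀ (b b′ : Boundary G) → (∀ {u v} → b ≡ pair u v → u ≢ v) → (∀ {u v} → b′ ≡ pair u v → u ≢ v) →
    (∀ {x} → _∈∂_ G x b → _∈∂_ G x b′) → (∀ {x} → _∈∂_ G x b′ → _∈∂_ G x b) → ∀ s → ∃ λ t → end b′ t ≡ end b s
  matching-side (single u) (single u′) _ _ into _ near = near , cong just (sym (into refl))
  matching-side (single u) (single u′) _ _ into _ far = far , refl
  matching-side (single u) (pair u′ v′) _ d _ back _ = contradiction (trans (back (inj₁ refl)) (sym (back (inj₂ refl)))) (d refl)
  matching-side (pair u v) (single u′) d _ into _ _ = contradiction (trans (into (inj₁ refl)) (sym (into (inj₂ refl)))) (d refl)
  matching-side (pair u v) (pair u′ v′) _ _ into _ near with into (inj₁ refl)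
  ... | inj₁ p = near , cong just (sym p)
  ... | inj₂ p = far , cong just (sym p)
  matching-side (pair u v) (pair u′ v′) _ _ into _ far with into (inj₂ refl)
  ... | inj₁ p = near , cong just (sym p)
  ... | inj₂ p = far , cong just (sym p)

-- The induced action on the reduced graph

module Induced {G G′ : FinGraph} {c : Node (graph G)} {c′ : Node (graph G′)} (R : Reduction G c G′ c′)
  (simple : IsSimple (graph G)) (centre : IsNode (graph G) c)
  (fixed : ∀ α → TransportBack.mapNode (graph G) simple α c ≡ c) where

  open Lifting R simple centre public

  Ext : Set
  Ext = Fin G.m ⊎ Fin size × Side

  ∂ᴬ : Fin size → Boundary (graph G)
  ∂ᴬ a = Atom.∂ (atom a)

  -- The action of γ on old and new darts, as a relation: b and t are found by a search among the
  -- listed atoms, but only the two properties in `new` matter. They determine b, since atoms are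
  -- disjoint and nonempty, and t, since the two darts of `e_A` have different ends.
  data ExtRel (γ : Aut (graph G)) : Ext → Ext → Set where
    old : ∀ {d} → ExtRel γ (inj₁ d) (inj₁ (_≅_.dart γ d))
    new : ∀ {a s b t} → (∀ {d} → d ∈ Dᴬ a → _≅_.dart γ d ∈ Dᴬ b) →
          end (∂ᴬ b) t ≡ Maybe.map (_≅_.vert γ) (end (∂ᴬ a) s) → ExtRel γ (inj₂ (a , s)) (inj₂ (b , t))

  ext-functional : ∀ {γ x y y′} → ExtRel γ x y → ExtRel γ x y′ → y ≡ y′
  ext-functional old old = refl
  ext-functional {γ} (new {a} {s} {b} {t} into e) (new {b = b′} {t′} into′ e′) =
    go (let d , d∈ = atom-nonempty (atom a) in index-unique (into d∈) (into′ d∈)) t′ e′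
    where
    go : ∀ {b′} → b ≡ b′ → ∀ t′ → end (∂ᴬ b′) t′ ≡ Maybe.map (_≅_.vert γ) (end (∂ᴬ a) s) → inj₂ (b , t) ≡ inj₂ (b′ , t′)
    go refl t′ e′ = cong (λ t → inj₂ (b , t)) (end-side (∂ᴬ b) (boundary-distinct (atom b)) t t′ (trans e (sym e′)))

  -- The moved atom has the subgraph of some listed atom b, whose boundary may be written in the
  -- other order.
  ext-total : ∀ γ x → ∃ (ExtRel γ x)
  ext-total γ (inj₁ d) = _ , old
  ext-total γ (inj₂ (a , s)) = go (complete (move (atom a)))
    where
    open MoveAtom γ fixed
    distinct-image : ∀ b → (∀ {u v} → b ≡ pair u v → u ≢ v) → ∀ {u v} → mapBoundary b ≡ pair u v → u ≢ v
    distinct-image (pair u v) d refl p = d refl (Iso.vert-injective γ p)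
    end-image : ∀ b s → end (mapBoundary b) s ≡ Maybe.map (_≅_.vert γ) (end b s)
    end-image (single u) near = refl
    end-image (single u) far  = refl
    end-image (pair u v) near = refl
    end-image (pair u v) far  = refl
    go : (∃ λ b → Atom.S (atom b) ≡ imageSub (Atom.S (atom a))) → ∃ (ExtRel γ (inj₂ (a , s)))
    go (b , eq) =
      let t , p = matching-side (mapBoundary (∂ᴬ a)) (∂ᴬ b) (distinct-image (∂ᴬ a) (boundary-distinct (atom a))) (boundary-distinct (atom b))
                    (same-boundary (move (atom a)) (atom b) (sym eq)) (same-boundary (atom b) (move (atom a)) eq) s
      in inj₂ (b , t) , new (λ d∈ → subst (λ S → _ ∈ Sub.darts S) (sym eq) (∈image⁺ (_≅_.darts γ) d∈)) (trans p (end-image (∂ᴬ a) s))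

  ext-resp : ∀ {γ δ x y} → γ ≈ δ → ExtRel γ x y → ExtRel δ x y
  ext-resp {γ} {δ} (_ , pd) (old {d}) = subst (λ e → ExtRel δ (inj₁ d) (inj₁ e)) (sym (pd d)) old
  ext-resp (pv , pd) (new {a} {s} into e) = new (λ {d} d∈ → subst (_∈ _) (pd d) (into d∈)) (trans e (Maybe.map-cong pv (end (∂ᴬ a) s)))

  ext-identity : ∀ x → ExtRel identity x x
  ext-identity (inj₁ d) = old
  ext-identity (inj₂ (a , s)) = new id (sym (Maybe.map-id (end (∂ᴬ a) s)))

  ext-compose : ∀ {γ δ x y z} → ExtRel γ y z → ExtRel δ x y → ExtRel (γ · δ) x z
  ext-compose old old = old
  ext-compose {γ} (new into e) (new {a} {s} into′ e′) =
    new (into ∘ into′) (trans e (trans (cong (Maybe.map (_≅_.vert γ)) e′) (sym (Maybe.map-∘ (end (∂ᴬ a) s)))))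

  -- The inverse relates y to some x′, and by composition the identity relates x to x′, so the two
  -- are equal.
  ext-inverse : ∀ {γ x y} → ExtRel γ x y → ExtRel (inverse γ) y x
  ext-inverse {γ} {x} {y} r = go (ext-total (inverse γ) y)
    where
    go : ∃ (ExtRel (inverse γ) y) → ExtRel (inverse γ) y x
    go (x′ , r′) = subst (ExtRel (inverse γ) y)
      (ext-functional (ext-resp {δ = identity} (Iso.vert⁻-vert γ , Iso.dart⁻-dart γ) (ext-compose r′ r)) (ext-identity x)) r′

  module Between {γ : Aut (graph G)} {a s b t} (r : ExtRel γ (inj₂ (a , s)) (inj₂ (b , t))) where

    private module γ = Iso γ

    darts-into : ∀ {d} → d ∈ Dᴬ a → γ.dart d ∈ Dᴬ b
    darts-into = go r
      where
      go : ExtRel γ (inj₂ (a , s)) (inj₂ (b , t)) → ∀ {d} → d ∈ Dᴬ a → γ.dart d ∈ Dᴬ b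
      go (new into _) = into

    end-image : end (∂ᴬ b) t ≡ Maybe.map γ.vert (end (∂ᴬ a) s)
    end-image = go r
      where
      go : ExtRel γ (inj₂ (a , s)) (inj₂ (b , t)) → end (∂ᴬ b) t ≡ Maybe.map γ.vert (end (∂ᴬ a) s)
      go (new _ e) = e

    verts-into : ∀ {x} → x ∈ Vᴬ a → γ.vert x ∈ Vᴬ b
    verts-into x∈ = let d , d∈ , dx = vertex-dart (atom a) x∈
                    in atom-end (atom b) (darts-into d∈) (γ.end-preserved dx)

    at-side : ∀ s′ → ∃ λ t′ → ExtRel γ (inj₂ (a , s′)) (inj₂ (b , t′))
    at-side s′ = go (ext-total γ (inj₂ (a , s′)))
      where
      go : ∃ (ExtRel γ (inj₂ (a , s′))) → ∃ λ t′ → ExtRel γ (inj₂ (a , s′)) (inj₂ (b , t′))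
      go (_ , new {b = b′} {t′} into e) =
        let d , d∈ = atom-nonempty (atom a)
        in t′ , subst (λ b → ExtRel γ (inj₂ (a , s′)) (inj₂ (b , t′))) (index-unique (into d∈) (darts-into d∈)) (new into e)

    mates-related : ExtRel γ (inj₂ (a , opposite s)) (inj₂ (b , opposite t))
    mates-related = go (at-side (opposite s))
      where
      go : (∃ λ t′ → ExtRel γ (inj₂ (a , opposite s)) (inj₂ (b , t′))) → ExtRel γ (inj₂ (a , opposite s)) (inj₂ (b , opposite t))
      go (t′ , new into e) = by (same-or-opposite t t′)
        where
        by : t ≡ t′ ⊎ opposite t ≡ t′ → ExtRel γ (inj₂ (a , opposite s)) (inj₂ (b , opposite t))
        by (inj₂ refl) = new into e
        by (inj₁ refl) = contradiction (end-side (∂ᴬ a) (boundary-distinct (atom a)) (opposite s) s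
          (Maybe.map-injective γ.vert-injective (trans (sym e) end-image))) (opposite-≢ s)

    boundary-into : ∀ {x} → OnBoundary (atom a) x → OnBoundary (atom b) (γ.vert x)
    boundary-into {x} x∈ = go (∈∂⇒end (∂ᴬ a) x∈)
      where
      go : (∃ λ s′ → end (∂ᴬ a) s′ ≡ just x) → OnBoundary (atom b) (γ.vert x)
      go (s′ , p) = by (at-side s′)
        where
        by : (∃ λ t′ → ExtRel γ (inj₂ (a , s′)) (inj₂ (b , t′))) → OnBoundary (atom b) (γ.vert x)
        by (t′ , new _ e) = end⇒∈∂ (∂ᴬ b) t′ (trans e (cong (Maybe.map γ.vert) p))

  module Restriction {γ : Aut (graph G)} {a s b t} (r : ExtRel γ (inj₂ (a , s)) (inj₂ (b , t))) where

    open Between r public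
    private
      module γ = Iso γ
      module Back = Between (ext-inverse r)

    vertex-into : VertexOf (atom a) → VertexOf (atom b)
    vertex-into (x , p) = γ.vert x , verts-into p

    restricted : ⟦ atom a ⟧ ≅ ⟦ atom b ⟧
    restricted = record
      { vertices = mk↔ₛ′ vertex-into (λ (y , p) → γ.vert⁻ y , Back.verts-into p)
          (λ (y , _) → element-≡ (γ.vert-vert⁻ y)) (λ (x , _) → element-≡ (γ.vert⁻-vert x))
      ; darts = mk↔ₛ′ (λ (d , p) → γ.dart d , darts-into p) (λ (e , p) → γ.dart⁻ e , Back.darts-into p)
          (λ (e , _) → element-≡ (γ.dart-dart⁻ e)) (λ (d , _) → element-≡ (γ.dart⁻-dart d))
      ; preserves = record
        { ι-preserved = λ (d , p) → map-proj₁-injective {G = graph G} {c} {p = Vᴬ b} (trans (ι-inside b (γ.dart d , darts-into p))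
            (trans (γ.ι-preserved d) (trans (cong (Maybe.map γ.vert) (sym (ι-inside a (d , p))))
              (trans (sym (Maybe.map-∘ {g = γ.vert} {f = proj₁} (Graph.ι ⟦ atom a ⟧ (d , p))))
                (Maybe.map-∘ {g = proj₁} {f = vertex-into} (Graph.ι ⟦ atom a ⟧ (d , p)))))))
        ; mate-preserved = λ (d , _) → element-≡ (γ.mate-preserved d)
        ; colour-preserved = λ (d , _) → γ.colour-preserved d
        ; label-preserved = λ (d , _) → γ.label-preserved d } }

    restricted-∂ : ∂-Isomorphism (atom a) (atom b)
    restricted-∂ = record
      { iso = restricted
      ; ∂-onto = λ (x , _) → mk⇔ boundary-into
          (λ p → subst (OnBoundary (atom a)) (γ.vert⁻-vert x) (Back.boundary-into p)) }

    colours-equal : newColour b ≡ newColour a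
    colours-equal = sym (Equivalence.from (classes a b) restricted-∂)

    interior-into : ∀ {x} → Interior (atom a) x → Interior (atom b) (γ.vert x)
    interior-into {x} (x∈ , x∉) = verts-into x∈ , λ p → x∉ (Equivalence.from (∂-Isomorphism.∂-onto restricted-∂ (x , x∈)) p)

  -- The rule `oriented` speaks only of darts with an end. The far dart of a pendant edge has none,
  -- and its label is obtained from its mate by reversal.
  labels-equal : ∀ {γ a s b t} → ExtRel γ (inj₂ (a , s)) (inj₂ (b , t)) → newLabel b t ≡ newLabel a s
  labels-equal {γ} {a} {s} {b} {t} r = go (end (∂ᴬ a) s) refl
    where
    module Re {s t} (r : ExtRel γ (inj₂ (a , s)) (inj₂ (b , t))) = Restriction r
    at-end : ∀ {s t x} (r : ExtRel γ (inj₂ (a , s)) (inj₂ (b , t))) → end (∂ᴬ a) s ≡ just x → newLabel b t ≡ newLabel a s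
    at-end {s} {t} {x} r p = sym (oriented a b (Re.restricted-∂ r) s t (x , boundary∈ (atom a) (end⇒∈∂ (∂ᴬ a) s p)) p
      (trans (Re.end-image r) (cong (Maybe.map (_≅_.vert γ)) p)))
    far-end : ∀ b s → end {G = graph G} b s ≡ nothing → ∃ λ x → end b (opposite s) ≡ just x
    far-end (single u) far _ = u , refl
    far-end (single _) near ()
    far-end (pair _ _) near ()
    far-end (pair _ _) far ()
    go : ∀ m → end (∂ᴬ a) s ≡ m → newLabel b t ≡ newLabel a s
    go (just x) p = at-end r p
    go nothing p =
      let x , q = far-end (∂ᴬ a) s p
      in trans (cong (newLabel b) (sym (opposite-involutive t))) (trans (newLabel-opposite b (opposite t))
           (trans (cong reverse (at-end (Re.mates-related r) q)) (trans (sym (newLabel-opposite a (opposite s)))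
             (cong (newLabel a) (opposite-involutive s)))))

  ext-ι : ∀ {γ x y} → ExtRel γ x y → Graph.ι extended y ≡ Maybe.map (_≅_.vert γ) (Graph.ι extended x)
  ext-ι {γ} (old {d}) = _≅_.ι-preserved γ d
  ext-ι (new _ e) = e

  ext-mate : ∀ {γ x y} → ExtRel γ x y → ExtRel γ (Graph.mate extended x) (Graph.mate extended y)
  ext-mate {γ} (old {d}) = subst (λ e → ExtRel γ (inj₁ (G.mate d)) (inj₁ e)) (sym (_≅_.mate-preserved γ d)) old
  ext-mate r@(new _ _) = Between.mates-related r

  ext-colour : ∀ {γ x y} → ExtRel γ x y → Graph.colour extended y ≡ Graph.colour extended x
  ext-colour {γ} (old {d}) = _≅_.colour-preserved γ d
  ext-colour r@(new _ _) = Restriction.colours-equal r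

  ext-label : ∀ {γ x y} → ExtRel γ x y → Graph.label extended y ≡ Graph.label extended x
  ext-label {γ} (old {d}) = _≅_.label-preserved γ d
  ext-label r@(new _ _) = labels-equal r

  record Tracks (γ : Aut (graph G)) (α : Aut (graph G′)) : Set where
    field
      vert-tracks : ∀ y → vert (_≅_.vert α y) ≡ _≅_.vert γ (vert y)
      dart-tracks : ∀ e → ExtRel γ (dart e) (dart (_≅_.dart α e))

  -- An image interior to an atom would be carried by the inverse to a vertex interior to the
  -- preimage of that atom, but it comes from a kept one.
  kept-image : ∀ γ y → ∃ λ y′ → vert y′ ≡ _≅_.vert γ (vert y)
  kept-image γ y = go (kept-or-interior (_≅_.vert γ (vert y)))
    where
    go : (∃ λ y′ → vert y′ ≡ _≅_.vert γ (vert y)) ⊎ (∃ λ b → Interior (atom b) (_≅_.vert γ (vert y))) →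
         ∃ λ y′ → vert y′ ≡ _≅_.vert γ (vert y)
    go (inj₁ p) = p
    go (inj₂ (b , i)) = by (ext-total (inverse γ) (inj₂ (b , near)))
      where
      by : ∃ (ExtRel (inverse γ) (inj₂ (b , near))) → ∃ λ y′ → vert y′ ≡ _≅_.vert γ (vert y)
      by (_ , r@(new {b = a} _ _)) = contradiction
        (subst (Interior (atom a)) (Iso.vert⁻-vert γ (vert y)) (Restriction.interior-into r i)) (vert-kept y a)

  kept-dart-image : ∀ γ e → ∃ λ e′ → ExtRel γ (dart e) (dart e′)
  kept-dart-image γ e = go (dart e) refl
    where
    go : ∀ z → dart e ≡ z → ∃ λ e′ → ExtRel γ (dart e) (dart e′)
    go (inj₂ (a , s)) eq = by (ext-total γ (inj₂ (a , s)))
      where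
      by : ∃ (ExtRel γ (inj₂ (a , s))) → ∃ λ e′ → ExtRel γ (dart e) (dart e′)
      by (inj₂ (b , t) , r) = newDart b t , subst₂ (ExtRel γ) (sym eq) (sym (dart-newDart b t)) r
    go (inj₁ d) eq = by (old-or-in-atom (_≅_.dart γ d))
      where
      by : (∃ λ e′ → dart e′ ≡ inj₁ (_≅_.dart γ d)) ⊎ (∃ λ b → _≅_.dart γ d ∈ Dᴬ b) → ∃ λ e′ → ExtRel γ (dart e) (dart e′)
      by (inj₁ (e′ , eq′)) = e′ , subst₂ (ExtRel γ) (sym eq) (sym eq′) old
      by (inj₂ (b , γd∈)) = back (ext-total (inverse γ) (inj₂ (b , near)))
        where
        back : ∃ (ExtRel (inverse γ) (inj₂ (b , near))) → ∃ λ e′ → ExtRel γ (dart e) (dart e′)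
        back (_ , new {b = a} into _) = contradiction (subst (_∈ Dᴬ a) (Iso.dart⁻-dart γ d) (into γd∈)) (dart-kept a eq)

  ext-injective : ∀ {γ x x′ y} → ExtRel γ x y → ExtRel γ x′ y → x ≡ x′
  ext-injective r r′ = ext-functional (ext-inverse r) (ext-inverse r′)

  induced : ∀ γ → ∃ (Tracks γ)
  induced γ = α , record { vert-tracks = v-spec ; dart-tracks = d-spec }
    where
    v : Fin G′.n → Fin G′.n
    v y = proj₁ (kept-image γ y)
    v-spec : ∀ y → vert (v y) ≡ _≅_.vert γ (vert y)
    v-spec y = proj₂ (kept-image γ y)
    d : Fin G′.m → Fin G′.m
    d e = proj₁ (kept-dart-image γ e)
    d-spec : ∀ e → ExtRel γ (dart e) (dart (d e))
    d-spec e = proj₂ (kept-dart-image γ e)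
    α : Aut (graph G′)
    α = injection⇒automorphism v d
      (λ {y} {y′} p → vert-injective (Iso.vert-injective γ (trans (sym (v-spec y)) (trans (cong vert p) (v-spec y′)))))
      (λ {e} {e′} p → dart-injective (ext-injective (d-spec e) (subst (λ z → ExtRel γ (dart e′) (dart z)) (sym p) (d-spec e′))))
      record
        { ι-preserved = λ e → Maybe.map-injective vert-injective
            (trans (sym (ι-preserved (d e))) (trans (ext-ι (d-spec e)) (trans (cong (Maybe.map (_≅_.vert γ)) (ι-preserved e))
              (trans (sym (Maybe.map-∘ (G′.ι e))) (trans (Maybe.map-cong (λ y → sym (v-spec y)) (G′.ι e)) (Maybe.map-∘ (G′.ι e)))))))
        ; mate-preserved = λ e → dart-injective (trans (dart-mate refl) (ext-functional (ext-mate (d-spec e))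
            (subst (λ z → ExtRel γ z (dart (d (G′.mate e)))) (dart-mate refl) (d-spec (G′.mate e)))))
        ; colour-preserved = λ e → trans (sym (colour-preserved (d e))) (trans (ext-colour (d-spec e)) (colour-preserved e))
        ; label-preserved = λ e → trans (sym (label-preserved (d e))) (trans (ext-label (d-spec e)) (label-preserved e)) }

-- The semiregular group on the reduced graph and its quotient

module QuotientReduction {G G′ : FinGraph} {c : Node (graph G)} {c′ : Node (graph G′)} (R : Reduction G c G′ c′)
  (simple : IsSimple (graph G)) (centre : IsNode (graph G) c)
  (fixed : ∀ α → TransportBack.mapNode (graph G) simple α c ≡ c)
  (H : FinGraph) (isQuotient : IsQuotient (graph G) (graph H)) where

  open Induced R simple centre fixed
  open IsQuotient isQuotient
  open IsSubgroup subgroup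

  private module H = FinGraph H

  module Π = Onto projection

  orbitV : ∀ {x y} → Π.vert x ≡ Π.vert y → OrbitV Γ x y
  orbitV = Equivalence.to (proj₁ fibres _ _)

  orbitV⁻ : ∀ {γ x y} → Γ γ → _≅_.vert γ x ≡ y → Π.vert x ≡ Π.vert y
  orbitV⁻ g p = Equivalence.from (proj₁ fibres _ _) (_ , g , p)

  orbitD : ∀ {d e} → Π.dart d ≡ Π.dart e → OrbitD Γ d e
  orbitD = Equivalence.to (proj₂ fibres _ _)

  orbitD⁻ : ∀ {γ d e} → Γ γ → _≅_.dart γ d ≡ e → Π.dart d ≡ Π.dart e
  orbitD⁻ g p = Equivalence.from (proj₂ fibres _ _) (_ , g , p)

  Γ-inverse : ∀ {γ} → Γ γ → Γ (inverse γ)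
  Γ-inverse {γ} g = let β , b , pv , pd = has-inverses g in respects
    ((λ x → trans (cong (_≅_.vert β) (sym (Iso.vert-vert⁻ γ x))) (pv (Iso.vert⁻ γ x))) ,
     (λ d → trans (cong (_≅_.dart β) (sym (Iso.dart-dart⁻ γ d))) (pd (Iso.dart⁻ γ d)))) b

  ≈-from-quotient : ∀ {γ δ : Aut (graph G)} → inverse δ · γ ≈ identity → γ ≈ δ
  ≈-from-quotient {γ} {δ} (pv , pd) =
    (λ x → trans (sym (Iso.vert-vert⁻ δ (_≅_.vert γ x))) (cong (_≅_.vert δ) (pv x))) ,
    (λ d → trans (sym (Iso.dart-dart⁻ δ (_≅_.dart γ d))) (cong (_≅_.dart δ) (pd d)))

  same-dart : ∀ {γ δ d} → Γ γ → Γ δ → _≅_.dart γ d ≡ _≅_.dart δ d → γ ≈ δ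
  same-dart {γ} {δ} {d} g g′ p = ≈-from-quotient {γ} {δ}
    (proj₁ (proj₂ (semiregular (inverse δ · γ) (has-products (Γ-inverse g′) g))) d
      (trans (cong (Iso.dart⁻ δ) p) (Iso.dart⁻-dart δ d)))

  near-end : ∀ a → ∃ λ x → end (∂ᴬ a) near ≡ just x
  near-end a = go (∂ᴬ a)
    where
    go : ∀ b → ∃ λ x → end {G = graph G} b near ≡ just x
    go (single u) = u , refl
    go (pair u v) = u , refl

  ext-old : ∀ {γ d z} → ExtRel γ (inj₁ d) z → z ≡ inj₁ (_≅_.dart γ d)
  ext-old old = refl

  -- An element that fixes a dart of `e_A` fixes its near end, which always exists, and vertex
  -- stabilisers in Γ are trivial.
  ext-fixed : ∀ {γ z} → Γ γ → ExtRel γ z z → γ ≈ identity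
  ext-fixed {γ} {inj₁ d} g r = proj₁ (proj₂ (semiregular γ g)) d (sym (Sum.inj₁-injective (ext-old r)))
  ext-fixed {γ} {inj₂ (a , s)} g r =
    let x , p = near-end a
        q = Between.end-image (at-near s r)
    in proj₁ (semiregular γ g) x (sym (Maybe.just-injective (trans (sym p) (trans q (cong (Maybe.map (_≅_.vert γ)) p)))))
    where
    at-near : ∀ s → ExtRel γ (inj₂ (a , s)) (inj₂ (a , s)) → ExtRel γ (inj₂ (a , near)) (inj₂ (a , near))
    at-near near r = r
    at-near far r  = Between.mates-related r

  ext-agree : ∀ {γ δ z z′} → Γ γ → Γ δ → ExtRel γ z z′ → ExtRel δ z z′ → γ ≈ δ
  ext-agree {γ} {δ} g g′ r r′ = ≈-from-quotient {γ} {δ}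
    (ext-fixed (has-products (Γ-inverse g′) g) (ext-compose (ext-inverse r′) r))

  ExtOrbit : Ext → Ext → Set
  ExtOrbit z z′ = ∃ λ γ → Γ γ × ExtRel γ z z′

  index-image : ∀ {γ a s b d} → d ∈ Dᴬ a → _≅_.dart γ d ∈ Dᴬ b → ∃ λ t → ExtRel γ (inj₂ (a , s)) (inj₂ (b , t))
  index-image {γ} {a} {s} {b} d∈ γd∈ = go (ext-total γ (inj₂ (a , s)))
    where
    go : ∃ (ExtRel γ (inj₂ (a , s))) → ∃ λ t → ExtRel γ (inj₂ (a , s)) (inj₂ (b , t))
    go (_ , new {b = b′} {t} into e) = t , subst (λ b → ExtRel γ (inj₂ (a , s)) (inj₂ (b , t))) (index-unique (into d∈) γd∈) (new into e)

  -- For new darts, fix a dart `d₀` of the first atom. Its images in the second atom are found by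
  -- comparing projections to H, and by semiregularity each of them comes from one element of Γ
  -- only, so it remains to test that element on the ends.
  extOrbit? : ∀ z z′ → Dec (ExtOrbit z z′)
  extOrbit? (inj₁ d) (inj₁ d′) = map′
    (λ p → let γ , g , q = orbitD p in γ , g , subst (λ e → ExtRel γ (inj₁ d) (inj₁ e)) q old)
    (λ (γ , g , r) → orbitD⁻ g (sym (Sum.inj₁-injective (ext-old r)))) (Π.dart d ≟ Π.dart d′)
  extOrbit? (inj₁ d) (inj₂ _) = no λ { (_ , _ , ()) }
  extOrbit? (inj₂ _) (inj₁ d) = no λ { (_ , _ , ()) }
  extOrbit? (inj₂ (a , s)) (inj₂ (b , t)) = map′ found missed (any? candidate?)
    where
    d₀ = proj₁ (atom-nonempty (atom a))
    d₀∈ = proj₂ (atom-nonempty (atom a))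
    Candidate : Fin G.m → Set
    Candidate d′ = d′ ∈ Dᴬ b × Σ (Π.dart d₀ ≡ Π.dart d′) λ p →
      end (∂ᴬ b) t ≡ Maybe.map (_≅_.vert (proj₁ (orbitD p))) (end (∂ᴬ a) s)
    candidate? : ∀ d′ → Dec (Candidate d′)
    candidate? d′ with d′ ∈? Dᴬ b | Π.dart d₀ ≟ Π.dart d′
    ... | no d′∉ | _ = no λ (d′∈ , _) → d′∉ d′∈
    ... | yes _ | no ¬p = no λ (_ , p , _) → ¬p p
    -- Two proofs of the same equality may yield different elements of Γ, but both send `d₀` to
    -- `d′`, so they agree.
    ... | yes d′∈ | yes p = map′ (λ e → d′∈ , p , e) (λ (_ , p′ , e) → trans e (Maybe.map-cong (λ x →
            proj₁ (same-dart (proj₁ (proj₂ (orbitD p′))) (proj₁ (proj₂ (orbitD p)))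
                     (trans (proj₂ (proj₂ (orbitD p′))) (sym (proj₂ (proj₂ (orbitD p)))))) x) (end (∂ᴬ a) s)))
          (Maybe.≡-dec _≟_ (end (∂ᴬ b) t) (Maybe.map (_≅_.vert (proj₁ (orbitD p))) (end (∂ᴬ a) s)))
    found : ∃ Candidate → ExtOrbit (inj₂ (a , s)) (inj₂ (b , t))
    found (d′ , d′∈ , p , e) = go (orbitD p) e
      where
      go : (o : OrbitD Γ d₀ d′) → end (∂ᴬ b) t ≡ Maybe.map (_≅_.vert (proj₁ o)) (end (∂ᴬ a) s) → ExtOrbit (inj₂ (a , s)) (inj₂ (b , t))
      go (γ , g , q) e = γ , g , new (Between.darts-into (proj₂ (index-image {γ} {a} {s} {b} d₀∈ (subst (_∈ Dᴬ b) (sym q) d′∈)))) e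
    missed : ExtOrbit (inj₂ (a , s)) (inj₂ (b , t)) → ∃ Candidate
    missed (δ , g , new into e) = _≅_.dart δ d₀ , into d₀∈ , p , trans e (Maybe.map-cong agree (end (∂ᴬ a) s))
      where
      p : Π.dart d₀ ≡ Π.dart (_≅_.dart δ d₀)
      p = orbitD⁻ g refl
      agree : ∀ x → _≅_.vert δ x ≡ _≅_.vert (proj₁ (orbitD p)) x
      agree = proj₁ (same-dart g (proj₁ (proj₂ (orbitD p))) (sym (proj₂ (proj₂ (orbitD p)))))

  Γ′ : Aut (graph G′) → Set
  Γ′ α = ∃ λ γ → Γ γ × Tracks γ α

  tracks-≈ : ∀ {γ δ α β} → Tracks γ α → Tracks δ β → γ ≈ δ → α ≈ β
  tracks-≈ {γ} {δ} {α} {β} t t′ eq =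
    (λ y → vert-injective (trans (Tracks.vert-tracks t y) (trans (proj₁ eq (vert y)) (sym (Tracks.vert-tracks t′ y))))) ,
    (λ e → dart-injective (ext-functional (ext-resp {γ} {δ} eq (Tracks.dart-tracks t e)) (Tracks.dart-tracks t′ e)))

  tracks-identity : Tracks identity identity
  tracks-identity = record { vert-tracks = λ _ → refl ; dart-tracks = λ e → ext-identity (dart e) }

  tracks-compose : ∀ {γ δ α β} → Tracks γ α → Tracks δ β → Tracks (γ · δ) (α · β)
  tracks-compose {γ} t t′ = record
    { vert-tracks = λ y → trans (Tracks.vert-tracks t _) (cong (_≅_.vert γ) (Tracks.vert-tracks t′ y))
    ; dart-tracks = λ e → ext-compose (Tracks.dart-tracks t _) (Tracks.dart-tracks t′ e) }

  subgroup′ : IsSubgroup Γ′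
  subgroup′ = record
    { respects = λ { (pv , pd) (γ , g , t) → γ , g , record
        { vert-tracks = λ y → trans (cong vert (sym (pv y))) (Tracks.vert-tracks t y)
        ; dart-tracks = λ e → subst (λ f → ExtRel γ (dart e) (dart f)) (pd e) (Tracks.dart-tracks t e) } }
    ; has-identity = identity , has-identity , tracks-identity
    ; has-products = λ (γ , g , t) (δ , g′ , t′) → γ · δ , has-products g g′ , tracks-compose t t′
    ; has-inverses = λ {α} (γ , g , t) → let β , t′ = induced (inverse γ) in
        β , (inverse γ , Γ-inverse g , t′) , tracks-≈ {α = β · α} {β = identity} (tracks-compose t′ t) tracks-identity
          (Iso.vert⁻-vert γ , Iso.dart⁻-dart γ)
    }

  vert-power : ∀ {a} (τ : Aut ⟦ atom a ⟧) (γ : Aut (graph G)) → (∀ x → proj₁ (_≅_.vert τ x) ≡ _≅_.vert γ (proj₁ x)) →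
               ∀ k x → proj₁ (_≅_.vert (power τ k) x) ≡ _≅_.vert (power γ k) (proj₁ x)
  vert-power τ γ p zero    x = refl
  vert-power τ γ p (suc k) x = trans (p _) (cong (_≅_.vert γ) (vert-power τ γ p k x))

  dart-power : ∀ {a} (τ : Aut ⟦ atom a ⟧) (γ : Aut (graph G)) → (∀ d → proj₁ (_≅_.dart τ d) ≡ _≅_.dart γ (proj₁ d)) →
               ∀ k d → proj₁ (_≅_.dart (power τ k) d) ≡ _≅_.dart (power γ k) (proj₁ d)
  dart-power τ γ p zero    d = refl
  dart-power τ γ p (suc k) d = trans (p _) (cong (_≅_.dart γ) (dart-power τ γ p k d))

  Γ-power : ∀ {γ} → Γ γ → ∀ k → Γ (power γ k)
  Γ-power g zero    = has-identity
  Γ-power g (suc k) = has-products g (Γ-power g k)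

  module Reversal {γ a} (g : Γ γ) (r : ExtRel γ (inj₂ (a , near)) (inj₂ (a , far))) where

    open Restriction r public using (restricted; restricted-∂)

    back : ExtRel γ (inj₂ (a , far)) (inj₂ (a , near))
    back = Between.mates-related r

    is-pair : ∃ λ u → ∃ λ v → ∂ᴬ a ≡ pair u v
    is-pair = go (∂ᴬ a) refl
      where
      go : ∀ b → ∂ᴬ a ≡ b → ∃ λ u → ∃ λ v → ∂ᴬ a ≡ pair u v
      go (pair u v) eq = u , v , eq
      go (single u) eq = case trans (sym (cong (λ b → end b far) eq))
        (trans (Between.end-image r) (cong (λ b → Maybe.map (_≅_.vert γ) (end b near)) eq)) of λ ()

    exchanged-ends : ∀ {u v} → ∂ᴬ a ≡ pair u v → _≅_.vert γ u ≡ v × _≅_.vert γ v ≡ u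
    exchanged-ends eq =
      sym (Maybe.just-injective (trans (sym (cong (λ b → end b far) eq))
        (trans (Between.end-image r) (cong (λ b → Maybe.map (_≅_.vert γ) (end b near)) eq)))) ,
      sym (Maybe.just-injective (trans (sym (cong (λ b → end b near) eq))
        (trans (Between.end-image back) (cong (λ b → Maybe.map (_≅_.vert γ) (end b far)) eq))))

    -- The square of γ fixes a dart of `e_A` and is trivial. Powers of the restriction are
    -- restrictions of powers of γ, which lie in Γ, so semiregularity is inherited.
    halving : IsHalving (atom a) restricted
    halving = record
      { involution = let pv , pd = ext-fixed (has-products g g) (ext-compose back r)
                     in (λ (x , _) → element-≡ (pv x)) , (λ (d , _) → element-≡ (pd d))
      ; semiregular = λ { β (k , bv , bd) → let
            on-v = λ x → trans (cong proj₁ (bv x)) (vert-power restricted γ (λ _ → refl) k x)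
            on-d = λ d → trans (cong proj₁ (bd d)) (dart-power restricted γ (λ _ → refl) k d)
            close : power γ k ≈ identity → β ≈ identity
            close = λ (pv , pd) → (λ x → element-≡ (trans (on-v x) (pv (proj₁ x)))) , (λ d → element-≡ (trans (on-d d) (pd (proj₁ d))))
            sv , sd , sm = semiregular (power γ k) (Γ-power g k)
          in (λ x p → close (sv (proj₁ x) (trans (sym (on-v x)) (cong proj₁ p)))) ,
             (λ d p → close (sd (proj₁ d) (trans (sym (on-d d)) (cong proj₁ p)))) ,
             (λ d l p → close (sm (proj₁ d) l (trans (sym (on-d d)) (cong proj₁ p)))) }
      ; exchanges = let u , v , eq = is-pair ; γu , γv = exchanged-ends eq in
          pair-exchanges (atom a) restricted eq (λ { (_ , _) refl → γu }) (λ { (_ , _) refl → γv }) }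

    -- Every new edge that Γ reverses is therefore halvable, as semiregularity on the reduced graph
    -- demands.
    label-halvable : ∀ s → newLabel a s ≡ halvable
    label-halvable near = let u , v , eq = is-pair in proj₁ (type-pair (atom a) _ eq (types a)) (restricted , halving)
    label-halvable far = trans (newLabel-opposite a near) (cong reverse (label-halvable near))

  semiregular′ : IsSemiregular Γ′
  semiregular′ α (γ , g , t) =
      (λ y p → trivial (proj₁ (semiregular γ g) (vert y) (trans (sym (vert-tracks y)) (cong vert p)))) ,
      (λ e p → trivial (ext-fixed g (subst (ExtRel γ (dart e)) (cong dart p) (dart-tracks e)))) ,
      (λ e l p → trivial (reversed e (dart e) refl l (subst (ExtRel γ (dart e)) (trans (cong dart p) (dart-mate refl)) (dart-tracks e))))
    where
    open Tracks t
    trivial : γ ≈ identity → α ≈ identity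
    trivial = tracks-≈ {γ} {identity} {α} {identity} t tracks-identity
    reversed : ∀ e z → dart e ≡ z → G′.label e ≢ halvable → ExtRel γ (dart e) (Graph.mate extended (dart e)) → γ ≈ identity
    reversed e (inj₁ d) eq l r = proj₂ (proj₂ (semiregular γ g)) d
      (λ p → l (trans (sym (label-preserved e)) (trans (cong (Graph.label extended) eq) p)))
      (sym (Sum.inj₁-injective (ext-old (subst (λ z → ExtRel γ z (Graph.mate extended z)) eq r))))
    reversed e (inj₂ (a , s)) eq l r = contradiction
      (trans (sym (label-preserved e)) (trans (cong (Graph.label extended) eq)
        (Reversal.label-halvable g (from-near s (subst (λ z → ExtRel γ z (Graph.mate extended z)) eq r)) s))) l
      where
      from-near : ∀ s → ExtRel γ (inj₂ (a , s)) (inj₂ (a , opposite s)) → ExtRel γ (inj₂ (a , near)) (inj₂ (a , far))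
      from-near near r = r
      from-near far r = Between.mates-related r

  equivV : IsDecEquivalence λ y z → Π.vert (vert y) ≡ Π.vert (vert z)
  equivV = kernel (Π.vert ∘ vert)

  equivD : IsDecEquivalence λ e f → ExtOrbit (dart e) (dart f)
  equivD = record
    { isEquivalence = record
      { refl = identity , has-identity , ext-identity _
      ; sym = λ (γ , g , r) → inverse γ , Γ-inverse g , ext-inverse r
      ; trans = λ (γ , g , r) (δ , g′ , r′) → δ · γ , has-products g′ g , ext-compose r′ r }
    ; _≟_ = λ e f → extOrbit? (dart e) (dart f) }

  map-class : ∀ {X : Set} {k} (f : X → Fin G.n) (class : X → Fin k) (γ : Fin G.n → Fin G.n) →
    (∀ {x x′} → f x′ ≡ γ (f x) → class x ≡ class x′) → ∀ mx mx′ →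
    Maybe.map f mx′ ≡ Maybe.map γ (Maybe.map f mx) → Maybe.map class mx ≡ Maybe.map class mx′
  map-class f class γ resp nothing nothing _ = refl
  map-class f class γ resp (just x) (just x′) p = cong just (resp (Maybe.just-injective p))

  transV : Transversal λ y z → Π.vert (vert y) ≡ Π.vert (vert z)
  transV = finTransversal equivV

  transD : Transversal λ e f → ExtOrbit (dart e) (dart f)
  transD = finTransversal equivD

  ι-resp : ∀ {e f} → ExtOrbit (dart e) (dart f) →
           Maybe.map (Transversal.class transV) (G′.ι e) ≡ Maybe.map (Transversal.class transV) (G′.ι f)
  ι-resp {e} {f} (γ , g , r) = map-class vert (Transversal.class transV) (_≅_.vert γ)
    (λ p → Equivalence.from (class-≡ equivV transV) (orbitV⁻ g (sym p))) (G′.ι e) (G′.ι f)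
    (trans (sym (ι-preserved f)) (trans (ext-ι r) (cong (Maybe.map (_≅_.vert γ)) (ι-preserved e))))

  mate-resp : ∀ {e f} → ExtOrbit (dart e) (dart f) → ExtOrbit (dart (G′.mate e)) (dart (G′.mate f))
  mate-resp (γ , g , r) = γ , g , subst₂ (ExtRel γ) (sym (dart-mate refl)) (sym (dart-mate refl)) (ext-mate r)

  colour-resp : ∀ {e f} → ExtOrbit (dart e) (dart f) → G′.colour e ≡ G′.colour f
  colour-resp {e} {f} (_ , _ , r) = trans (sym (colour-preserved e)) (trans (sym (ext-colour r)) (colour-preserved f))

  label-resp : ∀ {e f} → ExtOrbit (dart e) (dart f) → G′.label e ≡ G′.label f
  label-resp {e} {f} (_ , _ , r) = trans (sym (label-preserved e)) (trans (sym (ext-label r)) (label-preserved f))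

  module Q′ = QuotientGraph (graph G′) G′.isGraph equivV equivD transV transD ι-resp mate-resp colour-resp label-resp

  H′ : FinGraph
  H′ = Q′.quotient

  isQuotient′ : IsQuotient (graph G′) (graph H′)
  isQuotient′ = record
    { Γ = Γ′ ; subgroup = subgroup′ ; semiregular = semiregular′ ; projection = Q′.onto
    ; fibres = (λ y z → mk⇔ (λ p → inducedV (Equivalence.to (class-≡ equivV transV) p))
                            (λ (α , (γ , g , t) , p) → Equivalence.from (class-≡ equivV transV)
                               (orbitV⁻ g (trans (sym (Tracks.vert-tracks t y)) (cong vert p))))) ,
               (λ e f → mk⇔ (λ p → inducedD (Equivalence.to (class-≡ equivD transD) p))
                            (λ (α , (γ , g , t) , p) → Equivalence.from (class-≡ equivD transD)
                               (γ , g , subst (λ f → ExtRel γ (dart e) (dart f)) p (Tracks.dart-tracks t e)))) }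
    where
    inducedV : ∀ {y z} → Π.vert (vert y) ≡ Π.vert (vert z) → OrbitV Γ′ y z
    inducedV {y} p = let γ , g , q = orbitV p ; α , t = induced γ
                     in α , (γ , g , t) , vert-injective (trans (Tracks.vert-tracks t y) q)
    inducedD : ∀ {e f} → ExtOrbit (dart e) (dart f) → OrbitD Γ′ e f
    inducedD {e} (γ , g , r) = let α , t = induced γ
                               in α , (γ , g , t) , dart-injective (ext-functional (Tracks.dart-tracks t e) r)

module _ {n m : ℕ} {G : Graph (Fin n) (Fin m)} where

  sideOf-end : ∀ (b : Boundary G) {x s} → sideOf b x ≡ just s → end b s ≡ just x
  sideOf-end (single u) {x} p with x ≟ u
  sideOf-end (single u) refl | yes refl = refl
  sideOf-end (pair u v) {x} p with x ≟ u | x ≟ v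
  sideOf-end (pair u v) refl | yes refl | _ = refl
  sideOf-end (pair u v) refl | no _ | yes refl = refl

  sideOf-boundary : ∀ (b : Boundary G) {x} → _∈∂_ G x b → ∃ λ s → sideOf b x ≡ just s
  sideOf-boundary (single u) {x} x∈ with x ≟ u
  ... | yes _ = near , refl
  ... | no x≢ = contradiction x∈ x≢
  sideOf-boundary (pair u v) {x} x∈ with x ≟ u | x ≟ v
  ... | yes _ | _ = near , refl
  ... | no _ | yes _ = far , refl
  ... | no x≢u | no x≢v = contradiction x∈ Sum.[ x≢u , x≢v ]

  sideOf-interior : ∀ (b : Boundary G) {x} → ¬ _∈∂_ G x b → sideOf b x ≡ nothing
  sideOf-interior b {x} x∉ = go (sideOf b x) refl
    where
    go : ∀ m → sideOf b x ≡ m → sideOf b x ≡ nothing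
    go nothing p = p
    go (just s) p = contradiction (end⇒∈∂ b s (sideOf-end b p)) x∉

-- The replacement of the edges p(e_A)

module Assembly {G G′ : FinGraph} {c : Node (graph G)} {c′ : Node (graph G′)} (R : Reduction G c G′ c′)
  (simple : IsSimple (graph G)) (centre : IsNode (graph G) c)
  (fixed : ∀ α → TransportBack.mapNode (graph G) simple α c ≡ c)
  (H : FinGraph) (isQuotient : IsQuotient (graph G) (graph H)) where

  open Induced R simple centre fixed
  open QuotientReduction R simple centre fixed H isQuotient
  open IsQuotient isQuotient using (Γ; subgroup)
  open IsSubgroup subgroup

  private
    module H  = FinGraph H
    module H′ = FinGraph H′

  p : Onto (graph G′) (graph H′)
  p = Q′.onto

  module p = Onto p
  module p-preserves = Preserves p.preserves
  module Π-preserves = Preserves Π.preserves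

  edgeImage : Fin size → Side → Fin H′.m
  edgeImage a s = p.dart (newDart a s)

  p-vert : ∀ {y z} → p.vert y ≡ p.vert z ⇔ Π.vert (vert y) ≡ Π.vert (vert z)
  p-vert = class-≡ equivV transV

  p-dart : ∀ {e f} → p.dart e ≡ p.dart f ⇔ ExtOrbit (dart e) (dart f)
  p-dart = class-≡ equivD transD

  image-≡ : ∀ {a s b t} → edgeImage a s ≡ edgeImage b t ⇔ ExtOrbit (inj₂ (a , s)) (inj₂ (b , t))
  image-≡ {a} {s} {b} {t} = mk⇔
    (λ q → subst₂ ExtOrbit (dart-newDart a s) (dart-newDart b t) (Equivalence.to p-dart q))
    (λ o → Equivalence.from p-dart (subst₂ ExtOrbit (sym (dart-newDart a s)) (sym (dart-newDart b t)) o))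

  image-opposite : ∀ {a s b t} → edgeImage a s ≡ edgeImage b t → edgeImage a (opposite s) ≡ edgeImage b (opposite t)
  image-opposite q = let γ , g , r = Equivalence.to image-≡ q in Equivalence.from image-≡ (γ , g , Between.mates-related r)

  mate-image : ∀ a s → H′.mate (edgeImage a s) ≡ edgeImage a (opposite s)
  mate-image a s = trans (p-preserves.mate-preserved (newDart a s))
    (cong p.dart (new-unique (dart-mate (dart-newDart a s))))

  SameEdge : Fin size → Fin size → Set
  SameEdge a b = ∃ λ s → ∃ λ t → edgeImage a s ≡ edgeImage b t

  sameEdge-at : ∀ {a b} → SameEdge a b → ∀ s → ∃ λ t → edgeImage a s ≡ edgeImage b t
  sameEdge-at (s₀ , t , q) s with same-or-opposite s₀ s
  ... | inj₁ refl = t , q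
  ... | inj₂ refl = opposite t , image-opposite q

  sameEdge-equivalence : IsDecEquivalence SameEdge
  sameEdge-equivalence = record
    { isEquivalence = record
      { refl = near , near , refl
      ; sym = λ (s , t , q) → t , s , sym q
      ; trans = λ (s , t , q) o → let r , q′ = sameEdge-at o t in s , r , trans q q′ }
    ; _≟_ = λ a b → map′
        (Sum.[ (λ q → near , near , q) , (λ q → near , far , q) ])
        (λ o → let t , q = sameEdge-at o near in by t q)
        ((edgeImage a near ≟ edgeImage b near) ⊎-dec (edgeImage a near ≟ edgeImage b far)) }
    where
    by : ∀ {a b} t → edgeImage a near ≡ edgeImage b t → edgeImage a near ≡ edgeImage b near ⊎ edgeImage a near ≡ edgeImage b far
    by near q = inj₁ q
    by far q  = inj₂ q

  module Edges = Transversal (finTransversal sameEdge-equivalence)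

  atom-isGraph : ∀ a → IsGraph ⟦ atom a ⟧
  atom-isGraph a = record
    { mate-involutive = λ (d , _) → element-≡ (IsGraph.mate-involutive G.isGraph d)
    ; colour-mate = λ (d , _) → IsGraph.colour-mate G.isGraph d
    ; label-mate = λ (d , _) → IsGraph.label-mate G.isGraph d }

  module AtomQuotient (a : Fin size) where

    equiv-v : IsDecEquivalence λ (x y : VertexOf (atom a)) → Π.vert (proj₁ x) ≡ Π.vert (proj₁ y)
    equiv-v = kernel (Π.vert ∘ proj₁)

    equiv-d : IsDecEquivalence λ (d e : DartOf (atom a)) → Π.dart (proj₁ d) ≡ Π.dart (proj₁ e)
    equiv-d = kernel (Π.dart ∘ proj₁)

    trans-v : Transversal λ (x y : VertexOf (atom a)) → Π.vert (proj₁ x) ≡ Π.vert (proj₁ y)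
    trans-v = subsetTransversal equiv-v

    trans-d : Transversal λ (d e : DartOf (atom a)) → Π.dart (proj₁ d) ≡ Π.dart (proj₁ e)
    trans-d = subsetTransversal equiv-d

    inner-ι-resp : ∀ {d e : DartOf (atom a)} → Π.dart (proj₁ d) ≡ Π.dart (proj₁ e) →
             Maybe.map (Transversal.class trans-v) (Graph.ι ⟦ atom a ⟧ d) ≡ Maybe.map (Transversal.class trans-v) (Graph.ι ⟦ atom a ⟧ e)
    inner-ι-resp {d} {e} q = let γ , g , γd = orbitD q in map-class proj₁ (Transversal.class trans-v) (_≅_.vert γ)
      (λ r → Equivalence.from (class-≡ equiv-v trans-v) (orbitV⁻ g (sym r))) (Graph.ι ⟦ atom a ⟧ d) (Graph.ι ⟦ atom a ⟧ e)
      (trans (ι-inside a e) (trans (cong G.ι (sym γd)) (trans (_≅_.ι-preserved γ (proj₁ d))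
        (cong (Maybe.map (_≅_.vert γ)) (sym (ι-inside a d))))))

    inner-mate-resp : ∀ {d e : DartOf (atom a)} → Π.dart (proj₁ d) ≡ Π.dart (proj₁ e) →
                Π.dart (G.mate (proj₁ d)) ≡ Π.dart (G.mate (proj₁ e))
    inner-mate-resp q = trans (sym (Π-preserves.mate-preserved _)) (trans (cong H.mate q) (Π-preserves.mate-preserved _))

    inner-colour-resp : ∀ {d e : DartOf (atom a)} → Π.dart (proj₁ d) ≡ Π.dart (proj₁ e) → G.colour (proj₁ d) ≡ G.colour (proj₁ e)
    inner-colour-resp q = trans (sym (Π-preserves.colour-preserved _)) (trans (cong H.colour q) (Π-preserves.colour-preserved _))

    inner-label-resp : ∀ {d e : DartOf (atom a)} → Π.dart (proj₁ d) ≡ Π.dart (proj₁ e) → G.label (proj₁ d) ≡ G.label (proj₁ e)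
    inner-label-resp q = trans (sym (Π-preserves.label-preserved _)) (trans (cong H.label q) (Π-preserves.label-preserved _))

    module Q = QuotientGraph ⟦ atom a ⟧ (atom-isGraph a) equiv-v equiv-d trans-v trans-d
      (λ {d} {e} → inner-ι-resp {d} {e}) (λ {d} {e} → inner-mate-resp {d} {e}) (λ {d} {e} → inner-colour-resp {d} {e}) (λ {d} {e} → inner-label-resp {d} {e})

    -- In all cases the quotient of A identifies what `Π` identifies. Whether this is an edge-,
    -- loop- or half-quotient is determined afterwards in `prescribed`.
    π : Onto ⟦ atom a ⟧ (graph Q.quotient)
    π = Q.onto

    π-vert : ∀ {x y} → Onto.vert π x ≡ Onto.vert π y ⇔ Π.vert (proj₁ x) ≡ Π.vert (proj₁ y)
    π-vert = class-≡ equiv-v trans-v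

    π-dart : ∀ {d e} → Onto.dart π d ≡ Onto.dart π e ⇔ Π.dart (proj₁ d) ≡ Π.dart (proj₁ e)
    π-dart = class-≡ equiv-d trans-d

    Stabiliser : Aut (graph G) → Set
    Stabiliser γ = ∃ λ t → ExtRel γ (inj₂ (a , near)) (inj₂ (a , t))

    dart-stabiliser : ∀ {γ d} → d ∈ Dᴬ a → _≅_.dart γ d ∈ Dᴬ a → Stabiliser γ
    dart-stabiliser = index-image

    interior-stabiliser : ∀ {γ x} → Interior (atom a) x → _≅_.vert γ x ∈ Vᴬ a → Stabiliser γ
    interior-stabiliser {γ} {x} i γx∈ = go (ext-total γ (inj₂ (a , near)))
      where
      go : ∃ (ExtRel γ (inj₂ (a , near))) → Stabiliser γ
      go (_ , r@(new {b = b} {t} _ _)) = t , subst (λ b → ExtRel γ (inj₂ (a , near)) (inj₂ (b , t)))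
        (interior-index (Restriction.interior-into r i) γx∈) r

    -- Boundary vertices are kept, and kept vertices are moved to kept ones, which are not interior
    -- to any atom.
    boundary-stays : ∀ {γ x} → OnBoundary (atom a) x → _≅_.vert γ x ∈ Vᴬ a → OnBoundary (atom a) (_≅_.vert γ x)
    boundary-stays {γ} {x} x∈ γx∈ = go (interior-or-kept {a} γx∈)
      where
      go : Interior (atom a) (_≅_.vert γ x) ⊎ OnBoundary (atom a) (_≅_.vert γ x) → OnBoundary (atom a) (_≅_.vert γ x)
      go (inj₂ b) = b
      go (inj₁ i) = let y , vy = boundary-kept {a} x∈
                        y′ , vy′ = kept-image γ y
                    in contradiction (subst (Interior (atom a)) (sym (trans vy′ (cong (_≅_.vert γ) vy))) i) (vert-kept y′ a)

    module Whole (¬half : edgeImage a near ≢ edgeImage a far) where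

      stabiliser-trivial : ∀ {γ} → Γ γ → Stabiliser γ → γ ≈ identity
      stabiliser-trivial g (near , r) = ext-fixed g r
      stabiliser-trivial g (far , r)  = contradiction (Equivalence.from image-≡ (_ , g , r)) ¬half

      dart-fibres : ∀ d e → Onto.dart π d ≡ Onto.dart π e ⇔ d ≡ e
      dart-fibres d e = mk⇔ (λ q → by (orbitD (Equivalence.to π-dart q))) (cong (Onto.dart π))
        where
        by : OrbitD Γ (proj₁ d) (proj₁ e) → d ≡ e
        by (γ , g , γd) = element-≡ (trans (sym (proj₂ (stabiliser-trivial g
          (dart-stabiliser (proj₂ d) (subst (_∈ Dᴬ a) (sym γd) (proj₂ e)))) (proj₁ d))) γd)

      -- An element that moves an interior vertex of A to a vertex of A stabilises A and is trivial
      -- here. A boundary vertex may belong to several atoms, so its identification with the other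
      -- one may come from an element that moves A away.
      vertex-fibres : ∀ x y → Π.vert (proj₁ x) ≡ Π.vert (proj₁ y) →
                      x ≡ y ⊎ (OnBoundary (atom a) (proj₁ x) × OnBoundary (atom a) (proj₁ y))
      vertex-fibres x y q = by (orbitV q) (interior-or-kept {a} (proj₂ x))
        where
        by : OrbitV Γ (proj₁ x) (proj₁ y) → Interior (atom a) (proj₁ x) ⊎ OnBoundary (atom a) (proj₁ x) →
             x ≡ y ⊎ (OnBoundary (atom a) (proj₁ x) × OnBoundary (atom a) (proj₁ y))
        by (γ , g , γx) (inj₁ i) = inj₁ (element-≡ (trans (sym (proj₁ (stabiliser-trivial g
          (interior-stabiliser i (subst (_∈ Vᴬ a) (sym γx) (proj₂ y)))) (proj₁ x))) γx))
        by (γ , g , γx) (inj₂ b) = inj₂ (b , subst (OnBoundary (atom a)) γx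
          (boundary-stays {γ} b (subst (_∈ Vᴬ a) (sym γx) (proj₂ y))))

    image-ι : ∀ s {x} → end (∂ᴬ a) s ≡ just x → ∃ λ y → vert y ≡ x × H′.ι (edgeImage a s) ≡ just (p.vert y)
    image-ι s {x} e =
      let y , vy , ιy = end-kept {newDart a s} (trans (cong (Graph.ι extended) (dart-newDart a s)) e)
      in y , vy , trans (p-preserves.ι-preserved (newDart a s)) (cong (Maybe.map p.vert) ιy)

    ends-identified : ∀ s t {x y} → end (∂ᴬ a) s ≡ just x → end (∂ᴬ a) t ≡ just y →
                      Π.vert x ≡ Π.vert y ⇔ H′.ι (edgeImage a s) ≡ H′.ι (edgeImage a t)
    ends-identified s t e e′ = go (image-ι s e) (image-ι t e′)
      where
      go : ∀ {x y} → (∃ λ z → vert z ≡ x × H′.ι (edgeImage a s) ≡ just (p.vert z)) →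
           (∃ λ z → vert z ≡ y × H′.ι (edgeImage a t) ≡ just (p.vert z)) → Π.vert x ≡ Π.vert y ⇔ H′.ι (edgeImage a s) ≡ H′.ι (edgeImage a t)
      go (z , refl , q) (z′ , refl , q′) = mk⇔
        (λ eq → trans q (trans (cong just (Equivalence.from p-vert eq)) (sym q′)))
        (λ eq → Equivalence.to p-vert (Maybe.just-injective (trans (sym q) (trans eq q′))))

    prescribed-edge : edgeImage a near ≢ edgeImage a far → H′.ι (edgeImage a near) ≢ H′.ι (edgeImage a far) → IsEdgeQuotient (atom a) π
    prescribed-edge ¬half distinct-ends =
      (λ x y → mk⇔ (λ q → by x y (Equivalence.to π-vert q) (W.vertex-fibres x y (Equivalence.to π-vert q))) (cong (Onto.vert π))) ,
      W.dart-fibres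
      where
      module W = Whole ¬half
      equal-ends : ∀ {x y} s t → end (∂ᴬ a) s ≡ just x → end (∂ᴬ a) t ≡ just y → Π.vert x ≡ Π.vert y → x ≡ y
      equal-ends near near e e′ _ = Maybe.just-injective (trans (sym e) e′)
      equal-ends far far e e′ _   = Maybe.just-injective (trans (sym e) e′)
      equal-ends near far e e′ q  = contradiction (Equivalence.to (ends-identified near far e e′) q) distinct-ends
      equal-ends far near e e′ q  = contradiction (sym (Equivalence.to (ends-identified far near e e′) q)) distinct-ends
      by : ∀ x y → Π.vert (proj₁ x) ≡ Π.vert (proj₁ y) →
           x ≡ y ⊎ (OnBoundary (atom a) (proj₁ x) × OnBoundary (atom a) (proj₁ y)) → x ≡ y
      by x y q (inj₁ eq) = eq
      by x y q (inj₂ (b , b′)) = let s , e = ∈∂⇒end (∂ᴬ a) b ; t , e′ = ∈∂⇒end (∂ᴬ a) b′ in element-≡ (equal-ends s t e e′ q)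

    prescribed-loop : edgeImage a near ≢ edgeImage a far → H′.ι (edgeImage a near) ≡ H′.ι (edgeImage a far) → IsLoopQuotient (atom a) π
    prescribed-loop ¬half equal-ends =
      (λ x y → mk⇔ (λ q → W.vertex-fibres x y (Equivalence.to π-vert q)) (λ o → Equivalence.from π-vert (by o))) , W.dart-fibres
      where
      module W = Whole ¬half
      all-equal : ∀ s t → H′.ι (edgeImage a s) ≡ H′.ι (edgeImage a t)
      all-equal near near = refl
      all-equal far far   = refl
      all-equal near far  = equal-ends
      all-equal far near  = sym equal-ends
      by : ∀ {x y : VertexOf (atom a)} → x ≡ y ⊎ (OnBoundary (atom a) (proj₁ x) × OnBoundary (atom a) (proj₁ y)) → Π.vert (proj₁ x) ≡ Π.vert (proj₁ y)
      by (inj₁ refl) = refl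
      by (inj₂ (b , b′)) = let s , e = ∈∂⇒end (∂ᴬ a) b ; t , e′ = ∈∂⇒end (∂ᴬ a) b′
                           in Equivalence.from (ends-identified s t e e′) (all-equal s t)

    module Half {γ} (g : Γ γ) (r : ExtRel γ (inj₂ (a , near)) (inj₂ (a , far))) where

      open Reversal g r

      stabiliser-power : ∀ {δ} → Γ δ → Stabiliser δ → ∃ λ k → δ ≈ power γ k
      stabiliser-power d (near , q) = 0 , ext-fixed d q
      stabiliser-power d (far , q)  = 1 , ext-agree d g q r

      orbit-v : ∀ {x y k} → _≅_.vert (power γ k) (proj₁ x) ≡ proj₁ y → OrbitV ⟨ restricted ⟩ x y
      orbit-v {x} {y} {k} q = power restricted k , (k , (λ _ → refl) , (λ _ → refl)) ,
        element-≡ (trans (vert-power restricted γ (λ _ → refl) k x) q)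

      -- The stabiliser of A in Γ consists of the identity and γ, so on darts and interior vertices
      -- the orbits of Γ are those of the halving.
      half-quotient : IsHalfQuotient (atom a) π
      half-quotient = restricted , halving ,
        (λ x y → mk⇔ (λ q → to-v x y (orbitV (Equivalence.to π-vert q)) (interior-or-kept {a} (proj₂ x)))
                     (λ { (β , (k , bv , _) , q) → Equivalence.from π-vert (orbitV⁻ (Γ-power g k)
                          (trans (sym (trans (cong proj₁ (bv x)) (vert-power restricted γ (λ _ → refl) k x))) (cong proj₁ q))) })) ,
        (λ d e → mk⇔ (λ q → to-d d e (orbitD (Equivalence.to π-dart q)))
                     (λ { (β , (k , _ , bd) , q) → Equivalence.from π-dart (orbitD⁻ (Γ-power g k)
                          (trans (sym (trans (cong proj₁ (bd d)) (dart-power restricted γ (λ _ → refl) k d))) (cong proj₁ q))) }))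
        where
        to-d : ∀ d e → OrbitD Γ (proj₁ d) (proj₁ e) → OrbitD ⟨ restricted ⟩ d e
        to-d d e (δ , h , δd) =
          let k , _ , pd = stabiliser-power h (dart-stabiliser (proj₂ d) (subst (_∈ Dᴬ a) (sym δd) (proj₂ e)))
          in power restricted k , (k , (λ _ → refl) , (λ _ → refl)) ,
             element-≡ (trans (dart-power restricted γ (λ _ → refl) k d) (trans (sym (pd (proj₁ d))) δd))
        to-v : ∀ x y → OrbitV Γ (proj₁ x) (proj₁ y) → Interior (atom a) (proj₁ x) ⊎ OnBoundary (atom a) (proj₁ x) →
               OrbitV ⟨ restricted ⟩ x y
        to-v x y (δ , h , δx) (inj₁ i) =
          let k , pv , _ = stabiliser-power h (interior-stabiliser i (subst (_∈ Vᴬ a) (sym δx) (proj₂ y)))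
          in orbit-v {x} {y} {k} (trans (sym (pv (proj₁ x))) δx)
        -- Here δ need not stabilise A, but x and y are both among the two boundary vertices, which
        -- γ exchanges.
        to-v x y (δ , h , δx) (inj₂ b) =
          let u , v , eq = is-pair
              γu , γv = exchanged-ends eq
          in on-pair eq γu γv (subst (_∈∂_ (graph G) (proj₁ x)) eq b)
               (subst (_∈∂_ (graph G) (proj₁ y)) eq (subst (OnBoundary (atom a)) δx
                 (boundary-stays {δ} b (subst (_∈ Vᴬ a) (sym δx) (proj₂ y)))))
          where
          on-pair : ∀ {u v} → ∂ᴬ a ≡ pair u v → _≅_.vert γ u ≡ v → _≅_.vert γ v ≡ u →
                    proj₁ x ≡ u ⊎ proj₁ x ≡ v → proj₁ y ≡ u ⊎ proj₁ y ≡ v → OrbitV ⟨ restricted ⟩ x y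
          on-pair _ γu γv (inj₁ q) (inj₁ q′) = orbit-v {x} {y} {0} (trans q (sym q′))
          on-pair _ γu γv (inj₂ q) (inj₂ q′) = orbit-v {x} {y} {0} (trans q (sym q′))
          on-pair _ γu γv (inj₁ q) (inj₂ q′) = orbit-v {x} {y} {1} (trans (cong (_≅_.vert γ) q) (trans γu (sym q′)))
          on-pair _ γu γv (inj₂ q) (inj₁ q′) = orbit-v {x} {y} {1} (trans (cong (_≅_.vert γ) q) (trans γv (sym q′)))

    -- A half-edge arises exactly when an element of Γ reverses `e_A`. A pendant edge falls under
    -- the last case, since its far dart has no end.
    prescribed : Prescribed (atom a) π (graph H′) (edgeImage a near)
    prescribed = go (edgeImage a near ≟ edgeImage a far) (Maybe.≡-dec _≟_ (H′.ι (edgeImage a near)) (H′.ι (edgeImage a far)))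
      where
      mate-far : H′.mate (edgeImage a near) ≡ edgeImage a far
      mate-far = mate-image a near
      go : Dec (edgeImage a near ≡ edgeImage a far) → Dec (H′.ι (edgeImage a near) ≡ H′.ι (edgeImage a far)) → Prescribed (atom a) π (graph H′) (edgeImage a near)
      go (yes q) _ = let γ , g , r = Equivalence.to image-≡ q
                     in half-edge (trans mate-far (sym q)) (Half.half-quotient g r)
      go (no ¬q) (yes e) = loop (λ q → ¬q (sym (trans (sym mate-far) q))) (trans e (cong H′.ι (sym mate-far))) (prescribed-loop ¬q e)
      go (no ¬q) (no ¬e) = edge (λ q → ¬q (sym (trans (sym mate-far) q))) (λ e → ¬e (trans e (cong H′.ι mate-far))) (prescribed-edge ¬q ¬e)

    attached : Fin G.n → Maybe (Fin H′.n)
    attached x = sideOf (∂ᴬ a) x >>= λ s → H′.ι (edgeImage a s)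

    attached-boundary : ∀ {x} → OnBoundary (atom a) x → ∃ λ y → vert y ≡ x × attached x ≡ just (p.vert y)
    attached-boundary {x} x∈ =
      let s , q = sideOf-boundary (∂ᴬ a) x∈
          y , vy , ιy = image-ι s (sideOf-end (∂ᴬ a) q)
      in y , vy , trans (cong (_>>= λ s → H′.ι (edgeImage a s)) q) ιy

    attached-interior : ∀ {x} → Interior (atom a) x → attached x ≡ nothing
    attached-interior (_ , x∉) = cong (_>>= λ s → H′.ι (edgeImage a s)) (sideOf-interior (∂ᴬ a) x∉)

    attached-resp : ∀ (x y : VertexOf (atom a)) → Π.vert (proj₁ x) ≡ Π.vert (proj₁ y) → attached (proj₁ x) ≡ attached (proj₁ y)
    attached-resp x y q = go (interior-or-kept {a} (proj₂ x)) (interior-or-kept {a} (proj₂ y))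
      where
      mixed : ∀ {x y} → y ∈ Vᴬ a → Interior (atom a) y → OnBoundary (atom a) x → Π.vert x ≡ Π.vert y → ⊥
      mixed y∈ (_ , y∉) b q = let γ , g , γx = orbitV q
        in y∉ (subst (OnBoundary (atom a)) γx (boundary-stays {γ} b (subst (_∈ Vᴬ a) (sym γx) y∈)))
      go : Interior (atom a) (proj₁ x) ⊎ OnBoundary (atom a) (proj₁ x) → Interior (atom a) (proj₁ y) ⊎ OnBoundary (atom a) (proj₁ y) →
           attached (proj₁ x) ≡ attached (proj₁ y)
      go (inj₁ i) (inj₁ j) = trans (attached-interior i) (sym (attached-interior j))
      go (inj₁ i) (inj₂ b) = contradiction (mixed (proj₂ x) i b (sym q)) id
      go (inj₂ b) (inj₁ j) = contradiction (mixed (proj₂ y) j b q) id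
      go (inj₂ b) (inj₂ b′) = by (attached-boundary b) (attached-boundary b′)
        where
        by : (∃ λ z → vert z ≡ proj₁ x × attached (proj₁ x) ≡ just (p.vert z)) →
             (∃ λ z → vert z ≡ proj₁ y × attached (proj₁ y) ≡ just (p.vert z)) → attached (proj₁ x) ≡ attached (proj₁ y)
        by (z , vz , e) (z′ , vz′ , e′) = trans e (trans (cong just (Equivalence.from p-vert
          (trans (cong Π.vert vz) (trans q (cong Π.vert (sym vz′)))))) (sym e′))

  module AQ (j : Fin Edges.size) = AtomQuotient (Edges.rep j)

  quotients : AtomQuotients R H′ p
  quotients = record
    { count = Edges.size
    ; rep = Edges.rep
    ; every = λ a s → let t , q = sameEdge-at (Edges.class-spec a) s in Edges.class a , t , sym q
    ; once = λ i j s t q → Edges.separate i j (s , t , q)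
    ; Q = λ j → AQ.Q.quotient j
    ; π = λ j → AQ.π j
    ; prescribed = λ j → AQ.prescribed j
    -- The attachment is read off at a representative; `attached-resp` makes it independent of the
    -- choice.
    ; glue = λ j i → AQ.attached j (proj₁ (Transversal.rep (AQ.trans-v j) i))
    ; glue-spec = λ j x → AQ.attached-resp j (Transversal.rep (AQ.trans-v j) (Onto.vert (AQ.π j) x)) x (sym (Transversal.class-spec (AQ.trans-v j) x)) }

  open AtomQuotients quotients using (GluedV; GluedD; glued; LiveV; LiveD; place; glue; glue-spec; rep; every; once; count)

  -- Relates elements of the glued graph and of H that have a common preimage in G. Boundary
  -- vertices of the copies are left out, as they are glued and not live. Shown to be total,
  -- functional and injective, the relation yields the isomorphism of H with the live part.
  RepV : GluedV → Fin H.n → Set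
  RepV (inj₁ h) y = ∃ λ z → p.vert z ≡ h × Π.vert (vert z) ≡ y
  RepV (inj₂ (j , i)) y = ∃ λ x → Interior (atom (rep j)) (proj₁ x) × Onto.vert (AQ.π j) x ≡ i × Π.vert (proj₁ x) ≡ y

  RepD : GluedD → Fin H.m → Set
  RepD (inj₁ e) y = ∃ λ f → ∃ λ d → p.dart f ≡ e × dart f ≡ inj₁ d × Π.dart d ≡ y
  RepD (inj₂ (j , i)) y = ∃ λ δ → Onto.dart (AQ.π j) δ ≡ i × Π.dart (proj₁ δ) ≡ y

  moves-to-rep : ∀ a → ∃ λ j → ∃ λ t → ∃ λ γ → Γ γ × ExtRel γ (inj₂ (a , near)) (inj₂ (rep j , t))
  moves-to-rep a = let j , t , q = every a near
                       γ , g , r = Equivalence.to image-≡ (sym q)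
                   in j , t , γ , g , r

  repV-total : ∀ y → ∃ λ g → RepV g y
  repV-total y = let x , q = Π.vert-onto y in go x q (kept-or-interior x)
    where
    go : ∀ x → Π.vert x ≡ y → (∃ λ z → vert z ≡ x) ⊎ (∃ λ a → Interior (atom a) x) → ∃ λ g → RepV g y
    go x q (inj₁ (z , refl)) = inj₁ (p.vert z) , z , refl , q
    go x q (inj₂ (a , i)) =
      let j , t , γ , g , r = moves-to-rep a
          i′ = Restriction.interior-into r i
      in inj₂ (j , _) , (_≅_.vert γ x , proj₁ i′) , i′ , refl , trans (sym (orbitV⁻ g refl)) q

  repD-total : ∀ y → ∃ λ g → RepD g y
  repD-total y = let d , q = Π.dart-onto y in go d q (old-or-in-atom d)
    where
    go : ∀ d → Π.dart d ≡ y → (∃ λ e → dart e ≡ inj₁ d) ⊎ (∃ λ a → d ∈ Dᴬ a) → ∃ λ g → RepD g y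
    go d q (inj₁ (e , eq)) = inj₁ (p.dart e) , e , d , refl , eq , q
    go d q (inj₂ (a , d∈)) =
      let j , t , γ , g , r = moves-to-rep a
      in inj₂ (j , _) , (_≅_.dart γ d , Between.darts-into r d∈) , refl , trans (sym (orbitD⁻ g refl)) q

  -- Γ moves kept vertices to kept vertices.
  kept≠interior : ∀ {z a x} → Interior (atom a) x → Π.vert (vert z) ≡ Π.vert x → ⊥
  kept≠interior {z} {a} i q = let γ , g , γz = orbitV q
                                  z′ , vz′ = kept-image γ z
                              in vert-kept z′ a (subst (Interior (atom a)) (sym (trans vz′ γz)) i)

  rep-unique : ∀ {γ j k t} → Γ γ → ExtRel γ (inj₂ (rep j , near)) (inj₂ (rep k , t)) → j ≡ k
  rep-unique {γ} {j} {k} {t} g r = once j k near t (Equivalence.from image-≡ (γ , g , r))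

  -- An element carrying an interior vertex of one chosen atom to one of another carries the first
  -- atom to the second. One atom is chosen for each replaced edge of H′, so the two coincide.
  repV-functional : ∀ g g′ {y} → RepV g y → RepV g′ y → g ≡ g′
  repV-functional (inj₁ h) (inj₁ h′) (z , refl , q) (z′ , refl , q′) = cong inj₁ (Equivalence.from p-vert (trans q (sym q′)))
  repV-functional (inj₁ h) (inj₂ _) (z , _ , q) (x , i , _ , q′) = contradiction (kept≠interior i (trans q (sym q′))) id
  repV-functional (inj₂ _) (inj₁ h) (x , i , _ , q) (z , _ , q′) = contradiction (kept≠interior i (trans q′ (sym q))) id
  repV-functional (inj₂ (j , i)) (inj₂ (k , i′)) (x , x-in , eq , q) (x′ , x′-in , eq′ , q′) = go (orbitV (trans q (sym q′)))
    where
    same : j ≡ k → inj₂ (j , i) ≡ inj₂ (k , i′)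
    same refl = cong (λ i → inj₂ (j , i)) (trans (sym eq) (trans (Equivalence.from (AQ.π-vert j {x} {x′}) (trans q (sym q′))) eq′))
    go : OrbitV Γ (proj₁ x) (proj₁ x′) → inj₂ (j , i) ≡ inj₂ (k , i′)
    go (γ , g , γx) = by (ext-total γ (inj₂ (rep j , near)))
      where
      by : ∃ (ExtRel γ (inj₂ (rep j , near))) → inj₂ (j , i) ≡ inj₂ (k , i′)
      by (_ , r@(new {b = b} {t} _ _)) = same (rep-unique g (subst (λ b → ExtRel γ (inj₂ (rep j , near)) (inj₂ (b , t)))
        (interior-index (Restriction.interior-into r x-in) (subst (_∈ Vᴬ (rep k)) (sym γx) (proj₂ x′))) r))

  repV-injective : ∀ g {y y′} → RepV g y → RepV g y′ → y ≡ y′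
  repV-injective (inj₁ h) (z , eq , q) (z′ , eq′ , q′) =
    trans (sym q) (trans (Equivalence.to p-vert (trans eq (sym eq′))) q′)
  repV-injective (inj₂ (j , i)) (x , _ , eq , q) (x′ , _ , eq′ , q′) =
    trans (sym q) (trans (Equivalence.to (AQ.π-vert j) (trans eq (sym eq′))) q′)

  -- The inverse of an element carrying d into an atom carries that atom to one that contains d, but
  -- kept darts lie in no atom.
  old≠new : ∀ {f d k e} → dart f ≡ inj₁ d → e ∈ Dᴬ (rep k) → Π.dart d ≡ Π.dart e → ⊥
  old≠new {f} {d} {k} {e} eq e∈ q = let γ , g , γd = orbitD q in go γ γd (ext-total (inverse γ) (inj₂ (rep k , near)))
    where
    go : ∀ γ → _≅_.dart γ d ≡ e → ∃ (ExtRel (inverse γ) (inj₂ (rep k , near))) → ⊥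
    go γ γd (_ , new {b = b} into _) = dart-kept b eq (subst (_∈ Dᴬ b)
      (trans (cong (Iso.dart⁻ γ) (sym γd)) (Iso.dart⁻-dart γ d)) (into e∈))

  repD-functional : ∀ g g′ {y} → RepD g y → RepD g′ y → g ≡ g′
  repD-functional (inj₁ e) (inj₁ e′) (f , d , refl , eq , q) (f′ , d′ , refl , eq′ , q′) =
    let γ , g , γd = orbitD (trans q (sym q′))
    in cong inj₁ (Equivalence.from p-dart (γ , g , subst₂ (ExtRel γ) (sym eq) (trans (cong inj₁ γd) (sym eq′)) old))
  repD-functional (inj₁ e) (inj₂ (k , _)) (f , d , _ , eq , q) (δ , _ , q′) = contradiction (old≠new {k = k} eq (proj₂ δ) (trans q (sym q′))) id
  repD-functional (inj₂ (k , _)) (inj₁ e) (δ , _ , q) (f , d , _ , eq , q′) = contradiction (old≠new {k = k} eq (proj₂ δ) (trans q′ (sym q))) id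
  repD-functional (inj₂ (j , i)) (inj₂ (k , i′)) (δ , eq , q) (ε′ , eq′ , q′) =
    let γ , g , γδ = orbitD (trans q (sym q′))
    in same (rep-unique g (proj₂ (index-image {γ} {rep j} {near} {rep k} (proj₂ δ) (subst (_∈ Dᴬ (rep k)) (sym γδ) (proj₂ ε′)))))
    where
    same : j ≡ k → inj₂ (j , i) ≡ inj₂ (k , i′)
    same refl = cong (λ i → inj₂ (j , i)) (trans (sym eq) (trans (Equivalence.from (AQ.π-dart j {δ} {ε′}) (trans q (sym q′))) eq′))

  repD-injective : ∀ g {y y′} → RepD g y → RepD g y′ → y ≡ y′
  repD-injective (inj₁ e) (f , d , eq , fd , q) (f′ , d′ , eq′ , fd′ , q′) =
    let γ , g , r = Equivalence.to p-dart (trans eq (sym eq′))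
    in trans (sym q) (trans (orbitD⁻ g (sym (Sum.inj₁-injective (ext-old (subst₂ (ExtRel γ) fd fd′ r))))) q′)
  repD-injective (inj₂ (j , i)) (δ , eq , q) (ε′ , eq′ , q′) =
    trans (sym q) (trans (Equivalence.to (AQ.π-dart j) (trans eq (sym eq′))) q′)

  glue-interior : ∀ j x → Interior (atom (rep j)) (proj₁ x) → glue j (Onto.vert (AQ.π j) x) ≡ nothing
  glue-interior j x i = trans (glue-spec j x) (AQ.attached-interior j i)

  repV-live : ∀ g {y} → RepV g y → LiveV g
  repV-live (inj₁ h) _ = tt
  repV-live (inj₂ (j , _)) (x , i , refl , _) = glue-interior j x i

  live-repV : ∀ g → LiveV g → ∃ λ y → RepV g y
  live-repV (inj₁ h) _ = let z , q = p.vert-onto h in _ , z , q , refl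
  live-repV (inj₂ (j , i)) unglued = let x , q = Onto.vert-onto (AQ.π j) i in go x q (interior-or-kept {rep j} (proj₂ x))
    where
    go : ∀ x → Onto.vert (AQ.π j) x ≡ i → Interior (atom (rep j)) (proj₁ x) ⊎ OnBoundary (atom (rep j)) (proj₁ x) → ∃ λ y → RepV (inj₂ (j , i)) y
    go x q (inj₁ x-in) = _ , x , x-in , q , refl
    go x refl (inj₂ b) = let y , _ , e = AQ.attached-boundary j b
                         in case trans (sym unglued) (trans (glue-spec j x) e) of λ ()

  repD-live : ∀ g {y} → RepD g y → LiveD g
  repD-live (inj₂ _) _ = tt
  repD-live (inj₁ _) (f , d , refl , eq , _) a s q =
    go (subst₂ ExtOrbit (dart-newDart a s) eq (Equivalence.to p-dart q))
    where
    go : ¬ ExtOrbit (inj₂ (a , s)) (inj₁ d)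
    go (_ , _ , ())

  live-repD : ∀ g → LiveD g → ∃ λ y → RepD g y
  live-repD (inj₂ (j , i)) _ = let δ , q = Onto.dart-onto (AQ.π j) i in _ , δ , q , refl
  live-repD (inj₁ e) live-e = let f , q = p.dart-onto e in go f q (dart f) refl
    where
    go : ∀ f → p.dart f ≡ e → ∀ z → dart f ≡ z → ∃ λ y → RepD (inj₁ e) y
    go f q (inj₁ d) eq = _ , f , d , q , eq , refl
    go f q (inj₂ (a , s)) eq = contradiction (trans (cong p.dart (sym (new-unique eq))) q) (live-e a s)

  gluedVertex : Fin H.n → GluedV
  gluedVertex y = proj₁ (repV-total y)

  gluedDart : Fin H.m → GluedD
  gluedDart y = proj₁ (repD-total y)

  gluedVertex-spec : ∀ {g y} → RepV g y → g ≡ gluedVertex y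
  gluedVertex-spec {g} {y} r = repV-functional g (gluedVertex y) r (proj₂ (repV-total y))

  gluedDart-spec : ∀ {g y} → RepD g y → g ≡ gluedDart y
  gluedDart-spec {g} {y} r = repD-functional g (gluedDart y) r (proj₂ (repD-total y))

  -- For a boundary vertex both sides pass through the kept vertex of the reduced graph over it:
  -- gluing puts it at the end of the replaced edge, which is the projection of that vertex.
  place-spec : ∀ j x → place j (Onto.vert (AQ.π j) x) ≡ gluedVertex (Π.vert (proj₁ x))
  place-spec j x = go (interior-or-kept {rep j} (proj₂ x))
    where
    i = Onto.vert (AQ.π j) x
    go : Interior (atom (rep j)) (proj₁ x) ⊎ OnBoundary (atom (rep j)) (proj₁ x) → place j i ≡ gluedVertex (Π.vert (proj₁ x))
    go (inj₁ x-in) = trans (cong (Maybe.maybe′ inj₁ (inj₂ (j , i))) (glue-interior j x x-in)) (gluedVertex-spec (x , x-in , refl , refl))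
    go (inj₂ b) = let z , vz , e = AQ.attached-boundary j b
                  in trans (cong (Maybe.maybe′ inj₁ (inj₂ (j , i))) (trans (glue-spec j x) e)) (gluedVertex-spec (z , refl , cong Π.vert vz))

  -- Both sides come from the incidence in G, for old darts by way of the reduced graph and for new
  -- ones by way of the atom.
  ι-spec : ∀ g {y} → RepD g y → Graph.ι glued g ≡ Maybe.map gluedVertex (H.ι y)
  ι-spec (inj₁ _) (f , d , refl , eq , refl) =
    trans (cong (Maybe.map inj₁) (p-preserves.ι-preserved f))
      (trans (sym (Maybe.map-∘ (G′.ι f)))
        (trans (Maybe.map-cong (λ z → gluedVertex-spec {inj₁ (p.vert z)} (z , refl , refl)) (G′.ι f))
          (trans (Maybe.map-∘ {g = gluedVertex ∘ Π.vert} {f = vert} (G′.ι f))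
            (trans (cong (Maybe.map (gluedVertex ∘ Π.vert)) (trans (sym (ι-preserved f)) (cong (Graph.ι extended) eq)))
              (trans (Maybe.map-∘ {g = gluedVertex} {f = Π.vert} (G.ι d)) (cong (Maybe.map gluedVertex) (sym (Π-preserves.ι-preserved d))))))))
  ι-spec (inj₂ (j , _)) (δ , refl , refl) =
    trans (cong (Maybe.map (place j)) (Preserves.ι-preserved (Onto.preserves (AQ.π j)) δ))
      (trans (sym (Maybe.map-∘ (Graph.ι ⟦ atom (rep j) ⟧ δ)))
        (trans (Maybe.map-cong (place-spec j) (Graph.ι ⟦ atom (rep j) ⟧ δ))
          (trans (Maybe.map-∘ {g = gluedVertex ∘ Π.vert} {f = proj₁} (Graph.ι ⟦ atom (rep j) ⟧ δ))
            (trans (cong (Maybe.map (gluedVertex ∘ Π.vert)) (ι-inside (rep j) δ))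
              (trans (Maybe.map-∘ {g = gluedVertex} {f = Π.vert} (G.ι (proj₁ δ))) (cong (Maybe.map gluedVertex) (sym (Π-preserves.ι-preserved (proj₁ δ)))))))))

  mate-spec : ∀ g {y} → RepD g y → RepD (Graph.mate glued g) (H.mate y)
  mate-spec (inj₁ _) (f , d , refl , eq , refl) =
    G′.mate f , G.mate d , sym (p-preserves.mate-preserved f) , dart-mate eq , sym (Π-preserves.mate-preserved d)
  mate-spec (inj₂ (j , _)) (δ , refl , refl) =
    Graph.mate ⟦ atom (rep j) ⟧ δ , sym (Preserves.mate-preserved (Onto.preserves (AQ.π j)) δ) , sym (Π-preserves.mate-preserved (proj₁ δ))

  colour-spec : ∀ g {y} → RepD g y → Graph.colour glued g ≡ H.colour y
  colour-spec (inj₁ _) (f , d , refl , eq , refl) = trans (p-preserves.colour-preserved f)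
    (trans (sym (colour-preserved f)) (trans (cong (Graph.colour extended) eq) (sym (Π-preserves.colour-preserved d))))
  colour-spec (inj₂ (j , _)) (δ , refl , refl) =
    trans (Preserves.colour-preserved (Onto.preserves (AQ.π j)) δ) (sym (Π-preserves.colour-preserved (proj₁ δ)))

  label-spec : ∀ g {y} → RepD g y → Graph.label glued g ≡ H.label y
  label-spec (inj₁ _) (f , d , refl , eq , refl) = trans (p-preserves.label-preserved f)
    (trans (sym (label-preserved f)) (trans (cong (Graph.label extended) eq) (sym (Π-preserves.label-preserved d))))
  label-spec (inj₂ (j , _)) (δ , refl , refl) =
    trans (Preserves.label-preserved (Onto.preserves (AQ.π j)) δ) (sym (Π-preserves.label-preserved (proj₁ δ)))

  replacement : Replacement R H′ p H
  replacement = record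
    { quotients = quotients
    ; result = record
      { vert = gluedVertex ; dart = gluedDart
      ; preserves = record
        { ι-preserved = λ y → ι-spec (gluedDart y) (proj₂ (repD-total y))
        ; mate-preserved = λ y → gluedDart-spec (mate-spec (gluedDart y) (proj₂ (repD-total y)))
        ; colour-preserved = λ y → colour-spec (gluedDart y) (proj₂ (repD-total y))
        ; label-preserved = λ y → label-spec (gluedDart y) (proj₂ (repD-total y)) }
      ; vert-injective = λ {y} {y′} q → repV-injective (gluedVertex y) (proj₂ (repV-total y)) (subst (λ g → RepV g y′) (sym q) (proj₂ (repV-total y′)))
      ; dart-injective = λ {y} {y′} q → repD-injective (gluedDart y) (proj₂ (repD-total y)) (subst (λ g → RepD g y′) (sym q) (proj₂ (repD-total y′)))
      ; vert-image = λ g → mk⇔ (λ l → let y , r = live-repV g l in y , sym (gluedVertex-spec r))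
                               (λ { (y , refl) → repV-live (gluedVertex y) (proj₂ (repV-total y)) })
      ; dart-image = λ g → mk⇔ (λ l → let y , r = live-repD g l in y , sym (gluedDart-spec r))
                               (λ { (y , refl) → repD-live (gluedDart y) (proj₂ (repD-total y)) }) } }

theorem1p2 : (G : FinGraph) → IsAdmissible G → (series : ReductionSeries G) →
    let open ReductionSeries series in
    (i : Fin r) (H : FinGraph) → IsQuotient (graph (member (inject₁ i))) (graph H) →
    Σ FinGraph λ H′ → Σ (IsQuotient (graph (member (suc i))) (graph H′)) λ q →
    Replacement (step i) H′ (IsQuotient.projection q) H
theorem1p2 G admissible series i H isQuotient = H′ , isQuotient′ , replacement
  where
  open ReductionSeries series
  open IsGood (member-good admissible series (inject₁ i))
  open QuotientReduction (step i) simple (isNode (not-primitive i)) fixed H isQuotient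
  open Assembly (step i) simple (isNode (not-primitive i)) fixed H isQuotient
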